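{- If $\pi$ is a $\mathsf{CA}$ proof (cyclic proof) of a formula $\phi$, then one can construct a $\mathsf{PA}$ proof of $\phi$ of size exponential in $|\pi|$.
   Context: Language of arithmetic $\{0,\mathsf{s},+,\times,<\}$; $\mathsf{Q}$ is Robinson arithmetic with inequality (axioms: $\mathsf{s}x\neq 0$; $\mathsf{s}x=\mathsf{s}y\supset x=y$; $x\neq0\supset\exists y.x=\mathsf{s}y$; $x+0=x$; $x+\mathsf{s}y=\mathsf{s}(x+y)$; $x\cdot0=0$; $x\cdot\mathsf{s}y=x\cdot y+x$; $x<y\equiv\exists z.(x+\mathsf{s}z=y)$); $\mathsf{PA}$ is $\mathsf{Q}$ plus the full induction schema. $\mathsf{CA}$ proofs: use a sequent calculus for first-order logic with equality (cedents are finite sets; rules: identity, equality and negation axioms, weakening, cut, left/right rules for $\wedge,\vee,\forall,\exists$ with fresh eigenvariables, a substitution rule $\theta$-$\mathit{sub}$ from $\Gamma\Rightarrow\Delta$ to $\theta(\Gamma)\Rightarrow\theta(\Delta)$, and initial sequents for instances of the axioms of $\mathsf{Q}$). A preproof is a possibly infinite tree labelled by sequents and rule instances in a locally correct way; it is regular if it has finitely many distinct labelled subtrees, hence representable as a finite graph with cycles, whose size is $|\pi|$. Along an infinite branch $(\Gamma_i\Rightarrow\Delta_i)_i$, $t'$ is a precursor of $t$ at $i$ if the step at $i$ is $\theta$-$\mathit{sub}$ and $t=\theta(t')$, or the step is another rule and either $t'=t$ occurs in $\Gamma_i$ or $t'$ is $t$. A trace is $(t_i)_{i\ge m}$ with $t_i$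 in $\Gamma_i\Rightarrow\Delta_i$ and, for each $i$, either $t_{i+1}$ a precursor of $t_i$ at $i$, or $t_{i+1}<t\in\Gamma_{i+1}$ for a precursor $t$ of $t_i$ at $i$ (a progress point). A $\mathsf{CA}$ proof (cyclic proof) is a regular preproof in which every infinite branch has a trace with infinitely many progress points. -}

module Defs where

open import Data.Nat using (ℕ; zero; suc; _+_; _*_; _≤_; _^_; _≟_)
open import Data.Fin using (Fin; zero; suc)
open import Data.List using (List; []; _∷_; _++_; map)
open import Data.Nat.ListAction using (sum)
open import Data.List.Membership.Propositional using (_∈_)
open import Data.List.Relation.Unary.All using (All; []; _∷_)
open import Data.List.Relation.Binary.Pointwise using (Pointwise)
open import Data.Product using (Σ; _×_; _,_; ∃)
open import Data.Sum using (_⊎_)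
open import Data.Unit using (⊤)
open import Data.Empty using (⊥)
open import Relation.Nullary using (¬_; does)
open import Relation.Binary.PropositionalEquality using (_≡_)
open import Data.Bool using (if_then_else_)

-- Syntax (locally nameless): bound variables are de Bruijn indices
-- (Fin n, n = number of binders in scope), free variables are names ℕ.

infixl 7 _⊗_
infixl 6 _⊕_
infix 4 _≐_ _≺_ _≉_ _⊀_
infixr 3 _∧'_
infixr 2 _∨'_

data Term (n : ℕ) : Set where
  bv  : Fin n → Term n
  fv  : ℕ → Term n
  zer : Term n
  sc  : Term n → Term n
  _⊕_ : Term n → Term n → Term n
  _⊗_ : Term n → Term n → Term n

-- Formulas in negation normal form: atoms t = u, t < u and their negations,
-- ∧, ∨, ∀, ∃.  Negation is the De Morgan dual 'dual'.
data Formula (n : ℕ) : Set where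
  _≐_ _≺_ _≉_ _⊀_ : Term n → Term n → Formula n
  _∧'_ _∨'_ : Formula n → Formula n → Formula n
  ∀' ∃' : Formula (suc n) → Formula n

dual : ∀ {n} → Formula n → Formula n
dual (t ≐ u) = t ≉ u
dual (t ≺ u) = t ⊀ u
dual (t ≉ u) = t ≐ u
dual (t ⊀ u) = t ≺ u
dual (φ ∧' ψ) = dual φ ∨' dual ψ
dual (φ ∨' ψ) = dual φ ∧' dual ψ
dual (∀' φ) = ∃' (dual φ)
dual (∃' φ) = ∀' (dual φ)

_⊃_ : ∀ {n} → Formula n → Formula n → Formula n
φ ⊃ ψ = dual φ ∨' ψ

_⇔'_ : ∀ {n} → Formula n → Formula n → Formula n
φ ⇔' ψ = (φ ⊃ ψ) ∧' (ψ ⊃ φ)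

bsubT : ∀ {n m} → (Fin n → Term m) → Term n → Term m
bsubT σ (bv i) = σ i
bsubT σ (fv x) = fv x
bsubT σ zer = zer
bsubT σ (sc t) = sc (bsubT σ t)
bsubT σ (t ⊕ u) = bsubT σ t ⊕ bsubT σ u
bsubT σ (t ⊗ u) = bsubT σ t ⊗ bsubT σ u

shiftB : ∀ {m} → Term m → Term (suc m)
shiftB = bsubT (λ i → bv (suc i))

liftB : ∀ {n m} → (Fin n → Term m) → Fin (suc n) → Term (suc m)
liftB σ zero = bv zero
liftB σ (suc i) = shiftB (σ i)

bsubF : ∀ {n m} → (Fin n → Term m) → Formula n → Formula m
bsubF σ (t ≐ u) = bsubT σ t ≐ bsubT σ u
bsubF σ (t ≺ u) = bsubT σ t ≺ bsubT σ u
bsubF σ (t ≉ u) = bsubT σ t ≉ bsubT σ u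
bsubF σ (t ⊀ u) = bsubT σ t ⊀ bsubT σ u
bsubF σ (φ ∧' ψ) = bsubF σ φ ∧' bsubF σ ψ
bsubF σ (φ ∨' ψ) = bsubF σ φ ∨' bsubF σ ψ
bsubF σ (∀' φ) = ∀' (bsubF (liftB σ) φ)
bsubF σ (∃' φ) = ∃' (bsubF (liftB σ) φ)

inst : ∀ {n} → Formula (suc n) → Term n → Formula n
inst {n} φ t = bsubF σ φ
  where
  σ : Fin (suc n) → Term n
  σ zero = t
  σ (suc i) = bv i

embed : ∀ {n} → Term 0 → Term n
embed = bsubT (λ ())

Subst : Set
Subst = ℕ → Term 0

fsubT : ∀ {n} → Subst → Term n → Term n
fsubT θ (bv i) = bv i
fsubT θ (fv x) = embed (θ x)
fsubT θ zer = zer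
fsubT θ (sc t) = sc (fsubT θ t)
fsubT θ (t ⊕ u) = fsubT θ t ⊕ fsubT θ u
fsubT θ (t ⊗ u) = fsubT θ t ⊗ fsubT θ u

fsubF : ∀ {n} → Subst → Formula n → Formula n
fsubF θ (t ≐ u) = fsubT θ t ≐ fsubT θ u
fsubF θ (t ≺ u) = fsubT θ t ≺ fsubT θ u
fsubF θ (t ≉ u) = fsubT θ t ≉ fsubT θ u
fsubF θ (t ⊀ u) = fsubT θ t ⊀ fsubT θ u
fsubF θ (φ ∧' ψ) = fsubF θ φ ∧' fsubF θ ψ
fsubF θ (φ ∨' ψ) = fsubF θ φ ∨' fsubF θ ψ
fsubF θ (∀' φ) = ∀' (fsubF θ φ)
fsubF θ (∃' φ) = ∃' (fsubF θ φ)

_↦_ : ℕ → Term 0 → Subst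
(x ↦ t) y = if does (y ≟ x) then t else fv y

data FreeT {n} (x : ℕ) : Term n → Set where
  here : FreeT x (fv x)
  sc₁  : ∀ {t} → FreeT x t → FreeT x (sc t)
  ⊕₁ : ∀ {t u} → FreeT x t → FreeT x (t ⊕ u)
  ⊕₂ : ∀ {t u} → FreeT x u → FreeT x (t ⊕ u)
  ⊗₁ : ∀ {t u} → FreeT x t → FreeT x (t ⊗ u)
  ⊗₂ : ∀ {t u} → FreeT x u → FreeT x (t ⊗ u)

FreeA : ∀ {n} → ℕ → Term n → Term n → Set
FreeA x t u = FreeT x t ⊎ FreeT x u

FreeF : ∀ {n} → ℕ → Formula n → Set
FreeF x (t ≐ u) = FreeA x t u
FreeF x (t ≺ u) = FreeA x t u
FreeF x (t ≉ u) = FreeA x t u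
FreeF x (t ⊀ u) = FreeA x t u
FreeF x (φ ∧' ψ) = FreeF x φ ⊎ FreeF x ψ
FreeF x (φ ∨' ψ) = FreeF x φ ⊎ FreeF x ψ
FreeF x (∀' φ) = FreeF x φ
FreeF x (∃' φ) = FreeF x φ

data OccT {n} (t : Term 0) : Term n → Set where
  here : OccT t (embed t)
  sc₁  : ∀ {u} → OccT t u → OccT t (sc u)
  ⊕₁ : ∀ {u v} → OccT t u → OccT t (u ⊕ v)
  ⊕₂ : ∀ {u v} → OccT t v → OccT t (u ⊕ v)
  ⊗₁ : ∀ {u v} → OccT t u → OccT t (u ⊗ v)
  ⊗₂ : ∀ {u v} → OccT t v → OccT t (u ⊗ v)

OccA : ∀ {n} → Term 0 → Term n → Term n → Set
OccA t u v = OccT t u ⊎ OccT t v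

OccF : ∀ {n} → Term 0 → Formula n → Set
OccF t (u ≐ v) = OccA t u v
OccF t (u ≺ v) = OccA t u v
OccF t (u ≉ v) = OccA t u v
OccF t (u ⊀ v) = OccA t u v
OccF t (φ ∧' ψ) = OccF t φ ⊎ OccF t ψ
OccF t (φ ∨' ψ) = OccF t φ ⊎ OccF t ψ
OccF t (∀' φ) = OccF t φ
OccF t (∃' φ) = OccF t φ

IsAtom : Formula 0 → Set
IsAtom (t ≐ u) = ⊤
IsAtom (t ≺ u) = ⊤
IsAtom _ = ⊥

-- Sequents; cedents are finite sets, represented by lists up to ≋.

Cedent : Set
Cedent = List (Formula 0)

record Sequent : Set where
  constructor _⇒_
  field
    ante : Cedent
    succ : Cedent
open Sequent public

_≋_ : Cedent → Cedent → Set
Γ ≋ Δ = ∀ φ → (φ ∈ Γ → φ ∈ Δ) × (φ ∈ Δ → φ ∈ Γ)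

_≈S_ : Sequent → Sequent → Set
S ≈S T = (ante S ≋ ante T) × (succ S ≋ succ T)

FreshIn : ℕ → Cedent → Set
FreshIn x Γ = ∀ φ → φ ∈ Γ → ¬ FreeF x φ

OccS : Term 0 → Sequent → Set
OccS t S = Σ (Formula 0) λ φ → (φ ∈ ante S ⊎ φ ∈ succ S) × OccF t φ

data QAxiom : Set where
  q1 q2 q3 q4 q5 q6 q7 q8 : QAxiom

qFormula : QAxiom → Formula 0
qFormula q1 = sc (fv 0) ≉ zer
qFormula q2 = (sc (fv 0) ≐ sc (fv 1)) ⊃ (fv 0 ≐ fv 1)
qFormula q3 = (fv 0 ≉ zer) ⊃ ∃' (fv 0 ≐ sc (bv zero))
qFormula q4 = fv 0 ⊕ zer ≐ fv 0
qFormula q5 = fv 0 ⊕ sc (fv 1) ≐ sc (fv 0 ⊕ fv 1)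
qFormula q6 = fv 0 ⊗ zer ≐ zer
qFormula q7 = fv 0 ⊗ sc (fv 1) ≐ fv 0 ⊗ fv 1 ⊕ fv 0
qFormula q8 = (fv 0 ≺ fv 1) ⇔' ∃' (fv 0 ⊕ sc (bv zero) ≐ fv 1)

indAxiom : Formula 1 → Formula 0
indAxiom φ = (inst φ zer ∧' ∀' (φ ⊃ stepφ)) ⊃ ∀' φ
  where
  σ : Fin 1 → Term 1
  σ zero = sc (bv zero)
  σ (suc ())
  stepφ : Formula 1
  stepφ = bsubF σ φ

[_] : Formula 0 → Cedent
[ φ ] = φ ∷ []

data Rule : Set where
  idR    : (φ : Formula 0) → Rule
  eqRefl : (t : Term 0) → Rule
  eqSub  : (s t : Term 0) (x : ℕ) (φ : Formula 0) → Rule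
  negL   : (φ : Formula 0) → Rule
  negR   : (φ : Formula 0) → Rule
  wkR    : (Γ Δ Γ' Δ' : Cedent) → Rule
  cutR   : (Γ Δ : Cedent) (φ : Formula 0) → Rule
  ∧L ∧R ∨L ∨R : (Γ Δ : Cedent) (φ ψ : Formula 0) → Rule
  ∀L ∃R  : (Γ Δ : Cedent) (φ : Formula 1) (t : Term 0) → Rule
  ∀R ∃L  : (Γ Δ : Cedent) (φ : Formula 1) (x : ℕ) → Rule
  subR   : (θ : Subst) (Γ Δ : Cedent) → Rule
  qAx    : (a : QAxiom) (θ : Subst) → Rule

concl : Rule → Sequent
concl (idR φ) = [ φ ] ⇒ [ φ ]
concl (eqRefl t) = [] ⇒ [ t ≐ t ]
concl (eqSub s t x φ) = ((s ≐ t) ∷ fsubF (x ↦ s) φ ∷ []) ⇒ [ fsubF (x ↦ t) φ ]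
concl (negL φ) = (φ ∷ dual φ ∷ []) ⇒ []
concl (negR φ) = [] ⇒ (φ ∷ dual φ ∷ [])
concl (wkR Γ Δ Γ' Δ') = (Γ ++ Γ') ⇒ (Δ ++ Δ')
concl (cutR Γ Δ φ) = Γ ⇒ Δ
concl (∧L Γ Δ φ ψ) = ((φ ∧' ψ) ∷ Γ) ⇒ Δ
concl (∧R Γ Δ φ ψ) = Γ ⇒ ((φ ∧' ψ) ∷ Δ)
concl (∨L Γ Δ φ ψ) = ((φ ∨' ψ) ∷ Γ) ⇒ Δ
concl (∨R Γ Δ φ ψ) = Γ ⇒ ((φ ∨' ψ) ∷ Δ)
concl (∀L Γ Δ φ t) = (∀' φ ∷ Γ) ⇒ Δ
concl (∃R Γ Δ φ t) = Γ ⇒ (∃' φ ∷ Δ)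
concl (∀R Γ Δ φ x) = Γ ⇒ (∀' φ ∷ Δ)
concl (∃L Γ Δ φ x) = (∃' φ ∷ Γ) ⇒ Δ
concl (subR θ Γ Δ) = map (fsubF θ) Γ ⇒ map (fsubF θ) Δ
concl (qAx a θ) = [] ⇒ [ fsubF θ (qFormula a) ]

prems : Rule → List Sequent
prems (idR φ) = []
prems (eqRefl t) = []
prems (eqSub s t x φ) = []
prems (negL φ) = []
prems (negR φ) = []
prems (wkR Γ Δ Γ' Δ') = (Γ ⇒ Δ) ∷ []
prems (cutR Γ Δ φ) = (Γ ⇒ (φ ∷ Δ)) ∷ ((φ ∷ Γ) ⇒ Δ) ∷ []
prems (∧L Γ Δ φ ψ) = ((φ ∷ ψ ∷ Γ) ⇒ Δ) ∷ []
prems (∧R Γ Δ φ ψ) = (Γ ⇒ (φ ∷ Δ)) ∷ (Γ ⇒ (ψ ∷ Δ)) ∷ []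
prems (∨L Γ Δ φ ψ) = ((φ ∷ Γ) ⇒ Δ) ∷ ((ψ ∷ Γ) ⇒ Δ) ∷ []
prems (∨R Γ Δ φ ψ) = (Γ ⇒ (φ ∷ ψ ∷ Δ)) ∷ []
prems (∀L Γ Δ φ t) = ((inst φ t ∷ Γ) ⇒ Δ) ∷ []
prems (∃R Γ Δ φ t) = (Γ ⇒ (inst φ t ∷ Δ)) ∷ []
prems (∀R Γ Δ φ x) = (Γ ⇒ (inst φ (fv x) ∷ Δ)) ∷ []
prems (∃L Γ Δ φ x) = ((inst φ (fv x) ∷ Γ) ⇒ Δ) ∷ []
prems (subR θ Γ Δ) = (Γ ⇒ Δ) ∷ []
prems (qAx a θ) = []

Side : Rule → Set
Side (eqSub s t x φ) = IsAtom φ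
Side (negL φ) = IsAtom φ
Side (negR φ) = IsAtom φ
Side (∀R Γ Δ φ x) = FreshIn x Γ × FreshIn x Δ × ¬ FreeF x (∀' φ)
Side (∃L Γ Δ φ x) = FreshIn x Γ × FreshIn x Δ × ¬ FreeF x (∃' φ)
Side _ = ⊤

termSize : ∀ {n} → Term n → ℕ
termSize (bv i) = 1
termSize (fv x) = 1
termSize zer = 1
termSize (sc t) = suc (termSize t)
termSize (t ⊕ u) = suc (termSize t + termSize u)
termSize (t ⊗ u) = suc (termSize t + termSize u)

formSize : ∀ {n} → Formula n → ℕ
formSize (t ≐ u) = suc (termSize t + termSize u)
formSize (t ≺ u) = suc (termSize t + termSize u)
formSize (t ≉ u) = suc (termSize t + termSize u)
formSize (t ⊀ u) = suc (termSize t + termSize u)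
formSize (φ ∧' ψ) = suc (formSize φ + formSize ψ)
formSize (φ ∨' ψ) = suc (formSize φ + formSize ψ)
formSize (∀' φ) = suc (formSize φ)
formSize (∃' φ) = suc (formSize φ)

seqSize : Sequent → ℕ
seqSize (Γ ⇒ Δ) = sum (map formSize Γ) + sum (map formSize Δ)

data PAProof : Sequent → Set where
  rule : ∀ {S} (r : Rule) → Side r → S ≈S concl r → All PAProof (prems r) → PAProof S
  ind  : ∀ {S} (φ : Formula 1) → S ≈S ([] ⇒ [ indAxiom φ ]) → PAProof S

mutual
  paSize : ∀ {S} → PAProof S → ℕ
  paSize {S} (rule r _ _ ps) = suc (seqSize S + paSizes ps)
  paSize {S} (ind φ _) = suc (seqSize S)

  paSizes : ∀ {Ss} → All PAProof Ss → ℕ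
  paSizes [] = 0
  paSizes (p ∷ ps) = paSize p + paSizes ps

-- Regular preproofs, represented as finite graphs

record Preproof : Set where
  field
    nodes : ℕ
    seq   : Fin nodes → Sequent
    rl    : Fin nodes → Rule
    next  : Fin nodes → List (Fin nodes)
    root  : Fin nodes
    side  : ∀ v → Side (rl v)
    lconc : ∀ v → seq v ≈S concl (rl v)
    lprem : ∀ v → Pointwise (λ w S → seq w ≈S S) (next v) (prems (rl v))
open Preproof public

sumFin : ∀ n → (Fin n → ℕ) → ℕ
sumFin zero f = 0
sumFin (suc n) f = f zero + sumFin n (λ i → f (suc i))

ppSize : Preproof → ℕ
ppSize π = sumFin (nodes π) (λ v → suc (seqSize (seq π v)))

-- infinite branches (from the root) of the unfolded tree
record Branch (π : Preproof) : Set where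
  field
    b     : ℕ → Fin (nodes π)
    start : b 0 ≡ root π
    step  : ∀ i → b (suc i) ∈ next π (b i)
open Branch public

PrecR : Rule → Cedent → Term 0 → Term 0 → Set
PrecR (subR θ Γ₀ Δ₀) Γ t' t = t ≡ fsubT θ t'
PrecR _ Γ t' t = ((t' ≐ t) ∈ Γ) ⊎ (t' ≡ t)

module _ {π : Preproof} (β : Branch π) where
  Γat : ℕ → Cedent
  Γat i = ante (seq π (b β i))

  Prec : ℕ → Term 0 → Term 0 → Set
  Prec i t' t = PrecR (rl π (b β i)) (Γat i) t' t

  Progress : ℕ → Term 0 → Term 0 → Set
  Progress i tᵢ tᵢ₊₁ = Σ (Term 0) λ t → Prec i t tᵢ × ((tᵢ₊₁ ≺ t) ∈ Γat (suc i))

  record ProgressingTrace : Set where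
    field
      m      : ℕ
      τ      : ℕ → Term 0
      occ    : ∀ i → m ≤ i → OccS (τ i) (seq π (b β i))
      tstep  : ∀ i → m ≤ i → Prec i (τ (suc i)) (τ i) ⊎ Progress i (τ i) (τ (suc i))
      infprog : ∀ k → Σ ℕ λ i → k ≤ i × m ≤ i × Progress i (τ i) (τ (suc i))

record CAProof (S : Sequent) : Set where
  field
    pre  : Preproof
    rootSeq : seq pre (root pre) ≈S S
    gtc  : (β : Branch pre) → ProgressingTrace β
open CAProof public

{-# OPTIONS --safe #-}
module Submission where

-- A deterministic automaton in the style of Safra follows a branch of the preproof.
-- Its registers r_0, r_1, ..., ordered by age, bound the values of the terms they track;
-- a register is dropped when it tracks no term (priority 2j for register j) and can be
-- decremented when all its terms have made progress (priority 2j + 1).  By the global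
-- trace condition no reachable cycle has even least priority, so the number ρ_j of states
-- reachable through edges of priority ≥ 2j drops whenever register j is dropped.  Hence
-- along a falsified branch the tuple (ρ_0, r_0, ρ_1, r_1, ...) decreases
-- lexicographically.  PA therefore proves, by one induction per component, the conjunction
-- over all states of "the sequent is valid whenever the registers bound the terms they
-- track"; there are exponentially many states and linearly many components.

open import Defs
open import Data.Nat
open import Data.Nat.Properties hiding (_≟_)
open import Data.Nat.ListAction using (sum)
open import Data.Nat.Solver using (module +-*-Solver)
open import Data.Bool using (Bool; true; false; T; if_then_else_; _∧_; _∨_; not)
open import Data.Bool.Properties using (∨-zeroʳ; ∧-zeroʳ; ∧-identityʳ) renaming (_≟_ to _≟B_)
open import Data.Fin using (Fin; zero; suc; inject₁; fromℕ; toℕ; combine; remQuot; funToFin; finToFun)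
open import Data.Fin.Properties using (any?; injective⇒≤; remQuot-combine; finToFun-funToFin; pigeonhole)
open import Data.List using (List; []; _∷_; _++_; map; length; concatMap; allFin; replicate; tabulate; lookup; upTo)
open import Data.List.Properties using (map-++; length-++; length-map; length-tabulate; length-replicate; length-upTo; tabulate-cong)
open import Data.List.Membership.Propositional using (_∈_; _∉_)
open import Data.List.Membership.Propositional.Properties using (∈-++⁺ˡ; ∈-++⁺ʳ; ∈-++⁻; ∈-map⁺; ∈-map⁻; ∈-allFin; ∈-upTo⁺; ∈-upTo⁻)
open import Data.List.Relation.Unary.Any using (here; there)
open import Data.List.Relation.Unary.Any.Properties using (lookup-index)
open import Data.List.Relation.Unary.All using (All; []; _∷_)
open import Data.List.Relation.Binary.Pointwise using (Pointwise; []; _∷_)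
import Data.List.Relation.Unary.All as All
import Data.List.Relation.Unary.Any as Any
open import Data.Maybe using (Maybe; just; nothing)
open import Data.Product using (Σ; _×_; _,_; proj₁; proj₂)
open import Data.Sum using (_⊎_; inj₁; inj₂; [_,_]′)
open import Data.Unit using (⊤; tt)
open import Data.Empty using (⊥; ⊥-elim)
open import Function using (_∘_; id; case_of_)
open import Relation.Nullary using (¬_; Dec; yes; no; does; contradiction)
open import Relation.Nullary.Decidable using (map′; _⊎-dec_; _×-dec_)
open import Relation.Binary.Construct.Closure.ReflexiveTransitive using (Star; ε; _◅_; _◅◅_)
open import Relation.Binary.PropositionalEquality using (_≡_; _≢_; refl; sym; trans; cong; cong₂; subst; subst₂)

-- The trace condition chooses a trace with the whole infinite branch in view, while a formula of PA
-- can only speak about the sequent at hand. The choice must therefore become finite data updated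
-- edge by edge, and this is what forces a deterministic automaton. A trace is picked up at a
-- progress point and may merge with others, so each term keeps a word of registers, and among the
-- ways of reaching a term the one with the older registers wins. The registers are not functions of
-- the values of the terms but free variables that only bound them; PA thus never has to code
-- sequences, and an edge of the automaton acts on them by one substitution. The size comes out as
-- follows. With n terms a state is a node with an n × n matrix of bits, so there are at most
-- 2^(n·n) states per node. All costs are powers of one base W of this order of magnitude, up to a
-- fixed exponent; each of the 2(n + 1) inductions raises the power by a constant. The final size is
-- W to a power linear in n, that is, 2 to a polynomial in the size of the cyclic proof.

-- Syntax: decidable equality, substitutions and sizes

eqT? : ∀ {n} (t u : Term n) → Maybe (t ≡ u)
eqT? (bv i) (bv j) with i Data.Fin.≟ j
... | yes refl = just refl
... | no _ = nothing
eqT? (fv x) (fv y) with x ≟ y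
... | yes refl = just refl
... | no _ = nothing
eqT? zer zer = just refl
eqT? (sc t) (sc u) with eqT? t u
... | just refl = just refl
... | nothing = nothing
eqT? (t ⊕ u) (t' ⊕ u') with eqT? t t' | eqT? u u'
... | just refl | just refl = just refl
... | _ | _ = nothing
eqT? (t ⊗ u) (t' ⊗ u') with eqT? t t' | eqT? u u'
... | just refl | just refl = just refl
... | _ | _ = nothing
eqT? _ _ = nothing

-- Success on the diagonal is all that a decision needs: a failing test then refutes equality,
-- without a separate clause for each pair of distinct constructors.
eqT?-refl : ∀ {n} (t : Term n) → eqT? t t ≡ just refl
eqT?-refl (bv i) with i Data.Fin.≟ i
... | yes refl = refl
... | no p = contradiction refl p
eqT?-refl (fv x) with x ≟ x
... | yes refl = refl
... | no p = contradiction refl p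
eqT?-refl zer = refl
eqT?-refl (sc t) rewrite eqT?-refl t = refl
eqT?-refl (t ⊕ u) rewrite eqT?-refl t | eqT?-refl u = refl
eqT?-refl (t ⊗ u) rewrite eqT?-refl t | eqT?-refl u = refl

_≟T_ : ∀ {n} (t u : Term n) → Dec (t ≡ u)
t ≟T u with eqT? t u in eq
... | just p = yes p
... | nothing = no λ { refl → case trans (sym eq) (eqT?-refl t) of λ () }

eqF? : ∀ {n} (φ ψ : Formula n) → Maybe (φ ≡ ψ)
eqF? (t ≐ u) (t' ≐ u') with eqT? t t' | eqT? u u'
... | just refl | just refl = just refl
... | _ | _ = nothing
eqF? (t ≺ u) (t' ≺ u') with eqT? t t' | eqT? u u'
... | just refl | just refl = just refl
... | _ | _ = nothing
eqF? (t ≉ u) (t' ≉ u') with eqT? t t' | eqT? u u'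
... | just refl | just refl = just refl
... | _ | _ = nothing
eqF? (t ⊀ u) (t' ⊀ u') with eqT? t t' | eqT? u u'
... | just refl | just refl = just refl
... | _ | _ = nothing
eqF? (φ ∧' ψ) (φ' ∧' ψ') with eqF? φ φ' | eqF? ψ ψ'
... | just refl | just refl = just refl
... | _ | _ = nothing
eqF? (φ ∨' ψ) (φ' ∨' ψ') with eqF? φ φ' | eqF? ψ ψ'
... | just refl | just refl = just refl
... | _ | _ = nothing
eqF? (∀' φ) (∀' ψ) with eqF? φ ψ
... | just refl = just refl
... | nothing = nothing
eqF? (∃' φ) (∃' ψ) with eqF? φ ψ
... | just refl = just refl
... | nothing = nothing
eqF? _ _ = nothing

eqF?-refl : ∀ {n} (φ : Formula n) → eqF? φ φ ≡ just refl
eqF?-refl (t ≐ u) rewrite eqT?-refl t | eqT?-refl u = refl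
eqF?-refl (t ≺ u) rewrite eqT?-refl t | eqT?-refl u = refl
eqF?-refl (t ≉ u) rewrite eqT?-refl t | eqT?-refl u = refl
eqF?-refl (t ⊀ u) rewrite eqT?-refl t | eqT?-refl u = refl
eqF?-refl (φ ∧' ψ) rewrite eqF?-refl φ | eqF?-refl ψ = refl
eqF?-refl (φ ∨' ψ) rewrite eqF?-refl φ | eqF?-refl ψ = refl
eqF?-refl (∀' φ) rewrite eqF?-refl φ = refl
eqF?-refl (∃' φ) rewrite eqF?-refl φ = refl

_≟F_ : ∀ {n} (φ ψ : Formula n) → Dec (φ ≡ ψ)
φ ≟F ψ with eqF? φ ψ in eq
... | just p = yes p
... | nothing = no λ { refl → case trans (sym eq) (eqF?-refl φ) of λ () }

bsubT-cong : ∀ {n m} {σ τ : Fin n → Term m} → (∀ i → σ i ≡ τ i) → ∀ t → bsubT σ t ≡ bsubT τ t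
bsubT-cong e (bv i) = e i
bsubT-cong e (fv x) = refl
bsubT-cong e zer = refl
bsubT-cong e (sc t) = cong sc (bsubT-cong e t)
bsubT-cong e (t ⊕ u) = cong₂ _⊕_ (bsubT-cong e t) (bsubT-cong e u)
bsubT-cong e (t ⊗ u) = cong₂ _⊗_ (bsubT-cong e t) (bsubT-cong e u)

bsubT-∘ : ∀ {n m k} (τ : Fin m → Term k) (σ : Fin n → Term m) t → bsubT τ (bsubT σ t) ≡ bsubT (bsubT τ ∘ σ) t
bsubT-∘ τ σ (bv i) = refl
bsubT-∘ τ σ (fv x) = refl
bsubT-∘ τ σ zer = refl
bsubT-∘ τ σ (sc t) = cong sc (bsubT-∘ τ σ t)
bsubT-∘ τ σ (t ⊕ u) = cong₂ _⊕_ (bsubT-∘ τ σ t) (bsubT-∘ τ σ u)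
bsubT-∘ τ σ (t ⊗ u) = cong₂ _⊗_ (bsubT-∘ τ σ t) (bsubT-∘ τ σ u)

bsubT-embed : ∀ {n m} (σ : Fin n → Term m) (t : Term 0) → bsubT σ (embed t) ≡ embed t
bsubT-embed σ t = trans (bsubT-∘ σ _ t) (bsubT-cong (λ ()) t)

embed-id : (t : Term 0) → embed t ≡ t
embed-id (fv x) = refl
embed-id zer = refl
embed-id (sc t) = cong sc (embed-id t)
embed-id (t ⊕ u) = cong₂ _⊕_ (embed-id t) (embed-id u)
embed-id (t ⊗ u) = cong₂ _⊗_ (embed-id t) (embed-id u)

free-embed : ∀ {n} {x} (t : Term 0) → FreeT x t → FreeT x (embed {n} t)
free-embed (fv x) here = here
free-embed (sc t) (sc₁ p) = sc₁ (free-embed t p)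
free-embed (t ⊕ u) (⊕₁ p) = ⊕₁ (free-embed t p)
free-embed (t ⊕ u) (⊕₂ p) = ⊕₂ (free-embed u p)
free-embed (t ⊗ u) (⊗₁ p) = ⊗₁ (free-embed t p)
free-embed (t ⊗ u) (⊗₂ p) = ⊗₂ (free-embed u p)

fsubT-cong : ∀ {n} {θ θ' : Subst} (t : Term n) → (∀ x → FreeT x t → θ x ≡ θ' x) → fsubT θ t ≡ fsubT θ' t
fsubT-cong (bv i) e = refl
fsubT-cong (fv x) e = cong embed (e x here)
fsubT-cong zer e = refl
fsubT-cong (sc t) e = cong sc (fsubT-cong t (λ x p → e x (sc₁ p)))
fsubT-cong (t ⊕ u) e = cong₂ _⊕_ (fsubT-cong t (λ x p → e x (⊕₁ p))) (fsubT-cong u (λ x p → e x (⊕₂ p)))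
fsubT-cong (t ⊗ u) e = cong₂ _⊗_ (fsubT-cong t (λ x p → e x (⊗₁ p))) (fsubT-cong u (λ x p → e x (⊗₂ p)))

fsubF-cong : ∀ {n} {θ θ' : Subst} (φ : Formula n) → (∀ x → FreeF x φ → θ x ≡ θ' x) → fsubF θ φ ≡ fsubF θ' φ
fsubF-cong (t ≐ u) e = cong₂ _≐_ (fsubT-cong t (λ x p → e x (inj₁ p))) (fsubT-cong u (λ x p → e x (inj₂ p)))
fsubF-cong (t ≺ u) e = cong₂ _≺_ (fsubT-cong t (λ x p → e x (inj₁ p))) (fsubT-cong u (λ x p → e x (inj₂ p)))
fsubF-cong (t ≉ u) e = cong₂ _≉_ (fsubT-cong t (λ x p → e x (inj₁ p))) (fsubT-cong u (λ x p → e x (inj₂ p)))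
fsubF-cong (t ⊀ u) e = cong₂ _⊀_ (fsubT-cong t (λ x p → e x (inj₁ p))) (fsubT-cong u (λ x p → e x (inj₂ p)))
fsubF-cong (φ ∧' ψ) e = cong₂ _∧'_ (fsubF-cong φ (λ x p → e x (inj₁ p))) (fsubF-cong ψ (λ x p → e x (inj₂ p)))
fsubF-cong (φ ∨' ψ) e = cong₂ _∨'_ (fsubF-cong φ (λ x p → e x (inj₁ p))) (fsubF-cong ψ (λ x p → e x (inj₂ p)))
fsubF-cong (∀' φ) e = cong ∀' (fsubF-cong φ e)
fsubF-cong (∃' φ) e = cong ∃' (fsubF-cong φ e)

fsubT-fv : ∀ {n} (t : Term n) → fsubT fv t ≡ t
fsubT-fv (bv i) = refl
fsubT-fv (fv x) = refl
fsubT-fv zer = refl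
fsubT-fv (sc t) = cong sc (fsubT-fv t)
fsubT-fv (t ⊕ u) = cong₂ _⊕_ (fsubT-fv t) (fsubT-fv u)
fsubT-fv (t ⊗ u) = cong₂ _⊗_ (fsubT-fv t) (fsubT-fv u)

fsubF-fv : ∀ {n} (φ : Formula n) → fsubF fv φ ≡ φ
fsubF-fv (t ≐ u) = cong₂ _≐_ (fsubT-fv t) (fsubT-fv u)
fsubF-fv (t ≺ u) = cong₂ _≺_ (fsubT-fv t) (fsubT-fv u)
fsubF-fv (t ≉ u) = cong₂ _≉_ (fsubT-fv t) (fsubT-fv u)
fsubF-fv (t ⊀ u) = cong₂ _⊀_ (fsubT-fv t) (fsubT-fv u)
fsubF-fv (φ ∧' ψ) = cong₂ _∧'_ (fsubF-fv φ) (fsubF-fv ψ)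
fsubF-fv (φ ∨' ψ) = cong₂ _∨'_ (fsubF-fv φ) (fsubF-fv ψ)
fsubF-fv (∀' φ) = cong ∀' (fsubF-fv φ)
fsubF-fv (∃' φ) = cong ∃' (fsubF-fv φ)

fsubF-id : ∀ {n} {θ : Subst} (φ : Formula n) → (∀ x → FreeF x φ → θ x ≡ fv x) → fsubF θ φ ≡ φ
fsubF-id φ e = trans (fsubF-cong φ e) (fsubF-fv φ)

bsubF-dual : ∀ {n m} (σ : Fin n → Term m) (φ : Formula n) → bsubF σ (dual φ) ≡ dual (bsubF σ φ)
bsubF-dual σ (t ≐ u) = refl
bsubF-dual σ (t ≺ u) = refl
bsubF-dual σ (t ≉ u) = refl
bsubF-dual σ (t ⊀ u) = refl
bsubF-dual σ (φ ∧' ψ) = cong₂ _∨'_ (bsubF-dual σ φ) (bsubF-dual σ ψ)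
bsubF-dual σ (φ ∨' ψ) = cong₂ _∧'_ (bsubF-dual σ φ) (bsubF-dual σ ψ)
bsubF-dual σ (∀' φ) = cong ∃' (bsubF-dual (liftB σ) φ)
bsubF-dual σ (∃' φ) = cong ∀' (bsubF-dual (liftB σ) φ)

dual-size : ∀ {n} (φ : Formula n) → formSize (dual φ) ≡ formSize φ
dual-size (t ≐ u) = refl
dual-size (t ≺ u) = refl
dual-size (t ≉ u) = refl
dual-size (t ⊀ u) = refl
dual-size (φ ∧' ψ) = cong suc (cong₂ _+_ (dual-size φ) (dual-size ψ))
dual-size (φ ∨' ψ) = cong suc (cong₂ _+_ (dual-size φ) (dual-size ψ))
dual-size (∀' φ) = cong suc (dual-size φ)
dual-size (∃' φ) = cong suc (dual-size φ)

dual-free : ∀ {n x} (φ : Formula n) → FreeF x (dual φ) → FreeF x φ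
dual-free (t ≐ u) p = p
dual-free (t ≺ u) p = p
dual-free (t ≉ u) p = p
dual-free (t ⊀ u) p = p
dual-free (φ ∧' ψ) = [ inj₁ ∘ dual-free φ , inj₂ ∘ dual-free ψ ]′
dual-free (φ ∨' ψ) = [ inj₁ ∘ dual-free φ , inj₂ ∘ dual-free ψ ]′
dual-free (∀' φ) p = dual-free φ p
dual-free (∃' φ) p = dual-free φ p

bsubT-size : ∀ {n m} (σ : Fin n → Term m) → (∀ i → termSize (σ i) ≡ 1) → ∀ t → termSize (bsubT σ t) ≡ termSize t
bsubT-size σ h (bv i) = h i
bsubT-size σ h (fv x) = refl
bsubT-size σ h zer = refl
bsubT-size σ h (sc t) = cong suc (bsubT-size σ h t)
bsubT-size σ h (t ⊕ u) = cong suc (cong₂ _+_ (bsubT-size σ h t) (bsubT-size σ h u))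
bsubT-size σ h (t ⊗ u) = cong suc (cong₂ _+_ (bsubT-size σ h t) (bsubT-size σ h u))

liftB-size : ∀ {n m} (σ : Fin n → Term m) → (∀ i → termSize (σ i) ≡ 1) → ∀ i → termSize (liftB σ i) ≡ 1
liftB-size σ h zero = refl
liftB-size σ h (suc i) = trans (bsubT-size _ (λ _ → refl) (σ i)) (h i)

bsubF-size : ∀ {n m} (σ : Fin n → Term m) → (∀ i → termSize (σ i) ≡ 1) → ∀ φ → formSize (bsubF σ φ) ≡ formSize φ
bsubF-size σ h (t ≐ u) = cong suc (cong₂ _+_ (bsubT-size σ h t) (bsubT-size σ h u))
bsubF-size σ h (t ≺ u) = cong suc (cong₂ _+_ (bsubT-size σ h t) (bsubT-size σ h u))
bsubF-size σ h (t ≉ u) = cong suc (cong₂ _+_ (bsubT-size σ h t) (bsubT-size σ h u))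
bsubF-size σ h (t ⊀ u) = cong suc (cong₂ _+_ (bsubT-size σ h t) (bsubT-size σ h u))
bsubF-size σ h (φ ∧' ψ) = cong suc (cong₂ _+_ (bsubF-size σ h φ) (bsubF-size σ h ψ))
bsubF-size σ h (φ ∨' ψ) = cong suc (cong₂ _+_ (bsubF-size σ h φ) (bsubF-size σ h ψ))
bsubF-size σ h (∀' φ) = cong suc (bsubF-size (liftB σ) (liftB-size σ h) φ)
bsubF-size σ h (∃' φ) = cong suc (bsubF-size (liftB σ) (liftB-size σ h) φ)

inst-size : (φ : Formula 1) (x : ℕ) → formSize (inst φ (fv x)) ≡ formSize φ
inst-size φ x = bsubF-size _ (λ { zero → refl }) φ

-- Turning a name into a bound variable

data NameView (y x : ℕ) : Bool → Set where
  same : y ≡ x → NameView y x true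
  diff : y ≢ x → NameView y x false

-- Indexed by the Boolean, so that one `with` on `does (y ≟ x)` reduces every `if` in `_↦_` and
-- `absT` and still yields the evidence.
nameView : ∀ y x → NameView y x (does (y ≟ x))
nameView y x with y ≡ᵇ x in eq
... | true = same (≡ᵇ⇒≡ y x (subst T (sym eq) tt))
... | false = diff λ e → subst T eq (≡⇒≡ᵇ y x e)

-- Abstraction of a name: it becomes the outermost (largest) de Bruijn index.
absT : ∀ {n} → ℕ → Term n → Term (suc n)
absT x (bv i) = bv (inject₁ i)
absT {n} x (fv y) = if does (y ≟ x) then bv (fromℕ n) else fv y
absT x zer = zer
absT x (sc t) = sc (absT x t)
absT x (t ⊕ u) = absT x t ⊕ absT x u
absT x (t ⊗ u) = absT x t ⊗ absT x u

absF : ∀ {n} → ℕ → Formula n → Formula (suc n)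
absF x (t ≐ u) = absT x t ≐ absT x u
absF x (t ≺ u) = absT x t ≺ absT x u
absF x (t ≉ u) = absT x t ≉ absT x u
absF x (t ⊀ u) = absT x t ⊀ absT x u
absF x (φ ∧' ψ) = absF x φ ∧' absF x ψ
absF x (φ ∨' ψ) = absF x φ ∨' absF x ψ
absF x (∀' φ) = ∀' (absF x φ)
absF x (∃' φ) = ∃' (absF x φ)

absT-size : ∀ {n} x (t : Term n) → termSize (absT x t) ≡ termSize t
absT-size x (bv i) = refl
absT-size x (fv y) with does (y ≟ x)
... | true = refl
... | false = refl
absT-size x zer = refl
absT-size x (sc t) = cong suc (absT-size x t)
absT-size x (t ⊕ u) = cong suc (cong₂ _+_ (absT-size x t) (absT-size x u))
absT-size x (t ⊗ u) = cong suc (cong₂ _+_ (absT-size x t) (absT-size x u))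

absF-size : ∀ {n} x (φ : Formula n) → formSize (absF x φ) ≡ formSize φ
absF-size x (t ≐ u) = cong suc (cong₂ _+_ (absT-size x t) (absT-size x u))
absF-size x (t ≺ u) = cong suc (cong₂ _+_ (absT-size x t) (absT-size x u))
absF-size x (t ≉ u) = cong suc (cong₂ _+_ (absT-size x t) (absT-size x u))
absF-size x (t ⊀ u) = cong suc (cong₂ _+_ (absT-size x t) (absT-size x u))
absF-size x (φ ∧' ψ) = cong suc (cong₂ _+_ (absF-size x φ) (absF-size x ψ))
absF-size x (φ ∨' ψ) = cong suc (cong₂ _+_ (absF-size x φ) (absF-size x ψ))
absF-size x (∀' φ) = cong suc (absF-size x φ)
absF-size x (∃' φ) = cong suc (absF-size x φ)

absT-free : ∀ {n} x y (t : Term n) → FreeT y (absT x t) → FreeT y t × y ≢ x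
absT-free x y (fv z) p with does (z ≟ x) | nameView z x
absT-free x .z (fv z) here | false | diff z≢x = here , z≢x
absT-free x y (sc t) (sc₁ p) = let q , e = absT-free x y t p in sc₁ q , e
absT-free x y (t ⊕ u) (⊕₁ p) = let q , e = absT-free x y t p in ⊕₁ q , e
absT-free x y (t ⊕ u) (⊕₂ p) = let q , e = absT-free x y u p in ⊕₂ q , e
absT-free x y (t ⊗ u) (⊗₁ p) = let q , e = absT-free x y t p in ⊗₁ q , e
absT-free x y (t ⊗ u) (⊗₂ p) = let q , e = absT-free x y u p in ⊗₂ q , e

absA-free : ∀ {n} x y (t u : Term n) → FreeA y (absT x t) (absT x u) → FreeA y t u × y ≢ x
absA-free x y t u (inj₁ p) = let q , e = absT-free x y t p in inj₁ q , e
absA-free x y t u (inj₂ p) = let q , e = absT-free x y u p in inj₂ q , e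

absF-free : ∀ {n} x y (φ : Formula n) → FreeF y (absF x φ) → FreeF y φ × y ≢ x
absF-free x y (t ≐ u) = absA-free x y t u
absF-free x y (t ≺ u) = absA-free x y t u
absF-free x y (t ≉ u) = absA-free x y t u
absF-free x y (t ⊀ u) = absA-free x y t u
absF-free x y (φ ∧' ψ) (inj₁ p) = let q , e = absF-free x y φ p in inj₁ q , e
absF-free x y (φ ∧' ψ) (inj₂ p) = let q , e = absF-free x y ψ p in inj₂ q , e
absF-free x y (φ ∨' ψ) (inj₁ p) = let q , e = absF-free x y φ p in inj₁ q , e
absF-free x y (φ ∨' ψ) (inj₂ p) = let q , e = absF-free x y ψ p in inj₂ q , e
absF-free x y (∀' φ) = absF-free x y φ
absF-free x y (∃' φ) = absF-free x y φ

-- The substitution of `inst` is local to it and changes under each binder. Its values on the lower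
-- indices and on the outermost one are all that matters, and `liftB` preserves this description.
record Instantiates {n} (σ : Fin (suc n) → Term n) (t : Term 0) : Set where
  constructor instantiates
  field
    low : ∀ i → σ (inject₁ i) ≡ bv i
    top : σ (fromℕ n) ≡ embed t

lift-instantiates : ∀ {n} {σ : Fin (suc n) → Term n} {t} → Instantiates σ t → Instantiates (liftB σ) t
lift-instantiates {t = t} (instantiates l h) = instantiates
  (λ { zero → refl ; (suc i) → cong shiftB (l i) })
  (trans (cong shiftB h) (bsubT-embed _ t))

bsubT-absT : ∀ {n} {σ : Fin (suc n) → Term n} {t} → Instantiates σ t → ∀ x u → bsubT σ (absT x u) ≡ fsubT (x ↦ t) u
bsubT-absT s x (bv i) = Instantiates.low s i
bsubT-absT s x (fv y) with does (y ≟ x)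
... | true = Instantiates.top s
... | false = refl
bsubT-absT s x zer = refl
bsubT-absT s x (sc u) = cong sc (bsubT-absT s x u)
bsubT-absT s x (u ⊕ v) = cong₂ _⊕_ (bsubT-absT s x u) (bsubT-absT s x v)
bsubT-absT s x (u ⊗ v) = cong₂ _⊗_ (bsubT-absT s x u) (bsubT-absT s x v)

bsubF-absF : ∀ {n} {σ : Fin (suc n) → Term n} {t} → Instantiates σ t → ∀ x φ → bsubF σ (absF x φ) ≡ fsubF (x ↦ t) φ
bsubF-absF s x (t ≐ u) = cong₂ _≐_ (bsubT-absT s x t) (bsubT-absT s x u)
bsubF-absF s x (t ≺ u) = cong₂ _≺_ (bsubT-absT s x t) (bsubT-absT s x u)
bsubF-absF s x (t ≉ u) = cong₂ _≉_ (bsubT-absT s x t) (bsubT-absT s x u)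
bsubF-absF s x (t ⊀ u) = cong₂ _⊀_ (bsubT-absT s x t) (bsubT-absT s x u)
bsubF-absF s x (φ ∧' ψ) = cong₂ _∧'_ (bsubF-absF s x φ) (bsubF-absF s x ψ)
bsubF-absF s x (φ ∨' ψ) = cong₂ _∨'_ (bsubF-absF s x φ) (bsubF-absF s x ψ)
bsubF-absF s x (∀' φ) = cong ∀' (bsubF-absF (lift-instantiates s) x φ)
bsubF-absF s x (∃' φ) = cong ∃' (bsubF-absF (lift-instantiates s) x φ)

inst-absF : ∀ x (φ : Formula 0) t → inst (absF x φ) t ≡ fsubF (x ↦ t) φ
inst-absF x φ t = bsubF-absF (instantiates (λ ()) (sym (embed-id t))) x φ

↦-self : ∀ x t → (x ↦ t) x ≡ t
↦-self x t with does (x ≟ x) | nameView x x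
... | true | same _ = refl
... | false | diff p = contradiction refl p

↦-other : ∀ {x y} t → y ≢ x → (x ↦ t) y ≡ fv y
↦-other {x} {y} t p with does (y ≟ x) | nameView y x
... | true | same q = contradiction q p
... | false | diff _ = refl

↦-id : ∀ x y → (x ↦ fv x) y ≡ fv y
↦-id x y with does (y ≟ x) | nameView y x
... | true | same refl = refl
... | false | diff _ = refl

inst-absF-self : ∀ x (φ : Formula 0) → inst (absF x φ) (fv x) ≡ φ
inst-absF-self x φ = trans (inst-absF x φ (fv x)) (fsubF-id φ (λ y _ → ↦-id x y))

absT-embed : ∀ {n} x (u : Term 0) → ¬ FreeT x u → absT {n} x (embed u) ≡ embed u
absT-embed x (fv y) nf with does (y ≟ x) | nameView y x
... | true | same refl = contradiction here nf
... | false | diff _ = refl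
absT-embed x zer nf = refl
absT-embed x (sc u) nf = cong sc (absT-embed x u (nf ∘ sc₁))
absT-embed x (u ⊕ v) nf = cong₂ _⊕_ (absT-embed x u (nf ∘ ⊕₁)) (absT-embed x v (nf ∘ ⊕₂))
absT-embed x (u ⊗ v) nf = cong₂ _⊗_ (absT-embed x u (nf ∘ ⊗₁)) (absT-embed x v (nf ∘ ⊗₂))

Avoids : Subst → ℕ → ℕ → Set
Avoids θ x y = y ≢ x → ¬ FreeT x (θ y)

-- `Avoids` is the condition against capture: an x inside θ y would be bound if the substitution
-- came before the abstraction.
fsubT-absT : ∀ {n} (θ : Subst) x → θ x ≡ fv x → (t : Term n) → (∀ y → FreeT y t → Avoids θ x y) →
  fsubT θ (absT x t) ≡ absT x (fsubT θ t)
fsubT-absT θ x e (bv i) a = refl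
fsubT-absT θ x e (fv y) a with does (y ≟ x) | nameView y x
... | false | diff q = sym (absT-embed x (θ y) (a y here q))
... | true | same refl rewrite e with does (y ≟ y) | nameView y y
...   | true | same _ = refl
...   | false | diff q = contradiction refl q
fsubT-absT θ x e zer a = refl
fsubT-absT θ x e (sc t) a = cong sc (fsubT-absT θ x e t (λ y p → a y (sc₁ p)))
fsubT-absT θ x e (t ⊕ u) a = cong₂ _⊕_ (fsubT-absT θ x e t (λ y p → a y (⊕₁ p))) (fsubT-absT θ x e u (λ y p → a y (⊕₂ p)))
fsubT-absT θ x e (t ⊗ u) a = cong₂ _⊗_ (fsubT-absT θ x e t (λ y p → a y (⊗₁ p))) (fsubT-absT θ x e u (λ y p → a y (⊗₂ p)))

fsubF-absF : ∀ {n} (θ : Subst) x → θ x ≡ fv x → (φ : Formula n) → (∀ y → FreeF y φ → Avoids θ x y) →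
  fsubF θ (absF x φ) ≡ absF x (fsubF θ φ)
fsubF-absF θ x e (t ≐ u) a = cong₂ _≐_ (fsubT-absT θ x e t (λ y p → a y (inj₁ p))) (fsubT-absT θ x e u (λ y p → a y (inj₂ p)))
fsubF-absF θ x e (t ≺ u) a = cong₂ _≺_ (fsubT-absT θ x e t (λ y p → a y (inj₁ p))) (fsubT-absT θ x e u (λ y p → a y (inj₂ p)))
fsubF-absF θ x e (t ≉ u) a = cong₂ _≉_ (fsubT-absT θ x e t (λ y p → a y (inj₁ p))) (fsubT-absT θ x e u (λ y p → a y (inj₂ p)))
fsubF-absF θ x e (t ⊀ u) a = cong₂ _⊀_ (fsubT-absT θ x e t (λ y p → a y (inj₁ p))) (fsubT-absT θ x e u (λ y p → a y (inj₂ p)))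
fsubF-absF θ x e (φ ∧' ψ) a = cong₂ _∧'_ (fsubF-absF θ x e φ (λ y p → a y (inj₁ p))) (fsubF-absF θ x e ψ (λ y p → a y (inj₂ p)))
fsubF-absF θ x e (φ ∨' ψ) a = cong₂ _∨'_ (fsubF-absF θ x e φ (λ y p → a y (inj₁ p))) (fsubF-absF θ x e ψ (λ y p → a y (inj₂ p)))
fsubF-absF θ x e (∀' φ) a = cong ∀' (fsubF-absF θ x e φ a)
fsubF-absF θ x e (∃' φ) a = cong ∃' (fsubF-absF θ x e φ a)

-- Repeated names do no harm: the inner occurrence binds and the outer quantifier is vacuous. The
-- lists of names collected from a preproof do repeat.
closeAll : List ℕ → Formula 0 → Formula 0
closeAll [] φ = φ
closeAll (x ∷ xs) φ = ∀' (absF x (closeAll xs φ))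

closeAll-free : ∀ {y} xs φ → FreeF y (closeAll xs φ) → FreeF y φ × y ∉ xs
closeAll-free [] φ p = p , λ ()
closeAll-free {y} (x ∷ xs) φ p with absF-free x y (closeAll xs φ) p
... | q , y≢x with closeAll-free xs φ q
...   | r , y∉xs = r , λ { (here e) → y≢x e ; (there m) → y∉xs m }

closeAll-size : ∀ xs φ → formSize (closeAll xs φ) ≡ length xs + formSize φ
closeAll-size [] φ = refl
closeAll-size (x ∷ xs) φ = cong suc (trans (absF-size x (closeAll xs φ)) (closeAll-size xs φ))

fsubF-closeAll : ∀ (θ : Subst) xs φ → (∀ x → x ∈ xs → θ x ≡ fv x) → (∀ x → x ∈ xs → ∀ y → FreeF y φ → Avoids θ x y) →
  fsubF θ (closeAll xs φ) ≡ closeAll xs (fsubF θ φ)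
fsubF-closeAll θ [] φ e a = refl
fsubF-closeAll θ (x ∷ xs) φ e a = cong ∀' (trans
  (fsubF-absF θ x (e x (here refl)) (closeAll xs φ) (λ y p → a x (here refl) y (proj₁ (closeAll-free xs φ p))))
  (cong (absF x) (fsubF-closeAll θ xs φ (λ y m → e y (there m)) (λ y m → a y (there m)))))

-- Derivations with costs

_⊆_ : Cedent → Cedent → Set
Γ ⊆ Δ = ∀ {φ} → φ ∈ Γ → φ ∈ Δ

≋-refl : ∀ {Γ} → Γ ≋ Γ
≋-refl φ = id , id

-- Contraction is free for sets. The logical rules below therefore take the principal formula by
-- membership and keep it in the premises.
≋-mem : ∀ {φ Γ} → φ ∈ Γ → Γ ≋ (φ ∷ Γ)
≋-mem m ψ = there , λ { (here refl) → m ; (there n) → n }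

≋-++ : ∀ {Γ Γ'} → Γ ⊆ Γ' → Γ' ≋ (Γ ++ Γ')
≋-++ {Γ} s φ = ∈-++⁺ʳ Γ , λ m → [ s , id ]′ (∈-++⁻ Γ m)

∅-⊆ : ∀ {Γ : Cedent} → [] ⊆ Γ
∅-⊆ ()

[]-⊆ : ∀ {φ Γ} → φ ∈ Γ → [ φ ] ⊆ Γ
[]-⊆ m (here refl) = m

∷-⊆ : ∀ {φ Γ Δ} → φ ∈ Δ → Γ ⊆ Δ → (φ ∷ Γ) ⊆ Δ
∷-⊆ m s (here refl) = m
∷-⊆ m s (there n) = s n

∷-mono : ∀ {φ Γ Δ} → Γ ⊆ Δ → (φ ∷ Γ) ⊆ (φ ∷ Δ)
∷-mono s = ∷-⊆ (here refl) (there ∘ s)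

++-⊆ : ∀ {Γ Γ' Δ} → Γ ⊆ Δ → Γ' ⊆ Δ → (Γ ++ Γ') ⊆ Δ
++-⊆ {Γ} s s' m = [ s , s' ]′ (∈-++⁻ Γ m)

-- The cost c bounds both the number of rules of a derivation and the amount by
-- which its sequents exceed the end sequent; unlike the size itself it is additive.
record Der (c : ℕ) (Γ Δ : Cedent) : Set where
  constructor der
  field
    proof : PAProof (Γ ⇒ Δ)
    bound : paSize proof ≤ c * (seqSize (Γ ⇒ Δ) + c)

Der-mono : ∀ {c c' Γ Δ} → c ≤ c' → Der c Γ Δ → Der c' Γ Δ
Der-mono {Γ = Γ} {Δ} h (der p b) = der p (≤-trans b (*-mono-≤ h (+-monoʳ-≤ (seqSize (Γ ⇒ Δ)) h)))

paSizes-subst : ∀ {Ss Ss'} (e : Ss ≡ Ss') (ps : All PAProof Ss) → paSizes (subst (All PAProof) e ps) ≡ paSizes ps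
paSizes-subst refl ps = refl

premise-bound : ∀ c s s' d k {P} → P ≤ c * (s' + c) → s' ≤ s + d → d + c ≤ k → P ≤ c * (s + k)
premise-bound c s s' d k h hs hk = ≤-trans h (*-monoʳ-≤ c (≤-trans (+-monoˡ-≤ c hs)
  (≤-trans (≤-reflexive (+-assoc s d c)) (+-monoʳ-≤ s hk))))

ax : ∀ r → Side r → prems r ≡ [] → ∀ {Γ Δ} → (Γ ⇒ Δ) ≈S concl r → Der 1 Γ Δ
ax r s e {Γ} {Δ} q = der (rule r s q (subst (All PAProof) (sym e) []))
  (≤-trans (≤-reflexive (cong suc (trans (cong (seqSize (Γ ⇒ Δ) +_) (paSizes-subst (sym e) [])) (+-identityʳ _))))
           (≤-reflexive (trans (+-comm 1 _) (sym (*-identityˡ _)))))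

-- The number d is the excess of the premise over the conclusion. All sizes are measured from the
-- end sequent, so an excess is paid once, where it arises.
rule₁ : ∀ r → Side r → ∀ {Γ' Δ'} → prems r ≡ (Γ' ⇒ Δ') ∷ [] → ∀ {Γ Δ c} d → (Γ ⇒ Δ) ≈S concl r →
  seqSize (Γ' ⇒ Δ') ≤ seqSize (Γ ⇒ Δ) + d → Der c Γ' Δ' → Der (suc (c + d)) Γ Δ
rule₁ r s {Γ'} {Δ'} e {Γ} {Δ} {c} d q hs (der p b) = der (rule r s q (subst (All PAProof) (sym e) (p ∷ []))) (begin
    suc (S + paSizes (subst (All PAProof) (sym e) (p ∷ [])))
      ≡⟨ cong (λ z → suc (S + z)) (trans (paSizes-subst (sym e) (p ∷ [])) (+-identityʳ _)) ⟩
    suc S + paSize p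
      ≤⟨ +-mono-≤ (≤-trans (≤-reflexive (+-comm 1 S)) (+-monoʳ-≤ S (s≤s z≤n))) (premise-bound c S (seqSize (Γ' ⇒ Δ')) d k b hs hk) ⟩
    (S + k) + c * (S + k)
      ≤⟨ *-monoˡ-≤ (S + k) {suc c} {k} (s≤s (m≤m+n c d)) ⟩
    k * (S + k) ∎)
  where
  open ≤-Reasoning
  S = seqSize (Γ ⇒ Δ)
  k = suc (c + d)
  hk : d + c ≤ k
  hk = ≤-trans (≤-reflexive (+-comm d c)) (n≤1+n _)

rule₂ : ∀ r → Side r → ∀ {Γ₁ Δ₁ Γ₂ Δ₂} → prems r ≡ (Γ₁ ⇒ Δ₁) ∷ (Γ₂ ⇒ Δ₂) ∷ [] → ∀ {Γ Δ c₁ c₂} d → (Γ ⇒ Δ) ≈S concl r →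
  seqSize (Γ₁ ⇒ Δ₁) ≤ seqSize (Γ ⇒ Δ) + d → seqSize (Γ₂ ⇒ Δ₂) ≤ seqSize (Γ ⇒ Δ) + d →
  Der c₁ Γ₁ Δ₁ → Der c₂ Γ₂ Δ₂ → Der (suc (c₁ + c₂ + d)) Γ Δ
rule₂ r s {Γ₁} {Δ₁} {Γ₂} {Δ₂} e {Γ} {Δ} {c₁} {c₂} d q hs₁ hs₂ (der p₁ b₁) (der p₂ b₂) =
  der (rule r s q (subst (All PAProof) (sym e) (p₁ ∷ p₂ ∷ []))) (begin
    suc (S + paSizes (subst (All PAProof) (sym e) (p₁ ∷ p₂ ∷ [])))
      ≡⟨ cong (λ z → suc (S + z)) (trans (paSizes-subst (sym e) (p₁ ∷ p₂ ∷ [])) (cong (paSize p₁ +_) (+-identityʳ _))) ⟩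
    suc S + (paSize p₁ + paSize p₂)
      ≤⟨ +-mono-≤ (≤-trans (≤-reflexive (+-comm 1 S)) (+-monoʳ-≤ S (s≤s z≤n)))
           (+-mono-≤ (premise-bound c₁ S (seqSize (Γ₁ ⇒ Δ₁)) d k b₁ hs₁ hk₁) (premise-bound c₂ S (seqSize (Γ₂ ⇒ Δ₂)) d k b₂ hs₂ hk₂)) ⟩
    (S + k) + (c₁ * (S + k) + c₂ * (S + k))
      ≡⟨ cong ((S + k) +_) (sym (*-distribʳ-+ (S + k) c₁ c₂)) ⟩
    (S + k) + (c₁ + c₂) * (S + k)
      ≤⟨ *-monoˡ-≤ (S + k) {suc (c₁ + c₂)} {k} (s≤s (m≤m+n (c₁ + c₂) d)) ⟩
    k * (S + k) ∎)
  where
  open ≤-Reasoning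
  S = seqSize (Γ ⇒ Δ)
  k = suc (c₁ + c₂ + d)
  hk₁ : d + c₁ ≤ k
  hk₁ = ≤-trans (≤-reflexive (+-comm d c₁)) (m≤n⇒m≤1+n (+-monoˡ-≤ d (m≤m+n c₁ c₂)))
  hk₂ : d + c₂ ≤ k
  hk₂ = ≤-trans (≤-reflexive (+-comm d c₂)) (m≤n⇒m≤1+n (+-monoˡ-≤ d (m≤n+m c₂ c₁)))

szL₁ : ∀ a g d → a + g + d ≤ g + d + a
szL₁ a g d = ≤-reflexive (solve 3 (λ a g d → a :+ g :+ d := g :+ d :+ a) refl a g d)
  where open +-*-Solver

szR₁ : ∀ a g d → g + (a + d) ≤ g + d + a
szR₁ a g d = ≤-reflexive (solve 3 (λ a g d → g :+ (a :+ d) := g :+ d :+ a) refl a g d)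
  where open +-*-Solver

szL₂ : ∀ a b g d → a + (b + g) + d ≤ g + d + (a + b)
szL₂ a b g d = ≤-reflexive (solve 4 (λ a b g d → a :+ (b :+ g) :+ d := g :+ d :+ (a :+ b)) refl a b g d)
  where open +-*-Solver

szR₂ : ∀ a b g d → g + (a + (b + d)) ≤ g + d + (a + b)
szR₂ a b g d = ≤-reflexive (solve 4 (λ a b g d → g :+ (a :+ (b :+ d)) := g :+ d :+ (a :+ b)) refl a b g d)
  where open +-*-Solver

sz : Cedent → ℕ
sz Γ = sum (map formSize Γ)

wkBy : ∀ {c Γ Δ Γ' Δ'} d → seqSize (Γ ⇒ Δ) ≤ seqSize (Γ' ⇒ Δ') + d → Γ ⊆ Γ' → Δ ⊆ Δ' → Der c Γ Δ → Der (suc (c + d)) Γ' Δ'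
wkBy {Γ = Γ} {Δ} {Γ'} {Δ'} d h s t p = rule₁ (wkR Γ Δ Γ' Δ') tt refl d (≋-++ s , ≋-++ t) h p

wk : ∀ {c Γ Δ Γ' Δ'} → Γ ⊆ Γ' → Δ ⊆ Δ' → Der c Γ Δ → Der (suc (c + seqSize (Γ ⇒ Δ))) Γ' Δ'
wk {Γ = Γ} {Δ} {Γ'} {Δ'} s t p = wkBy _ (m≤n+m _ (seqSize (Γ' ⇒ Δ'))) s t p

idr : ∀ {φ Γ Δ} → φ ∈ Γ → φ ∈ Δ → Der (2 + (formSize φ + formSize φ)) Γ Δ
idr {φ} m n = Der-mono (≤-reflexive (cong (λ z → suc (suc z)) (cong₂ _+_ (+-identityʳ (formSize φ)) (+-identityʳ (formSize φ)))))
  (wk ([]-⊆ m) ([]-⊆ n) (ax (idR φ) tt refl (≋-refl , ≋-refl)))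

cut : ∀ {c₁ c₂ Γ Δ} φ → Der c₁ Γ (φ ∷ Δ) → Der c₂ (φ ∷ Γ) Δ → Der (suc (c₁ + c₂ + formSize φ)) Γ Δ
cut {Γ = Γ} {Δ} φ p q = rule₂ (cutR Γ Δ φ) tt refl (formSize φ) (≋-refl , ≋-refl)
  (szR₁ (formSize φ) (sz Γ) (sz Δ)) (szL₁ (formSize φ) (sz Γ) (sz Δ)) p q

have : ∀ {c₁ c₂ Γ Δ} φ → Der c₁ Γ [ φ ] → Der c₂ (φ ∷ Γ) Δ → Der (suc (suc c₁ + c₂ + formSize φ)) Γ Δ
have {c₁} {Γ = Γ} {Δ} φ p q = cut φ
  (Der-mono (≤-reflexive (cong suc (+-identityʳ c₁)))
    (wkBy 0 (≤-trans (+-monoʳ-≤ (sz Γ) (+-monoʳ-≤ (formSize φ) z≤n)) (≤-reflexive (sym (+-identityʳ _)))) id (∷-mono ∅-⊆) p)) q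

∧L≤ : ∀ {c Γ Δ φ ψ} a b → formSize φ ≤ a → formSize ψ ≤ b → (φ ∧' ψ) ∈ Γ → Der c (φ ∷ ψ ∷ Γ) Δ → Der (suc (c + (a + b))) Γ Δ
∧L≤ {Γ = Γ} {Δ} {φ} {ψ} a b ha hb m p = rule₁ (∧L Γ Δ φ ψ) tt refl _ (≋-mem m , ≋-refl)
  (≤-trans (szL₂ (formSize φ) _ (sz Γ) (sz Δ)) (+-monoʳ-≤ (sz Γ + sz Δ) (+-mono-≤ ha hb))) p

∨R≤ : ∀ {c Γ Δ φ ψ} a b → formSize φ ≤ a → formSize ψ ≤ b → (φ ∨' ψ) ∈ Δ → Der c Γ (φ ∷ ψ ∷ Δ) → Der (suc (c + (a + b))) Γ Δ
∨R≤ {Γ = Γ} {Δ} {φ} {ψ} a b ha hb m p = rule₁ (∨R Γ Δ φ ψ) tt refl _ (≋-refl , ≋-mem m)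
  (≤-trans (szR₂ (formSize φ) _ (sz Γ) (sz Δ)) (+-monoʳ-≤ (sz Γ + sz Δ) (+-mono-≤ ha hb))) p

∧R≤ : ∀ {c₁ c₂ Γ Δ φ ψ} a b → formSize φ ≤ a → formSize ψ ≤ b → (φ ∧' ψ) ∈ Δ → Der c₁ Γ (φ ∷ Δ) → Der c₂ Γ (ψ ∷ Δ) → Der (suc (c₁ + c₂ + (a + b))) Γ Δ
∧R≤ {Γ = Γ} {Δ} {φ} {ψ} a b ha hb m p q = rule₂ (∧R Γ Δ φ ψ) tt refl _ (≋-refl , ≋-mem m)
  (≤-trans (szR₁ (formSize φ) (sz Γ) (sz Δ)) (+-monoʳ-≤ (sz Γ + sz Δ) (≤-trans ha (m≤m+n a b))))
  (≤-trans (szR₁ (formSize ψ) (sz Γ) (sz Δ)) (+-monoʳ-≤ (sz Γ + sz Δ) (≤-trans hb (m≤n+m b a)))) p q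

∨L≤ : ∀ {c₁ c₂ Γ Δ φ ψ} a b → formSize φ ≤ a → formSize ψ ≤ b → (φ ∨' ψ) ∈ Γ → Der c₁ (φ ∷ Γ) Δ → Der c₂ (ψ ∷ Γ) Δ → Der (suc (c₁ + c₂ + (a + b))) Γ Δ
∨L≤ {Γ = Γ} {Δ} {φ} {ψ} a b ha hb m p q = rule₂ (∨L Γ Δ φ ψ) tt refl _ (≋-mem m , ≋-refl)
  (≤-trans (szL₁ (formSize φ) (sz Γ) (sz Δ)) (+-monoʳ-≤ (sz Γ + sz Δ) (≤-trans ha (m≤m+n a b))))
  (≤-trans (szL₁ (formSize ψ) (sz Γ) (sz Δ)) (+-monoʳ-≤ (sz Γ + sz Δ) (≤-trans hb (m≤n+m b a)))) p q

∀L≤ : ∀ {c Γ Δ φ} a t → formSize (inst φ t) ≤ a → ∀' φ ∈ Γ → Der c (inst φ t ∷ Γ) Δ → Der (suc (c + a)) Γ Δ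
∀L≤ {Γ = Γ} {Δ} {φ} a t h m p = rule₁ (∀L Γ Δ φ t) tt refl _ (≋-mem m , ≋-refl)
  (≤-trans (szL₁ _ (sz Γ) (sz Δ)) (+-monoʳ-≤ (sz Γ + sz Δ) h)) p

∃R≤ : ∀ {c Γ Δ φ} a t → formSize (inst φ t) ≤ a → ∃' φ ∈ Δ → Der c Γ (inst φ t ∷ Δ) → Der (suc (c + a)) Γ Δ
∃R≤ {Γ = Γ} {Δ} {φ} a t h m p = rule₁ (∃R Γ Δ φ t) tt refl _ (≋-refl , ≋-mem m)
  (≤-trans (szR₁ _ (sz Γ) (sz Δ)) (+-monoʳ-≤ (sz Γ + sz Δ) h)) p

∀R≤ : ∀ {c Γ Δ φ} a x → formSize φ ≤ a → FreshIn x Γ → FreshIn x Δ → ∀' φ ∈ Δ → Der c Γ (inst φ (fv x) ∷ Δ) → Der (suc (c + a)) Γ Δ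
∀R≤ {Γ = Γ} {Δ} {φ} a x h f g m p = rule₁ (∀R Γ Δ φ x) (f , g , g _ m) refl _ (≋-refl , ≋-mem m)
  (≤-trans (szR₁ _ (sz Γ) (sz Δ)) (+-monoʳ-≤ (sz Γ + sz Δ) (≤-trans (≤-reflexive (inst-size φ x)) h))) p

∃L≤ : ∀ {c Γ Δ φ} a x → formSize φ ≤ a → FreshIn x Γ → FreshIn x Δ → ∃' φ ∈ Γ → Der c (inst φ (fv x) ∷ Γ) Δ → Der (suc (c + a)) Γ Δ
∃L≤ {Γ = Γ} {Δ} {φ} a x h f g m p = rule₁ (∃L Γ Δ φ x) (f , g , f _ m) refl _ (≋-mem m , ≋-refl)
  (≤-trans (szL₁ _ (sz Γ) (sz Δ)) (+-monoʳ-≤ (sz Γ + sz Δ) (≤-trans (≤-reflexive (inst-size φ x)) h))) p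

∧L∈ : ∀ {c Γ Δ φ ψ} → (φ ∧' ψ) ∈ Γ → Der c (φ ∷ ψ ∷ Γ) Δ → Der (suc (c + (formSize φ + formSize ψ))) Γ Δ
∧L∈ = ∧L≤ _ _ ≤-refl ≤-refl

∨R∈ : ∀ {c Γ Δ φ ψ} → (φ ∨' ψ) ∈ Δ → Der c Γ (φ ∷ ψ ∷ Δ) → Der (suc (c + (formSize φ + formSize ψ))) Γ Δ
∨R∈ = ∨R≤ _ _ ≤-refl ≤-refl

∨L∈ : ∀ {c₁ c₂ Γ Δ φ ψ} → (φ ∨' ψ) ∈ Γ → Der c₁ (φ ∷ Γ) Δ → Der c₂ (ψ ∷ Γ) Δ → Der (suc (c₁ + c₂ + (formSize φ + formSize ψ))) Γ Δ
∨L∈ = ∨L≤ _ _ ≤-refl ≤-refl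

∀L∈ : ∀ {c Γ Δ φ} t → ∀' φ ∈ Γ → Der c (inst φ t ∷ Γ) Δ → Der (suc (c + formSize (inst φ t))) Γ Δ
∀L∈ t = ∀L≤ _ t ≤-refl

∀R∈ : ∀ {c Γ Δ φ} x → FreshIn x Γ → FreshIn x Δ → ∀' φ ∈ Δ → Der c Γ (inst φ (fv x) ∷ Δ) → Der (suc (c + formSize φ)) Γ Δ
∀R∈ x = ∀R≤ _ x ≤-refl

∃L∈ : ∀ {c Γ Δ φ} x → FreshIn x Γ → FreshIn x Δ → ∃' φ ∈ Γ → Der c (inst φ (fv x) ∷ Γ) Δ → Der (suc (c + formSize φ)) Γ Δ
∃L∈ x = ∃L≤ _ x ≤-refl

sub : ∀ {c Γ Δ} (θ : Subst) → Der c Γ Δ → Der (suc (c + seqSize (Γ ⇒ Δ))) (map (fsubF θ) Γ) (map (fsubF θ) Δ)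
sub {Γ = Γ} {Δ} θ p = rule₁ (subR θ Γ Δ) tt refl _ (≋-refl , ≋-refl) (m≤n+m _ (seqSize (map (fsubF θ) Γ ⇒ map (fsubF θ) Δ))) p

-- Fresh names; contradiction and excluded middle for arbitrary formulas

freshT : ∀ {n} → Term n → ℕ
freshT (bv i) = 0
freshT (fv x) = suc x
freshT zer = 0
freshT (sc t) = freshT t
freshT (t ⊕ u) = freshT t ⊔ freshT u
freshT (t ⊗ u) = freshT t ⊔ freshT u

freshF : ∀ {n} → Formula n → ℕ
freshF (t ≐ u) = freshT t ⊔ freshT u
freshF (t ≺ u) = freshT t ⊔ freshT u
freshF (t ≉ u) = freshT t ⊔ freshT u
freshF (t ⊀ u) = freshT t ⊔ freshT u
freshF (φ ∧' ψ) = freshF φ ⊔ freshF ψ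
freshF (φ ∨' ψ) = freshF φ ⊔ freshF ψ
freshF (∀' φ) = freshF φ
freshF (∃' φ) = freshF φ

freshT-bound : ∀ {n x} {t : Term n} → FreeT x t → x < freshT t
freshT-bound here = ≤-refl
freshT-bound (sc₁ p) = freshT-bound p
freshT-bound (⊕₁ p) = ≤-trans (freshT-bound p) (m≤m⊔n _ _)
freshT-bound (⊕₂ p) = ≤-trans (freshT-bound p) (m≤n⊔m _ _)
freshT-bound (⊗₁ p) = ≤-trans (freshT-bound p) (m≤m⊔n _ _)
freshT-bound (⊗₂ p) = ≤-trans (freshT-bound p) (m≤n⊔m _ _)

freshA-bound : ∀ {n x} {t u : Term n} → FreeA x t u → x < freshT t ⊔ freshT u
freshA-bound (inj₁ p) = ≤-trans (freshT-bound p) (m≤m⊔n _ _)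
freshA-bound (inj₂ p) = ≤-trans (freshT-bound p) (m≤n⊔m _ _)

freshF-bound : ∀ {n x} (φ : Formula n) → FreeF x φ → x < freshF φ
freshF-bound (t ≐ u) p = freshA-bound p
freshF-bound (t ≺ u) p = freshA-bound p
freshF-bound (t ≉ u) p = freshA-bound p
freshF-bound (t ⊀ u) p = freshA-bound p
freshF-bound (φ ∧' ψ) (inj₁ p) = ≤-trans (freshF-bound φ p) (m≤m⊔n _ _)
freshF-bound (φ ∧' ψ) (inj₂ p) = ≤-trans (freshF-bound ψ p) (m≤n⊔m _ _)
freshF-bound (φ ∨' ψ) (inj₁ p) = ≤-trans (freshF-bound φ p) (m≤m⊔n _ _)
freshF-bound (φ ∨' ψ) (inj₂ p) = ≤-trans (freshF-bound ψ p) (m≤n⊔m _ _)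
freshF-bound (∀' φ) p = freshF-bound φ p
freshF-bound (∃' φ) p = freshF-bound φ p

fresh-not : ∀ {n} (φ : Formula n) → ¬ FreeF (freshF φ) φ
fresh-not φ p = <-irrefl refl (freshF-bound φ p)

-- Each connective pays a linear price for its rules and weakenings, hence a square. The factor 5 is
-- set by the binary case, where the price is `5 * suc (a + b)`; the square of 1 + a + b exceeds a²
-- + b² by enough to cover it.
idCost : ℕ → ℕ
idCost s = 5 * (s * s)

idCost-bin : ∀ a b {c₁ c₂} → c₁ ≤ idCost a → c₂ ≤ idCost b →
  suc (suc (suc (c₁ + (a + a)) + (a + b)) + suc (suc (c₂ + (b + b)) + (a + b)) + (a + b)) ≤ idCost (suc (a + b))
idCost-bin a b {c₁} {c₂} h₁ h₂ = begin
    suc (suc (suc (c₁ + (a + a)) + (a + b)) + suc (suc (c₂ + (b + b)) + (a + b)) + (a + b))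
  ≡⟨ solve 4 (λ a b c₁ c₂ → con 1 :+ (con 1 :+ (con 1 :+ (c₁ :+ (a :+ a)) :+ (a :+ b)) :+ (con 1 :+ (con 1 :+ (c₂ :+ (b :+ b)) :+ (a :+ b))) :+ (a :+ b))
       := c₁ :+ c₂ :+ con 5 :* (con 1 :+ (a :+ b))) refl a b c₁ c₂ ⟩
    c₁ + c₂ + 5 * suc (a + b)
  ≤⟨ +-monoˡ-≤ _ (+-mono-≤ h₁ h₂) ⟩
    idCost a + idCost b + 5 * suc (a + b)
  ≤⟨ m≤m+n _ (5 * (a + b + 2 * (a * b))) ⟩
    idCost a + idCost b + 5 * suc (a + b) + 5 * (a + b + 2 * (a * b))
  ≡⟨ solve 2 (λ a b → con 5 :* (a :* a) :+ con 5 :* (b :* b) :+ con 5 :* (con 1 :+ (a :+ b)) :+ con 5 :* (a :+ b :+ con 2 :* (a :* b))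
       := con 5 :* ((con 1 :+ (a :+ b)) :* (con 1 :+ (a :+ b)))) refl a b ⟩
    idCost (suc (a + b)) ∎
  where
  open ≤-Reasoning
  open +-*-Solver

idCost-un : ∀ a {c} → c ≤ idCost a → suc (suc (suc (c + (a + a)) + a) + a) ≤ idCost (suc a)
idCost-un a {c} h = begin
    suc (suc (suc (c + (a + a)) + a) + a)
  ≡⟨ solve 2 (λ a c → con 1 :+ (con 1 :+ (con 1 :+ (c :+ (a :+ a)) :+ a) :+ a) := c :+ (con 3 :+ con 4 :* a)) refl a c ⟩
    c + (3 + 4 * a)
  ≤⟨ +-monoˡ-≤ _ h ⟩
    idCost a + (3 + 4 * a)
  ≤⟨ m≤m+n _ (2 + 6 * a) ⟩
    idCost a + (3 + 4 * a) + (2 + 6 * a)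
  ≡⟨ solve 1 (λ a → con 5 :* (a :* a) :+ (con 3 :+ con 4 :* a) :+ (con 2 :+ con 6 :* a) := con 5 :* ((con 1 :+ a) :* (con 1 :+ a))) refl a ⟩
    idCost (suc a) ∎
  where
  open ≤-Reasoning
  open +-*-Solver

swap≋ : ∀ {φ ψ : Formula 0} → (φ ∷ ψ ∷ []) ≋ (ψ ∷ φ ∷ [])
swap≋ χ = f , f
  where
  f : ∀ {φ ψ} → χ ∈ (φ ∷ ψ ∷ []) → χ ∈ (ψ ∷ φ ∷ [])
  f (here e) = there (here e)
  f (there (here e)) = here e

fresh-pair : ∀ {x} {φ ψ : Formula 0} → ¬ FreeF x φ → ¬ FreeF x ψ → FreshIn x (φ ∷ ψ ∷ [])
fresh-pair p q χ (here refl) = p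
fresh-pair p q χ (there (here refl)) = q

fresh-[] : ∀ {x} → FreshIn x []
fresh-[] χ ()

pair-size : ∀ (φ : Formula 0) → sz (φ ∷ dual φ ∷ []) ≡ formSize φ + formSize φ
pair-size φ = cong (formSize φ +_) (trans (+-identityʳ _) (dual-size φ))

wkPairL : ∀ {c Γ Δ} φ → φ ∈ Γ → dual φ ∈ Γ → Der c (φ ∷ dual φ ∷ []) [] → Der (suc (c + (formSize φ + formSize φ))) Γ Δ
wkPairL {Γ = Γ} {Δ} φ m n p = wkBy _ (≤-trans (≤-reflexive (trans (+-identityʳ _) (pair-size φ))) (m≤n+m _ (seqSize (Γ ⇒ Δ)))) (∷-⊆ m ([]-⊆ n)) ∅-⊆ p

wkPairR : ∀ {c Γ Δ} φ → φ ∈ Δ → dual φ ∈ Δ → Der c [] (φ ∷ dual φ ∷ []) → Der (suc (c + (formSize φ + formSize φ))) Γ Δ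
wkPairR {Γ = Γ} {Δ} φ m n p = wkBy _ (≤-trans (≤-reflexive (pair-size φ)) (m≤n+m _ (seqSize (Γ ⇒ Δ)))) ∅-⊆ (∷-⊆ m ([]-⊆ n)) p

duals≤ : ∀ {n} (φ : Formula n) → formSize (dual φ) ≤ formSize φ
duals≤ φ = ≤-reflexive (dual-size φ)

inst≤ : ∀ (φ : Formula 1) x → formSize (inst φ (fv x)) ≤ formSize φ
inst≤ φ x = ≤-reflexive (inst-size φ x)

resize : ∀ {a b Γ Δ} → a ≡ b → Der (suc (idCost a + (a + a))) Γ Δ → Der (suc (idCost b + (b + b))) Γ Δ
resize refl p = p

-- The recursion is on a bound for the size because instances are not subformulas.
idL-fuel : ∀ k φ → formSize φ ≤ k → Der (idCost (formSize φ)) (φ ∷ dual φ ∷ []) []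
idL-fuel k (t ≐ u) _ = Der-mono (s≤s z≤n) (ax (negL (t ≐ u)) tt refl (≋-refl , ≋-refl))
idL-fuel k (t ≺ u) _ = Der-mono (s≤s z≤n) (ax (negL (t ≺ u)) tt refl (≋-refl , ≋-refl))
idL-fuel k (t ≉ u) _ = Der-mono (s≤s z≤n) (ax (negL (t ≐ u)) tt refl (swap≋ , ≋-refl))
idL-fuel k (t ⊀ u) _ = Der-mono (s≤s z≤n) (ax (negL (t ≺ u)) tt refl (swap≋ , ≋-refl))
idL-fuel (suc k) (φ ∧' ψ) (s≤s h) = Der-mono (idCost-bin (formSize φ) (formSize ψ) ≤-refl ≤-refl)
  (∨L≤ _ _ (duals≤ φ) (duals≤ ψ) (there (here refl))
    (∧L∈ (there (here refl)) (wkPairL φ (here refl) (there (there (here refl))) (idL-fuel k φ (≤-trans (m≤m+n _ _) h))))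
    (∧L∈ (there (here refl)) (wkPairL ψ (there (here refl)) (there (there (here refl))) (idL-fuel k ψ (≤-trans (m≤n+m _ _) h)))))
idL-fuel (suc k) (φ ∨' ψ) (s≤s h) = Der-mono (idCost-bin (formSize φ) (formSize ψ) ≤-refl ≤-refl)
  (∨L∈ (here refl)
    (∧L≤ _ _ (duals≤ φ) (duals≤ ψ) (there (there (here refl))) (wkPairL φ (there (there (here refl))) (here refl) (idL-fuel k φ (≤-trans (m≤m+n _ _) h))))
    (∧L≤ _ _ (duals≤ φ) (duals≤ ψ) (there (there (here refl))) (wkPairL ψ (there (there (here refl))) (there (here refl)) (idL-fuel k ψ (≤-trans (m≤n+m _ _) h)))))
idL-fuel (suc k) (∀' φ) (s≤s h) = Der-mono (idCost-un (formSize φ) ≤-refl)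
  (∃L≤ _ (freshF φ) (duals≤ φ) (fresh-pair (fresh-not φ) (fresh-not φ ∘ dual-free φ)) fresh-[] (there (here refl))
    (∀L≤ _ (fv (freshF φ)) (inst≤ φ _) (there (here refl))
      (resize (inst-size φ (freshF φ))
        (wkPairL (inst φ (fv (freshF φ))) (here refl) (there (here (sym (bsubF-dual _ φ))))
          (idL-fuel k (inst φ (fv (freshF φ))) (≤-trans (inst≤ φ _) h))))))
idL-fuel (suc k) (∃' φ) (s≤s h) = Der-mono (idCost-un (formSize φ) ≤-refl)
  (∃L≤ _ (freshF φ) ≤-refl (fresh-pair (fresh-not φ) (fresh-not φ ∘ dual-free φ)) fresh-[] (here refl)
    (∀L≤ _ (fv (freshF φ)) (≤-trans (inst≤ (dual φ) _) (duals≤ φ)) (there (there (here refl)))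
      (resize (inst-size φ (freshF φ))
        (wkPairL (inst φ (fv (freshF φ))) (there (here refl)) (here (sym (bsubF-dual _ φ)))
          (idL-fuel k (inst φ (fv (freshF φ))) (≤-trans (inst≤ φ _) h))))))

emR-fuel : ∀ k φ → formSize φ ≤ k → Der (idCost (formSize φ)) [] (φ ∷ dual φ ∷ [])
emR-fuel k (t ≐ u) _ = Der-mono (s≤s z≤n) (ax (negR (t ≐ u)) tt refl (≋-refl , ≋-refl))
emR-fuel k (t ≺ u) _ = Der-mono (s≤s z≤n) (ax (negR (t ≺ u)) tt refl (≋-refl , ≋-refl))
emR-fuel k (t ≉ u) _ = Der-mono (s≤s z≤n) (ax (negR (t ≐ u)) tt refl (≋-refl , swap≋))
emR-fuel k (t ⊀ u) _ = Der-mono (s≤s z≤n) (ax (negR (t ≺ u)) tt refl (≋-refl , swap≋))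
emR-fuel (suc k) (φ ∧' ψ) (s≤s h) = Der-mono (idCost-bin (formSize φ) (formSize ψ) ≤-refl ≤-refl)
  (∧R≤ _ _ ≤-refl ≤-refl (here refl)
    (∨R≤ _ _ (duals≤ φ) (duals≤ ψ) (there (there (here refl))) (wkPairR φ (there (there (here refl))) (here refl) (emR-fuel k φ (≤-trans (m≤m+n _ _) h))))
    (∨R≤ _ _ (duals≤ φ) (duals≤ ψ) (there (there (here refl))) (wkPairR ψ (there (there (here refl))) (there (here refl)) (emR-fuel k ψ (≤-trans (m≤n+m _ _) h)))))
emR-fuel (suc k) (φ ∨' ψ) (s≤s h) = Der-mono (idCost-bin (formSize φ) (formSize ψ) ≤-refl ≤-refl)
  (∧R≤ _ _ (duals≤ φ) (duals≤ ψ) (there (here refl))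
    (∨R∈ (there (here refl)) (wkPairR φ (here refl) (there (there (here refl))) (emR-fuel k φ (≤-trans (m≤m+n _ _) h))))
    (∨R∈ (there (here refl)) (wkPairR ψ (there (here refl)) (there (there (here refl))) (emR-fuel k ψ (≤-trans (m≤n+m _ _) h)))))
emR-fuel (suc k) (∀' φ) (s≤s h) = Der-mono (idCost-un (formSize φ) ≤-refl)
  (∀R≤ _ (freshF φ) ≤-refl fresh-[] (fresh-pair (fresh-not φ) (fresh-not φ ∘ dual-free φ)) (here refl)
    (∃R≤ _ (fv (freshF φ)) (≤-trans (inst≤ (dual φ) _) (duals≤ φ)) (there (there (here refl)))
      (resize (inst-size φ (freshF φ))
        (wkPairR (inst φ (fv (freshF φ))) (there (here refl)) (here (sym (bsubF-dual _ φ)))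
          (emR-fuel k (inst φ (fv (freshF φ))) (≤-trans (inst≤ φ _) h))))))
emR-fuel (suc k) (∃' φ) (s≤s h) = Der-mono (idCost-un (formSize φ) ≤-refl)
  (∀R≤ _ (freshF φ) (duals≤ φ) fresh-[] (fresh-pair (fresh-not φ) (fresh-not φ ∘ dual-free φ)) (there (here refl))
    (∃R≤ _ (fv (freshF φ)) (inst≤ φ _) (there (here refl))
      (resize (inst-size φ (freshF φ))
        (wkPairR (inst φ (fv (freshF φ))) (here refl) (there (here (sym (bsubF-dual _ φ))))
          (emR-fuel k (inst φ (fv (freshF φ))) (≤-trans (inst≤ φ _) h))))))

contraCost : ℕ → ℕ
contraCost s = suc (idCost s + (s + s))

contra : ∀ {Γ Δ} φ → φ ∈ Γ → dual φ ∈ Γ → Der (contraCost (formSize φ)) Γ Δ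
contra φ m n = wkPairL φ m n (idL-fuel _ φ ≤-refl)

em : ∀ {Γ Δ} φ → φ ∈ Δ → dual φ ∈ Δ → Der (contraCost (formSize φ)) Γ Δ
em φ m n = wkPairR φ m n (emR-fuel _ φ ≤-refl)

contraCost-mono : ∀ {a b} → a ≤ b → contraCost a ≤ contraCost b
contraCost-mono h = s≤s (+-mono-≤ (*-monoʳ-≤ 5 (*-mono-≤ h h)) (+-mono-≤ h h))

-- Finite disjunctions, conjunctions and universal closures in derivations

⋁ : Cedent → Formula 0
⋁ [] = zer ≉ zer
⋁ (φ ∷ φs) = φ ∨' ⋁ φs

⋀ : Cedent → Formula 0
⋀ [] = zer ≐ zer
⋀ (φ ∷ φs) = φ ∧' ⋀ φs

⋁-size : ∀ φs → formSize (⋁ φs) ≡ length φs + sz φs + 3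
⋁-size [] = refl
⋁-size (φ ∷ φs) = cong suc (trans (cong (formSize φ +_) (⋁-size φs))
  (solve 3 (λ a l s → a :+ (l :+ s :+ con 3) := l :+ (a :+ s) :+ con 3) refl (formSize φ) (length φs) (sz φs)))
  where open +-*-Solver

⋀-size : ∀ φs → formSize (⋀ φs) ≡ length φs + sz φs + 3
⋀-size [] = refl
⋀-size (φ ∷ φs) = cong suc (trans (cong (formSize φ +_) (⋀-size φs))
  (solve 3 (λ a l s → a :+ (l :+ s :+ con 3) := l :+ (a :+ s) :+ con 3) refl (formSize φ) (length φs) (sz φs)))
  where open +-*-Solver

⋁-free : ∀ {x} φs → FreeF x (⋁ φs) → Σ (Formula 0) λ φ → φ ∈ φs × FreeF x φ
⋁-free [] (inj₁ ())
⋁-free [] (inj₂ ())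
⋁-free (φ ∷ φs) (inj₁ p) = φ , here refl , p
⋁-free (φ ∷ φs) (inj₂ p) = let ψ , m , q = ⋁-free φs p in ψ , there m , q

⋀-free : ∀ {x} φs → FreeF x (⋀ φs) → Σ (Formula 0) λ φ → φ ∈ φs × FreeF x φ
⋀-free [] (inj₁ ())
⋀-free [] (inj₂ ())
⋀-free (φ ∷ φs) (inj₁ p) = φ , here refl , p
⋀-free (φ ∷ φs) (inj₂ p) = let ψ , m , q = ⋀-free φs p in ψ , there m , q

∈-size : ∀ {φ Γ} → φ ∈ Γ → formSize φ ≤ sz Γ
∈-size (here refl) = m≤m+n _ _
∈-size {Γ = ψ ∷ _} (there m) = ≤-trans (∈-size m) (m≤n+m _ (formSize ψ))

-- The accounting for a recursion along a list: a base B and a uniform charge per element. Charging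
-- every element at the size of the outer formula makes the total a plain product.
iter-step : ∀ B l {o o'} k → o ≤ o' → k ≤ suc o' → B + l * suc o + k ≤ B + suc l * suc o'
iter-step B l {o} {o'} k h hk = begin
    B + l * suc o + k ≤⟨ +-mono-≤ (+-monoʳ-≤ B (*-monoʳ-≤ l (s≤s h))) hk ⟩
    B + l * suc o' + suc o' ≡⟨ solve 3 (λ B x y → B :+ x :+ y := B :+ (y :+ x)) refl B (l * suc o') (suc o') ⟩
    B + suc l * suc o' ∎
  where
  open ≤-Reasoning
  open +-*-Solver

iter-suc : ∀ B l {o o'} k → o ≤ o' → k ≤ o' → suc (B + l * suc o + k) ≤ B + suc l * suc o'
iter-suc B l {o} k h hk = ≤-trans (≤-reflexive (sym (+-suc (B + l * suc o) k))) (iter-step B l (suc k) h (s≤s hk))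

-- Γ₀ and Δ₀ form the sequent that is really derived. It is weakened once, after all disjuncts have
-- been exposed, and not at each of them.
⋁R : ∀ φs {Γ Δ Γ₀ Δ₀ c} → ⋁ φs ∈ Δ → Γ₀ ⊆ Γ → (∀ {φ} → φ ∈ Δ₀ → φ ∈ φs ⊎ φ ∈ Δ) → Der c Γ₀ Δ₀ →
  Der (suc (c + seqSize (Γ₀ ⇒ Δ₀)) + length φs * suc (formSize (⋁ φs))) Γ Δ
⋁R [] m s t p = Der-mono (m≤m+n _ 0) (wk s ([ (λ ()) , id ]′ ∘ t) p)
⋁R (φ ∷ φs) {Γ₀ = Γ₀} {Δ₀} {c} m s t p = Der-mono
  (iter-suc (suc (c + seqSize (Γ₀ ⇒ Δ₀))) (length φs) (formSize φ + formSize (⋁ φs)) (≤-trans (m≤n+m _ (formSize φ)) (n≤1+n _)) (n≤1+n _))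
  (∨R∈ m (⋁R φs (there (here refl)) s (λ n → [ (λ { (here refl) → inj₂ (here refl) ; (there k) → inj₁ k }) , inj₂ ∘ there ∘ there ]′ (t n)) p))

botL : ∀ {Γ Δ} → (zer ≉ zer) ∈ Γ → Der 17 Γ Δ
botL m = cut (zer ≐ zer) (wk {Γ = []} {Δ = [ zer ≐ zer ]} ∅-⊆ ([]-⊆ (here refl)) (ax (eqRefl zer) tt refl (≋-refl , ≋-refl)))
  (wk (∷-⊆ (here refl) ([]-⊆ (there m))) ∅-⊆ (ax (negL (zer ≐ zer)) tt refl (≋-refl , ≋-refl)))

-- The branches are given over any larger Γ' because the remaining disjunctions pile up in the
-- antecedent.
⋁L : ∀ φs {Γ Δ Γ₀ c} → ⋁ φs ∈ Γ → Γ₀ ⊆ Γ → (∀ φ → φ ∈ φs → ∀ {Γ'} → Γ₀ ⊆ Γ' → φ ∈ Γ' → Der c Γ' Δ) →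
  Der (17 + length φs * suc (c + formSize (⋁ φs))) Γ Δ
⋁L [] m s h = Der-mono (m≤m+n 17 0) (botL m)
⋁L (φ ∷ φs) {c = c} m s h = Der-mono
  (≤-trans (≤-reflexive (solve 4 (λ c x f o → con 1 :+ (c :+ x :+ (f :+ o)) := x :+ (con 1 :+ (c :+ (f :+ o)))) refl c _ (formSize φ) (formSize (⋁ φs))))
    (iter-step 17 (length φs) (suc (c + (formSize φ + formSize (⋁ φs)))) (+-monoʳ-≤ c (≤-trans (m≤n+m _ (formSize φ)) (n≤1+n _))) (s≤s (+-monoʳ-≤ c (n≤1+n _)))))
  (∨L∈ m (h φ (here refl) (there ∘ s) (here refl)) (⋁L φs (here refl) (there ∘ s) (λ ψ n → h ψ (there n))))
  where open +-*-Solver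

⋀R : ∀ φs {Γ c} → (∀ φ → φ ∈ φs → Der c Γ [ φ ]) → Der (5 + length φs * suc (suc c + formSize (⋀ φs))) Γ [ ⋀ φs ]
⋀R [] h = Der-mono (m≤m+n 5 0) (wk {Γ = []} {Δ = [ zer ≐ zer ]} ∅-⊆ id (ax (eqRefl zer) tt refl (≋-refl , ≋-refl)))
⋀R (φ ∷ φs) {Γ} {c} h = Der-mono
  (≤-trans (≤-reflexive (solve 4 (λ c x f o → con 1 :+ (con 1 :+ (c :+ con 0) :+ (con 1 :+ (x :+ con 0)) :+ (f :+ o)) := x :+ (con 1 :+ (con 1 :+ c :+ (con 1 :+ (f :+ o))))) refl c _ (formSize φ) (formSize (⋀ φs))))
    (iter-step 5 (length φs) (suc (suc c + suc (formSize φ + formSize (⋀ φs)))) (+-monoʳ-≤ (suc c) (≤-trans (m≤n+m _ (formSize φ)) (n≤1+n _))) ≤-refl))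
  (∧R≤ _ _ ≤-refl ≤-refl (here refl) (widen φ (h φ (here refl))) (widen (⋀ φs) (⋀R φs (λ ψ n → h ψ (there n)))))
  where
  open +-*-Solver
  widen : ∀ ψ {k} → Der k Γ [ ψ ] → Der (suc (k + 0)) Γ (ψ ∷ (φ ∧' ⋀ φs) ∷ [])
  widen ψ p = wkBy 0 (≤-trans (+-monoʳ-≤ (sz Γ) (+-monoʳ-≤ (formSize ψ) z≤n)) (m≤m+n _ 0)) id (∷-mono ∅-⊆) p

⋀L : ∀ φs {Γ φ} → ⋀ φs ∈ Γ → φ ∈ φs → Der (2 + (formSize φ + formSize φ) + length φs * suc (formSize (⋀ φs))) Γ [ φ ]
⋀L (φ ∷ φs) m (here refl) = Der-mono
  (≤-trans (≤-reflexive (sym (+-suc (2 + (formSize φ + formSize φ)) _))) (+-monoʳ-≤ (2 + (formSize φ + formSize φ)) (≤-trans (n≤1+n _) (m≤m+n _ (length φs * suc (formSize (⋀ (φ ∷ φs))))))))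
  (∧L∈ m (idr (here refl) (here refl)))
⋀L (φ ∷ φs) {φ = ψ} m (there n) = Der-mono
  (iter-suc (2 + (formSize ψ + formSize ψ)) (length φs) (formSize φ + formSize (⋀ φs)) (≤-trans (m≤n+m _ (formSize φ)) (n≤1+n _)) (n≤1+n _))
  (∧L∈ m (⋀L φs (there (here refl)) n))

coerceR : ∀ {c Γ φ ψ} → φ ≡ ψ → Der c Γ [ φ ] → Der c Γ [ ψ ]
coerceR refl p = p

coerceL : ∀ {c Γ Δ φ ψ} → φ ≡ ψ → Der c (φ ∷ Γ) Δ → Der c (ψ ∷ Γ) Δ
coerceL refl p = p

∀R-abs : ∀ {c Γ ψ} x → FreshIn x Γ → Der c Γ [ ψ ] → Der (suc c) Γ [ ∀' (absF x ψ) ]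
∀R-abs {c} {Γ} {ψ} x f p = Der-mono (≤-reflexive (cong suc (+-identityʳ c)))
  (rule₁ (∀R Γ [] (absF x ψ) x) (f , fresh-[] , λ q → proj₂ (absF-free x x ψ q) refl) refl 0 (≋-refl , ≋-refl)
    (≤-trans (+-monoʳ-≤ (sz Γ) (+-monoˡ-≤ 0 (≤-trans (≤-reflexive (inst-size (absF x ψ) x)) (n≤1+n _)))) (m≤m+n _ 0))
    (coerceR (sym (inst-absF-self x ψ)) p))

closeR : ∀ xs {c Γ ψ} → (∀ x → x ∈ xs → FreshIn x Γ) → Der c Γ [ ψ ] → Der (length xs + c) Γ [ closeAll xs ψ ]
closeR [] f p = p
closeR (x ∷ xs) f p = ∀R-abs x (f x (here refl)) (closeR xs (λ y m → f y (there m)) p)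

openL : ∀ xs {Γ ψ} → closeAll xs ψ ∈ Γ → Der (2 + (formSize ψ + formSize ψ) + length xs * suc (formSize (closeAll xs ψ))) Γ [ ψ ]
openL [] m = Der-mono (m≤m+n _ 0) (idr m (here refl))
openL (x ∷ xs) {Γ} {ψ} m = Der-mono
  (iter-suc (2 + (formSize ψ + formSize ψ)) (length xs) (formSize K) (≤-trans K≤ (n≤1+n _)) (≤-trans K≤ (n≤1+n _)))
  (∀L≤ (formSize K) (fv x) (≤-reflexive (cong formSize (inst-absF-self x K))) m
    (coerceL (sym (inst-absF-self x K)) (openL xs (here refl))))
  where
  K = closeAll xs ψ
  K≤ : formSize K ≤ formSize (absF x K)
  K≤ = ≤-reflexive (sym (absF-size x K))

-- The calculus has no rules for negation, so a formula crosses to the right as its dual by a cut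
-- against excluded middle.
dualsR : ∀ Γ₁ {Γ Δ Γ₀ Δ₀ c} w → (∀ {γ} → γ ∈ Γ₁ → formSize γ ≤ w) → map dual Γ₁ ⊆ Δ → Γ₀ ⊆ (Γ₁ ++ Γ) → Δ₀ ⊆ Δ → Der c Γ₀ Δ₀ →
  Der (suc (c + seqSize (Γ₀ ⇒ Δ₀)) + length Γ₁ * suc (contraCost w + w)) Γ Δ
dualsR [] w hw d s t p = Der-mono (m≤m+n _ 0) (wk s t p)
dualsR (γ ∷ Γ₁) {Γ} {Γ₀ = Γ₀} {Δ₀} {c} w hw d s t p = Der-mono
  (≤-trans (s≤s (+-mono-≤ (+-monoˡ-≤ (B + l * suc k) (contraCost-mono (hw (here refl)))) (hw (here refl))))
    (≤-trans (≤-reflexive (solve 3 (λ a x w → con 1 :+ (a :+ x :+ w) := x :+ (con 1 :+ (a :+ w))) refl (contraCost w) (B + l * suc k) w))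
      (iter-step B l (suc k) ≤-refl ≤-refl)))
  (cut γ (em γ (here refl) (there (d (here refl))))
    (dualsR Γ₁ w (hw ∘ there) (d ∘ there) (perm ∘ s) t p))
  where
  open +-*-Solver
  B = suc (c + seqSize (Γ₀ ⇒ Δ₀))
  l = length Γ₁
  k = contraCost w + w
  perm : (γ ∷ Γ₁ ++ Γ) ⊆ (Γ₁ ++ γ ∷ Γ)
  perm (here refl) = ∈-++⁺ʳ Γ₁ (here refl)
  perm (there m) = [ ∈-++⁺ˡ , ∈-++⁺ʳ Γ₁ ∘ there ]′ (∈-++⁻ Γ₁ m)

-- This discharges the guards of a successor state. Each is derived over every Γ' ⊇ Γ, since the
-- guards cut before it stand in its antecedent.
cutAll : ∀ gs {Γ Δ Γ₀ Δ₀ c₀ c} w → (∀ {g} → g ∈ gs → formSize g ≤ w) → (∀ g → g ∈ gs → ∀ {Γ'} → Γ ⊆ Γ' → Der c Γ' [ g ]) →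
  Γ₀ ⊆ (gs ++ Γ) → Δ₀ ⊆ Δ → Der c₀ Γ₀ Δ₀ → Der (suc (c₀ + seqSize (Γ₀ ⇒ Δ₀)) + length gs * suc (suc c + w)) Γ Δ
cutAll [] w hw h s t p = Der-mono (m≤m+n _ 0) (wk s t p)
cutAll (g ∷ gs) {Γ} {Γ₀ = Γ₀} {Δ₀} {c₀} {c} w hw h s t p = Der-mono
  (≤-trans (s≤s (+-monoʳ-≤ (suc c + (B + l * suc k)) (hw (here refl))))
    (≤-trans (≤-reflexive (solve 3 (λ a x w → con 1 :+ (a :+ x :+ w) := x :+ (con 1 :+ (a :+ w))) refl (suc c) (B + l * suc k) w))
      (iter-step B l (suc k) ≤-refl ≤-refl)))
  (have g (h g (here refl) id)
    (cutAll gs w (hw ∘ there) (λ g' m s' → h g' (there m) (s' ∘ there)) (perm ∘ s) t p))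
  where
  open +-*-Solver
  B = suc (c₀ + seqSize (Γ₀ ⇒ Δ₀))
  l = length gs
  k = suc c + w
  perm : (g ∷ gs ++ Γ) ⊆ (gs ++ g ∷ Γ)
  perm (here refl) = ∈-++⁺ʳ gs (here refl)
  perm (there m) = [ ∈-++⁺ˡ , ∈-++⁺ʳ gs ∘ there ]′ (∈-++⁻ gs m)

imp : Cedent → Cedent → Formula 0
imp Γ Δ = ⋁ (map dual Γ ++ Δ)

impR : ∀ Γ₁ Δ₁ {Γ Γ₀ c} w → (∀ {γ} → γ ∈ Γ₁ → formSize γ ≤ w) → Γ₀ ⊆ (Γ₁ ++ Γ) → Der c Γ₀ Δ₁ →
  Der (suc (suc (c + seqSize (Γ₀ ⇒ Δ₁)) + length Γ₁ * suc (contraCost w + w) + seqSize (Γ ⇒ (map dual Γ₁ ++ Δ₁)))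
       + length (map dual Γ₁ ++ Δ₁) * suc (formSize (imp Γ₁ Δ₁))) Γ [ imp Γ₁ Δ₁ ]
impR Γ₁ Δ₁ w hw s p = ⋁R (map dual Γ₁ ++ Δ₁) (here refl) id inj₁ (dualsR Γ₁ w hw ∈-++⁺ˡ s (∈-++⁺ʳ (map dual Γ₁)) p)

impL : ∀ Γ₁ Δ₁ {Γ} w → (∀ {γ} → γ ∈ Γ₁ → formSize γ ≤ w) → (∀ {γ} → γ ∈ Δ₁ → formSize γ ≤ w) → imp Γ₁ Δ₁ ∈ Γ → Γ₁ ⊆ Γ →
  Der (17 + length (map dual Γ₁ ++ Δ₁) * suc (suc (contraCost w) + formSize (imp Γ₁ Δ₁))) Γ Δ₁
impL Γ₁ Δ₁ w hΓ hΔ m s = ⋁L (map dual Γ₁ ++ Δ₁) m s λ φ n s' k → close φ (∈-++⁻ (map dual Γ₁) n) s' k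
  where
  close : ∀ φ → φ ∈ map dual Γ₁ ⊎ φ ∈ Δ₁ → ∀ {Γ'} → Γ₁ ⊆ Γ' → φ ∈ Γ' → Der (suc (contraCost w)) Γ' Δ₁
  close φ (inj₁ n) s' k with ∈-map⁻ dual n
  ... | γ , g , refl = Der-mono (≤-trans (contraCost-mono (hΓ g)) (n≤1+n _)) (contra γ (s' g) k)
  close φ (inj₂ n) s' k = Der-mono (s≤s (s≤s (≤-trans (+-mono-≤ (hΔ n) (hΔ n)) (m≤n+m _ (idCost w))))) (idr k n)

-- The induction axiom for a named variable

absF-dual : ∀ {n} x (φ : Formula n) → absF x (dual φ) ≡ dual (absF x φ)
absF-dual x (t ≐ u) = refl
absF-dual x (t ≺ u) = refl
absF-dual x (t ≉ u) = refl
absF-dual x (t ⊀ u) = refl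
absF-dual x (φ ∧' ψ) = cong₂ _∨'_ (absF-dual x φ) (absF-dual x ψ)
absF-dual x (φ ∨' ψ) = cong₂ _∧'_ (absF-dual x φ) (absF-dual x ψ)
absF-dual x (∀' φ) = cong ∃' (absF-dual x φ)
absF-dual x (∃' φ) = cong ∀' (absF-dual x φ)

-- The same device as `Instantiates`, for the successor substitution hidden in `indAxiom`.
record Increments {n} (σ : Fin (suc n) → Term (suc n)) : Set where
  constructor increments
  field
    low : ∀ i → σ (inject₁ i) ≡ bv (inject₁ i)
    top : σ (fromℕ n) ≡ sc (bv (fromℕ n))

lift-increments : ∀ {n} {σ : Fin (suc n) → Term (suc n)} → Increments σ → Increments (liftB σ)
lift-increments (increments l h) = increments
  (λ { zero → refl ; (suc i) → cong shiftB (l i) }) (cong shiftB h)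

bsubT-inc : ∀ {n} {σ : Fin (suc n) → Term (suc n)} → Increments σ → ∀ x u → bsubT σ (absT x u) ≡ absT x (fsubT (x ↦ sc (fv x)) u)
bsubT-inc s x (bv i) = Increments.low s i
bsubT-inc {n} s x (fv y) with does (y ≟ x) | nameView y x
... | true | same refl = trans (Increments.top s) (cong sc top)
  where
  top : bv (fromℕ n) ≡ absT x (fv x)
  top with does (x ≟ x) | nameView x x
  ... | true | _ = refl
  ... | false | diff p = contradiction refl p
... | false | diff p = other
  where
  other : fv y ≡ absT x (fv y)
  other with does (y ≟ x) | nameView y x
  ... | true | same q = contradiction q p
  ... | false | _ = refl
bsubT-inc s x zer = refl
bsubT-inc s x (sc u) = cong sc (bsubT-inc s x u)
bsubT-inc s x (u ⊕ v) = cong₂ _⊕_ (bsubT-inc s x u) (bsubT-inc s x v)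
bsubT-inc s x (u ⊗ v) = cong₂ _⊗_ (bsubT-inc s x u) (bsubT-inc s x v)

bsubF-inc : ∀ {n} {σ : Fin (suc n) → Term (suc n)} → Increments σ → ∀ x φ → bsubF σ (absF x φ) ≡ absF x (fsubF (x ↦ sc (fv x)) φ)
bsubF-inc s x (t ≐ u) = cong₂ _≐_ (bsubT-inc s x t) (bsubT-inc s x u)
bsubF-inc s x (t ≺ u) = cong₂ _≺_ (bsubT-inc s x t) (bsubT-inc s x u)
bsubF-inc s x (t ≉ u) = cong₂ _≉_ (bsubT-inc s x t) (bsubT-inc s x u)
bsubF-inc s x (t ⊀ u) = cong₂ _⊀_ (bsubT-inc s x t) (bsubT-inc s x u)
bsubF-inc s x (φ ∧' ψ) = cong₂ _∧'_ (bsubF-inc s x φ) (bsubF-inc s x ψ)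
bsubF-inc s x (φ ∨' ψ) = cong₂ _∨'_ (bsubF-inc s x φ) (bsubF-inc s x ψ)
bsubF-inc s x (∀' φ) = cong ∀' (bsubF-inc (lift-increments s) x φ)
bsubF-inc s x (∃' φ) = cong ∃' (bsubF-inc (lift-increments s) x φ)

indHyp : ℕ → Formula 0 → Formula 0
indHyp y K = fsubF (y ↦ zer) K ∧' ∀' (absF y (K ⊃ fsubF (y ↦ sc (fv y)) K))

indAxiom-abs : ∀ y K → indAxiom (absF y K) ≡ (indHyp y K ⊃ ∀' (absF y K))
indAxiom-abs y K = cong₂ (λ a b → (a ∧' ∀' b) ⊃ ∀' (absF y K)) (inst-absF y K zer)
  (cong₂ _∨'_ (sym (absF-dual y K)) (bsubF-inc (increments (λ ()) refl) y K))

∧R₀ : ∀ {c₁ c₂ Γ φ ψ} → Der c₁ Γ [ φ ] → Der c₂ Γ [ ψ ] → Der (suc (c₁ + c₂)) Γ [ φ ∧' ψ ]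
∧R₀ {c₁} {c₂} {Γ} {φ} {ψ} p q = Der-mono (≤-reflexive (cong suc (+-identityʳ (c₁ + c₂))))
  (rule₂ (∧R Γ [] φ ψ) tt refl 0 (≋-refl , ≋-refl) (le (m≤m+n (formSize φ) _)) (le (m≤n+m (formSize ψ) (formSize φ))) p q)
  where
  le : ∀ {a b} → a ≤ b → sz Γ + (a + 0) ≤ sz Γ + suc (b + 0) + 0
  le h = ≤-trans (+-monoʳ-≤ (sz Γ) (≤-trans (+-monoˡ-≤ 0 h) (n≤1+n _))) (m≤m+n _ 0)

indAx : ∀ {Γ} y K → Der 2 Γ [ indHyp y K ⊃ ∀' (absF y K) ]
indAx {Γ} y K = wkBy 0 (≤-trans (m≤n+m _ (sz Γ)) (m≤m+n _ 0)) ∅-⊆ id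
  (der (ind (absF y K) (≋-refl , λ χ → subst (λ z → (χ ∈ [ indHyp y K ⊃ ∀' (absF y K) ] → χ ∈ [ z ]) × (χ ∈ [ z ] → χ ∈ [ indHyp y K ⊃ ∀' (absF y K) ])) (sym (indAxiom-abs y K)) (id , id)))
    (≤-reflexive (trans (+-comm 1 _) (sym (*-identityˡ _)))))

drop₀ : ∀ {c Γ Γ' ψ Δ} → sz Γ ≤ sz Γ' → Γ ⊆ Γ' → Der c Γ [ ψ ] → Der (suc (c + 0)) Γ' (ψ ∷ Δ)
drop₀ {ψ = ψ} h s p = wkBy 0 (≤-trans (+-mono-≤ h (+-monoʳ-≤ (formSize ψ) z≤n)) (m≤m+n _ 0)) s (∷-mono ∅-⊆) p

-- Costs as powers of a fixed base

module Scaled (W : ℕ) (8≤W : 8 ≤ W) where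

  instance
    W-nonZero : NonZero W
    W-nonZero = >-nonZero (≤-trans (s≤s z≤n) 8≤W)

  -- Only the exponent is tracked: a rule raises it by a constant, and no coefficients appear. As a
  -- record it keeps the exponent visible to unification, which could not recover it from `W ^ a`.
  record D (a : ℕ) (Γ Δ : Cedent) : Set where
    constructor mkD
    field
      get : Der (W ^ a) Γ Δ
  open D public

  toD : ∀ {c} a {Γ Δ} → c ≤ W ^ a → Der c Γ Δ → D a Γ Δ
  toD a h p = mkD (Der-mono h p)

  1≤pow : ∀ a → 1 ≤ W ^ a
  1≤pow a = m^n>0 W a

  pow-mono : ∀ {a b} → a ≤ b → W ^ a ≤ W ^ b
  pow-mono = ^-monoʳ-≤ W

  up : ∀ {a b x} → a ≤ b → x ≤ W ^ a → x ≤ W ^ b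
  up h p = ≤-trans p (pow-mono h)

  -- One further power absorbs up to eight summands. The largest need is in `contraCost≤`, where
  -- `1 + idCost s` takes six.
  add₈ : ∀ {a x} → x ≤ 8 * W ^ a → x ≤ W ^ suc a
  add₈ {a} h = ≤-trans h (*-monoˡ-≤ (W ^ a) 8≤W)

  add₂ : ∀ {a x y} → x ≤ W ^ a → y ≤ W ^ a → x + y ≤ W ^ suc a
  add₂ {a} {x} {y} p q = add₈ {a} (≤-trans (+-mono-≤ p q) (≤-trans (≤-reflexive (cong (W ^ a +_) (sym (+-identityʳ _)))) (*-monoˡ-≤ (W ^ a) {2} {8} (s≤s (s≤s z≤n)))))

  suc₁ : ∀ {a x} → x ≤ W ^ a → suc x ≤ W ^ suc a
  suc₁ {a} p = add₂ {a} {1} (1≤pow a) p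

  mul : ∀ {a b x y} → x ≤ W ^ a → y ≤ W ^ b → x * y ≤ W ^ (a + b)
  mul {a} {b} p q = ≤-trans (*-mono-≤ p q) (≤-reflexive (sym (^-distribˡ-+-* W a b)))

  self≤pow : ∀ x → x ≤ W ^ x
  self≤pow zero = z≤n
  self≤pow (suc x) = suc₁ {x} (self≤pow x)

  base : ∀ {x a} → x ≤ W → x ≤ W ^ suc a
  base {x} {a} h = ≤-trans h (m≤m*n W (W ^ a) {{>-nonZero (1≤pow a)}})

  contraCost≤ : ∀ {a s} → s ≤ W ^ a → contraCost s ≤ W ^ (2 + (a + a))
  contraCost≤ {a} {s} h = add₂ {suc (a + a)} {1 + idCost s}
    (≤-trans (s≤s (*-monoʳ-≤ 5 (mul {a} {a} h h))) (add₈ {a + a} (≤-trans (+-monoˡ-≤ (5 * W ^ (a + a)) (1≤pow (a + a))) (*-monoˡ-≤ (W ^ (a + a)) {6} {8} (s≤s (s≤s (s≤s (s≤s (s≤s (s≤s z≤n)))))) ))))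
    (add₂ {a + a} (up (m≤m+n a a) h) (up (m≤m+n a a) h))

  lift : ∀ {a b Γ Δ} → a ≤ b → D a Γ Δ → D b Γ Δ
  lift h (mkD p) = mkD (Der-mono (pow-mono h) p)

  rule₂-cost : ∀ a {x y z} → x ≤ W ^ a → y ≤ W ^ a → z ≤ W ^ a → suc (x + y + z) ≤ W ^ suc a
  rule₂-cost a p q r = add₈ {a} (≤-trans (s≤s (+-mono-≤ (+-mono-≤ p q) r))
    (≤-trans (≤-reflexive (solve 1 (λ w → con 1 :+ (w :+ w :+ w) := con 1 :+ con 3 :* w) refl (W ^ a)))
      (≤-trans (+-monoˡ-≤ (3 * W ^ a) (1≤pow a)) (*-monoˡ-≤ (W ^ a) {4} {8} (s≤s (s≤s (s≤s (s≤s z≤n))))))))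
    where open +-*-Solver

  rule₁-cost : ∀ a {x z} → x ≤ W ^ a → z ≤ W ^ a → suc (x + z) ≤ W ^ suc a
  rule₁-cost a {x} {z} p q = ≤-trans (s≤s (+-monoˡ-≤ z (m≤m+n x 0))) (rule₂-cost a {x} {0} {z} p z≤n q)

  cutD : ∀ a {Γ Δ} φ → formSize φ ≤ W ^ a → D a Γ (φ ∷ Δ) → D a (φ ∷ Γ) Δ → D (1 + a) Γ Δ
  cutD a φ h (mkD p) (mkD q) = toD _ (rule₂-cost a ≤-refl ≤-refl h) (cut φ p q)

  dropD : ∀ a {Γ Γ' ψ Δ} → sz Γ ≤ sz Γ' → Γ ⊆ Γ' → D a Γ [ ψ ] → D (1 + a) Γ' (ψ ∷ Δ)
  dropD a h s (mkD p) = toD _ (rule₁-cost a ≤-refl z≤n) (drop₀ h s p)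

  haveD : ∀ a {Γ Δ} φ → formSize φ ≤ W ^ a → D a Γ [ φ ] → D a (φ ∷ Γ) Δ → D (2 + a) Γ Δ
  haveD a φ h p q = cutD (1 + a) φ (up (n≤1+n a) h) (dropD a ≤-refl id p) (lift (n≤1+n a) q)

  wkD : ∀ a {Γ Δ Γ' Δ'} → seqSize (Γ ⇒ Δ) ≤ W ^ a → Γ ⊆ Γ' → Δ ⊆ Δ' → D a Γ Δ → D (1 + a) Γ' Δ'
  wkD a h s t (mkD p) = toD _ (rule₁-cost a ≤-refl h) (wk s t p)

  subD : ∀ a {Γ Δ} θ → seqSize (Γ ⇒ Δ) ≤ W ^ a → D a Γ Δ → D (1 + a) (map (fsubF θ) Γ) (map (fsubF θ) Δ)
  subD a θ h (mkD p) = toD _ (rule₁-cost a ≤-refl h) (sub θ p)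

  ∨RD : ∀ a {Γ Δ φ ψ} → formSize (φ ∨' ψ) ≤ W ^ a → (φ ∨' ψ) ∈ Δ → D a Γ (φ ∷ ψ ∷ Δ) → D (1 + a) Γ Δ
  ∨RD a h m (mkD p) = toD _ (rule₁-cost a ≤-refl (≤-trans (n≤1+n _) h)) (∨R∈ m p)

  ∨LD : ∀ a {Γ Δ φ ψ} → formSize (φ ∨' ψ) ≤ W ^ a → (φ ∨' ψ) ∈ Γ → D a (φ ∷ Γ) Δ → D a (ψ ∷ Γ) Δ → D (1 + a) Γ Δ
  ∨LD a h m (mkD p) (mkD q) = toD _ (rule₂-cost a ≤-refl ≤-refl (≤-trans (n≤1+n _) h)) (∨L∈ m p q)

  ∀LD : ∀ a {Γ Δ ψ} y → formSize ψ ≤ W ^ a → ∀' (absF y ψ) ∈ Γ → D a (ψ ∷ Γ) Δ → D (1 + a) Γ Δ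
  ∀LD a {ψ = ψ} y h m (mkD p) = toD _ (rule₁-cost a ≤-refl h)
    (∀L≤ (formSize ψ) (fv y) (≤-reflexive (cong formSize (inst-absF-self y ψ))) m (coerceL (sym (inst-absF-self y ψ)) p))

  ∧RD : ∀ a {Γ φ ψ} → D a Γ [ φ ] → D a Γ [ ψ ] → D (1 + a) Γ [ φ ∧' ψ ]
  ∧RD a (mkD p) (mkD q) = toD _ (≤-trans (s≤s (m≤m+n _ 0)) (rule₂-cost a ≤-refl ≤-refl z≤n)) (∧R₀ p q)

  contraD : ∀ a {Γ Δ} φ → formSize φ ≤ W ^ a → φ ∈ Γ → dual φ ∈ Γ → D (2 + (a + a)) Γ Δ
  contraD a φ h m n = toD _ (contraCost≤ {a} h) (contra φ m n)

  emD : ∀ a {Γ Δ} φ → formSize φ ≤ W ^ a → φ ∈ Δ → dual φ ∈ Δ → D (2 + (a + a)) Γ Δ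
  emD a φ h m n = toD _ (contraCost≤ {a} h) (em φ m n)

  idrD : ∀ a {Γ Δ} φ → formSize φ ≤ W ^ a → φ ∈ Γ → φ ∈ Δ → D (3 + a) Γ Δ
  idrD a φ h m n = toD _ (suc₁ {2 + a} (suc₁ {1 + a} (add₂ {a} h h))) (idr m n)

  -- Induction as a rule, by a cut on the axiom `A`. Of its two disjuncts, `dual H` contradicts the
  -- hypothesis `H` assembled from base and step, and the universal formula is instantiated at y
  -- itself.
  indD : ∀ b a {Γ} y K → formSize K ≤ W ^ b → formSize (fsubF (y ↦ zer) K) ≤ W ^ b → formSize (fsubF (y ↦ sc (fv y)) K) ≤ W ^ b → FreshIn y Γ →
    D a Γ [ fsubF (y ↦ zer) K ] → D a (K ∷ Γ) [ fsubF (y ↦ sc (fv y)) K ] → D (16 + ((b + b) + a)) Γ [ K ]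
  indD b a {Γ} y K hK hK₀ hK₁ f p₀ p₁ =
    haveD (14 + e) A (up (lo 10 4) hA) (toD _ (base {2} {13 + e} (≤-trans (s≤s (s≤s z≤n)) 8≤W)) (indAx y K))
      (∨LD (13 + e) (up (lo 9 4) hA) (here refl)
        (haveD (11 + e) H (up (lo 8 3) h≤)
          (lift (n≤1+n _) (weaken (9 + e) (∧RD (8 + e) (lift (hi 8) p₀) (toD _ (suc₁ {7 + e} ≤-refl) (∀R-abs y f (get (lift (n≤1+n _) B)))))))
          (lift (≤-trans (≤-reflexive (cong (5 +_) (trans (+-suc b (2 + b)) (cong suc (trans (+-suc b (1 + b)) (cong suc (+-suc b b))))))) (+-mono-≤ {8} {11} (m≤n+m 8 3) (m≤m+n (b + b) a))) (contraD (3 + b) H h≤ (here refl) (there (here refl)))))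
        (lift (lo 9 4) (∀LD (3 + b) y (up (m≤n+m b 3) hK) (here refl) (idrD b K hK (here refl) (here refl)))))
    where
    H = indHyp y K
    A = H ⊃ ∀' (absF y K)
    K₁ = fsubF (y ↦ sc (fv y)) K
    e = (b + b) + a
    lo : ∀ k j → j + b ≤ (k + j) + e
    lo k j = ≤-trans (+-monoʳ-≤ j (≤-trans (m≤m+n b b) (m≤m+n (b + b) a))) (+-monoˡ-≤ e (m≤n+m j k))
    hi : ∀ k → a ≤ k + e
    hi k = ≤-trans (m≤n+m a (b + b)) (m≤n+m e k)
    weaken : ∀ c {ψ} → D c Γ [ ψ ] → D (1 + c) (dual H ∷ A ∷ Γ) [ ψ ]
    weaken c p = dropD c (≤-trans (m≤n+m _ (formSize A)) (m≤n+m _ (formSize (dual H)))) (there ∘ there) p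
    hImp : formSize (K ⊃ K₁) ≤ W ^ (1 + b)
    hImp = rule₁-cost b (≤-trans (duals≤ K) hK) hK₁
    h≤ : formSize H ≤ W ^ (3 + b)
    h≤ = rule₁-cost (2 + b) (up (m≤n+m b 2) hK₀) (suc₁ {1 + b} (≤-trans (≤-reflexive (absF-size y (K ⊃ K₁))) hImp))
    hA : formSize A ≤ W ^ (4 + b)
    hA = rule₁-cost (3 + b) (≤-trans (duals≤ H) h≤) (suc₁ {2 + b} (≤-trans (≤-reflexive (absF-size y K)) (up (m≤n+m b 2) hK)))
    B : D (6 + e) Γ [ K ⊃ K₁ ]
    B = lift (n≤1+n _) (∨RD (4 + e) (up (lo 3 1) hImp) (here refl)
      (lift (n≤1+n _) (cutD (2 + e) K (up (lo 2 0) hK) (lift (+-monoʳ-≤ 2 (m≤m+n (b + b) a)) (emD b K hK (here refl) (there (here refl))))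
        (lift (+-mono-≤ (s≤s (z≤n {1})) (m≤n+m a (b + b))) (toD (1 + a) (rule₁-cost a ≤-refl z≤n)
          (wkBy 0 (≤-trans (+-monoʳ-≤ (formSize K + sz Γ) (≤-trans (+-monoʳ-≤ (formSize K₁) z≤n) (m≤n+m _ (formSize (dual K))))) (m≤m+n _ 0)) id ([]-⊆ (there (here refl))) (get p₁)))))))

-- Order in PA

-- The order lemmas are finitely many fixed derivations. Their costs are constants that influence
-- only the final exponent, so they are left unevaluated.
Prov : Cedent → Cedent → Set
Prov Γ Δ = Σ ℕ λ c → Der c Γ Δ

wkP : ∀ {Γ Δ Γ' Δ'} → Γ ⊆ Γ' → Δ ⊆ Δ' → Prov Γ Δ → Prov Γ' Δ'
wkP s t (_ , p) = _ , wk s t p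

haveP : ∀ {Γ Δ} φ → Prov Γ [ φ ] → Prov (φ ∷ Γ) Δ → Prov Γ Δ
haveP φ (_ , p) (_ , q) = _ , have φ p q

subP : ∀ {Γ Δ} θ → Prov Γ Δ → Prov (map (fsubF θ) Γ) (map (fsubF θ) Δ)
subP θ (_ , p) = _ , sub θ p

∧LP : ∀ {Γ Δ φ ψ} → (φ ∧' ψ) ∈ Γ → Prov (φ ∷ ψ ∷ Γ) Δ → Prov Γ Δ
∧LP m (_ , p) = _ , ∧L∈ m p

∨LP : ∀ {Γ Δ φ ψ} → (φ ∨' ψ) ∈ Γ → Prov (φ ∷ Γ) Δ → Prov (ψ ∷ Γ) Δ → Prov Γ Δ
∨LP m (_ , p) (_ , q) = _ , ∨L∈ m p q

∨RP : ∀ {Γ Δ φ ψ} → (φ ∨' ψ) ∈ Δ → Prov Γ (φ ∷ ψ ∷ Δ) → Prov Γ Δ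
∨RP m (_ , p) = _ , ∨R∈ m p

∀LP : ∀ {Γ Δ φ} t → ∀' φ ∈ Γ → Prov (inst φ t ∷ Γ) Δ → Prov Γ Δ
∀LP t m (_ , p) = _ , ∀L∈ t m p

freshC : Cedent → ℕ
freshC [] = 0
freshC (φ ∷ Γ) = freshF φ ⊔ freshC Γ

freshC-bound : ∀ {x φ} Γ → φ ∈ Γ → FreeF x φ → x < freshC Γ
freshC-bound (φ ∷ Γ) (here refl) f = ≤-trans (freshF-bound φ f) (m≤m⊔n _ _)
freshC-bound (φ ∷ Γ) (there m) f = ≤-trans (freshC-bound Γ m f) (m≤n⊔m (freshF φ) _)

freshC-fresh : ∀ Γ {x} → freshC Γ ≤ x → FreshIn x Γ
freshC-fresh Γ h φ m f = <-irrefl refl (≤-trans (freshC-bound Γ m f) h)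

∃LP : ∀ {Γ Δ φ} x → freshC Γ ≤ x → freshC Δ ≤ x → ∃' φ ∈ Γ → Prov (inst φ (fv x) ∷ Γ) Δ → Prov Γ Δ
∃LP {Γ} {Δ} x f g m (_ , p) = _ , ∃L∈ x (freshC-fresh Γ f) (freshC-fresh Δ g) m p

axP : ∀ r → Side r → prems r ≡ [] → Prov (ante (concl r)) (succ (concl r))
axP r s e = _ , ax r s e (≋-refl , ≋-refl)

idP : ∀ {Γ Δ} φ → φ ∈ Γ → φ ∈ Δ → Prov Γ Δ
idP φ m n = _ , idr m n

contraP : ∀ {Γ Δ} φ → φ ∈ Γ → dual φ ∈ Γ → Prov Γ Δ
contraP φ m n = _ , contra φ m n

casesP : ∀ {Γ Δ} φ → Prov (φ ∷ Γ) Δ → Prov (dual φ ∷ Γ) Δ → Prov Γ Δ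
casesP {Γ} {Δ} φ (_ , p) (_ , q) = _ , cut φ (cut (dual φ) (em φ (there (here refl)) (here refl)) (wk (∷-mono id) there q)) p

-- The name 9 marks the hole to be rewritten; the lemmas below otherwise use only the names 0 to 3.
rewP : ∀ {Γ} s t φ → IsAtom φ → (s ≐ t) ∈ Γ → fsubF (9 ↦ s) φ ∈ Γ → Prov Γ [ fsubF (9 ↦ t) φ ]
rewP s t φ a m n = wkP (∷-⊆ m ([]-⊆ n)) id (axP (eqSub s t 9 φ) a refl)

reflP : ∀ {Γ} t → Prov Γ [ t ≐ t ]
reflP t = wkP ∅-⊆ id (axP (eqRefl t) tt refl)

⟨_,_⟩ : Term 0 → Term 0 → Subst
⟨ a , b ⟩ 0 = a
⟨ a , b ⟩ 1 = b
⟨ a , b ⟩ n = fv n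

qP : ∀ {Γ} q a b → Prov Γ [ fsubF ⟨ a , b ⟩ (qFormula q) ]
qP q a b = wkP ∅-⊆ id (axP (qAx q ⟨ a , b ⟩) tt refl)

pattern m0 = here refl
pattern m1 = there (here refl)
pattern m2 = there (there (here refl))
pattern m3 = there (there (there (here refl)))
pattern m4 = there (there (there (there (here refl))))

splitP : ∀ {Γ Δ φ} χ ψ → Prov [ φ ] (χ ∷ ψ ∷ []) → Prov (χ ∷ φ ∷ Γ) Δ → Prov (ψ ∷ φ ∷ Γ) Δ → Prov (φ ∷ Γ) Δ
splitP χ ψ (_ , p) (_ , q) (_ , r) = _ , cut χ (cut ψ (wk ([]-⊆ m0) (∷-⊆ m1 ([]-⊆ m0)) p) (wk id there r)) q

-- Opaque, so that the costs inside these pairs are never normalised.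
abstract
  ≺-intro : Prov [ fv 0 ⊕ sc (fv 2) ≐ fv 1 ] [ fv 0 ≺ fv 1 ]
  ≺-intro = haveP (fsubF ⟨ fv 0 , fv 1 ⟩ (qFormula q8)) (qP q8 (fv 0) (fv 1))
    (∧LP m0 (∨LP m1 (∀LP (fv 2) m0 (contraP (fv 0 ⊕ sc (fv 2) ≐ fv 1) (there m4) m0)) (idP (fv 0 ≺ fv 1) m0 m0)))

  ≺-elim : Prov [ fv 0 ≺ fv 1 ] [ ∃' (fv 0 ⊕ sc (bv zero) ≐ fv 1) ]
  ≺-elim = haveP (fsubF ⟨ fv 0 , fv 1 ⟩ (qFormula q8)) (qP q8 (fv 0) (fv 1))
    (∧LP m0 (∨LP m0 (contraP (fv 0 ≺ fv 1) (there (there (there (there m0)))) m0) (idP (∃' (fv 0 ⊕ sc (bv zero) ≐ fv 1)) m0 m0)))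

  ≺-zero : Prov [ fv 0 ≺ zer ] []
  ≺-zero = haveP (∃' (fv 0 ⊕ sc (bv zero) ≐ zer)) (subP ⟨ fv 0 , zer ⟩ ≺-elim)
    (∃LP 2 (s≤s z≤n) z≤n m0
      (haveP (fv 0 ⊕ sc (fv 2) ≐ sc (fv 0 ⊕ fv 2)) (qP q5 (fv 0) (fv 2))
        (haveP (sc (fv 0 ⊕ fv 2) ≐ zer) (rewP (fv 0 ⊕ sc (fv 2)) (sc (fv 0 ⊕ fv 2)) (fv 9 ≐ zer) tt m0 m1)
          (haveP (sc (fv 0 ⊕ fv 2) ≉ zer) (qP q1 (fv 0 ⊕ fv 2) zer)
            (contraP (sc (fv 0 ⊕ fv 2) ≐ zer) m1 m0)))))

  ≺-suc : Prov [] [ fv 0 ≺ sc (fv 0) ]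
  ≺-suc = haveP (fv 0 ⊕ sc zer ≐ sc (fv 0 ⊕ zer)) (qP q5 (fv 0) zer)
    (haveP (fv 0 ⊕ zer ≐ fv 0) (qP q4 (fv 0) zer)
      (haveP (fv 0 ⊕ sc zer ≐ sc (fv 0)) (rewP (fv 0 ⊕ zer) (fv 0) (fv 0 ⊕ sc zer ≐ sc (fv 9)) tt m0 m1)
        (wkP ([]-⊆ m0) id (subP (λ { 2 → zer ; x → ⟨ fv 0 , sc (fv 0) ⟩ x }) ≺-intro))))

  ≺-step : Prov [ fv 0 ≺ fv 1 ] [ fv 0 ≺ sc (fv 1) ]
  ≺-step = haveP (∃' (fv 0 ⊕ sc (bv zero) ≐ fv 1)) ≺-elim
    (∃LP 2 (s≤s (s≤s z≤n)) (s≤s (s≤s z≤n)) m0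
      -- The witness grows by one: x + s(s z) = s(x + s z) = s y.
      (haveP (fv 0 ⊕ sc (sc (fv 2)) ≐ sc (fv 0 ⊕ sc (fv 2))) (qP q5 (fv 0) (sc (fv 2)))
        (haveP (fv 0 ⊕ sc (sc (fv 2)) ≐ sc (fv 1)) (rewP (fv 0 ⊕ sc (fv 2)) (fv 1) (fv 0 ⊕ sc (sc (fv 2)) ≐ sc (fv 9)) tt m1 m0)
          (wkP ([]-⊆ m0) id (subP (λ { 2 → sc (fv 2) ; x → ⟨ fv 0 , sc (fv 1) ⟩ x }) ≺-intro)))))

  -- From x + s z = s y injectivity of the successor gives x + z = y. If z is 0 then x = y; if z is
  -- a successor it witnesses x < y.
  ≺-suc-inv : Prov [ fv 0 ≺ sc (fv 1) ] ((fv 0 ≺ fv 1) ∷ (fv 0 ≐ fv 1) ∷ [])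
  ≺-suc-inv = haveP (∃' (fv 0 ⊕ sc (bv zero) ≐ sc (fv 1))) (subP ⟨ fv 0 , sc (fv 1) ⟩ ≺-elim)
    (∃LP 2 (s≤s (s≤s z≤n)) (s≤s (s≤s z≤n)) m0
      (haveP (fv 0 ⊕ sc (fv 2) ≐ sc (fv 0 ⊕ fv 2)) (qP q5 (fv 0) (fv 2))
        (haveP (sc (fv 0 ⊕ fv 2) ≐ sc (fv 1)) (rewP (fv 0 ⊕ sc (fv 2)) (sc (fv 0 ⊕ fv 2)) (fv 9 ≐ sc (fv 1)) tt m0 m1)
          (haveP (fsubF ⟨ fv 0 ⊕ fv 2 , fv 1 ⟩ (qFormula q2)) (qP q2 (fv 0 ⊕ fv 2) (fv 1))
            (∨LP m0 (contraP (sc (fv 0 ⊕ fv 2) ≐ sc (fv 1)) (there m1) m0)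
              (casesP (fv 2 ≐ zer)
                (haveP (fv 0 ⊕ zer ≐ fv 1) (rewP (fv 2) zer (fv 0 ⊕ fv 9 ≐ fv 1) tt m0 m1)
                  (haveP (fv 0 ⊕ zer ≐ fv 0) (qP q4 (fv 0) zer)
                    (wkP id ([]-⊆ m1) (rewP (fv 0 ⊕ zer) (fv 0) (fv 9 ≐ fv 1) tt m0 m1))))
                (haveP (fsubF ⟨ fv 2 , zer ⟩ (qFormula q3)) (qP q3 (fv 2) zer)
                  (∨LP m0 (contraP (fv 2 ≐ zer) m0 (there m1))
                    (∃LP 3 (s≤s (s≤s (s≤s z≤n))) (s≤s (s≤s z≤n)) m0
                      (haveP (fv 0 ⊕ sc (fv 3) ≐ fv 1) (rewP (fv 2) (sc (fv 3)) (fv 0 ⊕ fv 9 ≐ fv 1) tt m0 (there m3))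
                        (wkP ([]-⊆ m0) ([]-⊆ m0) (subP (λ { 2 → fv 3 ; x → ⟨ fv 0 , fv 1 ⟩ x }) ≺-intro))))))))))))

  ≺-pred : Prov [ fv 0 ≺ fv 1 ] [ ∃' (fv 1 ≐ sc (bv zero)) ]
  ≺-pred = haveP (fsubF ⟨ fv 1 , zer ⟩ (qFormula q3)) (qP q3 (fv 1) zer)
    (∨LP m0
      (haveP (fv 0 ≺ zer) (rewP (fv 1) zer (fv 0 ≺ fv 9) tt m0 m2) (wkP ([]-⊆ m0) ∅-⊆ ≺-zero))
      (idP (∃' (fv 1 ≐ sc (bv zero))) m0 m0))

  -- A weak bound is written `≺ sc`, so this composes a strict with a weak inequality. Of the order
  -- facts here it is the one proved by induction, on the upper bound; `≺-suc-inv` drives the step.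
  ≺-trans : Prov ((fv 0 ≺ fv 1) ∷ (fv 1 ≺ sc (fv 2)) ∷ []) [ fv 0 ≺ fv 2 ]
  ≺-trans = haveP K (wkP ∅-⊆ id all) (∨LP m0 (contraP (fv 0 ≺ fv 1) m2 m0)
      (∨LP m0 (contraP (fv 1 ≺ sc (fv 2)) m4 m0) (idP (fv 0 ≺ fv 2) m0 m0)))
    where
    K : Formula 0
    K = (fv 0 ⊀ fv 1) ∨' (fv 1 ⊀ sc (fv 2)) ∨' (fv 0 ≺ fv 2)
    K⟨_⟩ : Term 0 → Formula 0
    K⟨ t ⟩ = (fv 0 ⊀ fv 1) ∨' (fv 1 ⊀ sc t) ∨' (fv 0 ≺ t)
    intro : ∀ {Γ} t → Prov ((fv 1 ≺ sc t) ∷ (fv 0 ≺ fv 1) ∷ Γ) [ fv 0 ≺ t ] → Prov Γ [ K⟨ t ⟩ ]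
    intro t p = ∨RP m0 (∨RP m1 (casesP (fv 0 ≺ fv 1) (casesP (fv 1 ≺ sc t) (wkP id ([]-⊆ m1) p) (idP (fv 1 ⊀ sc t) m0 m0)) (idP (fv 0 ⊀ fv 1) m0 m2)))
    base₀ : Prov [] [ K⟨ zer ⟩ ]
    base₀ = intro zer (splitP (fv 1 ≺ zer) (fv 1 ≐ zer) (subP ⟨ fv 1 , zer ⟩ ≺-suc-inv) (wkP ([]-⊆ m0) ∅-⊆ (subP ⟨ fv 1 , zer ⟩ ≺-zero))
      (haveP (fv 0 ≺ zer) (rewP (fv 1) zer (fv 0 ≺ fv 9) tt m0 m2) (wkP ([]-⊆ m0) ∅-⊆ ≺-zero)))
    step₀ : Prov [ K ] [ K⟨ sc (fv 2) ⟩ ]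
    step₀ = intro (sc (fv 2)) (splitP (fv 1 ≺ sc (fv 2)) (fv 1 ≐ sc (fv 2)) (subP ⟨ fv 1 , sc (fv 2) ⟩ ≺-suc-inv)
        (∨LP m3 (contraP (fv 0 ≺ fv 1) m3 m0)
          (∨LP m0 (contraP (fv 1 ≺ sc (fv 2)) m2 m0) (wkP ([]-⊆ m0) id (subP ⟨ fv 0 , fv 2 ⟩ ≺-step))))
        (rewP (fv 1) (sc (fv 2)) (fv 0 ≺ fv 9) tt m0 m2))
    all : Prov [] [ K ]
    all = _ , get (indD a a 2 K (up (m≤n+m 30 (c₀ + c₁)) lit) (up (m≤n+m 30 (c₀ + c₁)) lit) (up (m≤n+m 30 (c₀ + c₁)) lit) fresh-[]
        (toD a (up (≤-trans (m≤m+n c₀ c₁) (m≤m+n _ 30)) (self≤pow c₀)) (proj₂ base₀))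
        (toD a (up (≤-trans (m≤n+m c₁ c₀) (m≤m+n _ 30)) (self≤pow c₁)) (proj₂ step₀)))
      where
      open Scaled 8 ≤-refl
      c₀ c₁ a : ℕ
      c₀ = proj₁ base₀
      c₁ = proj₁ step₀
      a = c₀ + c₁ + 30
      lit : ∀ {x} {_ : T (x ≤ᵇ 30)} → x ≤ 8 ^ 30
      lit {x} {h} = ≤-trans (≤ᵇ⇒≤ x 30 h) (self≤pow 30)

  pred-≺ : Prov [ fv 1 ≐ sc (fv 0) ] [ fv 0 ≺ fv 1 ]
  pred-≺ = haveP (fv 1 ≐ fv 1) (reflP (fv 1))
    (haveP (sc (fv 0) ≐ fv 1) (rewP (fv 1) (sc (fv 0)) (fv 9 ≐ fv 1) tt m1 m0)
      (haveP (fv 0 ≺ sc (fv 0)) (wkP ∅-⊆ id ≺-suc) (rewP (sc (fv 0)) (fv 1) (fv 0 ≺ fv 9) tt m1 m0)))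

  ≺-pred-bound : Prov ((fv 0 ≺ fv 1) ∷ (fv 1 ≐ sc (fv 2)) ∷ []) [ fv 0 ≺ sc (fv 2) ]
  ≺-pred-bound = rewP (fv 1) (sc (fv 2)) (fv 0 ≺ fv 9) tt m1 m0

  ≐-≺ : Prov ((fv 0 ≐ fv 1) ∷ (fv 1 ≺ fv 2) ∷ []) [ fv 0 ≺ fv 2 ]
  ≐-≺ = haveP (fv 0 ≐ fv 0) (reflP (fv 0))
    (haveP (fv 1 ≐ fv 0) (rewP (fv 0) (fv 1) (fv 9 ≐ fv 0) tt m1 m0) (rewP (fv 1) (fv 0) (fv 9 ≺ fv 2) tt m0 m3))

κ : ℕ
κ = proj₁ ≺-zero + (proj₁ ≺-suc + (proj₁ ≺-step + (proj₁ ≺-trans + (proj₁ ≺-pred + (proj₁ pred-≺ + (proj₁ ≺-pred-bound + proj₁ ≐-≺))))))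

-- Determinisation of traces


anyB : List Bool → Bool
anyB [] = false
anyB (b ∷ bs) = b ∨ anyB bs

-- The lexicographic value of a row cut off after its first 1 at a position ≥ j (k is
-- the number of columns): it cannot decrease along a trace unless an event of
-- priority < 2j occurs.
Φ : ℕ → ℕ → List Bool → ℕ
Φ j k [] = 0
Φ j zero (_ ∷ _) = 0
Φ zero (suc k) (true ∷ W) = suc k
Φ zero (suc k) (false ∷ W) = Φ zero k W
Φ (suc j) (suc k) (true ∷ W) = 2 ^ k + Φ j k W
Φ (suc j) (suc k) (false ∷ W) = Φ j k W

hasBit : ℕ → List Bool → Bool
hasBit zero W = anyB W
hasBit (suc j) [] = false
hasBit (suc j) (b ∷ W) = hasBit j W

n<2^n : ∀ n → n < 2 ^ n
n<2^n zero = s≤s z≤n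
n<2^n (suc n) = ≤-trans (s≤s (n<2^n n)) (≤-trans (+-monoˡ-≤ (2 ^ n) (m^n>0 2 n)) (≤-reflexive (cong (2 ^ n +_) (sym (+-identityʳ _)))))

Φ₀≤ : ∀ k W → Φ 0 k W ≤ k
Φ₀≤ k [] = z≤n
Φ₀≤ zero (_ ∷ _) = z≤n
Φ₀≤ (suc k) (true ∷ W) = ≤-refl
Φ₀≤ (suc k) (false ∷ W) = m≤n⇒m≤1+n (Φ₀≤ k W)

Φ< : ∀ j k W → Φ j k W < 2 ^ k
Φ< j k [] = m^n>0 2 k
Φ< j zero (_ ∷ _) = s≤s z≤n
Φ< zero (suc k) W@(_ ∷ _) = ≤-trans (s≤s (Φ₀≤ (suc k) W)) (n<2^n (suc k))
Φ< (suc j) (suc k) (true ∷ W) = ≤-trans (+-monoʳ-< (2 ^ k) (Φ< j k W)) (≤-reflexive (cong (2 ^ k +_) (sym (+-identityʳ _))))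
Φ< (suc j) (suc k) (false ∷ W) = ≤-trans (Φ< j k W) (m≤m+n _ _)

-- Lexicographic with true on top: older registers (further left) are preferred.
data _⊑_ : List Bool → List Bool → Set where
  nil : [] ⊑ []
  same∷ : ∀ {b u w} → u ⊑ w → (b ∷ u) ⊑ (b ∷ w)
  jump : ∀ {u w} → (false ∷ u) ⊑ (true ∷ w)

⊑-refl : ∀ {u} → u ⊑ u
⊑-refl {[]} = nil
⊑-refl {b ∷ u} = same∷ ⊑-refl

⊑-trans : ∀ {u v w} → u ⊑ v → v ⊑ w → u ⊑ w
⊑-trans nil nil = nil
⊑-trans (same∷ p) (same∷ q) = same∷ (⊑-trans p q)
⊑-trans (same∷ p) jump = jump
⊑-trans jump (same∷ q) = jump

Φ-mono : ∀ {u w} j k → u ⊑ w → Φ j k u ≤ Φ j k w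
Φ-mono j k nil = z≤n
Φ-mono j zero (same∷ p) = z≤n
Φ-mono zero (suc k) (same∷ {true} p) = ≤-refl
Φ-mono zero (suc k) (same∷ {false} p) = Φ-mono zero k p
Φ-mono (suc j) (suc k) (same∷ {true} p) = +-monoʳ-≤ (2 ^ k) (Φ-mono j k p)
Φ-mono (suc j) (suc k) (same∷ {false} p) = Φ-mono j k p
Φ-mono j zero jump = z≤n
Φ-mono zero (suc k) (jump {u}) = m≤n⇒m≤1+n (Φ₀≤ k u)
Φ-mono (suc j) (suc k) (jump {u}) = ≤-trans (<⇒≤ (Φ< j k u)) (m≤m+n _ _)

best : List Bool → List Bool → List Bool
best [] w = w
best u [] = u
best (true ∷ u) (true ∷ w) = true ∷ best u w
best (true ∷ u) (false ∷ w) = true ∷ u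
best (false ∷ u) (true ∷ w) = true ∷ w
best (false ∷ u) (false ∷ w) = false ∷ best u w

best-left : ∀ u w → length u ≡ length w → u ⊑ best u w
best-left [] [] e = nil
best-left (true ∷ u) (true ∷ w) e = same∷ (best-left u w (suc-injective e))
best-left (true ∷ u) (false ∷ w) e = ⊑-refl
best-left (false ∷ u) (true ∷ w) e = jump
best-left (false ∷ u) (false ∷ w) e = same∷ (best-left u w (suc-injective e))

best-right : ∀ u w → length u ≡ length w → w ⊑ best u w
best-right [] [] e = nil
best-right (true ∷ u) (true ∷ w) e = same∷ (best-right u w (suc-injective e))
best-right (true ∷ u) (false ∷ w) e = jump
best-right (false ∷ u) (true ∷ w) e = ⊑-refl
best-right (false ∷ u) (false ∷ w) e = same∷ (best-right u w (suc-injective e))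

-- The new guards of a term have to follow from the old guards of one predecessor, so the maximum
-- must be one of the words compared and not a mixture.
best-choice : ∀ u w → best u w ≡ u ⊎ best u w ≡ w
best-choice [] w = inj₂ refl
best-choice (b ∷ u) [] = inj₁ refl
best-choice (true ∷ u) (true ∷ w) = [ inj₁ ∘ cong (true ∷_) , inj₂ ∘ cong (true ∷_) ]′ (best-choice u w)
best-choice (true ∷ u) (false ∷ w) = inj₁ refl
best-choice (false ∷ u) (true ∷ w) = inj₂ refl
best-choice (false ∷ u) (false ∷ w) = [ inj₁ ∘ cong (false ∷_) , inj₂ ∘ cong (false ∷_) ]′ (best-choice u w)

bestOf : List Bool → List (List Bool) → List Bool
bestOf z [] = z
bestOf z (u ∷ us) = best u (bestOf z us)

bestOf-choice : ∀ z us → bestOf z us ≡ z ⊎ bestOf z us ∈ us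
bestOf-choice z [] = inj₁ refl
bestOf-choice z (u ∷ us) with best-choice u (bestOf z us)
... | inj₁ e = inj₂ (here e)
... | inj₂ e = [ inj₁ ∘ trans e , (λ m → inj₂ (there (subst (_∈ us) (sym e) m))) ]′ (bestOf-choice z us)

bestOf-length : ∀ z us → (∀ u → u ∈ us → length u ≡ length z) → length (bestOf z us) ≡ length z
bestOf-length z us h with bestOf-choice z us
... | inj₁ e = cong length e
... | inj₂ m = h _ m

bestOf-max : ∀ z us → (∀ u → u ∈ us → length u ≡ length z) → ∀ {u} → u ∈ us → u ⊑ bestOf z us
bestOf-max z (u ∷ us) h (here refl) = best-left u _ (trans (h u (here refl)) (sym (bestOf-length z us (λ w m → h w (there m)))))
bestOf-max z (u ∷ us) h (there m) = ⊑-trans (bestOf-max z us (λ w k → h w (there k)) m)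
  (best-right u _ (trans (h u (here refl)) (sym (bestOf-length z us (λ w k → h w (there k))))))

zeros : ℕ → List Bool
zeros r = replicate r false

Φ-zeros : ∀ j k r → Φ j k (zeros r) ≡ 0
Φ-zeros j k zero = refl
Φ-zeros j zero (suc r) = refl
Φ-zeros zero (suc k) (suc r) = Φ-zeros zero k r
Φ-zeros (suc j) (suc k) (suc r) = Φ-zeros j k r

Φ-pad : ∀ j k W r → Φ j k (W ++ zeros r) ≡ Φ j k W
Φ-pad j k [] r = Φ-zeros j k r
Φ-pad j zero (_ ∷ _) r = refl
Φ-pad zero (suc k) (true ∷ W) r = refl
Φ-pad zero (suc k) (false ∷ W) r = Φ-pad zero k W r
Φ-pad (suc j) (suc k) (true ∷ W) r = cong (2 ^ k +_) (Φ-pad j k W r)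
Φ-pad (suc j) (suc k) (false ∷ W) r = Φ-pad j k W r

anyB-zeros : ∀ r → anyB (zeros r) ≡ false
anyB-zeros zero = refl
anyB-zeros (suc r) = anyB-zeros r

zeros-⊑ : ∀ u → zeros (length u) ⊑ u
zeros-⊑ [] = nil
zeros-⊑ (true ∷ u) = jump
zeros-⊑ (false ∷ u) = same∷ (zeros-⊑ u)

++-⊑ : ∀ W {u v} → u ⊑ v → (W ++ u) ⊑ (W ++ v)
++-⊑ [] p = p
++-⊑ (b ∷ W) p = same∷ (++-⊑ W p)

anyB-++ʳ : ∀ W {V} → anyB V ≡ true → anyB (W ++ V) ≡ true
anyB-++ʳ [] h = h
anyB-++ʳ (true ∷ W) h = refl
anyB-++ʳ (false ∷ W) h = anyB-++ʳ W h

hasBit-++ : ∀ j W {V} → j ≤ length W → anyB V ≡ true → hasBit j (W ++ V) ≡ true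
hasBit-++ zero W h a = anyB-++ʳ W a
hasBit-++ (suc j) (b ∷ W) (s≤s h) a = hasBit-++ j W h a

hasBit-[] : ∀ j → hasBit j [] ≡ false
hasBit-[] zero = refl
hasBit-[] (suc j) = refl

Φ₀-pos : ∀ k W → length W ≤ k → anyB W ≡ true → 0 < Φ 0 k W
Φ₀-pos (suc k) (true ∷ W) h a = s≤s z≤n
Φ₀-pos (suc k) (false ∷ W) (s≤s h) a = Φ₀-pos k W h a

Φ₀-pos⁻ : ∀ k W → 0 < Φ 0 k W → anyB W ≡ true
Φ₀-pos⁻ (suc k) (true ∷ W) p = refl
Φ₀-pos⁻ (suc k) (false ∷ W) p = Φ₀-pos⁻ k W p

Φ₀-grow : ∀ k W → Φ 0 k W ≤ Φ 0 (suc k) W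
Φ₀-grow k [] = z≤n
Φ₀-grow zero (_ ∷ _) = z≤n
Φ₀-grow (suc k) (true ∷ W) = n≤1+n _
Φ₀-grow (suc k) (false ∷ W) = Φ₀-grow k W

-- When a register is dropped, the columns behind it move one place to the left. The first remaining
-- 1 moves with them, and this is the strict gain.
Φ₀-strict : ∀ k W → 0 < Φ 0 k W → Φ 0 k W < Φ 0 (suc k) W
Φ₀-strict (suc k) (true ∷ W) p = ≤-refl
Φ₀-strict (suc k) (false ∷ W) p = Φ₀-strict k W p

-- By `Φ<` a bit before position j outweighs everything behind it, so equal values agree on the
-- first j bits. What is left of the value vanishes exactly when no later bit exists, provided that
-- no bit lies beyond the k columns.
hasBit-transfer : ∀ j k W W' → Φ j k W ≡ Φ j k W' → length W ≤ k → length W' ≤ k → hasBit j W ≡ true → hasBit j W' ≡ true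
hasBit-transfer zero k W W' e l l' h = Φ₀-pos⁻ k W' (≤-trans (Φ₀-pos k W l h) (≤-reflexive e))
hasBit-transfer (suc j) (suc k) (true ∷ W) [] e l l' h = contradiction (m+n≡0⇒m≡0 (2 ^ k) e) (λ z → <-irrefl (sym z) (m^n>0 2 k))
hasBit-transfer (suc j) (suc k) (false ∷ W) [] e (s≤s l) l' h =
  contradiction (trans (sym (hasBit-[] j)) (hasBit-transfer j k W [] e l z≤n h)) λ ()
hasBit-transfer (suc j) (suc k) (true ∷ W) (true ∷ W') e (s≤s l) (s≤s l') h = hasBit-transfer j k W W' (+-cancelˡ-≡ (2 ^ k) _ _ e) l l' h
hasBit-transfer (suc j) (suc k) (false ∷ W) (false ∷ W') e (s≤s l) (s≤s l') h = hasBit-transfer j k W W' e l l' h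
hasBit-transfer (suc j) (suc k) (true ∷ W) (false ∷ W') e l l' h =
  contradiction (≤-trans (s≤s (m≤m+n (2 ^ k) (Φ j k W))) (≤-trans (s≤s (≤-reflexive e)) (Φ< j k W'))) (<-irrefl refl)
hasBit-transfer (suc j) (suc k) (false ∷ W) (true ∷ W') e l l' h =
  contradiction (≤-trans (s≤s (m≤m+n (2 ^ k) (Φ j k W'))) (≤-trans (s≤s (≤-reflexive (sym e))) (Φ< j k W))) (<-irrefl refl)

-- Registers as columns of a bit matrix

module Columns (n : ℕ) where

  Col : Set
  Col = Fin n → Bool

  row : List Col → Fin n → List Bool
  row cs t = map (λ c → c t) cs

  _∖_ : Col → Col → Col
  (d ∖ c) t = d t ∧ not (c t)

  -- A register is dropped once it tracks no term (priority 0), and reset once all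
  -- of its terms have made progress (priority 1).
  data Run : List Col → ℕ → List Col → Set where
    done : Run [] 0 []
    kill : ∀ {c cs p cs'} → (∀ t → c t ≡ false) → Run cs p cs' → Run (c ∷ cs) 0 cs'
    flash : ∀ {c cs p cs'} → Σ (Fin n) (λ t → c t ≡ true) → (∀ t → c t ≡ true → anyB (row cs t) ≡ true) →
      Run (map (_∖ c) cs) p cs' → Run (c ∷ cs) 1 (c ∷ cs')
    keep : ∀ {c cs p cs'} → Σ (Fin n) (λ t → c t ≡ true × anyB (row cs t) ≡ false) → Run cs p cs' → Run (c ∷ cs) (2 + p) (c ∷ cs')

  -- Recursion is on the length because a reset continues with altered columns, which are no sublist
  -- of the input.
  run-fuel : ∀ k cs → length cs ≡ k → Σ ℕ λ p → Σ (List Col) λ cs' → Run cs p cs'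
  run-fuel zero [] e = _ , _ , done
  run-fuel (suc k) (c ∷ cs) e with any? (λ t → c t ≟B true)
  ... | no ne = let _ , _ , r = run-fuel k cs (suc-injective e) in _ , _ , kill (λ t → ¬true (λ h → ne (t , h))) r
    where
    ¬true : ∀ {b} → b ≢ true → b ≡ false
    ¬true {true} h = contradiction refl h
    ¬true {false} h = refl
  ... | yes ne with any? (λ t → (c t ≟B true) ×-dec (anyB (row cs t) ≟B false))
  ...   | yes q = let _ , _ , r = run-fuel k cs (suc-injective e) in _ , _ , keep q r
  ...   | no q = let _ , _ , r = run-fuel k (map (_∖ c) cs) (trans (length-map _ cs) (suc-injective e)) in _ , _ , flash ne (λ t h → ¬false (λ f → q (t , h , f))) r
    where
    ¬false : ∀ {b} → b ≢ false → b ≡ true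
    ¬false {true} h = refl
    ¬false {false} h = contradiction refl h

  row-∖-false : ∀ c cs t → c t ≡ false → row (map (_∖ c) cs) t ≡ row cs t
  row-∖-false c [] t e = refl
  row-∖-false c (d ∷ cs) t e = cong₂ _∷_ (trans (cong (λ b → d t ∧ not b) e) (∧-identityʳ (d t))) (row-∖-false c cs t e)

  row-∖-true : ∀ c cs t → c t ≡ true → anyB (row (map (_∖ c) cs) t) ≡ false
  row-∖-true c [] t e = refl
  row-∖-true c (d ∷ cs) t e rewrite e | ∧-zeroʳ (d t) = row-∖-true c cs t e

  run-any : ∀ {cs p cs'} → Run cs p cs' → ∀ t → anyB (row cs t) ≡ false → anyB (row cs' t) ≡ false
  run-any done t h = refl
  run-any (kill {c} ne r) t h rewrite ne t = run-any r t h
  run-any (flash {c} {cs} ne f r) t h with c t in eq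
  ... | false = run-any r t (trans (cong anyB (row-∖-false c cs t eq)) h)
  run-any (keep {c} q r) t h with c t
  ... | false = run-any r t h

  -- Every surviving register owns a term whose last bit lies in its column. Owners of different
  -- registers differ, which limits the registers to n, as the nodes of a Safra tree are limited by
  -- the number of states.
  Enders : List Col → Set
  Enders [] = ⊤
  Enders (c ∷ cs) = Σ (Fin n) (λ t → c t ≡ true × anyB (row cs t) ≡ false) × Enders cs

  run-enders : ∀ {cs p cs'} → Run cs p cs' → Enders cs'
  run-enders done = tt
  run-enders (kill _ r) = run-enders r
  run-enders (flash {c} {cs} (t , h) f r) = (t , h , run-any r t (row-∖-true c cs t h)) , run-enders r
  run-enders (keep (t , h , q) r) = (t , h , run-any r t q) , run-enders r

  ender : ∀ cs → Enders cs → Fin (length cs) → Fin n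
  ender (c ∷ cs) (e , es) zero = proj₁ e
  ender (c ∷ cs) (e , es) (suc i) = ender cs es i

  ender-any : ∀ cs es i → anyB (row cs (ender cs es i)) ≡ true
  ender-any (c ∷ cs) ((t , h , _) , es) zero rewrite h = refl
  ender-any (c ∷ cs) (e , es) (suc i) rewrite ender-any cs es i = ∨-zeroʳ _

  ender-injective : ∀ cs es {i j} → ender cs es i ≡ ender cs es j → i ≡ j
  ender-injective (c ∷ cs) es {zero} {zero} e = refl
  ender-injective (c ∷ cs) ((t , h , q) , es) {zero} {suc j} refl = contradiction (trans (sym q) (ender-any cs es j)) λ ()
  ender-injective (c ∷ cs) ((t , h , q) , es) {suc i} {zero} refl = contradiction (trans (sym q) (ender-any cs es i)) λ ()
  ender-injective (c ∷ cs) (e , es) {suc i} {suc j} eq = cong suc (ender-injective cs es eq)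

  run-length : ∀ {cs p cs'} → Run cs p cs' → length cs' ≤ n
  run-length {cs' = cs'} r = injective⇒≤ {f = ender cs' (run-enders r)} (ender-injective cs' (run-enders r))

  -- Without an event the run ends in `done`, and its priority is twice the number of registers, as
  -- if one behind the last were dropped. Thus every edge, also an uneventful one, is assigned a
  -- component that has to decrease.
  run-priority : ∀ {cs p cs'} → Run cs p cs' → p ≤ length cs' * 2
  run-priority done = z≤n
  run-priority (kill _ r) = z≤n
  run-priority (flash _ _ r) = s≤s z≤n
  run-priority (keep _ r) = s≤s (s≤s (run-priority r))

  -- Events of priority at least 2j leave the first j columns alone. Behind them a drop moves bits
  -- to the left, and a reset erases only bits that come after a 1 of the same row; this erasure is
  -- why `Φ` ignores everything after its first 1 at or beyond j.
  run-Φ : ∀ {cs p cs'} → Run cs p cs' → ∀ j k t → j * 2 ≤ p → length cs ≤ k → Φ j k (row cs t) ≤ Φ j k (row cs' t)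
  run-Φ done j k t h l = z≤n
  run-Φ (kill {c} {cs' = cs'} ne r) zero (suc k) t h (s≤s l) rewrite ne t = ≤-trans (run-Φ r zero k t z≤n l) (Φ₀-grow k (row cs' t))
  run-Φ (flash {c} {cs} ne f r) zero (suc k) t h (s≤s l) with c t in eq
  ... | true = ≤-refl
  ... | false = ≤-trans (≤-reflexive (cong (Φ 0 k) (sym (row-∖-false c cs t eq)))) (run-Φ r zero k t z≤n (≤-trans (≤-reflexive (length-map _ cs)) l))
  run-Φ (flash ne f r) (suc j) k t (s≤s ()) l
  run-Φ (keep {c} q r) zero (suc k) t h (s≤s l) with c t
  ... | true = ≤-refl
  ... | false = run-Φ r zero k t z≤n l
  run-Φ (keep {c} q r) (suc j) (suc k) t (s≤s (s≤s h)) (s≤s l) with c t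
  ... | true = +-monoʳ-≤ (2 ^ k) (run-Φ r j k t h l)
  ... | false = run-Φ r j k t h l

  -- The dropped column is empty, so a bit at or beyond j lies strictly behind it and moves up. In
  -- the case `done` there is no such bit.
  run-Φ-strict : ∀ {cs p cs'} → Run cs p cs' → ∀ j k t → p ≡ j * 2 → length cs ≤ k → hasBit j (row cs t) ≡ true → Φ j k (row cs t) < Φ j k (row cs' t)
  run-Φ-strict done zero k t e l ()
  run-Φ-strict (kill {c} {cs} {cs' = cs'} ne r) zero (suc k) t e (s≤s l) b rewrite ne t =
    ≤-trans (s≤s le) (Φ₀-strict k (row cs' t) (≤-trans (Φ₀-pos k (row cs t) (≤-trans (≤-reflexive (length-map _ cs)) l) b) le))
    where
    le : Φ 0 k (row cs t) ≤ Φ 0 k (row cs' t)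
    le = run-Φ r zero k t z≤n l
  run-Φ-strict (flash ne f r) zero k t () l b
  run-Φ-strict (flash ne f r) (suc j) k t () l b
  run-Φ-strict (keep {c} q r) (suc j) (suc k) t e (s≤s l) b with c t
  ... | true = +-monoʳ-< (2 ^ k) (run-Φ-strict r j k t (suc-injective (suc-injective e)) l b)
  ... | false = run-Φ-strict r j k t (suc-injective (suc-injective e)) l b

  -- The function g is the decrement. It reaches only a reset that determines the priority and
  -- becomes the identity after the first event, so at most one register is decremented per edge;
  -- the others just move with their columns.
  tagsRun : ∀ {cs p cs'} → Run cs p cs' → (Term 0 → Term 0) → (ℕ → Term 0) → ℕ → Term 0
  tagsRun done g Rs i = zer
  tagsRun (kill _ r) g Rs i = tagsRun r id (Rs ∘ suc) i
  tagsRun (flash _ _ r) g Rs zero = g (Rs 0)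
  tagsRun (flash _ _ r) g Rs (suc i) = tagsRun r id (Rs ∘ suc) i
  tagsRun (keep _ r) g Rs zero = Rs 0
  tagsRun (keep _ r) g Rs (suc i) = tagsRun r g (Rs ∘ suc) i

  tagsRun-below : ∀ {cs p cs'} (r : Run cs p cs') g Rs i → suc i * 2 ≤ p → tagsRun r g Rs i ≡ Rs i
  tagsRun-below (flash _ _ r) g Rs i (s≤s ())
  tagsRun-below (keep _ r) g Rs zero h = refl
  tagsRun-below (keep _ r) g Rs (suc i) (s≤s (s≤s h)) = tagsRun-below r g (Rs ∘ suc) i h

  tagsRun-flash : ∀ {cs p cs'} (r : Run cs p cs') g Rs j → p ≡ suc (j * 2) → tagsRun r g Rs j ≡ g (Rs j)
  tagsRun-flash (flash _ _ r) g Rs zero e = refl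
  tagsRun-flash (keep _ r) g Rs (suc j) e = tagsRun-flash r g (Rs ∘ suc) j (suc-injective (suc-injective e))

-- A term with a later bit has made progress since the register was set or last reset,
-- so its bound is strict.
rowGuards : Term 0 → List Bool → (ℕ → Term 0) → Cedent
rowGuards t [] Rs = []
rowGuards t (true ∷ bs) Rs = (t ≺ (if anyB bs then Rs 0 else sc (Rs 0))) ∷ rowGuards t bs (Rs ∘ suc)
rowGuards t (false ∷ bs) Rs = rowGuards t bs (Rs ∘ suc)

rowGuards-none : ∀ t bs Rs → anyB bs ≡ false → rowGuards t bs Rs ≡ []
rowGuards-none t [] Rs e = refl
rowGuards-none t (false ∷ bs) Rs e = rowGuards-none t bs (Rs ∘ suc) e

rowGuards-pad : ∀ t bs r Rs → rowGuards t (bs ++ zeros r) Rs ≡ rowGuards t bs Rs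
rowGuards-pad t [] r Rs = rowGuards-none t (zeros r) Rs (anyB-zeros r)
rowGuards-pad t (true ∷ bs) r Rs = cong₂ _∷_ (cong (λ b → t ≺ (if b then Rs 0 else sc (Rs 0))) (anyB-pad bs)) (rowGuards-pad t bs r (Rs ∘ suc))
  where
  anyB-pad : ∀ bs → anyB (bs ++ zeros r) ≡ anyB bs
  anyB-pad [] = anyB-zeros r
  anyB-pad (true ∷ bs) = refl
  anyB-pad (false ∷ bs) = anyB-pad bs
rowGuards-pad t (false ∷ bs) r Rs = rowGuards-pad t bs r (Rs ∘ suc)

module GuardTransfer (n : ℕ) {P Q : Formula 0 → Set} (t : Term 0) (PQ : ∀ {φ} → P φ → Q φ) (weaken : ∀ {R} → P (t ≺ R) → Q (t ≺ sc R)) where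
  open Columns n

  -- A run only removes later bits, by `run-any`, so a guard can pass from strict to weak but not
  -- back. At a reset all guards of the register are strict, and a strict bound by R is a weak bound
  -- by its predecessor. P and Q will be derivability before and after, at different costs.
  run-guards : ∀ {cs p cs'} (r : Run cs p cs') g Rs i → (∀ {R} → P (t ≺ R) → Q (t ≺ sc (g R))) →
    All P (rowGuards t (row cs i) Rs) → All Q (rowGuards t (row cs' i) (tagsRun r g Rs))
  run-guards done g Rs i wg ps = []
  run-guards (kill ne r) g Rs i wg ps rewrite ne i = run-guards r id (Rs ∘ suc) i weaken ps
  run-guards (flash {c} {cs} {cs' = cs'} ne f r) g Rs i wg ps with c i in eq
  ... | false = run-guards r id (Rs ∘ suc) i weaken (subst (λ bs → All P (rowGuards t bs (Rs ∘ suc))) (sym (row-∖-false c cs i eq)) ps)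
  ... | true rewrite f i eq | run-any r i (row-∖-true c cs i eq) with ps
  ...   | p ∷ _ = wg p ∷ subst (All Q) (sym (rowGuards-none t (row cs' i) _ (run-any r i (row-∖-true c cs i eq)))) []
  run-guards (keep {c} {cs} {cs' = cs'} q r) g Rs i wg ps with c i
  ... | false = run-guards r g (Rs ∘ suc) i wg ps
  ... | true with anyB (row cs i) in eq | anyB (row cs' i) in eq' | ps
  ...   | true | true | p ∷ ps' = PQ p ∷ run-guards r g (Rs ∘ suc) i wg ps'
  ...   | true | false | p ∷ ps' = weaken p ∷ run-guards r g (Rs ∘ suc) i wg ps'
  ...   | false | false | p ∷ ps' = PQ p ∷ run-guards r g (Rs ∘ suc) i wg ps'
  ...   | false | true | _ = contradiction (trans (sym (run-any r i eq)) eq') λ ()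

-- Decidable reachability and counting

module _ {M : ℕ} {R : Fin M → Fin M → Set} (R? : ∀ s t → Dec (R s t)) where

  -- Warshall: paths whose intermediate points lie in a given list.
  Via : List (Fin M) → Fin M → Fin M → Set
  Via [] s t = s ≡ t ⊎ R s t
  Via (k ∷ L) s t = Via L s t ⊎ (Via L s k × Via L k t)

  via? : ∀ L s t → Dec (Via L s t)
  via? [] s t = (s Data.Fin.≟ t) ⊎-dec R? s t
  via? (k ∷ L) s t = via? L s t ⊎-dec (via? L s k ×-dec via? L k t)

  via-star : ∀ L {s t} → Via L s t → Star R s t
  via-star [] (inj₁ refl) = ε
  via-star [] (inj₂ r) = r ◅ ε
  via-star (k ∷ L) (inj₁ p) = via-star L p
  via-star (k ∷ L) (inj₂ (p , q)) = via-star L p ◅◅ via-star L q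

  via-trans : ∀ L {s t u} → t ∈ L → Via L s t → Via L t u → Via L s u
  via-trans (k ∷ L) (here refl) p q = inj₂ ([ id , proj₁ ]′ p , [ id , proj₂ ]′ q)
  via-trans (k ∷ L) (there m) (inj₁ p) (inj₁ q) = inj₁ (via-trans L m p q)
  via-trans (k ∷ L) (there m) (inj₁ p) (inj₂ (q , r)) = inj₂ (via-trans L m p q , r)
  via-trans (k ∷ L) (there m) (inj₂ (p , q)) (inj₁ r) = inj₂ (p , via-trans L m q r)
  via-trans (k ∷ L) (there m) (inj₂ (p , q)) (inj₂ (r , r')) = inj₂ (p , r')

  via-edge : ∀ L {s t} → Via [] s t → Via L s t
  via-edge [] p = p
  via-edge (k ∷ L) p = inj₁ (via-edge L p)

  star-via : ∀ {s t} → Star R s t → Via (allFin M) s t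
  star-via ε = via-edge (allFin M) (inj₁ refl)
  star-via (r ◅ p) = via-trans (allFin M) (∈-allFin _) (via-edge (allFin M) (inj₂ r)) (star-via p)

  star? : ∀ s t → Dec (Star R s t)
  star? s t = map′ (via-star (allFin M)) star-via (via? (allFin M) s t)

count : ∀ {m} {P : Fin m → Set} → (∀ i → Dec (P i)) → ℕ
count {zero} P? = 0
count {suc m} P? = (if does (P? zero) then 1 else 0) + count (P? ∘ suc)

count≤ : ∀ {m} {P : Fin m → Set} (P? : ∀ i → Dec (P i)) → count P? ≤ m
count≤ {zero} P? = z≤n
count≤ {suc m} P? with does (P? zero)
... | true = s≤s (count≤ (P? ∘ suc))
... | false = m≤n⇒m≤1+n (count≤ (P? ∘ suc))

count-mono : ∀ {m} {P Q : Fin m → Set} (P? : ∀ i → Dec (P i)) (Q? : ∀ i → Dec (Q i)) → (∀ i → P i → Q i) → count P? ≤ count Q?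
count-mono {zero} P? Q? h = z≤n
count-mono {suc m} P? Q? h with P? zero | Q? zero
... | yes p | yes q = s≤s (count-mono (P? ∘ suc) (Q? ∘ suc) (h ∘ suc))
... | yes p | no q = contradiction (h zero p) q
... | no p | yes q = m≤n⇒m≤1+n (count-mono (P? ∘ suc) (Q? ∘ suc) (h ∘ suc))
... | no p | no q = count-mono (P? ∘ suc) (Q? ∘ suc) (h ∘ suc)

count-strict : ∀ {m} {P Q : Fin m → Set} (P? : ∀ i → Dec (P i)) (Q? : ∀ i → Dec (Q i)) → (∀ i → P i → Q i) →
  ∀ i → ¬ P i → Q i → count P? < count Q?
count-strict {suc m} P? Q? h zero np nq with P? zero | Q? zero
... | yes p | _ = contradiction p np
... | no p | yes q = s≤s (count-mono (P? ∘ suc) (Q? ∘ suc) (h ∘ suc))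
... | no p | no q = contradiction nq q
count-strict {suc m} P? Q? h (suc i) np nq with P? zero | Q? zero
... | yes p | yes q = s≤s (count-strict (P? ∘ suc) (Q? ∘ suc) (h ∘ suc) i np nq)
... | yes p | no q = contradiction (h zero p) q
... | no p | yes q = m≤n⇒m≤1+n (count-strict (P? ∘ suc) (Q? ∘ suc) (h ∘ suc) i np nq)
... | no p | no q = count-strict (P? ∘ suc) (Q? ∘ suc) (h ∘ suc) i np nq

-- Subterms and names of formulas and sequents

strip : ∀ {n} → Term n → Maybe (Term 0)
strip (bv i) = nothing
strip (fv x) = just (fv x)
strip zer = just zer
strip (sc t) with strip t
... | just t' = just (sc t')
... | nothing = nothing
strip (t ⊕ u) with strip t | strip u
... | just t' | just u' = just (t' ⊕ u')
... | _ | _ = nothing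
strip (t ⊗ u) with strip t | strip u
... | just t' | just u' = just (t' ⊗ u')
... | _ | _ = nothing

strip-embed : ∀ {n} (t : Term 0) → strip {n} (embed t) ≡ just t
strip-embed (fv x) = refl
strip-embed zer = refl
strip-embed {n} (sc t) rewrite strip-embed {n} t = refl
strip-embed {n} (t ⊕ u) rewrite strip-embed {n} t | strip-embed {n} u = refl
strip-embed {n} (t ⊗ u) rewrite strip-embed {n} t | strip-embed {n} u = refl

strip-sound : ∀ {n} (u : Term n) {t} → strip u ≡ just t → embed t ≡ u
strip-sound (fv x) refl = refl
strip-sound zer refl = refl
strip-sound (sc u) e with strip u in eq
strip-sound (sc u) refl | just u' = cong sc (strip-sound u eq)
strip-sound (u ⊕ v) e with strip u in eq | strip v in eq'
strip-sound (u ⊕ v) refl | just u' | just v' = cong₂ _⊕_ (strip-sound u eq) (strip-sound v eq')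
strip-sound (u ⊗ v) e with strip u in eq | strip v in eq'
strip-sound (u ⊗ v) refl | just u' | just v' = cong₂ _⊗_ (strip-sound u eq) (strip-sound v eq')

top : ∀ {n} → Term n → List (Term 0)
top u with strip u
... | just t = t ∷ []
... | nothing = []

-- Only subterms free of bound variables can lie on a trace, as `OccT` asks for an embedded
-- closed-index term; `strip` recognises them.
subs : ∀ {n} → Term n → List (Term 0)
subs u@(bv i) = []
subs u@(fv x) = top u
subs u@zer = top u
subs u@(sc t) = top u ++ subs t
subs u@(t ⊕ s) = top u ++ (subs t ++ subs s)
subs u@(t ⊗ s) = top u ++ (subs t ++ subs s)

top-embed : ∀ {n} (t : Term 0) → t ∈ top {n} (embed t)
top-embed {n} t rewrite strip-embed {n} t = here refl

top-sound : ∀ {n t} (u : Term n) → t ∈ top u → embed t ≡ u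
top-sound u m with strip u in eq
top-sound u (here refl) | just t = strip-sound u eq

top-length : ∀ {n} (u : Term n) → length (top u) ≤ 1
top-length u with strip u
... | just t = s≤s z≤n
... | nothing = z≤n

subs-embed : ∀ {n} (t : Term 0) → t ∈ subs {n} (embed t)
subs-embed {n} t@(fv x) = top-embed {n} t
subs-embed {n} t@zer = top-embed {n} t
subs-embed {n} t@(sc _) = ∈-++⁺ˡ (top-embed {n} t)
subs-embed {n} t@(_ ⊕ _) = ∈-++⁺ˡ (top-embed {n} t)
subs-embed {n} t@(_ ⊗ _) = ∈-++⁺ˡ (top-embed {n} t)

subs-occ : ∀ {n t} {u : Term n} → OccT t u → t ∈ subs u
subs-occ {n} {t} here = subs-embed {n} t
subs-occ {u = u@(sc _)} (sc₁ p) = ∈-++⁺ʳ (top u) (subs-occ p)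
subs-occ {u = u@(a ⊕ _)} (⊕₁ p) = ∈-++⁺ʳ (top u) (∈-++⁺ˡ (subs-occ p))
subs-occ {u = u@(a ⊕ _)} (⊕₂ p) = ∈-++⁺ʳ (top u) (∈-++⁺ʳ (subs a) (subs-occ p))
subs-occ {u = u@(a ⊗ _)} (⊗₁ p) = ∈-++⁺ʳ (top u) (∈-++⁺ˡ (subs-occ p))
subs-occ {u = u@(a ⊗ _)} (⊗₂ p) = ∈-++⁺ʳ (top u) (∈-++⁺ʳ (subs a) (subs-occ p))

subs-free : ∀ {n x t} (u : Term n) → t ∈ subs u → FreeT x t → FreeT x u
subs-free {n} {x} {t} u m f = go u m
  where
  at-top : ∀ u → t ∈ top u → FreeT x u
  at-top u k = subst (FreeT x) (top-sound u k) (free-embed t f)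
  go : ∀ u → t ∈ subs u → FreeT x u
  go u@(fv _) k = at-top u k
  go u@zer k = at-top u k
  go u@(sc a) k = [ at-top u , sc₁ ∘ go a ]′ (∈-++⁻ (top u) k)
  go u@(a ⊕ c) k = [ at-top u , [ ⊕₁ ∘ go a , ⊕₂ ∘ go c ]′ ∘ ∈-++⁻ (subs a) ]′ (∈-++⁻ (top u) k)
  go u@(a ⊗ c) k = [ at-top u , [ ⊗₁ ∘ go a , ⊗₂ ∘ go c ]′ ∘ ∈-++⁻ (subs a) ]′ (∈-++⁻ (top u) k)

embed-size : ∀ {n} (t : Term 0) → termSize (embed {n} t) ≡ termSize t
embed-size {n} t = bsubT-size {0} {n} _ (λ ()) t

subs-size : ∀ {n t} (u : Term n) → t ∈ subs u → termSize t ≤ termSize u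
subs-size {n} {t} u m = go u m
  where
  at-top : ∀ u → t ∈ top u → termSize t ≤ termSize u
  at-top u k = ≤-reflexive (trans (sym (embed-size t)) (cong termSize (top-sound u k)))
  go : ∀ u → t ∈ subs u → termSize t ≤ termSize u
  go u@(fv _) k = at-top u k
  go u@zer k = at-top u k
  go u@(sc a) k = [ at-top u , m≤n⇒m≤1+n ∘ go a ]′ (∈-++⁻ (top u) k)
  go u@(a ⊕ c) k = [ at-top u , [ (λ l → m≤n⇒m≤1+n (≤-trans (go a l) (m≤m+n _ _))) , (λ l → m≤n⇒m≤1+n (≤-trans (go c l) (m≤n+m _ (termSize a)))) ]′ ∘ ∈-++⁻ (subs a) ]′ (∈-++⁻ (top u) k)
  go u@(a ⊗ c) k = [ at-top u , [ (λ l → m≤n⇒m≤1+n (≤-trans (go a l) (m≤m+n _ _))) , (λ l → m≤n⇒m≤1+n (≤-trans (go c l) (m≤n+m _ (termSize a)))) ]′ ∘ ∈-++⁻ (subs a) ]′ (∈-++⁻ (top u) k)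

++-length≤ : ∀ {A : Set} (xs : List A) {ys a b} → length xs ≤ a → length ys ≤ b → length (xs ++ ys) ≤ a + b
++-length≤ xs h k = ≤-trans (≤-reflexive (length-++ xs)) (+-mono-≤ h k)

subs-length : ∀ {n} (u : Term n) → length (subs u) ≤ termSize u
subs-length (bv i) = z≤n
subs-length {n} u@(fv x) = top-length {n} u
subs-length {n} u@zer = top-length {n} u
subs-length u@(sc t) = ++-length≤ (top u) (top-length u) (subs-length t)
subs-length u@(t ⊕ s) = ++-length≤ (top u) (top-length u) (++-length≤ (subs t) (subs-length t) (subs-length s))
subs-length u@(t ⊗ s) = ++-length≤ (top u) (top-length u) (++-length≤ (subs t) (subs-length t) (subs-length s))

subsF : ∀ {n} → Formula n → List (Term 0)
subsF (t ≐ u) = subs t ++ subs u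
subsF (t ≺ u) = subs t ++ subs u
subsF (t ≉ u) = subs t ++ subs u
subsF (t ⊀ u) = subs t ++ subs u
subsF (φ ∧' ψ) = subsF φ ++ subsF ψ
subsF (φ ∨' ψ) = subsF φ ++ subsF ψ
subsF (∀' φ) = subsF φ
subsF (∃' φ) = subsF φ

subsA-occ : ∀ {n t} (u v : Term n) → OccA t u v → t ∈ subs u ++ subs v
subsA-occ u v (inj₁ p) = ∈-++⁺ˡ (subs-occ p)
subsA-occ u v (inj₂ p) = ∈-++⁺ʳ (subs u) (subs-occ p)

subsF-occ : ∀ {n t} (φ : Formula n) → OccF t φ → t ∈ subsF φ
subsF-occ (t ≐ u) p = subsA-occ t u p
subsF-occ (t ≺ u) p = subsA-occ t u p
subsF-occ (t ≉ u) p = subsA-occ t u p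
subsF-occ (t ⊀ u) p = subsA-occ t u p
subsF-occ (φ ∧' ψ) (inj₁ p) = ∈-++⁺ˡ (subsF-occ φ p)
subsF-occ (φ ∧' ψ) (inj₂ p) = ∈-++⁺ʳ (subsF φ) (subsF-occ ψ p)
subsF-occ (φ ∨' ψ) (inj₁ p) = ∈-++⁺ˡ (subsF-occ φ p)
subsF-occ (φ ∨' ψ) (inj₂ p) = ∈-++⁺ʳ (subsF φ) (subsF-occ ψ p)
subsF-occ (∀' φ) p = subsF-occ φ p
subsF-occ (∃' φ) p = subsF-occ φ p

subsA-free : ∀ {n x t} (u v : Term n) → t ∈ subs u ++ subs v → FreeT x t → FreeA x u v
subsA-free u v m f = [ (λ k → inj₁ (subs-free u k f)) , (λ k → inj₂ (subs-free v k f)) ]′ (∈-++⁻ (subs u) m)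

subsF-free : ∀ {n x t} (φ : Formula n) → t ∈ subsF φ → FreeT x t → FreeF x φ
subsF-free (t ≐ u) = subsA-free t u
subsF-free (t ≺ u) = subsA-free t u
subsF-free (t ≉ u) = subsA-free t u
subsF-free (t ⊀ u) = subsA-free t u
subsF-free (φ ∧' ψ) m f = [ (λ k → inj₁ (subsF-free φ k f)) , (λ k → inj₂ (subsF-free ψ k f)) ]′ (∈-++⁻ (subsF φ) m)
subsF-free (φ ∨' ψ) m f = [ (λ k → inj₁ (subsF-free φ k f)) , (λ k → inj₂ (subsF-free ψ k f)) ]′ (∈-++⁻ (subsF φ) m)
subsF-free (∀' φ) = subsF-free φ
subsF-free (∃' φ) = subsF-free φ

++-size : ∀ {t a c : ℕ} {A B : Set} → A ⊎ B → (A → t ≤ a) → (B → t ≤ c) → t ≤ suc (a + c)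
++-size {a = a} (inj₁ p) h k = m≤n⇒m≤1+n (≤-trans (h p) (m≤m+n a _))
++-size {a = a} (inj₂ p) h k = m≤n⇒m≤1+n (≤-trans (k p) (m≤n+m _ a))

subsF-size : ∀ {n t} (φ : Formula n) → t ∈ subsF φ → termSize t ≤ formSize φ
subsF-size (t ≐ u) m = ++-size (∈-++⁻ (subs t) m) (subs-size t) (subs-size u)
subsF-size (t ≺ u) m = ++-size (∈-++⁻ (subs t) m) (subs-size t) (subs-size u)
subsF-size (t ≉ u) m = ++-size (∈-++⁻ (subs t) m) (subs-size t) (subs-size u)
subsF-size (t ⊀ u) m = ++-size (∈-++⁻ (subs t) m) (subs-size t) (subs-size u)
subsF-size (φ ∧' ψ) m = ++-size (∈-++⁻ (subsF φ) m) (subsF-size φ) (subsF-size ψ)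
subsF-size (φ ∨' ψ) m = ++-size (∈-++⁻ (subsF φ) m) (subsF-size φ) (subsF-size ψ)
subsF-size (∀' φ) m = m≤n⇒m≤1+n (subsF-size φ m)
subsF-size (∃' φ) m = m≤n⇒m≤1+n (subsF-size φ m)

subsF-length : ∀ {n} (φ : Formula n) → length (subsF φ) ≤ formSize φ
subsF-length (t ≐ u) = m≤n⇒m≤1+n (++-length≤ (subs t) (subs-length t) (subs-length u))
subsF-length (t ≺ u) = m≤n⇒m≤1+n (++-length≤ (subs t) (subs-length t) (subs-length u))
subsF-length (t ≉ u) = m≤n⇒m≤1+n (++-length≤ (subs t) (subs-length t) (subs-length u))
subsF-length (t ⊀ u) = m≤n⇒m≤1+n (++-length≤ (subs t) (subs-length t) (subs-length u))
subsF-length (φ ∧' ψ) = m≤n⇒m≤1+n (++-length≤ (subsF φ) (subsF-length φ) (subsF-length ψ))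
subsF-length (φ ∨' ψ) = m≤n⇒m≤1+n (++-length≤ (subsF φ) (subsF-length φ) (subsF-length ψ))
subsF-length (∀' φ) = m≤n⇒m≤1+n (subsF-length φ)
subsF-length (∃' φ) = m≤n⇒m≤1+n (subsF-length φ)

namesT : ∀ {n} → Term n → List ℕ
namesT (bv i) = []
namesT (fv x) = x ∷ []
namesT zer = []
namesT (sc t) = namesT t
namesT (t ⊕ u) = namesT t ++ namesT u
namesT (t ⊗ u) = namesT t ++ namesT u

namesF : ∀ {n} → Formula n → List ℕ
namesF (t ≐ u) = namesT t ++ namesT u
namesF (t ≺ u) = namesT t ++ namesT u
namesF (t ≉ u) = namesT t ++ namesT u
namesF (t ⊀ u) = namesT t ++ namesT u
namesF (φ ∧' ψ) = namesF φ ++ namesF ψ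
namesF (φ ∨' ψ) = namesF φ ++ namesF ψ
namesF (∀' φ) = namesF φ
namesF (∃' φ) = namesF φ

namesT-free : ∀ {n x} {t : Term n} → FreeT x t → x ∈ namesT t
namesT-free here = here refl
namesT-free (sc₁ p) = namesT-free p
namesT-free (⊕₁ p) = ∈-++⁺ˡ (namesT-free p)
namesT-free {t = t ⊕ _} (⊕₂ p) = ∈-++⁺ʳ (namesT t) (namesT-free p)
namesT-free (⊗₁ p) = ∈-++⁺ˡ (namesT-free p)
namesT-free {t = t ⊗ _} (⊗₂ p) = ∈-++⁺ʳ (namesT t) (namesT-free p)

namesA-free : ∀ {n x} (t u : Term n) → FreeA x t u → x ∈ namesT t ++ namesT u
namesA-free t u (inj₁ p) = ∈-++⁺ˡ (namesT-free p)
namesA-free t u (inj₂ p) = ∈-++⁺ʳ (namesT t) (namesT-free p)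

namesF-free : ∀ {n x} (φ : Formula n) → FreeF x φ → x ∈ namesF φ
namesF-free (t ≐ u) = namesA-free t u
namesF-free (t ≺ u) = namesA-free t u
namesF-free (t ≉ u) = namesA-free t u
namesF-free (t ⊀ u) = namesA-free t u
namesF-free (φ ∧' ψ) (inj₁ p) = ∈-++⁺ˡ (namesF-free φ p)
namesF-free (φ ∧' ψ) (inj₂ p) = ∈-++⁺ʳ (namesF φ) (namesF-free ψ p)
namesF-free (φ ∨' ψ) (inj₁ p) = ∈-++⁺ˡ (namesF-free φ p)
namesF-free (φ ∨' ψ) (inj₂ p) = ∈-++⁺ʳ (namesF φ) (namesF-free ψ p)
namesF-free (∀' φ) p = namesF-free φ p
namesF-free (∃' φ) p = namesF-free φ p

free-namesT : ∀ {n x} (t : Term n) → x ∈ namesT t → FreeT x t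
free-namesT (fv x) (here refl) = here
free-namesT (sc t) m = sc₁ (free-namesT t m)
free-namesT (t ⊕ u) m = [ ⊕₁ ∘ free-namesT t , ⊕₂ ∘ free-namesT u ]′ (∈-++⁻ (namesT t) m)
free-namesT (t ⊗ u) m = [ ⊗₁ ∘ free-namesT t , ⊗₂ ∘ free-namesT u ]′ (∈-++⁻ (namesT t) m)

free-namesA : ∀ {n x} (t u : Term n) → x ∈ namesT t ++ namesT u → FreeA x t u
free-namesA t u m = [ inj₁ ∘ free-namesT t , inj₂ ∘ free-namesT u ]′ (∈-++⁻ (namesT t) m)

free-namesF : ∀ {n x} (φ : Formula n) → x ∈ namesF φ → FreeF x φ
free-namesF (t ≐ u) = free-namesA t u
free-namesF (t ≺ u) = free-namesA t u
free-namesF (t ≉ u) = free-namesA t u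
free-namesF (t ⊀ u) = free-namesA t u
free-namesF (φ ∧' ψ) m = [ inj₁ ∘ free-namesF φ , inj₂ ∘ free-namesF ψ ]′ (∈-++⁻ (namesF φ) m)
free-namesF (φ ∨' ψ) m = [ inj₁ ∘ free-namesF φ , inj₂ ∘ free-namesF ψ ]′ (∈-++⁻ (namesF φ) m)
free-namesF (∀' φ) = free-namesF φ
free-namesF (∃' φ) = free-namesF φ

namesT-length : ∀ {n} (t : Term n) → length (namesT t) ≤ termSize t
namesT-length (bv i) = z≤n
namesT-length (fv x) = ≤-refl
namesT-length zer = z≤n
namesT-length (sc t) = m≤n⇒m≤1+n (namesT-length t)
namesT-length (t ⊕ u) = m≤n⇒m≤1+n (++-length≤ (namesT t) (namesT-length t) (namesT-length u))
namesT-length (t ⊗ u) = m≤n⇒m≤1+n (++-length≤ (namesT t) (namesT-length t) (namesT-length u))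

namesF-length : ∀ {n} (φ : Formula n) → length (namesF φ) ≤ formSize φ
namesF-length (t ≐ u) = m≤n⇒m≤1+n (++-length≤ (namesT t) (namesT-length t) (namesT-length u))
namesF-length (t ≺ u) = m≤n⇒m≤1+n (++-length≤ (namesT t) (namesT-length t) (namesT-length u))
namesF-length (t ≉ u) = m≤n⇒m≤1+n (++-length≤ (namesT t) (namesT-length t) (namesT-length u))
namesF-length (t ⊀ u) = m≤n⇒m≤1+n (++-length≤ (namesT t) (namesT-length t) (namesT-length u))
namesF-length (φ ∧' ψ) = m≤n⇒m≤1+n (++-length≤ (namesF φ) (namesF-length φ) (namesF-length ψ))
namesF-length (φ ∨' ψ) = m≤n⇒m≤1+n (++-length≤ (namesF φ) (namesF-length φ) (namesF-length ψ))
namesF-length (∀' φ) = m≤n⇒m≤1+n (namesF-length φ)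
namesF-length (∃' φ) = m≤n⇒m≤1+n (namesF-length φ)

collect : ∀ {A : Set} → (Formula 0 → List A) → Sequent → List A
collect f (Γ ⇒ Δ) = concatMap f Γ ++ concatMap f Δ

_∈S_ : Formula 0 → Sequent → Set
φ ∈S S = φ ∈ ante S ⊎ φ ∈ succ S

∈-cM⁺ : ∀ {A B : Set} {y : B} (f : A → List B) {x xs} → x ∈ xs → y ∈ f x → y ∈ concatMap f xs
∈-cM⁺ f (here refl) n = ∈-++⁺ˡ n
∈-cM⁺ f {xs = x ∷ _} (there m) n = ∈-++⁺ʳ (f x) (∈-cM⁺ f m n)

∈-cM⁻ : ∀ {A B : Set} {y : B} (f : A → List B) xs → y ∈ concatMap f xs → Σ A λ x → x ∈ xs × y ∈ f x
∈-cM⁻ f (x ∷ xs) m with ∈-++⁻ (f x) m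
... | inj₁ n = x , here refl , n
... | inj₂ n = let z , k , l = ∈-cM⁻ f xs n in z , there k , l

collect⁺ : ∀ {A : Set} (f : Formula 0 → List A) S {a φ} → φ ∈S S → a ∈ f φ → a ∈ collect f S
collect⁺ f S (inj₁ m) n = ∈-++⁺ˡ (∈-cM⁺ f m n)
collect⁺ f S (inj₂ m) n = ∈-++⁺ʳ (concatMap f (ante S)) (∈-cM⁺ f m n)

collect⁻ : ∀ {A : Set} (f : Formula 0 → List A) S {a} → a ∈ collect f S → Σ (Formula 0) λ φ → φ ∈S S × a ∈ f φ
collect⁻ f S m with ∈-++⁻ (concatMap f (ante S)) m
... | inj₁ n = let φ , k , l = ∈-cM⁻ f (ante S) n in φ , inj₁ k , l
... | inj₂ n = let φ , k , l = ∈-cM⁻ f (succ S) n in φ , inj₂ k , l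

collect-length : ∀ {A : Set} (f : Formula 0 → List A) → (∀ φ → length (f φ) ≤ formSize φ) → ∀ S → length (collect f S) ≤ seqSize S
collect-length f h (Γ ⇒ Δ) = ++-length≤ (concatMap f Γ) (go Γ) (go Δ)
  where
  go : ∀ Γ → length (concatMap f Γ) ≤ sz Γ
  go [] = z≤n
  go (φ ∷ Γ) = ++-length≤ (f φ) (h φ) (go Γ)

gather : ∀ {A : Set} m → (Fin m → List A) → List A
gather zero f = []
gather (suc m) f = f zero ++ gather m (f ∘ suc)

gather⁺ : ∀ {A : Set} m (f : Fin m → List A) i {a} → a ∈ f i → a ∈ gather m f
gather⁺ (suc m) f zero k = ∈-++⁺ˡ k
gather⁺ (suc m) f (suc i) k = ∈-++⁺ʳ (f zero) (gather⁺ m (f ∘ suc) i k)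

gather⁻ : ∀ {A : Set} m (f : Fin m → List A) {a} → a ∈ gather m f → Σ (Fin m) λ i → a ∈ f i
gather⁻ (suc m) f k = [ (λ l → zero , l) , (λ l → let i , q = gather⁻ m (f ∘ suc) l in suc i , q) ]′ (∈-++⁻ (f zero) k)

gather-length : ∀ {A : Set} m (f : Fin m → List A) (g : Fin m → ℕ) → (∀ i → length (f i) ≤ g i) → length (gather m f) ≤ sumFin m g
gather-length zero f g h = z≤n
gather-length (suc m) f g h = ++-length≤ (f zero) (h zero) (gather-length m (f ∘ suc) (g ∘ suc) (h ∘ suc))

sumFin-≥ : ∀ m (g : Fin m → ℕ) i → g i ≤ sumFin m g
sumFin-≥ (suc m) g zero = m≤m+n _ _
sumFin-≥ (suc m) g (suc i) = ≤-trans (sumFin-≥ m (g ∘ suc) i) (m≤n+m _ (g zero))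

sumFin-count : ∀ m (g : Fin m → ℕ) → (∀ i → 1 ≤ g i) → m ≤ sumFin m g
sumFin-count zero g h = z≤n
sumFin-count (suc m) g h = +-mono-≤ (h zero) (sumFin-count m (g ∘ suc) (h ∘ suc))

maxFin : ∀ m → (Fin m → ℕ) → ℕ
maxFin zero g = 0
maxFin (suc m) g = g zero ⊔ maxFin m (g ∘ suc)

maxFin-≥ : ∀ m (g : Fin m → ℕ) i → g i ≤ maxFin m g
maxFin-≥ (suc m) g zero = m≤m⊔n _ _
maxFin-≥ (suc m) g (suc i) = ≤-trans (maxFin-≥ m (g ∘ suc) i) (m≤n⊔m (g zero) _)

data Structural : Rule → Set where
  isId : ∀ φ → Structural (idR φ)
  isRefl : ∀ t → Structural (eqRefl t)
  isEq : ∀ s t x φ → Structural (eqSub s t x φ)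
  isNegL : ∀ φ → Structural (negL φ)
  isNegR : ∀ φ → Structural (negR φ)
  isWk : ∀ Γ Δ Γ' Δ' → Structural (wkR Γ Δ Γ' Δ')
  isCut : ∀ Γ Δ φ → Structural (cutR Γ Δ φ)
  is∧L : ∀ Γ Δ φ ψ → Structural (∧L Γ Δ φ ψ)
  is∧R : ∀ Γ Δ φ ψ → Structural (∧R Γ Δ φ ψ)
  is∨L : ∀ Γ Δ φ ψ → Structural (∨L Γ Δ φ ψ)
  is∨R : ∀ Γ Δ φ ψ → Structural (∨R Γ Δ φ ψ)
  is∀L : ∀ Γ Δ φ t → Structural (∀L Γ Δ φ t)
  is∃R : ∀ Γ Δ φ t → Structural (∃R Γ Δ φ t)
  is∀R : ∀ Γ Δ φ x → Structural (∀R Γ Δ φ x)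
  is∃L : ∀ Γ Δ φ x → Structural (∃L Γ Δ φ x)
  isQ : ∀ a θ → Structural (qAx a θ)

-- `PrecR` ends in a catch-all clause that reduces only for a known rule. The view stores both
-- directions of its meaning, so that all rules except substitution are treated as one case.
data SubView (r : Rule) : Set where
  isSub : ∀ θ Γ Δ → r ≡ subR θ Γ Δ → SubView r
  notSub : Structural r → (∀ Γ t' t → PrecR r Γ t' t → ((t' ≐ t) ∈ Γ) ⊎ (t' ≡ t)) → (∀ Γ t' t → ((t' ≐ t) ∈ Γ) ⊎ (t' ≡ t) → PrecR r Γ t' t) → SubView r

subView : ∀ r → SubView r
subView (idR φ) = notSub (isId φ) (λ _ _ _ → id) (λ _ _ _ → id)
subView (eqRefl t) = notSub (isRefl t) (λ _ _ _ → id) (λ _ _ _ → id)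
subView (eqSub s t x φ) = notSub (isEq s t x φ) (λ _ _ _ → id) (λ _ _ _ → id)
subView (negL φ) = notSub (isNegL φ) (λ _ _ _ → id) (λ _ _ _ → id)
subView (negR φ) = notSub (isNegR φ) (λ _ _ _ → id) (λ _ _ _ → id)
subView (wkR Γ Δ Γ' Δ') = notSub (isWk Γ Δ Γ' Δ') (λ _ _ _ → id) (λ _ _ _ → id)
subView (cutR Γ Δ φ) = notSub (isCut Γ Δ φ) (λ _ _ _ → id) (λ _ _ _ → id)
subView (∧L Γ Δ φ ψ) = notSub (is∧L Γ Δ φ ψ) (λ _ _ _ → id) (λ _ _ _ → id)
subView (∧R Γ Δ φ ψ) = notSub (is∧R Γ Δ φ ψ) (λ _ _ _ → id) (λ _ _ _ → id)
subView (∨L Γ Δ φ ψ) = notSub (is∨L Γ Δ φ ψ) (λ _ _ _ → id) (λ _ _ _ → id)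
subView (∨R Γ Δ φ ψ) = notSub (is∨R Γ Δ φ ψ) (λ _ _ _ → id) (λ _ _ _ → id)
subView (∀L Γ Δ φ t) = notSub (is∀L Γ Δ φ t) (λ _ _ _ → id) (λ _ _ _ → id)
subView (∃R Γ Δ φ t) = notSub (is∃R Γ Δ φ t) (λ _ _ _ → id) (λ _ _ _ → id)
subView (∀R Γ Δ φ x) = notSub (is∀R Γ Δ φ x) (λ _ _ _ → id) (λ _ _ _ → id)
subView (∃L Γ Δ φ x) = notSub (is∃L Γ Δ φ x) (λ _ _ _ → id) (λ _ _ _ → id)
subView (subR θ Γ Δ) = isSub θ Γ Δ refl
subView (qAx a θ) = notSub (isQ a θ) (λ _ _ _ → id) (λ _ _ _ → id)

_∈T?_ : (t : Term 0) (ts : List (Term 0)) → Dec (t ∈ ts)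
t ∈T? ts = Any.any? (t ≟T_) ts

_∈F?_ : (φ : Formula 0) (Γ : Cedent) → Dec (φ ∈ Γ)
φ ∈F? Γ = Any.any? (φ ≟F_) Γ

precR? : ∀ r Γ t' t → Dec (PrecR r Γ t' t)
precR? r Γ t' t with subView r
... | isSub θ _ _ refl = t ≟T fsubT θ t'
... | notSub _ from to = map′ (to Γ t' t) (from Γ t' t) (((t' ≐ t) ∈F? Γ) ⊎-dec (t' ≟T t))

nthB : List Bool → ℕ → Bool
nthB [] i = false
nthB (b ∷ bs) zero = b
nthB (b ∷ bs) (suc i) = nthB bs i

tabulate-nthB : ∀ n bs → length bs ≤ n → tabulate {n = n} (λ c → nthB bs (toℕ c)) ≡ bs ++ zeros (n ∸ length bs)
tabulate-nthB zero [] h = refl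
tabulate-nthB (suc n) [] h = cong (false ∷_) (tabulate-nthB n [] z≤n)
tabulate-nthB (suc n) (b ∷ bs) (s≤s h) = cong (b ∷_) (tabulate-nthB n bs h)

hdB : List Bool → Bool
hdB [] = false
hdB (b ∷ _) = b

tlB : List Bool → List Bool
tlB [] = []
tlB (_ ∷ bs) = bs

oneHot : ∀ {n} → Fin n → List Bool
oneHot t = tabulate (λ i → does (i Data.Fin.≟ t))

oneHot-any : ∀ {n} (t : Fin n) → anyB (oneHot t) ≡ true
oneHot-any {n} t = go t
  where
  at : ∀ {n} (f : Fin n → Bool) i → f i ≡ true → anyB (tabulate f) ≡ true
  at f zero e rewrite e = refl
  at f (suc i) e with f zero
  ... | true = refl
  ... | false = at (f ∘ suc) i e
  go : ∀ t → anyB (oneHot {n} t) ≡ true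
  go t = at (λ i → does (i Data.Fin.≟ t)) t (diag (t Data.Fin.≟ t))
    where
    diag : (d : Dec (t ≡ t)) → does d ≡ true
    diag (yes _) = refl
    diag (no q) = contradiction refl q

onlyIf : ∀ {A P : Set} → Dec P → A → List A
onlyIf (yes _) a = a ∷ []
onlyIf (no _) a = []

onlyIf⁺ : ∀ {A P : Set} (d : Dec P) {a : A} → P → a ∈ onlyIf d a
onlyIf⁺ (yes _) p = here refl
onlyIf⁺ (no q) p = contradiction p q

onlyIf⁻ : ∀ {A P : Set} (d : Dec P) {a x : A} → x ∈ onlyIf d a → P × x ≡ a
onlyIf⁻ (yes p) (here e) = p , e

boolFin : Bool → Fin 2
boolFin false = zero
boolFin true = suc zero

finBool : Fin 2 → Bool
finBool zero = false
finBool (suc _) = true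

finBool-boolFin : ∀ b → finBool (boolFin b) ≡ b
finBool-boolFin false = refl
finBool-boolFin true = refl

-- The automaton of a preproof

module Automaton (π : Preproof) where

  terms : List (Term 0)
  terms = gather (nodes π) (λ v → collect subsF (seq π v))

  n : ℕ
  n = length terms

  open Columns n

  term : Fin n → Term 0
  term = lookup terms

  Occ : Fin (nodes π) → Term 0 → Set
  Occ v t = t ∈ collect subsF (seq π v)

  occS⇒Occ : ∀ {v t} → OccS t (seq π v) → Occ v t
  occS⇒Occ {v} (φ , k , o) = collect⁺ subsF (seq π v) k (subsF-occ φ o)

  termIx : ∀ {v t} → Occ v t → Fin n
  termIx {v} o = Any.index (gather⁺ (nodes π) _ v o)

  term-termIx : ∀ {v t} (o : Occ v t) → term (termIx o) ≡ t
  term-termIx {v} o = sym (lookup-index (gather⁺ (nodes π) _ v o))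

  Prev : Fin (nodes π) → Term 0 → Term 0 → Set
  Prev v = PrecR (rl π v) (ante (seq π v))

  Le : Fin (nodes π) → Fin n → Fin n → Set
  Le v a c = Occ v (term a) × Prev v (term c) (term a)

  Lt : Fin (nodes π) → Fin (nodes π) → Fin n → Fin n → Set
  Lt v w a c = Occ v (term a) × Σ (Fin n) λ d → Prev v (term d) (term a) × (term c ≺ term d) ∈ ante (seq π w)

  occ? : ∀ v t → Dec (Occ v t)
  occ? v t = t ∈T? collect subsF (seq π v)

  le? : ∀ v a c → Dec (Le v a c)
  le? v a c = occ? v (term a) ×-dec precR? (rl π v) _ (term c) (term a)

  lt? : ∀ v w a c → Dec (Lt v w a c)
  lt? v w a c = occ? v (term a) ×-dec any? (λ d → precR? (rl π v) _ (term d) (term a) ×-dec ((term c ≺ term d) ∈F? ante (seq π w)))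

  M : ℕ
  M = nodes π * ((2 ^ n) ^ n)

  State : Set
  State = Fin M

  encode : Fin (nodes π) → (Fin n → Fin n → Bool) → State
  encode v A = combine v (funToFin (λ t → funToFin (λ c → boolFin (A t c))))

  node : State → Fin (nodes π)
  node s = proj₁ (remQuot {nodes π} ((2 ^ n) ^ n) s)

  mat : State → Fin n → Fin n → Bool
  mat s t c = finBool (finToFun {2} {n} (finToFun {2 ^ n} {n} (proj₂ (remQuot {nodes π} ((2 ^ n) ^ n) s)) t) c)

  node-encode : ∀ v A → node (encode v A) ≡ v
  node-encode v A = cong proj₁ (remQuot-combine v _)

  mat-encode : ∀ v A t c → mat (encode v A) t c ≡ A t c
  mat-encode v A t c = trans (cong (λ q → finBool (finToFun {2} {n} (finToFun {2 ^ n} {n} (proj₂ q) t) c)) (remQuot-combine v code))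
    (trans (cong (λ r → finBool (finToFun {2} {n} r c)) (finToFun-funToFin (λ t → funToFin (λ c → boolFin (A t c))) t))
      (trans (cong finBool (finToFun-funToFin (λ c → boolFin (A t c)) c)) (finBool-boolFin (A t c))))
    where
    code : Fin ((2 ^ n) ^ n)
    code = funToFin (λ t → funToFin (λ c → boolFin (A t c)))

  rowOf : State → Fin n → List Bool
  rowOf s t = tabulate (mat s t)

  rowOf-length : ∀ s t → length (rowOf s t) ≡ n
  rowOf-length s t = length-tabulate (mat s t)

  -- A progress step towards c opens a register in column n + c, younger than all existing ones. The
  -- extension therefore has n + n columns until the run trims it.
  candsAt : State → Fin (nodes π) → Fin n → Fin n → List (List Bool)
  candsAt s w c a = onlyIf (le? (node s) a c) (rowOf s a ++ zeros n) ++ onlyIf (lt? (node s) w a c) (rowOf s a ++ oneHot c)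

  cands : State → Fin (nodes π) → Fin n → List (List Bool)
  cands s w c = concatMap (candsAt s w c) (allFin n)

  le-cand : ∀ s w {a c} → Le (node s) a c → (rowOf s a ++ zeros n) ∈ cands s w c
  le-cand s w {a} {c} l = ∈-cM⁺ (candsAt s w c) (∈-allFin a) (∈-++⁺ˡ (onlyIf⁺ (le? (node s) a c) l))

  lt-cand : ∀ s w {a c} → Lt (node s) w a c → (rowOf s a ++ oneHot c) ∈ cands s w c
  lt-cand s w {a} {c} l = ∈-cM⁺ (candsAt s w c) (∈-allFin a) (∈-++⁺ʳ (onlyIf (le? (node s) a c) _) (onlyIf⁺ (lt? (node s) w a c) l))

  cand⁻ : ∀ s w c {u} → u ∈ cands s w c → Σ (Fin n) λ a → (Le (node s) a c × u ≡ rowOf s a ++ zeros n) ⊎ (Lt (node s) w a c × u ≡ rowOf s a ++ oneHot c)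
  cand⁻ s w c m with ∈-cM⁻ (candsAt s w c) (allFin n) m
  ... | a , _ , k with ∈-++⁻ (onlyIf (le? (node s) a c) (rowOf s a ++ zeros n)) k
  ...   | inj₁ l = a , inj₁ (onlyIf⁻ (le? (node s) a c) l)
  ...   | inj₂ l = a , inj₂ (onlyIf⁻ (lt? (node s) w a c) l)

  cand-length : ∀ s w c u → u ∈ cands s w c → length u ≡ length (zeros (n + n))
  cand-length s w c u m with cand⁻ s w c m
  ... | a , inj₁ (_ , refl) = trans (length-++ (rowOf s a)) (trans (cong₂ _+_ (rowOf-length s a) (length-replicate n)) (sym (length-replicate (n + n))))
  ... | a , inj₂ (_ , refl) = trans (length-++ (rowOf s a)) (trans (cong₂ _+_ (rowOf-length s a) (length-tabulate _)) (sym (length-replicate (n + n))))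

  -- The all-false default belongs to a term that nothing leads to; such a row imposes no guard.
  ext : State → Fin (nodes π) → Fin n → List Bool
  ext s w c = bestOf (zeros (n + n)) (cands s w c)

  ext-length : ∀ s w c → length (ext s w c) ≡ n + n
  ext-length s w c = trans (bestOf-length _ (cands s w c) (cand-length s w c)) (length-replicate (n + n))

  colsOf : ℕ → (Fin n → List Bool) → List Col
  colsOf zero R = []
  colsOf (suc m) R = (λ t → hdB (R t)) ∷ colsOf m (λ t → tlB (R t))

  colsOf-length : ∀ m R → length (colsOf m R) ≡ m
  colsOf-length zero R = refl
  colsOf-length (suc m) R = cong suc (colsOf-length m _)

  row-colsOf : ∀ m R t → length (R t) ≡ m → row (colsOf m R) t ≡ R t
  row-colsOf zero R t e with R t
  ... | [] = refl
  row-colsOf (suc m) R t e with R t in eq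
  ... | b ∷ bs = cong (b ∷_) (trans (row-colsOf m (λ t → tlB (R t)) t (trans (cong (length ∘ tlB) eq) (suc-injective e))) (cong tlB eq))

  cols : State → Fin (nodes π) → List Col
  cols s w = colsOf (n + n) (ext s w)

  row-cols : ∀ s w c → row (cols s w) c ≡ ext s w c
  row-cols s w c = row-colsOf (n + n) (ext s w) c (ext-length s w c)

  prio : State → Fin (nodes π) → ℕ
  prio s w = proj₁ (run-fuel _ (cols s w) refl)

  out : State → Fin (nodes π) → List Col
  out s w = proj₁ (proj₂ (run-fuel _ (cols s w) refl))

  theRun : ∀ s w → Run (cols s w) (prio s w) (out s w)
  theRun s w = proj₂ (proj₂ (run-fuel _ (cols s w) refl))

  δ : State → Fin (nodes π) → State
  δ s w = encode w (λ t c → nthB (row (out s w) t) (toℕ c))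

  node-δ : ∀ s w → node (δ s w) ≡ w
  node-δ s w = node-encode w _

  row-length : ∀ cs t → length (row cs t) ≡ length cs
  row-length cs t = length-map _ cs

  -- A state stores exactly n columns; `run-length` ensures that nothing is lost when the result of
  -- the run is stored.
  rowOf-δ : ∀ s w t → rowOf (δ s w) t ≡ row (out s w) t ++ zeros (n ∸ length (row (out s w) t))
  rowOf-δ s w t = trans (tabulate-cong (mat-encode w (λ t c → nthB (row (out s w) t) (toℕ c)) t))
    (tabulate-nthB n (row (out s w) t) (≤-trans (≤-reflexive (row-length (out s w) t)) (run-length (theRun s w))))

  prio≤ : ∀ s w → prio s w ≤ n * 2
  prio≤ s w = ≤-trans (run-priority (theRun s w)) (*-monoˡ-≤ 2 (run-length (theRun s w)))

  Cell : ℕ → State → Fin n → ℕ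
  Cell j s a = Φ j (n + n) (rowOf s a)

  record Trace (s : State) (w : Fin (nodes π)) (a c : Fin n) : Set where
    constructor trace
    field
      word : List Bool
      cand : word ∈ cands s w c
      grows : (rowOf s a ++ zeros n) ⊑ word

  le-trace : ∀ s w {a c} → Le (node s) a c → Trace s w a c
  le-trace s w l = trace _ (le-cand s w l) ⊑-refl

  lt-trace : ∀ s w {a c} → Lt (node s) w a c → Trace s w a c
  lt-trace s w {a} {c} l = trace _ (lt-cand s w l) (++-⊑ (rowOf s a) (subst (λ k → zeros k ⊑ oneHot c) (length-tabulate (λ i → does (i Data.Fin.≟ c))) (zeros-⊑ (oneHot c))))

  module Step (j : ℕ) (s : State) (w : Fin (nodes π)) (h : j * 2 ≤ prio s w) where

    K : ℕ
    K = n + n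

    cols≤ : length (cols s w) ≤ K
    cols≤ = ≤-reflexive (colsOf-length K (ext s w))

    ext≤new : ∀ c → Φ j K (ext s w c) ≤ Cell j (δ s w) c
    ext≤new c = begin
      Φ j K (ext s w c) ≡⟨ cong (Φ j K) (sym (row-cols s w c)) ⟩
      Φ j K (row (cols s w) c) ≤⟨ run-Φ (theRun s w) j K c h cols≤ ⟩
      Φ j K (row (out s w) c) ≡⟨ sym (Φ-pad j K (row (out s w) c) _) ⟩
      Φ j K (row (out s w) c ++ zeros (n ∸ length (row (out s w) c))) ≡⟨ cong (Φ j K) (sym (rowOf-δ s w c)) ⟩
      Cell j (δ s w) c ∎
      where open ≤-Reasoning

    word≤new : ∀ {c u} → u ∈ cands s w c → Φ j K u ≤ Cell j (δ s w) c
    word≤new {c} m = ≤-trans (Φ-mono j K (bestOf-max _ (cands s w c) (cand-length s w c) m)) (ext≤new c)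

    old≤word : ∀ {a c} (t : Trace s w a c) → Cell j s a ≤ Φ j K (Trace.word t)
    old≤word {a} (trace u m g) = ≤-trans (≤-reflexive (sym (Φ-pad j K (rowOf s a) n))) (Φ-mono j K g)

    mono : ∀ {a c} → Trace s w a c → Cell j s a ≤ Cell j (δ s w) c
    mono t = ≤-trans (old≤word t) (word≤new (Trace.cand t))

    row≤ : ∀ s a → length (rowOf s a) ≤ K
    row≤ s a = ≤-trans (≤-reflexive (rowOf-length s a)) (m≤m+n n n)

    -- The value is squeezed between that of the candidate and itself. The candidate carries the bit
    -- of its new register, at a position at least n ≥ j, so the new row has a bit there or
    -- elsewhere beyond j.
    progress-bit : ∀ {a c} → j ≤ n → Lt (node s) w a c → Cell j s a ≡ Cell j (δ s w) c → hasBit j (rowOf (δ s w) c) ≡ true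
    progress-bit {a} {c} j≤n l e = hasBit-transfer j K (rowOf s a ++ oneHot c) (rowOf (δ s w) c)
      (≤-antisym (word≤new (lt-cand s w l)) (≤-trans (≤-reflexive (sym e)) (old≤word (lt-trace s w l))))
      (≤-reflexive (trans (cand-length s w c _ (lt-cand s w l)) (length-replicate K))) (row≤ (δ s w) c)
      (hasBit-++ j (rowOf s a) (≤-trans j≤n (≤-reflexive (sym (rowOf-length s a)))) (oneHot-any c))

    kill-strict : ∀ {a c} → prio s w ≡ j * 2 → Trace s w a c → hasBit j (rowOf s a) ≡ true → Cell j s a ≢ Cell j (δ s w) c
    kill-strict {a} {c} pe t hb e = <-irrefl refl (begin-strict
        Cell j s a ≤⟨ ≤-trans (old≤word t) (Φ-mono j K (bestOf-max _ (cands s w c) (cand-length s w c) (Trace.cand t))) ⟩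
        Φ j K (ext s w c) ≡⟨ cong (Φ j K) (sym (row-cols s w c)) ⟩
        Φ j K (row (cols s w) c) <⟨ run-Φ-strict (theRun s w) j K c pe cols≤ (subst (λ u → hasBit j u ≡ true) (sym (row-cols s w c)) bit) ⟩
        Φ j K (row (out s w) c) ≡⟨ sym (Φ-pad j K (row (out s w) c) _) ⟩
        Φ j K (row (out s w) c ++ zeros (n ∸ length (row (out s w) c))) ≡⟨ cong (Φ j K) (sym (rowOf-δ s w c)) ⟩
        Cell j (δ s w) c ≡⟨ sym e ⟩
        Cell j s a ∎)
      where
      open ≤-Reasoning
      bit : hasBit j (ext s w c) ≡ true
      bit = hasBit-transfer j K (rowOf s a) (ext s w c)
        (≤-antisym (≤-trans (old≤word t) (Φ-mono j K (bestOf-max _ (cands s w c) (cand-length s w c) (Trace.cand t)))) (≤-trans (ext≤new c) (≤-reflexive (sym e))))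
        (row≤ s a) (≤-reflexive (ext-length s w c)) hb

  Edge : State → State → Set
  Edge s s' = node s' ∈ next π (node s) × s' ≡ δ s (node s')

  EdgeFrom : ℕ → State → State → Set
  EdgeFrom j s s' = Edge s s' × j * 2 ≤ prio s (node s')

  edge? : ∀ s s' → Dec (Edge s s')
  edge? s s' = Any.any? (node s' Data.Fin.≟_) (next π (node s)) ×-dec (s' Data.Fin.≟ δ s (node s'))

  edgeFrom? : ∀ j s s' → Dec (EdgeFrom j s s')
  edgeFrom? j s s' = edge? s s' ×-dec (j * 2 ≤? prio s (node s'))

  -- Nothing is tracked at the root; a trace enters the matrix at a progress point.
  initial : State
  initial = encode (root π) (λ _ _ → false)

  node-initial : node initial ≡ root π
  node-initial = node-encode (root π) _

  Reachable : State → Set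
  Reachable = Star Edge initial

  reachable? : ∀ s → Dec (Reachable s)
  reachable? = star? edge? initial

  -- An edge of priority 2j that lies on no cycle of edges of priority ≥ 2j loses its
  -- source from the set of reachable states, so the rank drops.
  rank : ℕ → State → ℕ
  rank j s = count (star? (edgeFrom? j) s)

  rank≤ : ∀ j s → rank j s ≤ M
  rank≤ j s = count≤ (star? (edgeFrom? j) s)

  rank-mono : ∀ j {s s'} → EdgeFrom j s s' → rank j s' ≤ rank j s
  rank-mono j {s} {s'} e = count-mono (star? (edgeFrom? j) s') (star? (edgeFrom? j) s) (λ _ p → e ◅ p)

-- The global trace condition excludes cycles of even least priority

-- A branch is a function on ℕ. Storing the path that remains before s makes walking the lasso a
-- deterministic step function.
data Position {A : Set} (R S : A → A → Set) (s : A) : Set where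
  lead : ∀ x → Star R x s → Position R S s
  loop : ∀ x → Star S x s → Position R S s

module Lasso (π : Preproof) (gtc : (β : Branch π) → ProgressingTrace β) where
  open Automaton π

  -- On the cycle no priority falls below 2j, so the value of the tracked cell never decreases. Two
  -- laps starting at the same term have equal values, and the value is constant in between. A
  -- progress point then supplies a bit at or beyond j, and the edge e, of priority 2j, would raise
  -- the value strictly.
  module Cycle (j : ℕ) {s s' : State} (e : Edge s s') (pe : prio s (node s') ≡ j * 2)
    (pre : Star Edge initial s) (back : Star (EdgeFrom j) s' s) where

    Conf : Set
    Conf = Position Edge (EdgeFrom j) s

    state : Conf → State
    state (lead x _) = x
    state (loop x _) = x

    home : Conf
    home = loop s' back

    adv : Conf → Conf
    adv (lead x ε) = home
    adv (lead x (_ ◅ p)) = lead _ p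
    adv (loop x ε) = home
    adv (loop x (_ ◅ p)) = loop _ p

    adv-edge : ∀ c → Edge (state c) (state (adv c))
    adv-edge (lead x ε) = e
    adv-edge (lead x (f ◅ p)) = f
    adv-edge (loop x ε) = e
    adv-edge (loop x (f ◅ p)) = proj₁ f

    IsLoop : Conf → Set
    IsLoop (lead _ _) = ⊥
    IsLoop (loop _ _) = ⊤

    adv-loop : ∀ c → IsLoop c → IsLoop (adv c)
    adv-loop (loop x ε) _ = tt
    adv-loop (loop x (_ ◅ _)) _ = tt

    adv-from : ∀ c → IsLoop c → EdgeFrom j (state c) (state (adv c))
    adv-from (loop x ε) _ = e , ≤-reflexive (sym pe)
    adv-from (loop x (f ◅ p)) _ = f

    iter : ℕ → Conf → Conf
    iter zero c = c
    iter (suc k) c = adv (iter k c)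

    iter-+ : ∀ k i c → iter (k + i) c ≡ iter k (iter i c)
    iter-+ zero i c = refl
    iter-+ (suc k) i c = cong adv (iter-+ k i c)

    iter-adv : ∀ k c → iter k (adv c) ≡ adv (iter k c)
    iter-adv zero c = refl
    iter-adv (suc k) c = cong adv (iter-adv k c)

    len : ∀ {R : State → State → Set} {x y} → Star R x y → ℕ
    len ε = 0
    len (_ ◅ p) = suc (len p)

    lead-home : ∀ {x} (p : Star Edge x s) → iter (suc (len p)) (lead x p) ≡ home
    lead-home ε = refl
    lead-home {x} (f ◅ p) = trans (sym (iter-adv (suc (len p)) (lead x (f ◅ p)))) (lead-home p)

    loop-end : ∀ {x} (p : Star (EdgeFrom j) x s) → iter (len p) (loop x p) ≡ loop s ε
    loop-end ε = refl
    loop-end {x} (f ◅ p) = trans (sym (iter-adv (len p) (loop x (f ◅ p)))) (loop-end p)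

    per : ℕ
    per = suc (len back)

    conf : ℕ → Conf
    conf i = iter i (lead initial pre)

    conf-home : ∀ k → conf (k * per + suc (len pre)) ≡ home
    conf-home zero = lead-home pre
    conf-home (suc k) = trans (cong conf (+-assoc per (k * per) (suc (len pre))))
      (trans (iter-+ per (k * per + suc (len pre)) _) (trans (cong (iter per) (conf-home k)) (cong adv (loop-end back))))

    β : Branch π
    β = record { b = λ i → node (state (conf i)) ; start = node-initial ; step = λ i → proj₁ (adv-edge (conf i)) }

    open ProgressingTrace (gtc β)

    B : ℕ
    -- After the lead the loop is walked m times: time B is at `home` and not before the start m of
    -- the trace.
    B = m * per + suc (len pre)

    m≤B : m ≤ B
    m≤B = ≤-trans (m≤m*n m per) (m≤m+n _ _)

    at : ℕ → Conf
    at d = conf (d + B)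

    at-home : ∀ k → at (k * per) ≡ home
    at-home k = trans (cong conf (trans (sym (+-assoc (k * per) (m * per) _)) (cong (_+ suc (len pre)) (sym (*-distribʳ-+ per k m))))) (conf-home (k + m))

    at-loop : ∀ d → IsLoop (at d)
    at-loop zero = subst IsLoop (sym (at-home 0)) tt
    at-loop (suc d) = adv-loop (at d) (at-loop d)

    st : ℕ → State
    st d = state (at d)

    edge : ∀ d → EdgeFrom j (st d) (st (suc d))
    edge d = adv-from (at d) (at-loop d)

    valid : ∀ d → m ≤ d + B
    valid d = ≤-trans m≤B (m≤n+m B d)

    occurs : ∀ d → Occ (node (st d)) (τ (d + B))
    occurs d = occS⇒Occ (occ (d + B) (valid d))

    ix : ℕ → Fin n
    ix d = termIx (occurs d)

    term-ix : ∀ d → term (ix d) ≡ τ (d + B)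
    term-ix d = term-termIx (occurs d)

    occ-ix : ∀ d → Occ (node (st d)) (term (ix d))
    occ-ix d = subst (Occ (node (st d))) (sym (term-ix d)) (occurs d)

    progress-lt : ∀ d → Progress β (d + B) (τ (d + B)) (τ (suc d + B)) → Lt (node (st d)) (node (st (suc d))) (ix d) (ix (suc d))
    progress-lt d (t , p , k) = occ-ix d , termIx o ,
      subst₂ (Prev (node (st d))) (sym (term-termIx o)) (sym (term-ix d)) p ,
      subst₂ (λ u v → (u ≺ v) ∈ ante (seq π (node (st (suc d))))) (sym (term-ix (suc d))) (sym (term-termIx o)) k
      where
      o : Occ (node (st (suc d))) t
      o = collect⁺ subsF (seq π (node (st (suc d)))) (inj₁ k) (subsF-occ (τ (suc d + B) ≺ t) (inj₂ (subst (OccT t) (embed-id t) here)))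

    traceAt : ∀ d → Trace (st d) (node (st (suc d))) (ix d) (ix (suc d))
    traceAt d = [ (λ p → le-trace (st d) _ (occ-ix d , subst₂ (Prev (node (st d))) (sym (term-ix (suc d))) (sym (term-ix d)) p)) , (λ p → lt-trace (st d) _ (progress-lt d p)) ]′
      (tstep (d + B) (valid d))

    F : ℕ → ℕ
    F d = Cell j (st d) (ix d)

    F-next : ∀ d → Cell j (δ (st d) (node (st (suc d)))) (ix (suc d)) ≡ F (suc d)
    F-next d = cong (λ z → Cell j z (ix (suc d))) (sym (proj₂ (proj₁ (edge d))))

    F-step : ∀ d → F d ≤ F (suc d)
    F-step d = ≤-trans (Step.mono j (st d) _ (proj₂ (edge d)) (traceAt d)) (≤-reflexive (F-next d))

    F-plus : ∀ k d → F d ≤ F (k + d)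
    F-plus zero d = ≤-refl
    F-plus (suc k) d = ≤-trans (F-plus k d) (F-step (k + d))

    F-mono : ∀ {d d'} → d ≤ d' → F d ≤ F d'
    F-mono {d} {d'} h = ≤-trans (F-plus (d' ∸ d) d) (≤-reflexive (cong F (m∸n+n≡m h)))

    prog : ∀ lo → Σ ℕ λ d → lo ≤ d × Lt (node (st d)) (node (st (suc d))) (ix d) (ix (suc d))
    prog lo = i ∸ B , ≤-trans (≤-reflexive (sym (m+n∸n≡m lo B))) (∸-monoˡ-≤ B h) , progress-lt (i ∸ B) (subst (λ z → Progress β z (τ z) (τ (suc z))) (sym i≡) (proj₂ (proj₂ (proj₂ (infprog (lo + B))))))
      where
      i : ℕ
      i = proj₁ (infprog (lo + B))
      h : lo + B ≤ i
      h = proj₁ (proj₂ (infprog (lo + B)))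
      i≡ : i ∸ B + B ≡ i
      i≡ = m∸n+n≡m (≤-trans (m≤n+m B lo) h)

    -- Laps are chosen so that a progress point lies between consecutive ones. They all start in the
    -- same state, so among n + 1 of them two start at the same term.
    lap : ℕ → ℕ
    lap zero = 0
    lap (suc r) = suc (proj₁ (prog (lap r * per)))

    lap-suc : ∀ r → lap r < lap (suc r)
    lap-suc r = s≤s (≤-trans (m≤m*n (lap r) per) (proj₁ (proj₂ (prog (lap r * per)))))

    lap-mono : ∀ {r r'} → r ≤ r' → lap r ≤ lap r'
    lap-mono {r} {r'} h = subst (λ z → lap r ≤ lap z) (m∸n+n≡m h) (go (r' ∸ r))
      where
      go : ∀ k → lap r ≤ lap (k + r)
      go zero = ≤-refl
      go (suc k) = ≤-trans (go k) (<⇒≤ (lap-suc (k + r)))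

    no-repeat : ∀ r r' → r < r' → ix (lap r * per) ≢ ix (lap r' * per)
    no-repeat r r' h same-ix = Step.kill-strict j (st dk) _ (proj₂ (edge dk)) prio-dk (traceAt dk) bit-dk (trans (eqF (≤-trans (n≤1+n dk) sdk≤)  (m≤n+m D₁ (len back)) ) (trans (sym (eqF sdk≤ (≤-trans (m≤n+m D₁ (len back)) (n≤1+n dk)))) (sym (F-next dk))))
      where
      D₁ D₂ dk : ℕ
      D₁ = lap r * per
      D₂ = lap r' * per
      dk = len back + D₁
      dp = proj₁ (prog D₁)
      sdk≤ : suc dk ≤ D₂
      sdk≤ = *-monoˡ-≤ per (≤-trans (lap-suc r) (lap-mono h))
      sdp≤ : suc dp ≤ D₂
      sdp≤ = ≤-trans (m≤m*n (suc dp) per) (*-monoˡ-≤ per (lap-mono h))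
      F₁₂ : F D₂ ≡ F D₁
      F₁₂ = cong₂ (Cell j) (trans (cong state (at-home (lap r'))) (sym (cong state (at-home (lap r))))) (sym same-ix)
      eqF : ∀ {d} → d ≤ D₂ → D₁ ≤ d → F d ≡ F D₁
      eqF h₂ h₁ = ≤-antisym (≤-trans (F-mono h₂) (≤-reflexive F₁₂)) (F-mono h₁)
      at-dk : at dk ≡ loop s ε
      at-dk = trans (cong conf (+-assoc (len back) D₁ B)) (trans (iter-+ (len back) (D₁ + B) _) (trans (cong (iter (len back)) (at-home (lap r))) (loop-end back)))
      prio-dk : prio (st dk) (node (st (suc dk))) ≡ j * 2
      prio-dk = trans (cong (λ c → prio (state c) (node (state (adv c)))) at-dk) pe
      j≤n : j ≤ n
      j≤n = *-cancelʳ-≤ j n 2 (≤-trans (≤-reflexive (sym pe)) (prio≤ s (node s')))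
      bit-dp : hasBit j (rowOf (st (suc dp)) (ix (suc dp))) ≡ true
      bit-dp = subst (λ z → hasBit j (rowOf z (ix (suc dp))) ≡ true) (sym (proj₂ (proj₁ (edge dp))))
        (Step.progress-bit j (st dp) _ (proj₂ (edge dp)) j≤n (proj₂ (proj₂ (prog D₁)))
          (trans (eqF (≤-trans (n≤1+n dp) sdp≤) (proj₁ (proj₂ (prog D₁)))) (trans (sym (eqF sdp≤ (≤-trans (proj₁ (proj₂ (prog D₁))) (n≤1+n dp)))) (sym (F-next dp)))))
      short : ∀ d → length (rowOf (st d) (ix d)) ≤ n + n
      short d = ≤-trans (≤-reflexive (rowOf-length (st d) (ix d))) (m≤m+n n n)
      -- The edge e is traversed at the end of the first lap, perhaps before the progress point.
      -- Since the value is constant on the whole interval, the bit can be carried in either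
      -- direction.
      bit-dk : hasBit j (rowOf (st dk) (ix dk)) ≡ true
      bit-dk = hasBit-transfer j (n + n) (rowOf (st (suc dp)) (ix (suc dp))) (rowOf (st dk) (ix dk))
        (trans (eqF sdp≤ (≤-trans (proj₁ (proj₂ (prog D₁))) (n≤1+n dp))) (sym (eqF (≤-trans (n≤1+n dk) sdk≤) (m≤n+m D₁ (len back)))))
        (short (suc dp)) (short dk) bit-dp

    impossible : ⊥
    impossible = let r , r' , h , same-ix = pigeonhole (n<1+n n) (λ r → ix (lap (toℕ r) * per)) in no-repeat (toℕ r) (toℕ r') h same-ix

  rank-strict : ∀ j {s s'} → Reachable s → (e : Edge s s') → prio s (node s') ≡ j * 2 → rank j s' < rank j s
  rank-strict j {s} {s'} pre e pe = count-strict (star? (edgeFrom? j) s') (star? (edgeFrom? j) s)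
    (λ _ p → (e , ≤-reflexive (sym pe)) ◅ p) s (λ back → Cycle.impossible j e pe pre back) ε

-- Numerals, and the order lemmas at uniform cost

num : ℕ → Term 0
num zero = zer
num (suc k) = sc (num k)

num-size : ∀ k → termSize (num k) ≡ suc k
num-size zero = refl
num-size (suc k) = cong suc (num-size k)

num-closed : ∀ {x} k → ¬ FreeT x (num k)
num-closed (suc k) (sc₁ p) = num-closed k p

⟪_,_,_⟫ : Term 0 → Term 0 → Term 0 → Subst
⟪ a , b , c ⟫ 0 = a
⟪ a , b , c ⟫ 1 = b
⟪ a , b , c ⟫ 2 = c
⟪ a , b , c ⟫ n = fv n

module Arithmetic (W : ℕ) (32≤W : 32 ≤ W) (κ≤W : κ ≤ W) where
  8≤W : 8 ≤ W
  8≤W = ≤-trans (m≤m+n 8 24) 32≤W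
  open Scaled W 8≤W public

  lit : ∀ k {_ : T (k ≤ᵇ 32)} → k ≤ W
  lit k {h} = ≤-trans (≤ᵇ⇒≤ k 32 h) 32≤W

  W≤pow : ∀ a → W ≤ W ^ suc a
  W≤pow a = base {W} {a} ≤-refl

  -- One shape for the sizes of instances of the order lemmas; 20 + 10·W ≤ 11·W ≤ W².
  small² : ∀ {x} → x ≤ 20 + 10 * W → x ≤ W ^ 2
  small² {x} h = ≤-trans h (≤-trans (+-monoˡ-≤ (10 * W) (lit 20)) (≤-trans (*-monoˡ-≤ W {11} {W} (lit 11)) (≤-reflexive (cong (W *_) (sym (*-identityʳ W))))))

  atom-size : ∀ (t u : Term 0) → termSize t ≤ W → termSize u ≤ suc W → suc (termSize t + termSize u) ≤ 2 + 2 * W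
  atom-size t u h k = ≤-trans (s≤s (+-mono-≤ h k)) (≤-reflexive (solve 1 (λ w → con 1 :+ (w :+ (con 1 :+ w)) := con 2 :+ con 2 :* w) refl W))
    where open +-*-Solver

  ≺-size : ∀ t u → termSize t ≤ W → termSize u ≤ suc W → formSize (t ≺ u) ≤ W ^ 2
  ≺-size t u h k = small² (≤-trans (atom-size t u h k) (+-mono-≤ (s≤s (s≤s (z≤n {18}))) (*-monoˡ-≤ W (s≤s (s≤s (z≤n {8}))))))

  -- The exponent 3 consists of the lemma itself, a substitution and a weakening.
  useLem : ∀ {Γ₀ Δ₀ Γ Δ} (lem : Prov Γ₀ Δ₀) → proj₁ lem ≤ W → seqSize (Γ₀ ⇒ Δ₀) ≤ W → (θ : Subst) → seqSize (map (fsubF θ) Γ₀ ⇒ map (fsubF θ) Δ₀) ≤ W ^ 2 →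
    map (fsubF θ) Γ₀ ⊆ Γ → map (fsubF θ) Δ₀ ⊆ Δ → D 3 Γ Δ
  useLem (c , p) hc hs θ hθ i k = wkD 2 hθ i k (subD 1 θ (base {_} {0} hs) (toD 1 (base {_} {0} hc) p))

  κ₁ : proj₁ ≺-zero ≤ W
  κ₁ = ≤-trans (m≤m+n _ _) κ≤W
  private
    r₁ r₂ r₃ r₄ r₅ r₆ r₇ : ℕ
    r₇ = proj₁ ≐-≺
    r₆ = proj₁ ≺-pred-bound + r₇
    r₅ = proj₁ pred-≺ + r₆
    r₄ = proj₁ ≺-pred + r₅
    r₃ = proj₁ ≺-trans + r₄
    r₂ = proj₁ ≺-step + r₃
    r₁ = proj₁ ≺-suc + r₂
    t₁ : r₁ ≤ W
    t₁ = ≤-trans (m≤n+m r₁ (proj₁ ≺-zero)) κ≤W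
    t₂ : r₂ ≤ W
    t₂ = ≤-trans (m≤n+m r₂ (proj₁ ≺-suc)) t₁
    t₃ : r₃ ≤ W
    t₃ = ≤-trans (m≤n+m r₃ (proj₁ ≺-step)) t₂
    t₄ : r₄ ≤ W
    t₄ = ≤-trans (m≤n+m r₄ (proj₁ ≺-trans)) t₃
    t₅ : r₅ ≤ W
    t₅ = ≤-trans (m≤n+m r₅ (proj₁ ≺-pred)) t₄
    t₆ : r₆ ≤ W
    t₆ = ≤-trans (m≤n+m r₆ (proj₁ pred-≺)) t₅
    t₇ : r₇ ≤ W
    t₇ = ≤-trans (m≤n+m r₇ (proj₁ ≺-pred-bound)) t₆

  private
    e≡ : ∀ t → termSize (embed {0} t) ≡ termSize t
    e≡ t = cong termSize (embed-id t)

  module _ {Γ Δ : Cedent} where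

    zeroD : ∀ t → termSize t ≤ W → (t ≺ zer) ∈ Γ → D 3 Γ Δ
    zeroD t ht m = useLem ≺-zero κ₁ (lit 3) ⟪ t , zer , zer ⟫ bd ([]-⊆ (subst (_∈ Γ) (cong (_≺ zer) (sym (embed-id t))) m)) ∅-⊆
      where
      bd : suc (termSize (embed {0} t) + 1) + 0 + 0 ≤ W ^ 2
      bd = small² (≤-trans (≤-reflexive (solve 1 (λ a → con 1 :+ (a :+ con 1) :+ con 0 :+ con 0 := con 2 :+ a) refl _))
        (+-mono-≤ (s≤s (s≤s (z≤n {18}))) (≤-trans (≤-reflexive (e≡ t)) (≤-trans ht (m≤m+n W (9 * W))))))
        where open +-*-Solver

    sucD : ∀ t → termSize t ≤ W → (t ≺ sc t) ∈ Δ → D 3 Γ Δ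
    sucD t ht m = useLem ≺-suc (≤-trans (m≤m+n _ _) t₁) (lit 4) ⟪ t , zer , zer ⟫ bd ∅-⊆ ([]-⊆ (subst (λ z → (z ≺ sc z) ∈ Δ) (sym (embed-id t)) m))
      where
      bd : suc (termSize (embed {0} t) + suc (termSize (embed {0} t))) + 0 ≤ W ^ 2
      bd = small² (≤-trans (≤-reflexive (solve 1 (λ a → con 1 :+ (a :+ (con 1 :+ a)) :+ con 0 := con 2 :+ con 2 :* a) refl (termSize (embed {0} t))))
        (+-mono-≤ (s≤s (s≤s (z≤n {18}))) (*-mono-≤ {2} {10} (s≤s (s≤s z≤n)) (≤-trans (≤-reflexive (e≡ t)) ht))))
        where open +-*-Solver

  module _ {Γ : Cedent} where

    stepD : ∀ t u → termSize t ≤ W → termSize u ≤ W → (t ≺ u) ∈ Γ → D 3 Γ [ t ≺ sc u ]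
    stepD t u ht hu m = useLem ≺-step (≤-trans (m≤m+n _ _) t₂) (lit 7) ⟪ t , u , zer ⟫ bd
      ([]-⊆ (subst₂ (λ z y → (z ≺ y) ∈ Γ) (sym (embed-id t)) (sym (embed-id u)) m)) ([]-⊆ (here (cong₂ (λ z y → z ≺ sc y) (embed-id t) (embed-id u))))
      where
      bd : suc (termSize (embed {0} t) + termSize (embed {0} u)) + 0 + (suc (termSize (embed {0} t) + suc (termSize (embed {0} u))) + 0) ≤ W ^ 2
      bd = small² (≤-trans (≤-reflexive (trans (cong₂ (λ a b → suc (a + b) + 0 + (suc (a + suc b) + 0)) (e≡ t) (e≡ u)) (solve 2 (λ a b → con 1 :+ (a :+ b) :+ con 0 :+ (con 1 :+ (a :+ (con 1 :+ b)) :+ con 0) := con 3 :+ (con 2 :* a :+ con 2 :* b)) refl (termSize t) (termSize u))))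
        (+-mono-≤ (s≤s (s≤s (s≤s (z≤n {17})))) (≤-trans (+-mono-≤ (*-monoʳ-≤ 2 ht) (*-monoʳ-≤ 2 hu)) (≤-trans (≤-reflexive (sym (*-distribʳ-+ W 2 2))) (*-monoˡ-≤ W {4} {10} (s≤s (s≤s (s≤s (s≤s z≤n)))))))))
        where open +-*-Solver

    transD : ∀ t u v → termSize t ≤ W → termSize u ≤ W → termSize v ≤ W → (t ≺ u) ∈ Γ → (u ≺ sc v) ∈ Γ → D 3 Γ [ t ≺ v ]
    transD t u v ht hu hv m k = useLem ≺-trans (≤-trans (m≤m+n _ _) t₃) (lit 10) ⟪ t , u , v ⟫ bd
      (∷-⊆ (subst₂ (λ z y → (z ≺ y) ∈ Γ) (sym (embed-id t)) (sym (embed-id u)) m) ([]-⊆ (subst₂ (λ z y → (z ≺ sc y) ∈ Γ) (sym (embed-id u)) (sym (embed-id v)) k)))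
      ([]-⊆ (here (cong₂ _≺_ (embed-id t) (embed-id v))))
      where
      T' = termSize (embed {0} t)
      U' = termSize (embed {0} u)
      V' = termSize (embed {0} v)
      bd : suc (T' + U') + (suc (U' + suc V') + 0) + (suc (T' + V') + 0) ≤ W ^ 2
      bd = small² (≤-trans (≤-reflexive (trans (solve 3 (λ a b c → con 1 :+ (a :+ b) :+ (con 1 :+ (b :+ (con 1 :+ c)) :+ con 0) :+ (con 1 :+ (a :+ c) :+ con 0) := con 4 :+ con 2 :* (a :+ b :+ c)) refl T' U' V') (cong (λ z → 4 + 2 * z) (cong₂ _+_ (cong₂ _+_ (e≡ t) (e≡ u)) (e≡ v)))))
        (+-mono-≤ (s≤s (s≤s (s≤s (s≤s (z≤n {16}))))) (≤-trans (*-monoʳ-≤ 2 (+-mono-≤ (+-mono-≤ ht hu) hv)) (≤-trans (≤-reflexive (solve 1 (λ w → con 2 :* (w :+ w :+ w) := con 6 :* w) refl W)) (*-monoˡ-≤ W {6} {10} (s≤s (s≤s (s≤s (s≤s (s≤s (s≤s z≤n)))))))))))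
        where open +-*-Solver

    eqD : ∀ t u v → termSize t ≤ W → termSize u ≤ W → termSize v ≤ suc W → (t ≐ u) ∈ Γ → (u ≺ v) ∈ Γ → D 3 Γ [ t ≺ v ]
    eqD t u v ht hu hv m k = useLem ≐-≺ t₇ (lit 9) ⟪ t , u , v ⟫ bd
      (∷-⊆ (subst₂ (λ z y → (z ≐ y) ∈ Γ) (sym (embed-id t)) (sym (embed-id u)) m) ([]-⊆ (subst₂ (λ z y → (z ≺ y) ∈ Γ) (sym (embed-id u)) (sym (embed-id v)) k)))
      ([]-⊆ (here (cong₂ _≺_ (embed-id t) (embed-id v))))
      where
      T' = termSize (embed {0} t)
      U' = termSize (embed {0} u)
      V' = termSize (embed {0} v)
      bd : suc (T' + U') + (suc (U' + V') + 0) + (suc (T' + V') + 0) ≤ W ^ 2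
      bd = small² (≤-trans (≤-reflexive (trans (solve 3 (λ a b c → con 1 :+ (a :+ b) :+ (con 1 :+ (b :+ c) :+ con 0) :+ (con 1 :+ (a :+ c) :+ con 0) := con 3 :+ con 2 :* (a :+ b :+ c)) refl T' U' V') (cong (λ z → 3 + 2 * z) (cong₂ _+_ (cong₂ _+_ (e≡ t) (e≡ u)) (e≡ v)))))
        (≤-trans (+-monoʳ-≤ 3 (*-monoʳ-≤ 2 (+-mono-≤ (+-mono-≤ ht hu) hv))) (≤-trans (≤-reflexive (solve 1 (λ w → con 3 :+ con 2 :* (w :+ w :+ (con 1 :+ w)) := con 5 :+ con 6 :* w) refl W)) (+-mono-≤ (m≤m+n 5 15) (*-monoˡ-≤ W {6} {10} (s≤s (s≤s (s≤s (s≤s (s≤s (s≤s z≤n)))))))))))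
        where open +-*-Solver

    predBoundD : ∀ t u v → termSize t ≤ W → termSize u ≤ W → termSize v ≤ W → (t ≺ u) ∈ Γ → (u ≐ sc v) ∈ Γ → D 3 Γ [ t ≺ sc v ]
    predBoundD t u v ht hu hv m k = useLem ≺-pred-bound (≤-trans (m≤m+n _ _) t₆) (lit 11) ⟪ t , u , v ⟫ bd
      (∷-⊆ (subst₂ (λ z y → (z ≺ y) ∈ Γ) (sym (embed-id t)) (sym (embed-id u)) m) ([]-⊆ (subst₂ (λ z y → (z ≐ sc y) ∈ Γ) (sym (embed-id u)) (sym (embed-id v)) k)))
      ([]-⊆ (here (cong₂ (λ z y → z ≺ sc y) (embed-id t) (embed-id v))))
      where
      T' = termSize (embed {0} t)
      U' = termSize (embed {0} u)
      V' = termSize (embed {0} v)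
      bd : suc (T' + U') + (suc (U' + suc V') + 0) + (suc (T' + suc V') + 0) ≤ W ^ 2
      bd = small² (≤-trans (≤-reflexive (trans (solve 3 (λ a b c → con 1 :+ (a :+ b) :+ (con 1 :+ (b :+ (con 1 :+ c)) :+ con 0) :+ (con 1 :+ (a :+ (con 1 :+ c)) :+ con 0) := con 5 :+ con 2 :* (a :+ b :+ c)) refl T' U' V') (cong (λ z → 5 + 2 * z) (cong₂ _+_ (cong₂ _+_ (e≡ t) (e≡ u)) (e≡ v)))))
        (+-mono-≤ (m≤m+n 5 15) (≤-trans (*-monoʳ-≤ 2 (+-mono-≤ (+-mono-≤ ht hu) hv)) (≤-trans (≤-reflexive (solve 1 (λ w → con 2 :* (w :+ w :+ w) := con 6 :* w) refl W)) (*-monoˡ-≤ W {6} {10} (s≤s (s≤s (s≤s (s≤s (s≤s (s≤s z≤n)))))))))))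
        where open +-*-Solver

    predLessD : ∀ x y → (fv y ≐ sc (fv x)) ∈ Γ → D 3 Γ [ fv x ≺ fv y ]
    predLessD x y m = useLem pred-≺ (≤-trans (m≤m+n _ _) t₅) (lit 7) ⟪ fv x , fv y , zer ⟫ (base {_} {1} (lit 7)) ([]-⊆ m) id

    predD : ∀ t y → termSize t ≤ W → (t ≺ fv y) ∈ Γ → D 3 Γ [ ∃' (fv y ≐ sc (bv zero)) ]
    predD t y ht m = useLem ≺-pred (≤-trans (m≤m+n _ _) t₄) (lit 8) ⟪ t , fv y , zer ⟫ bd ([]-⊆ (subst (λ z → (z ≺ fv y) ∈ Γ) (sym (embed-id t)) m)) id
      where
      bd : suc (termSize (embed {0} t) + 1) + 0 + 5 ≤ W ^ 2
      bd = small² (≤-trans (≤-reflexive (solve 1 (λ a → con 1 :+ (a :+ con 1) :+ con 0 :+ con 5 := con 7 :+ a) refl _))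
        (+-mono-≤ (m≤m+n 7 13) (≤-trans (≤-reflexive (e≡ t)) (≤-trans ht (m≤m+n W (9 * W))))))
        where open +-*-Solver

  -- Unary numerals are compared one successor at a time. Ranks are at most the number of states,
  -- and a factor of that order is affordable.
  numLt : ∀ {Γ} a k → a < k → suc k ≤ W → Der (k * W ^ 4) Γ [ num a ≺ num k ]
  numLt {Γ} a (suc k) (s≤s h) hk with m≤n⇒m<n∨m≡n h
  ... | inj₂ refl = Der-mono (≤-trans (pow-mono {3} {4} (n≤1+n 3)) (m≤m+n _ _)) (get (sucD (num k) (≤-trans (≤-reflexive (num-size k)) (≤-trans (n≤1+n _) hk)) (here refl)))
  ... | inj₁ lt = Der-mono
    (≤-trans (≤-reflexive (solve 3 (λ x y z → con 1 :+ (con 1 :+ x :+ y :+ z) := (con 2 :+ (y :+ z)) :+ x) refl (k * W ^ 4) (W ^ 3) (formSize (num a ≺ num k))))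
      (+-monoˡ-≤ (k * W ^ 4) (add₈ {3} (≤-trans (+-mono-≤ (*-monoʳ-≤ 2 (1≤pow 3)) (+-monoʳ-≤ (W ^ 3) (up {2} {3} (n≤1+n 2) sz≤)))
        (≤-trans (≤-reflexive (solve 1 (λ w → con 2 :* w :+ (w :+ w) := con 4 :* w) refl (W ^ 3))) (*-monoˡ-≤ (W ^ 3) {4} {8} (s≤s (s≤s (s≤s (s≤s z≤n))))))))))
    (have (num a ≺ num k) (numLt a k lt (≤-trans (n≤1+n _) hk)) (get (stepD  (num a) (num k) ha hk' (here refl))))
    where
    open +-*-Solver
    hk' : termSize (num k) ≤ W
    hk' = ≤-trans (≤-reflexive (num-size k)) (≤-trans (n≤1+n _) hk)
    ha : termSize (num a) ≤ W
    ha = ≤-trans (≤-reflexive (num-size a)) (≤-trans (≤-trans lt (n≤1+n k)) (≤-trans (n≤1+n _) hk))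
    sz≤ : formSize (num a ≺ num k) ≤ W ^ 2
    sz≤ = ≺-size (num a) (num k) ha (≤-trans hk' (n≤1+n W))

  numLtD : ∀ {Γ} a k → a < k → suc k ≤ W → D 5 Γ [ num a ≺ num k ]
  numLtD a k h hk = toD 5 (mul {1} {4} (base {k} {0} (≤-trans (n≤1+n k) hk)) ≤-refl) (numLt a k h hk)

-- The induction formulas


-- Shifted by one: 0 means that there is no eigenvariable, and a bound on the value is a strict
-- bound on the name.
eigen : Rule → ℕ
eigen (∀R Γ Δ φ x) = suc x
eigen (∃L Γ Δ φ x) = suc x
eigen _ = 0

freshS : Sequent → ℕ
freshS (Γ ⇒ Δ) = freshC Γ ⊔ freshC Δ

freshS-bound : ∀ {x φ} S → φ ∈S S → FreeF x φ → x < freshS S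
freshS-bound (Γ ⇒ Δ) (inj₁ m) f = ≤-trans (freshC-bound Γ m f) (m≤m⊔n _ _)
freshS-bound (Γ ⇒ Δ) (inj₂ m) f = ≤-trans (freshC-bound Δ m f) (m≤n⊔m (freshC Γ) _)

alt : (ℕ → Term 0) → (ℕ → Term 0) → ℕ → Term 0
alt f g zero = f 0
alt f g (suc zero) = g 0
alt f g (suc (suc i)) = alt (f ∘ suc) (g ∘ suc) i

alt-even : ∀ f g j → alt f g (j * 2) ≡ f j
alt-even f g zero = refl
alt-even f g (suc j) = alt-even (f ∘ suc) (g ∘ suc) j

alt-odd : ∀ f g j → alt f g (suc (j * 2)) ≡ g j
alt-odd f g zero = refl
alt-odd f g (suc j) = alt-odd (f ∘ suc) (g ∘ suc) j

when : ∀ {A P : Set} → Dec P → List A → List A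
when (yes _) xs = xs
when (no _) xs = []

when⁺ : ∀ {A P : Set} (d : Dec P) {xs : List A} {x} → P → x ∈ xs → x ∈ when d xs
when⁺ (yes _) p m = m
when⁺ (no q) p m = contradiction p q

when⁻ : ∀ {A P : Set} (d : Dec P) {xs : List A} {x} → x ∈ when d xs → P × x ∈ xs
when⁻ (yes p) m = p , m

rowGuards-free : ∀ {x φ} t bs Rs → φ ∈ rowGuards t bs Rs → FreeF x φ → FreeT x t ⊎ Σ ℕ (λ i → i < length bs × FreeT x (Rs i))
rowGuards-free t (true ∷ bs) Rs (here refl) (inj₁ f) = inj₁ f
rowGuards-free t (true ∷ bs) Rs (here refl) (inj₂ f) with anyB bs
... | true = inj₂ (0 , s≤s z≤n , f)
rowGuards-free t (true ∷ bs) Rs (here refl) (inj₂ (sc₁ f)) | false = inj₂ (0 , s≤s z≤n , f)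
rowGuards-free t (true ∷ bs) Rs (there m) f = [ inj₁ , (λ { (i , h , q) → inj₂ (suc i , s≤s h , q) }) ]′ (rowGuards-free t bs (Rs ∘ suc) m f)
rowGuards-free t (false ∷ bs) Rs m f = [ inj₁ , (λ { (i , h , q) → inj₂ (suc i , s≤s h , q) }) ]′ (rowGuards-free t bs (Rs ∘ suc) m f)

rowGuards-cong : ∀ t bs {Rs Rs'} → (∀ i → i < length bs → Rs i ≡ Rs' i) → rowGuards t bs Rs ≡ rowGuards t bs Rs'
rowGuards-cong t [] h = refl
rowGuards-cong t (true ∷ bs) h = cong₂ _∷_ (cong (λ R → t ≺ (if anyB bs then R else sc R)) (h 0 (s≤s z≤n))) (rowGuards-cong t bs (λ i k → h (suc i) (s≤s k)))
rowGuards-cong t (false ∷ bs) h = rowGuards-cong t bs (λ i k → h (suc i) (s≤s k))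

rowGuards-sub : ∀ θ t bs Rs → map (fsubF θ) (rowGuards t bs Rs) ≡ rowGuards (fsubT θ t) bs (fsubT θ ∘ Rs)
rowGuards-sub θ t [] Rs = refl
rowGuards-sub θ t (true ∷ bs) Rs = cong₂ _∷_ (head (anyB bs)) (rowGuards-sub θ t bs (Rs ∘ suc))
  where
  head : ∀ b → fsubF θ (t ≺ (if b then Rs 0 else sc (Rs 0))) ≡ (fsubT θ t ≺ (if b then fsubT θ (Rs 0) else sc (fsubT θ (Rs 0))))
  head true = refl
  head false = refl
rowGuards-sub θ t (false ∷ bs) Rs = rowGuards-sub θ t bs (Rs ∘ suc)

rowGuards-length : ∀ t bs Rs → length (rowGuards t bs Rs) ≤ length bs
rowGuards-length t [] Rs = z≤n
rowGuards-length t (true ∷ bs) Rs = s≤s (rowGuards-length t bs (Rs ∘ suc))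
rowGuards-length t (false ∷ bs) Rs = m≤n⇒m≤1+n (rowGuards-length t bs (Rs ∘ suc))

rowGuards-size : ∀ {φ k} t bs Rs → (∀ i → termSize (Rs i) ≤ k) → φ ∈ rowGuards t bs Rs → formSize φ ≤ suc (termSize t + suc k)
rowGuards-size {k = k} t (true ∷ bs) Rs h (here refl) with anyB bs
... | true = s≤s (+-monoʳ-≤ (termSize t) (m≤n⇒m≤1+n (h 0)))
... | false = s≤s (+-monoʳ-≤ (termSize t) (s≤s (h 0)))
rowGuards-size t (true ∷ bs) Rs h (there m) = rowGuards-size t bs (Rs ∘ suc) (h ∘ suc) m
rowGuards-size t (false ∷ bs) Rs h m = rowGuards-size t bs (Rs ∘ suc) (h ∘ suc) m

rowGuards-map : ∀ {P Q : Formula 0 → Set} t t' bs Rs → (∀ i → P (t ≺ Rs i) → Q (t' ≺ Rs i)) → (∀ i → P (t ≺ sc (Rs i)) → Q (t' ≺ sc (Rs i))) →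
  All P (rowGuards t bs Rs) → All Q (rowGuards t' bs Rs)
rowGuards-map t t' [] Rs h k [] = []
rowGuards-map t t' (true ∷ bs) Rs h k ps with anyB bs | ps
... | true | p ∷ ps' = h 0 p ∷ rowGuards-map t t' bs (Rs ∘ suc) (h ∘ suc) (k ∘ suc) ps'
... | false | p ∷ ps' = k 0 p ∷ rowGuards-map t t' bs (Rs ∘ suc) (h ∘ suc) (k ∘ suc) ps'
rowGuards-map t t' (false ∷ bs) Rs h k ps = rowGuards-map t t' bs (Rs ∘ suc) (h ∘ suc) (k ∘ suc) ps

none-any : ∀ m {f : Fin m → Bool} → (∀ i → f i ≡ false) → anyB (tabulate f) ≡ false
none-any zero h = refl
none-any (suc m) h rewrite h zero = none-any m (h ∘ suc)

oneHot-guards : ∀ {Q : Formula 0 → Set} {m} t (c : Fin m) Rs → Q (t ≺ sc (Rs (toℕ c))) → All Q (rowGuards t (oneHot c) Rs)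
oneHot-guards {Q} {suc m} t zero Rs q rewrite none-any m {λ i → does (suc i Data.Fin.≟ zero {m})} (λ i → refl) = q ∷ subst (All Q) (sym (rowGuards-none t (tabulate {n = m} (λ i → false)) (Rs ∘ suc) (none-any m {λ i → false} (λ i → refl)))) []
oneHot-guards {Q} {suc m} t (suc c) Rs q = subst (λ bs → All Q (rowGuards t bs (Rs ∘ suc))) shift (oneHot-guards t c (Rs ∘ suc) q)
  where
  shift : oneHot c ≡ tabulate (λ i → does (suc i Data.Fin.≟ suc c))
  shift = tabulate-cong (λ i → refl)

-- The bit of the new register makes all older guards of the term strict, and the strict decrease
-- from t to t' pays for that. Only the new register gets a weak guard.
rowGuards-progress : ∀ {P Q : Formula 0 → Set} {m} t t' bs (c : Fin m) Rs → (∀ i → P (t ≺ Rs i) → Q (t' ≺ Rs i)) → (∀ i → P (t ≺ sc (Rs i)) → Q (t' ≺ Rs i)) →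
  Q (t' ≺ sc (Rs (length bs + toℕ c))) → All P (rowGuards t bs Rs) → All Q (rowGuards t' (bs ++ oneHot c) Rs)
rowGuards-progress t t' [] c Rs h k q ps = oneHot-guards t' c Rs q
rowGuards-progress {P} {Q} t t' (true ∷ bs) c Rs h k q ps with anyB bs | ps
... | true | p ∷ ps' = strict (anyB-++ʳ bs (oneHot-any c)) (h 0 p) ∷ rowGuards-progress t t' bs c (Rs ∘ suc) (h ∘ suc) (k ∘ suc) q ps'
  where
  strict : ∀ {b} → b ≡ true → Q (t' ≺ Rs 0) → Q (t' ≺ (if b then Rs 0 else sc (Rs 0)))
  strict refl z = z
... | false | p ∷ ps' = strict (anyB-++ʳ bs (oneHot-any c)) (k 0 p) ∷ rowGuards-progress t t' bs c (Rs ∘ suc) (h ∘ suc) (k ∘ suc) q ps'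
  where
  strict : ∀ {b} → b ≡ true → Q (t' ≺ Rs 0) → Q (t' ≺ (if b then Rs 0 else sc (Rs 0)))
  strict refl z = z
rowGuards-progress t t' (false ∷ bs) c Rs h k q ps = rowGuards-progress t t' bs c (Rs ∘ suc) (h ∘ suc) (k ∘ suc) q ps

module FlashGuard (n : ℕ) where
  open Columns n

  -- A register about to be decremented strictly bounds some term and is therefore not zero. This is
  -- why a reset requires the register to track at least one term.
  flash-guard : ∀ {cs p cs'} → Run cs p cs' → ∀ j → p ≡ suc (j * 2) →
    Σ (Fin n) λ t → ∀ {P : Formula 0 → Set} u Rs → All P (rowGuards u (row cs t) Rs) → P (u ≺ Rs j)
  flash-guard (flash {c} {cs} (t , h) f r) zero e = t , λ {P} u Rs ps → get {P} u Rs ps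
    where
    get : ∀ {P : Formula 0 → Set} u Rs → All P (rowGuards u (c t ∷ row cs t) Rs) → P (u ≺ Rs 0)
    get u Rs ps rewrite h | f t h with ps
    ... | p ∷ _ = p
  flash-guard (keep {c} {cs} q r) (suc j) e with flash-guard r j (suc-injective (suc-injective e))
  ... | t , k = t , λ {P} u Rs ps → k {P} u (Rs ∘ suc) (rest {P} u Rs ps)
    where
    rest : ∀ {P : Formula 0 → Set} u Rs → All P (rowGuards u (c t ∷ row cs t) Rs) → All P (rowGuards u (row cs t) (Rs ∘ suc))
    rest u Rs ps with c t | ps
    ... | true | _ ∷ ps' = ps'
    ... | false | ps' = ps'

module Main (π : Preproof) where
  open Automaton π public

  -- Priorities go up to 2n, the value on an edge without event when all n registers are in use, so
  -- j runs through 0, ..., n.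
  L : ℕ
  L = suc n * 2

  X : List ℕ
  X = gather (nodes π) (λ v → collect namesF (seq π v))

  -- Eigenvariables are included because a vacuous one need not occur in any sequent.
  bnd : ℕ
  bnd = maxFin (nodes π) (λ v → freshS (seq π v) ⊔ eigen (rl π v))

  seq-name< : ∀ v {φ x} → φ ∈S seq π v → FreeF x φ → x < bnd
  seq-name< v m f = ≤-trans (freshS-bound (seq π v) m f) (≤-trans (m≤m⊔n _ _) (maxFin-≥ (nodes π) _ v))

  eigen≤ : ∀ v → eigen (rl π v) ≤ bnd
  eigen≤ v = ≤-trans (m≤n⊔m (freshS (seq π v)) _) (maxFin-≥ (nodes π) _ v)

  seq-name∈ : ∀ v {φ x} → φ ∈S seq π v → FreeF x φ → x ∈ X
  seq-name∈ v {φ} m f = gather⁺ (nodes π) _ v (collect⁺ namesF (seq π v) m (namesF-free φ f))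

  X<bnd : ∀ {x} → x ∈ X → x < bnd
  X<bnd m = let v , k = gather⁻ (nodes π) (λ v → collect namesF (seq π v)) m
                φ , l , q = collect⁻ namesF (seq π v) k
            in seq-name< v l (free-namesF φ q)

  occ-formula : ∀ {v t x} → Occ v t → FreeT x t → Σ (Formula 0) λ φ → φ ∈S seq π v × FreeF x φ
  occ-formula {v} o f = let φ , m , k = collect⁻ subsF (seq π v) o in φ , m , subsF-free φ k f

  -- Register names: v_2j bounds rank j and v_(2j+1) is register j of the automaton;
  -- y_i is the variable of the induction on v_i.
  vN yN : ℕ → ℕ
  vN i = bnd + i
  yN i = bnd + (L + i)

  -- The eigenvariable for the predecessor of the register that an odd priority decrements.
  pN : ℕ
  pN = bnd + (L + L)

  ureg reg : ℕ → Term 0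
  ureg j = fv (vN (j * 2))
  reg j = fv (vN (suc (j * 2)))

  uGuard : State → ℕ → Formula 0
  uGuard s j = num (rank j s) ≺ sc (ureg j)

  -- Limited to terms of the current sequent, so that the names in guards are registers or names of
  -- that sequent; an eigenvariable of its rule is then fresh for them.
  rGuards-at : State → Fin n → Cedent
  rGuards-at s t = when (occ? (node s) (term t)) (rowGuards (term t) (rowOf s t) reg)

  uGuards rGuards guards : State → Cedent
  uGuards s = map (uGuard s) (upTo (suc n))
  rGuards s = concatMap (rGuards-at s) (allFin n)
  guards s = uGuards s ++ rGuards s

  hyps : State → Cedent
  hyps s = guards s ++ ante (seq π (node s))

  Dform : State → Formula 0
  Dform s = imp (hyps s) (succ (seq π (node s)))

  -- Only reachable states: branches start at the root, so the trace condition says nothing about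
  -- cycles elsewhere, and `rank-strict` would fail there.
  states : List State
  states = concatMap (λ s → onlyIf (reachable? s) s) (allFin M)

  states⁺ : ∀ {s} → Reachable s → s ∈ states
  states⁺ {s} r = ∈-cM⁺ (λ s → onlyIf (reachable? s) s) (∈-allFin s) (onlyIf⁺ (reachable? s) r)

  states⁻ : ∀ {s} → s ∈ states → Reachable s
  states⁻ m = let s , _ , k = ∈-cM⁻ (λ s → onlyIf (reachable? s) s) (allFin M) m
                  r , e = onlyIf⁻ (reachable? s) k
              in subst Reachable (sym e) r

  -- Opaque, so that conversion never unfolds the conjunction over all states.
  abstract
    E : Formula 0
    E = ⋀ (map Dform states)

    E≡ : E ≡ ⋀ (map Dform states)
    E≡ = refl

  IsReg : ℕ → Set
  IsReg x = Σ ℕ λ i → i < L × x ≡ vN i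

  SeqName : State → ℕ → Set
  SeqName s x = Σ (Formula 0) λ ψ → ψ ∈S seq π (node s) × FreeF x ψ

  uGuards-free : ∀ s {φ x} → φ ∈ uGuards s → FreeF x φ → IsReg x
  uGuards-free s k f = go (∈-map⁻ (uGuard s) k) f
    where
    go : ∀ {φ x} → Σ ℕ (λ j → j ∈ upTo (suc n) × φ ≡ uGuard s j) → FreeF x φ → IsReg x
    go (j , l , refl) (inj₁ q) = contradiction q (num-closed (rank j s))
    go (j , l , refl) (inj₂ (sc₁ here)) = j * 2 , *-monoˡ-< 2 (∈-upTo⁻ l) , refl

  rGuards⁻ : ∀ s {φ} → φ ∈ rGuards s → Σ (Fin n) λ t → Occ (node s) (term t) × φ ∈ rowGuards (term t) (rowOf s t) reg
  rGuards⁻ s k = let t , _ , l = ∈-cM⁻ (rGuards-at s) (allFin n) k in t , when⁻ (occ? (node s) (term t)) l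

  reg< : ∀ {i} → i < n → suc (i * 2) < L
  reg< {i} h = s≤s (s≤s (*-monoˡ-≤ 2 (<⇒≤ h)))

  rGuards-free : ∀ s {φ x} → φ ∈ rGuards s → FreeF x φ → SeqName s x ⊎ IsReg x
  rGuards-free s {φ} {x} k f = let t , o , l = rGuards⁻ s {φ} k in go t o (rowGuards-free {x} {φ} (term t) (rowOf s t) reg l f)
    where
    go : ∀ {x} t → Occ (node s) (term t) → FreeT x (term t) ⊎ Σ ℕ (λ i → i < length (rowOf s t) × FreeT x (reg i)) → SeqName s x ⊎ IsReg x
    go t o (inj₁ g) = inj₁ (occ-formula o g)
    go t o (inj₂ (i , h , here)) = inj₂ (suc (i * 2) , reg< (subst (i <_) (rowOf-length s t) h) , refl)

  guards-free : ∀ s {φ x} → φ ∈ guards s → FreeF x φ → SeqName s x ⊎ IsReg x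
  guards-free s {φ} {x} m f = [ (λ k → inj₂ (uGuards-free s {φ} {x} k f)) , (λ k → rGuards-free s {φ} {x} k f) ]′ (∈-++⁻ (uGuards s) {rGuards s} m)

  seqName∈ : ∀ {s x} → SeqName s x → x ∈ X
  seqName∈ {s} {x} (ψ , l , g) = seq-name∈ (node s) {ψ} {x} l g

  hyps-name : ∀ s {φ x} → φ ∈ hyps s → FreeF x φ → x ∈ X ⊎ IsReg x
  hyps-name s {φ} {x} m f = [ (λ k → [ inj₁ ∘ seqName∈ {s} {x} , inj₂ ]′ (guards-free s {φ} {x} k f)) , (λ k → inj₁ (seq-name∈ (node s) {φ} {x} (inj₁ k) f)) ]′ (∈-++⁻ (guards s) {ante (seq π (node s))} m)

  Dform-name : ∀ s {x} → FreeF x (Dform s) → x ∈ X ⊎ IsReg x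
  Dform-name s {x} f = let χ , k , h = ⋁-free (map dual (hyps s) ++ succ (seq π (node s))) f
                       in [ (λ l → go (∈-map⁻ dual l) h) , (λ l → inj₁ (seq-name∈ (node s) {χ} {x} (inj₂ l) h)) ]′ (∈-++⁻ (map dual (hyps s)) {succ (seq π (node s))} k)
    where
    go : ∀ {χ} → Σ (Formula 0) (λ γ → γ ∈ hyps s × χ ≡ dual γ) → FreeF x χ → x ∈ X ⊎ IsReg x
    go (γ , q , refl) h = hyps-name s {γ} {x} q (dual-free γ h)

  E-name : ∀ {x} → FreeF x E → x ∈ X ⊎ IsReg x
  E-name {x} f = let ψ , m , g = ⋀-free (map Dform states) (subst (FreeF x) E≡ f) in go (∈-map⁻ Dform m) g
    where
    go : ∀ {ψ} → Σ State (λ s → s ∈ states × ψ ≡ Dform s) → FreeF x ψ → x ∈ X ⊎ IsReg x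
    go (s , _ , refl) g = Dform-name s {x} g

  vsFrom : ℕ → ℕ → List ℕ
  vsFrom p zero = []
  vsFrom p (suc q) = vN p ∷ vsFrom (suc p) q

  vsFrom⁺ : ∀ p q i → p ≤ i → i < p + q → vN i ∈ vsFrom p q
  vsFrom⁺ p zero i h k = contradiction (≤-trans k (≤-trans (≤-reflexive (+-identityʳ p)) h)) (<-irrefl refl)
  vsFrom⁺ p (suc q) i h k with m≤n⇒m<n∨m≡n h
  ... | inj₁ l = there (vsFrom⁺ (suc p) q i l (≤-trans k (≤-reflexive (+-suc p q))))
  ... | inj₂ refl = here refl

  vsFrom-length : ∀ p q → length (vsFrom p q) ≡ q
  vsFrom-length p zero = refl
  vsFrom-length p (suc q) = cong suc (vsFrom-length (suc p) q)

  -- The names of the sequents are closed off together with the registers from p on. The induction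
  -- hypotheses then contain none of them, so substitutions and eigenvariables of the cyclic proof
  -- do not interfere.
  xs : ℕ → List ℕ
  xs p = vsFrom p (L ∸ p) ++ X

  body : ℕ → Term 0 → Formula 0
  body p t = (fv (vN p) ⊀ t) ∨' E

  -- The registers below p stay free: they are the fixed initial segment in the
  -- lexicographic induction.
  Kat : ℕ → Term 0 → Formula 0
  Kat p t = closeAll (xs p) (body p t)

  Kf : ℕ → Formula 0
  Kf p = Kat p (fv (yN p))

  -- Lexicographic induction as a stack of hypotheses. While v_i is at most y_i for i < q, each
  -- `Kf p` in the stack yields `E` for a tuple that is unchanged below p, is less than y_p at p,
  -- and is arbitrary afterwards.
  ctx : ℕ → Cedent
  ctx zero = []
  ctx (suc p) = Kf p ∷ (fv (vN p) ≺ sc (fv (yN p))) ∷ ctx p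

  ctx-K : ∀ p q → p < q → Kf p ∈ ctx q
  ctx-K p (suc q) (s≤s h) with m≤n⇒m<n∨m≡n h
  ... | inj₁ k = there (there (ctx-K p q k))
  ... | inj₂ refl = here refl

  ctx-y : ∀ p q → p < q → (fv (vN p) ≺ sc (fv (yN p))) ∈ ctx q
  ctx-y p (suc q) (s≤s h) with m≤n⇒m<n∨m≡n h
  ... | inj₁ k = there (there (ctx-y p q k))
  ... | inj₂ refl = there (here refl)

  vN-inj : ∀ {i j} → vN i ≡ vN j → i ≡ j
  vN-inj = +-cancelˡ-≡ bnd _ _

  yN-inj : ∀ {i j} → yN i ≡ yN j → i ≡ j
  yN-inj e = +-cancelˡ-≡ L _ _ (+-cancelˡ-≡ bnd _ _ e)

  y≢v : ∀ {i j} → j < L → yN i ≢ vN j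
  y≢v {i} {j} h e = <-irrefl (sym (+-cancelˡ-≡ bnd _ _ e)) (≤-trans h (m≤m+n L i))

  v≮bnd : ∀ {i} → ¬ vN i < bnd
  v≮bnd {i} h = <-irrefl refl (≤-trans h (m≤m+n bnd i))

  vs∋ : ∀ p i → p ≤ i → p < L → i < L → vN i ∈ xs p
  vs∋ p i h pL iL = ∈-++⁺ˡ (vsFrom⁺ p (L ∸ p) i h (≤-trans iL (≤-reflexive (sym (m+[n∸m]≡n (<⇒≤ pL))))))

  RegBelow YBelow : ℕ → ℕ → Set
  RegBelow p x = Σ ℕ λ i → i < p × x ≡ vN i
  YBelow p x = Σ ℕ λ i → i < p × x ≡ yN i

  K-name : ∀ p {x} → p < L → FreeF x (Kf p) → RegBelow p x ⊎ x ≡ yN p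
  K-name p {x} pL f = let g , nin = closeAll-free (xs p) (body p (fv (yN p))) f in go g nin
    where
    inE : x ∉ xs p → x ∈ X ⊎ IsReg x → RegBelow p x ⊎ x ≡ yN p
    inE nin (inj₁ m) = contradiction (∈-++⁺ʳ (vsFrom p (L ∸ p)) m) nin
    inE nin (inj₂ (i , h , refl)) = case i <? p of λ
      { (yes k) → inj₁ (i , k , refl)
      ; (no k) → contradiction (vs∋ p i (≮⇒≥ k) pL h) nin }
    go : FreeF x (body p (fv (yN p))) → x ∉ xs p → RegBelow p x ⊎ x ≡ yN p
    go (inj₁ (inj₁ here)) nin = contradiction (vs∋ p p ≤-refl pL pL) nin
    go (inj₁ (inj₂ here)) nin = inj₂ refl
    go (inj₂ g) nin = inE nin (E-name g)

  below-suc : ∀ {p x} {f : ℕ → ℕ} → Σ ℕ (λ i → i < p × x ≡ f i) → Σ ℕ (λ i → i < suc p × x ≡ f i)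
  below-suc (i , k , e) = i , m≤n⇒m≤1+n k , e

  ctx-name : ∀ p {x φ} → p ≤ L → φ ∈ ctx p → FreeF x φ → RegBelow p x ⊎ YBelow p x
  ctx-name (suc p) h (here refl) f = [ inj₁ ∘ below-suc , (λ e → inj₂ (p , ≤-refl , e)) ]′ (K-name p h f)
  ctx-name (suc p) h (there (here refl)) (inj₁ here) = inj₁ (p , ≤-refl , refl)
  ctx-name (suc p) h (there (here refl)) (inj₂ (sc₁ here)) = inj₂ (p , ≤-refl , refl)
  ctx-name (suc p) h (there (there m)) f = [ inj₁ ∘ below-suc , inj₂ ∘ below-suc ]′ (ctx-name p (≤-trans (n≤1+n p) h) m f)

  y≮bnd : ∀ {i} → ¬ yN i < bnd
  y≮bnd {i} q = <-irrefl refl (≤-trans q (m≤m+n bnd (L + i)))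

  vsFrom< : ∀ p q {x} → x ∈ vsFrom p q → p + q ≤ L → Σ ℕ λ i → p ≤ i × i < L × x ≡ vN i
  vsFrom< p (suc q) (here e) h = p , ≤-refl , ≤-trans (≤-trans (≤-reflexive (sym (+-comm p 1))) (+-monoʳ-≤ p (s≤s z≤n))) h , e
  vsFrom< p (suc q) (there m) h = let i , k , l , e = vsFrom< (suc p) q m (≤-trans (≤-reflexive (sym (+-suc p q))) h) in i , ≤-trans (n≤1+n p) k , l , e

  xs⁻ : ∀ p {x} → p ≤ L → x ∈ xs p → x < bnd ⊎ Σ ℕ (λ i → p ≤ i × i < L × x ≡ vN i)
  xs⁻ p h m = [ (λ k → inj₂ (vsFrom< p (L ∸ p) k (≤-reflexive (m+[n∸m]≡n h)))) , inj₁ ∘ X<bnd ]′ (∈-++⁻ (vsFrom p (L ∸ p)) m)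

  ctx-fresh : ∀ p → p ≤ L → ∀ x → x ∈ xs p → FreshIn x (ctx p)
  ctx-fresh p h x m φ k f = go (ctx-name p h k f) (xs⁻ p h m)
    where
    go : RegBelow p x ⊎ YBelow p x → x < bnd ⊎ Σ ℕ (λ i → p ≤ i × i < L × x ≡ vN i) → ⊥
    go (inj₁ (i , l , refl)) (inj₁ q) = v≮bnd q
    go (inj₁ (i , l , refl)) (inj₂ (i' , q , _ , e)) = <-irrefl (vN-inj e) (≤-trans l q)
    go (inj₂ (i , l , refl)) (inj₁ q) = y≮bnd q
    go (inj₂ (i , l , refl)) (inj₂ (i' , q , q' , e)) = y≢v q' e

  y-fresh : ∀ p → p ≤ L → FreshIn (yN p) (ctx p)
  y-fresh p h φ k f = [ (λ { (i , l , e) → y≢v (≤-trans l h) e }) , (λ { (i , l , e) → <-irrefl (sym (yN-inj e)) l }) ]′ (ctx-name p h k f)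

  y∉E : ∀ p → ¬ FreeF (yN p) E
  y∉E p f = [ (λ m → y≮bnd (X<bnd m)) , (λ { (i , h , e) → y≢v h e }) ]′ (E-name f)

  y∉xs : ∀ p → p ≤ L → yN p ∉ xs p
  y∉xs p h m = [ y≮bnd , (λ { (i , _ , l , e) → y≢v l e }) ]′ (xs⁻ p h m)

  Kat-sub : ∀ p t → p < L → (∀ x → x ∈ xs p → ¬ FreeT x t) → fsubF (yN p ↦ t) (Kf p) ≡ Kat p t
  Kat-sub p t h nf = trans
    (fsubF-closeAll (yN p ↦ t) (xs p) (body p (fv (yN p)))
      (λ x m → ↦-other t (λ e → y∉xs p (<⇒≤ h) (subst (_∈ xs p) e m)))
      (λ x m y _ y≢x f → avoid x m y y≢x f))
    (cong (closeAll (xs p)) (cong₂ _∨'_ (cong₂ _⊀_ (cong embed (↦-other t (λ e → y≢v h (sym e)))) (trans (cong embed (↦-self (yN p) t)) (embed-id t)))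
      (fsubF-id E (λ x f → ↦-other t (λ { refl → y∉E p f })))))
    where
    avoid : ∀ x → x ∈ xs p → ∀ y → y ≢ x → ¬ FreeT x ((yN p ↦ t) y)
    avoid x m y y≢x f = case y ≟ yN p of λ
      { (yes e) → nf x m (subst (FreeT x) (trans (cong (yN p ↦ t) e) (↦-self (yN p) t)) f)
      ; (no ne) → y≢x (fv-free (subst (FreeT x) (↦-other t ne) f)) }
      where
      fv-free : ∀ {x y} → FreeT {0} x (fv y) → y ≡ x
      fv-free here = refl

map-id-on : ∀ (θ : Subst) (Γ : Cedent) → (∀ φ → φ ∈ Γ → fsubF θ φ ≡ φ) → map (fsubF θ) Γ ≡ Γ
map-id-on θ [] h = refl
map-id-on θ (φ ∷ Γ) h = cong₂ _∷_ (h φ (here refl)) (map-id-on θ Γ (λ ψ m → h ψ (there m)))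

map-cong-on : ∀ (θ θ' : Subst) (Γ : Cedent) → (∀ φ → φ ∈ Γ → fsubF θ φ ≡ fsubF θ' φ) → map (fsubF θ) Γ ≡ map (fsubF θ') Γ
map-cong-on θ θ' [] h = refl
map-cong-on θ θ' (φ ∷ Γ) h = cong₂ _∷_ (h φ (here refl)) (map-cong-on θ θ' Γ (λ ψ m → h ψ (there m)))

-- The nested inductions

module Descent (π : Preproof) (W : ℕ) (32≤W : 32 ≤ W) (κ≤W : κ ≤ W) (hK : ∀ p → p < Main.L π → formSize (Main.Kf π p) ≤ W) (hL : Main.L π ≤ W) where
  open Main π public
  open Arithmetic W 32≤W κ≤W public

  K-size : ∀ p → formSize (Kf p) ≡ length (xs p) + (4 + formSize E)
  K-size p = closeAll-size (xs p) (body p (fv (yN p)))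

  E≤ : formSize E ≤ W
  E≤ = ≤-trans (≤-trans (m≤n+m _ 4) (≤-trans (m≤n+m _ (length (xs 0))) (≤-reflexive (sym (K-size 0))))) (hK 0 (s≤s z≤n))

  xs≤ : ∀ p → p < L → length (xs p) ≤ W
  xs≤ p h = ≤-trans (≤-trans (m≤m+n _ _) (≤-reflexive (sym (K-size p)))) (hK p h)

  body≤ : ∀ p (t : Term 0) → p < L → termSize t ≤ 2 → formSize (body p t) ≤ suc W
  body≤ p t h k = ≤-trans (s≤s (+-monoˡ-≤ (formSize E) (s≤s (s≤s k)))) (s≤s (≤-trans (m≤n+m _ (length (xs p))) (≤-trans (≤-reflexive (sym (K-size p))) (hK p h))))

  Kat≤ : ∀ p (t : Term 0) → p < L → termSize t ≤ 2 → formSize (Kat p t) ≤ suc W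
  Kat≤ p t h k = ≤-trans (≤-reflexive (closeAll-size (xs p) (body p t)))
    (≤-trans (+-monoʳ-≤ (length (xs p)) (s≤s (+-monoˡ-≤ (formSize E) (s≤s (s≤s k)))))
      (≤-trans (≤-reflexive (+-suc (length (xs p)) (4 + formSize E))) (s≤s (≤-trans (≤-reflexive (sym (K-size p))) (hK p h)))))

  sucW : ∀ {x} → x ≤ suc W → x ≤ W ^ 2
  sucW h = ≤-trans h (suc₁ {1} (W≤pow 0))

  ctx-size : ∀ p → p ≤ L → sz (ctx p) ≤ p * (W + 4)
  ctx-size zero h = z≤n
  ctx-size (suc p) h = ≤-trans (≤-reflexive (sym (+-assoc (formSize (Kf p)) 4 (sz (ctx p))))) (+-mono-≤ (+-monoˡ-≤ 4 (hK p h)) (ctx-size p (≤-trans (n≤1+n p) h)))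

  ctx≤ : ∀ p → p ≤ L → sz (ctx p) ≤ W ^ 3
  ctx≤ p h = ≤-trans (ctx-size p h) (mul {1} {2} (base {p} {0} (≤-trans h hL)) (add₂ {1} (W≤pow 0) (base {4} {0} (lit 4))))

  lift≤ : ∀ a {b Γ Δ} {h : T (a ≤ᵇ b)} → D a Γ Δ → D b Γ Δ
  lift≤ a {b} {h = h} = lift (≤ᵇ⇒≤ a b h)

  openK : ∀ p {Γ} → p < L → Kf p ∈ Γ → (fv (vN p) ≺ fv (yN p)) ∈ Γ → D 7 Γ [ E ]
  openK p {Γ} h m k = haveD 5 ψ (up {2} {5} (s≤s (s≤s z≤n)) (sucW (body≤ p (fv (yN p)) h (s≤s z≤n))))
    (lift≤ 4 (toD 4 cost (openL (xs p) m)))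
    (∨LD 4 (up {2} {4} (s≤s (s≤s z≤n)) (sucW (body≤ p (fv (yN p)) h (s≤s z≤n)))) (here refl)
      (contraD 1 (fv (vN p) ≺ fv (yN p)) (base {3} {0} (lit 3)) (there (there k)) (here refl))
      (idrD 1 E (base {_} {0} E≤) (here refl) (here refl)))
    where
    ψ = body p (fv (yN p))
    ψ≤ : formSize ψ ≤ W
    ψ≤ = ≤-trans (≤-trans (m≤n+m _ (length (xs p))) (≤-reflexive (sym (K-size p)))) (hK p h)
    cost : 2 + (formSize ψ + formSize ψ) + length (xs p) * suc (formSize (Kf p)) ≤ W ^ 4
    cost = add₂ {3} (up {2} {3} (n≤1+n 2) (small² (≤-trans (+-monoʳ-≤ 2 (+-mono-≤ ψ≤ ψ≤)) (+-mono-≤ (m≤m+n 2 18) (≤-trans (≤-reflexive (cong (W +_) (sym (+-identityʳ W)))) (*-monoˡ-≤ W (m≤m+n 2 8)))))))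
      (mul {1} {2} (base {_} {0} (xs≤ p h)) (suc₁ {1} (base {_} {0} (hK p h))))

  closeD : ∀ a p {Γ ψ} → p < L → (∀ x → x ∈ xs p → FreshIn x Γ) → D (1 + a) Γ [ ψ ] → D (2 + a) Γ [ closeAll (xs p) ψ ]
  closeD a p h f (mkD q) = toD (2 + a) (add₂ {1 + a} (base {_} {a} (xs≤ p h)) ≤-refl) (closeR (xs p) f q)

  -- Course-of-values induction on v_p. Ordinary induction on y_p proves `Kf p`, with the hypothesis
  -- as its step and v_p < 0 refuting its base; then y_p is set to the successor of v_p.
  indStep : ∀ a p → p < L → D a (ctx (suc p)) [ E ] → D (34 + a) (ctx p) [ E ]
  indStep a p h hyp = haveD (32 + a) (fv (vN p) ≺ sc (fv (vN p))) (base {4} {31 + a} (lit 4))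
      (lift (≤-trans (m≤m+n 3 29) (m≤m+n 32 a)) (sucD (fv (vN p)) (lit 1) (here refl)))
      substituted
    where
    Γ = ctx p
    y = yN p
    v = vN p
    h' : p ≤ L
    h' = <⇒≤ h
    fresh : ∀ x → x ∈ xs p → FreshIn x Γ
    fresh = ctx-fresh p h'
    freshK : ∀ x → x ∈ xs p → FreshIn x (Kf p ∷ Γ)
    freshK x m φ (here refl) f = proj₂ (closeAll-free (xs p) _ f) m
    freshK x m φ (there k) f = fresh x m φ k f
    p₀ : D 7 Γ [ Kat p zer ]
    p₀ = closeD 5 p h fresh (∨RD 5 (up {2} {5} (s≤s (s≤s z≤n)) (sucW (body≤ p zer h (s≤s z≤n)))) (here refl)
      (cutD 4 (fv v ≺ zer) (base {3} {3} (lit 3)) (emD 1 (fv v ≺ zer) (base {3} {0} (lit 3)) (here refl) (there (here refl)))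
        (lift≤ 3 (zeroD (fv v) (lit 1) (here refl)))))
    seq≤ : seqSize (ctx (suc p) ⇒ [ E ]) ≤ W ^ (4 + a)
    seq≤ = add₂ {3 + a} (up (m≤m+n 3 a) (ctx≤ (suc p) h)) (≤-trans (≤-reflexive (+-identityʳ (formSize E))) (base {_} {2 + a} E≤))
    4≤ : ∀ k → 4 ≤ 4 + k + a
    4≤ k = ≤-trans (m≤m+n 4 k) (m≤m+n (4 + k) a)
    2≤ : ∀ k → 2 ≤ 2 + k + a
    2≤ k = ≤-trans (m≤m+n 2 k) (m≤m+n (2 + k) a)
    p₁ : D (8 + a) (Kf p ∷ Γ) [ Kat p (sc (fv y)) ]
    -- The assumption v_p < s(y_p) is the second formula of `ctx (suc p)` as it stands, so v_p and
    -- y_p need not be compared.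
    p₁ = closeD (6 + a) p h freshK (∨RD (6 + a) (up (2≤ 4) (sucW (body≤ p (sc (fv y)) h ≤-refl))) (here refl)
      (cutD (5 + a) (fv v ≺ sc (fv y)) (base {4} {4 + a} (lit 4)) (lift (4≤ 1) (emD 1 (fv v ≺ sc (fv y)) (base {4} {0} (lit 4)) (here refl) (there (here refl))))
        (wkD (4 + a) seq≤ (∷-⊆ (there (here refl)) (∷-⊆ (here refl) (there ∘ there))) ([]-⊆ (there (here refl))) (lift (m≤n+m a 4) hyp))))
    coe : ∀ {k Γ φ ψ} → φ ≡ ψ → D k Γ [ φ ] → D k Γ [ ψ ]
    coe refl q = q
    e₀ : fsubF (y ↦ zer) (Kf p) ≡ Kat p zer
    e₀ = Kat-sub p zer h (λ _ _ ())
    e₁ : fsubF (y ↦ sc (fv y)) (Kf p) ≡ Kat p (sc (fv y))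
    e₁ = Kat-sub p (sc (fv y)) h (λ { x m (sc₁ here) → y∉xs p h' m })
    allK : D (28 + a) Γ [ Kf p ]
    allK = indD 2 (8 + a) y (Kf p) (up {1} {2} (s≤s z≤n) (base {_} {0} (hK p h)))
      (≤-trans (≤-reflexive (cong formSize e₀)) (sucW (Kat≤ p zer h (s≤s z≤n))))
      (≤-trans (≤-reflexive (cong formSize e₁)) (sucW (Kat≤ p (sc (fv y)) h ≤-refl)))
      (y-fresh p h') (coe (sym e₀) (lift (≤-trans (m≤m+n 7 1) (m≤m+n 8 a)) p₀)) (coe (sym e₁) p₁)
    opened : D (31 + a) ((fv v ≺ fv y) ∷ Γ) [ E ]
    opened = haveD (29 + a) (Kf p) (base {_} {28 + a} (hK p h)) (dropD (28 + a) (m≤n+m _ 3) there allK)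
      (lift (≤-trans (m≤m+n 7 22) (m≤m+n 29 a)) (openK p h (here refl) (there (here refl))))
    σ : Subst
    -- The name y_p is free neither in `ctx p` nor in `E`, so the substitution only changes v < y
    -- into v < s v.
    σ = y ↦ sc (fv v)
    eqs : map (fsubF σ) ((fv v ≺ fv y) ∷ Γ) ≡ (fv v ≺ sc (fv v)) ∷ Γ
    eqs = cong₂ _∷_ (cong₂ _≺_ (cong embed (↦-other _ (λ e → y≢v h (sym e)))) (trans (cong embed (↦-self y _)) refl))
      (map-id-on σ Γ (λ φ m → fsubF-id φ (λ x f → ↦-other _ (λ { refl → y-fresh p h' φ m f }))))
    eqE : fsubF σ E ≡ E
    eqE = fsubF-id E (λ x f → ↦-other _ (λ { refl → y∉E p f }))
    seq'≤ : seqSize (((fv v ≺ fv y) ∷ Γ) ⇒ [ E ]) ≤ W ^ (31 + a)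
    seq'≤ = add₂ {30 + a} (add₂ {29 + a} (base {3} {28 + a} (lit 3)) (up (≤-trans (m≤m+n 3 26) (m≤m+n 29 a)) (ctx≤ p h'))) (≤-trans (≤-reflexive (+-identityʳ (formSize E))) (base {_} {29 + a} E≤))
    substituted : D (32 + a) ((fv v ≺ sc (fv v)) ∷ Γ) [ E ]
    substituted = subst₂ (D (32 + a)) eqs (cong [_] eqE) (subD (31 + a) σ seq'≤ opened)

  -- Each component adds a constant to the exponent, so in the end the exponent is linear in L.
  descend : ∀ a q p → q + p ≡ L → D a (ctx L) [ E ] → D (q * 34 + a) (ctx p) [ E ]
  descend a zero p e q = subst (λ z → D a (ctx z) [ E ]) (sym e) q
  descend a (suc k) p e q = subst (λ z → D z (ctx p) [ E ]) (sym (+-assoc 34 (k * 34) a))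
    (indStep (k * 34 + a) p (≤-trans (s≤s (m≤n+m p k)) (≤-reflexive e)) (descend a k (suc p) (trans (+-suc k p) e) q))

-- The local step

sz-++ : ∀ Γ Δ → sz (Γ ++ Δ) ≡ sz Γ + sz Δ
sz-++ [] Δ = refl
sz-++ (φ ∷ Γ) Δ = trans (cong (formSize φ +_) (sz-++ Γ Δ)) (sym (+-assoc (formSize φ) (sz Γ) (sz Δ)))

sz-bound : ∀ Γ {w} → (∀ φ → φ ∈ Γ → formSize φ ≤ w) → sz Γ ≤ length Γ * w
sz-bound [] h = z≤n
sz-bound (φ ∷ Γ) h = +-mono-≤ (h φ (here refl)) (sz-bound Γ (λ ψ m → h ψ (there m)))

≋⇒⊆ : ∀ {Γ Δ} → Γ ≋ Δ → Γ ⊆ Δ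
≋⇒⊆ e {φ} = proj₁ (e φ)

≋⇒⊇ : ∀ {Γ Δ} → Γ ≋ Δ → Δ ⊆ Γ
≋⇒⊇ e {φ} = proj₂ (e φ)

module RuleStep (W : ℕ) (8≤W : 8 ≤ W) where
  open Scaled W 8≤W

  ∧LD : ∀ a {Γ Δ φ ψ} → formSize (φ ∧' ψ) ≤ W ^ a → (φ ∧' ψ) ∈ Γ → D a (φ ∷ ψ ∷ Γ) Δ → D (1 + a) Γ Δ
  ∧LD a h m (mkD p) = toD _ (rule₁-cost a ≤-refl (≤-trans (n≤1+n _) h)) (∧L∈ m p)

  ∧R∈D : ∀ a {Γ Δ φ ψ} → formSize (φ ∧' ψ) ≤ W ^ a → (φ ∧' ψ) ∈ Δ → D a Γ (φ ∷ Δ) → D a Γ (ψ ∷ Δ) → D (1 + a) Γ Δ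
  ∧R∈D a h m (mkD p) (mkD q) = toD _ (rule₂-cost a ≤-refl ≤-refl (≤-trans (n≤1+n _) h)) (∧R≤ _ _ ≤-refl ≤-refl m p q)

  ∀LinstD : ∀ a {Γ Δ φ} t → formSize (inst φ t) ≤ W ^ a → ∀' φ ∈ Γ → D a (inst φ t ∷ Γ) Δ → D (1 + a) Γ Δ
  ∀LinstD a t h m (mkD p) = toD _ (rule₁-cost a ≤-refl h) (∀L∈ t m p)

  ∃RD : ∀ a {Γ Δ φ} t → formSize (inst φ t) ≤ W ^ a → ∃' φ ∈ Δ → D a Γ (inst φ t ∷ Δ) → D (1 + a) Γ Δ
  ∃RD a {φ = φ} t h m (mkD p) = toD _ (rule₁-cost a ≤-refl h) (∃R≤ _ t ≤-refl m p)

  ∀RD : ∀ a {Γ Δ φ} x → formSize (∀' φ) ≤ W ^ a → FreshIn x Γ → FreshIn x Δ → ∀' φ ∈ Δ → D a Γ (inst φ (fv x) ∷ Δ) → D (1 + a) Γ Δ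
  ∀RD a x h f g m (mkD p) = toD _ (rule₁-cost a ≤-refl (≤-trans (n≤1+n _) h)) (∀R∈ x f g m p)

  ∃LD : ∀ a {Γ Δ φ} x → formSize (∃' φ) ≤ W ^ a → FreshIn x Γ → FreshIn x Δ → ∃' φ ∈ Γ → D a (inst φ (fv x) ∷ Γ) Δ → D (1 + a) Γ Δ
  ∃LD a x h f g m (mkD p) = toD _ (rule₁-cost a ≤-refl (≤-trans (n≤1+n _) h)) (∃L∈ x f g m p)

  -- Sw is the label of a node: the cedents stored in a rule may repeat formulas, so
  -- their size is not controlled by that of the preproof.
  Prem : ℕ → Cedent → Sequent → Set
  Prem a Ξ S = Σ Sequent λ Sw → Sw ≈S S × seqSize Sw ≤ W × D a (ante Sw ++ Ξ) (succ Sw)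

  module _ (a : ℕ) (Ξ Δ : Cedent) (hΞ : sz Ξ ≤ W ^ a) where

    wkPrem : ∀ {S Γ' Δ'} → Prem a Ξ S → ante S ⊆ Γ' → Ξ ⊆ Γ' → succ S ⊆ Δ' → D (4 + a) Γ' Δ'
    wkPrem (Sw , e , h , p) s x t = wkD (3 + a)
      (≤-trans (≤-reflexive (trans (cong (_+ sz (succ Sw)) (sz-++ (ante Sw) Ξ)) (swap (sz (ante Sw)) (sz Ξ) (sz (succ Sw)))))
        (up {2 + a} {3 + a} (n≤1+n _) (add₂ {1 + a} (base {_} {a} h) (up (n≤1+n a) hΞ))))
      (++-⊆ (s ∘ ≋⇒⊆ (proj₁ e)) x) (t ∘ ≋⇒⊆ (proj₂ e)) (lift (m≤n+m a 3) p)
      where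
      open +-*-Solver
      swap : ∀ x y z → x + y + z ≡ x + z + y
      swap = solve 3 (λ x y z → x :+ y :+ z := x :+ z :+ y) refl

    prem-size : ∀ {S φ} → Prem a Ξ S → φ ∈S S → formSize φ ≤ W
    prem-size (Sw , e , h , p) (inj₁ m) = ≤-trans (∈-size (≋⇒⊇ (proj₁ e) m)) (≤-trans (m≤m+n _ _) h)
    prem-size (Sw , e , h , p) (inj₂ m) = ≤-trans (∈-size (≋⇒⊇ (proj₂ e) m)) (≤-trans (m≤n+m _ (sz (ante Sw))) h)

    module _ (Sv : Sequent) (hSv : seqSize Sv ≤ W) (inΞ : ante Sv ⊆ Ξ) (inΔ : succ Sv ⊆ Δ) where

      left-size : ∀ {φ} → φ ∈ ante Sv → formSize φ ≤ W
      left-size m = ≤-trans (∈-size m) (≤-trans (m≤m+n _ _) hSv)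

      right-size : ∀ {φ} → φ ∈ succ Sv → formSize φ ≤ W
      right-size m = ≤-trans (∈-size m) (≤-trans (m≤n+m _ (sz (ante Sv))) hSv)

      axiomD : ∀ r → Side r → prems r ≡ [] → length (ante (concl r)) ≤ 3 → length (succ (concl r)) ≤ 3 → Sv ≈S concl r → D (8 + a) Ξ Δ
      axiomD r s e l₁ l₂ (eL , eR) = lift (≤-trans (m≤m+n 4 4) (m≤m+n 8 a)) (wkD 3
        (add₂ {2} (small (ante (concl r)) l₁ (λ φ m → left-size (≋⇒⊇ eL m))) (small (succ (concl r)) l₂ (λ φ m → right-size (≋⇒⊇ eR m))))
        (inΞ ∘ ≋⇒⊇ eL) (inΔ ∘ ≋⇒⊇ eR) (toD 3 (1≤pow 3) (ax r s e (≋-refl , ≋-refl))))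
        where
        small : ∀ Γ → length Γ ≤ 3 → (∀ φ → φ ∈ Γ → formSize φ ≤ W) → sz Γ ≤ W ^ 2
        small Γ l h = ≤-trans (sz-bound Γ h) (mul {1} {1} (base {_} {0} (≤-trans l (≤-trans (m≤m+n 3 5) 8≤W))) (base {_} {0} ≤-refl))

      W≤ : ∀ {x} k → x ≤ W → x ≤ W ^ (4 + k + a)
      W≤ k h = base {_} {3 + k + a} h

      5≤ : ∀ {Γ Δ} → D (5 + a) Γ Δ → D (8 + a) Γ Δ
      5≤ = lift (m≤n+m (5 + a) 3)

      -- The rule of the cyclic proof is repeated beside the side formulas in Ξ, the guards and
      -- induction hypotheses. Only the eigenvariable condition could suffer from them, so freshness
      -- is a separate assumption.
      ruleStep : ∀ r → Structural r → Side r → Sv ≈S concl r → (∀ x → eigen r ≡ suc x → FreshIn x Ξ) → (∀ x → eigen r ≡ suc x → FreshIn x (succ (concl r)) → FreshIn x Δ) →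
        All (Prem a Ξ) (prems r) → D (8 + a) Ξ Δ
      ruleStep _ (isId φ) s e _ _ _ = axiomD (idR φ) s refl (s≤s z≤n) (s≤s z≤n) e
      ruleStep _ (isRefl t) s e _ _ _ = axiomD (eqRefl t) s refl z≤n (s≤s z≤n) e
      ruleStep _ (isEq s₁ t x φ) s e _ _ _ = axiomD (eqSub s₁ t x φ) s refl (s≤s (s≤s z≤n)) (s≤s z≤n) e
      ruleStep _ (isNegL φ) s e _ _ _ = axiomD (negL φ) s refl (s≤s (s≤s z≤n)) z≤n e
      ruleStep _ (isNegR φ) s e _ _ _ = axiomD (negR φ) s refl z≤n (s≤s (s≤s z≤n)) e
      ruleStep _ (isQ q θ) s e _ _ _ = axiomD (qAx q θ) s refl z≤n (s≤s z≤n) e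
      ruleStep _ (isWk Γ' Δ' Γ'' Δ'') s (eL , eR) _ _ (p ∷ []) =
        lift (m≤n+m (4 + a) 4) (wkPrem p (inΞ ∘ ≋⇒⊇ eL ∘ ∈-++⁺ˡ) id (inΔ ∘ ≋⇒⊇ eR ∘ ∈-++⁺ˡ))
      ruleStep _ (isCut Γ' Δ' φ) s (eL , eR) _ _ (p ∷ q ∷ []) = 5≤ (cutD (4 + a) φ (W≤ 0 (prem-size p (inj₂ (here refl))))
        (wkPrem p (inΞ ∘ ≋⇒⊇ eL) id (∷-mono (inΔ ∘ ≋⇒⊇ eR)))
        (wkPrem q (∷-mono (inΞ ∘ ≋⇒⊇ eL)) there (inΔ ∘ ≋⇒⊇ eR)))
      ruleStep _ (is∧L Γ' Δ' φ ψ) s (eL , eR) _ _ (p ∷ []) = 5≤ (∧LD (4 + a) (W≤ 0 (left-size (≋⇒⊇ eL (here refl)))) (inΞ (≋⇒⊇ eL (here refl)))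
        (wkPrem p (∷-mono (∷-mono (inΞ ∘ ≋⇒⊇ eL ∘ there))) (there ∘ there) (inΔ ∘ ≋⇒⊇ eR)))
      ruleStep _ (is∧R Γ' Δ' φ ψ) s (eL , eR) _ _ (p ∷ q ∷ []) = 5≤ (∧R∈D (4 + a) (W≤ 0 (right-size (≋⇒⊇ eR (here refl)))) (inΔ (≋⇒⊇ eR (here refl)))
        (wkPrem p (inΞ ∘ ≋⇒⊇ eL) id (∷-mono (inΔ ∘ ≋⇒⊇ eR ∘ there)))
        (wkPrem q (inΞ ∘ ≋⇒⊇ eL) id (∷-mono (inΔ ∘ ≋⇒⊇ eR ∘ there))))
      ruleStep _ (is∨L Γ' Δ' φ ψ) s (eL , eR) _ _ (p ∷ q ∷ []) = 5≤ (∨LD (4 + a) (W≤ 0 (left-size (≋⇒⊇ eL (here refl)))) (inΞ (≋⇒⊇ eL (here refl)))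
        (wkPrem p (∷-mono (inΞ ∘ ≋⇒⊇ eL ∘ there)) there (inΔ ∘ ≋⇒⊇ eR))
        (wkPrem q (∷-mono (inΞ ∘ ≋⇒⊇ eL ∘ there)) there (inΔ ∘ ≋⇒⊇ eR)))
      ruleStep _ (is∨R Γ' Δ' φ ψ) s (eL , eR) _ _ (p ∷ []) = 5≤ (∨RD (4 + a) (W≤ 0 (right-size (≋⇒⊇ eR (here refl)))) (inΔ (≋⇒⊇ eR (here refl)))
        (wkPrem p (inΞ ∘ ≋⇒⊇ eL) id (∷-mono (∷-mono (inΔ ∘ ≋⇒⊇ eR ∘ there)))))
      ruleStep _ (is∀L Γ' Δ' φ t) s (eL , eR) _ _ (p ∷ []) = 5≤ (∀LinstD (4 + a) t (W≤ 0 (prem-size p (inj₁ (here refl)))) (inΞ (≋⇒⊇ eL (here refl)))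
        (wkPrem p (∷-mono (inΞ ∘ ≋⇒⊇ eL ∘ there)) there (inΔ ∘ ≋⇒⊇ eR)))
      ruleStep _ (is∃R Γ' Δ' φ t) s (eL , eR) _ _ (p ∷ []) = 5≤ (∃RD (4 + a) t (W≤ 0 (prem-size p (inj₂ (here refl)))) (inΔ (≋⇒⊇ eR (here refl)))
        (wkPrem p (inΞ ∘ ≋⇒⊇ eL) id (∷-mono (inΔ ∘ ≋⇒⊇ eR ∘ there))))
      ruleStep _ (is∀R Γ' Δ' φ x) (f , g , h) (eL , eR) fΞ fΔ (p ∷ []) = 5≤ (∀RD (4 + a) x (W≤ 0 (right-size (≋⇒⊇ eR (here refl)))) (fΞ x refl)
        (fΔ x refl λ { χ (here refl) → h ; χ (there m) → g χ m }) (inΔ (≋⇒⊇ eR (here refl)))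
        (wkPrem p (inΞ ∘ ≋⇒⊇ eL) id (∷-mono (inΔ ∘ ≋⇒⊇ eR ∘ there))))
      ruleStep _ (is∃L Γ' Δ' φ x) (f , g , h) (eL , eR) fΞ fΔ (p ∷ []) = 5≤ (∃LD (4 + a) x (W≤ 0 (left-size (≋⇒⊇ eL (here refl)))) (fΞ x refl)
        (fΔ x refl g) (inΞ (≋⇒⊇ eL (here refl)))
        (wkPrem p (∷-mono (inΞ ∘ ≋⇒⊇ eL ∘ there)) there (inΔ ∘ ≋⇒⊇ eR)))

choose : ∀ {A P : Set} → Dec P → A → A → A
choose (yes _) a b = a
choose (no _) a b = b

choose-yes : ∀ {A P : Set} (d : Dec P) {a b : A} → P → choose d a b ≡ a
choose-yes (yes _) p = refl
choose-yes (no q) p = contradiction p q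

choose-no : ∀ {A P : Set} (d : Dec P) {a b : A} → ¬ P → choose d a b ≡ b
choose-no (yes q) p = contradiction q p
choose-no (no _) p = refl

choose-elim : ∀ {A P : Set} (Q : A → Set) (d : Dec P) {a b : A} → (P → Q a) → (¬ P → Q b) → Q (choose d a b)
choose-elim Q (yes p) f g = f p
choose-elim Q (no p) f g = g p

nthOr : List (Term 0) → ℕ → Term 0
nthOr [] i = zer
nthOr (t ∷ ts) zero = t
nthOr (t ∷ ts) (suc i) = nthOr ts i

nthOr-lookup : ∀ ts (c : Fin (length ts)) → nthOr ts (toℕ c) ≡ lookup ts c
nthOr-lookup (t ∷ ts) zero = refl
nthOr-lookup (t ∷ ts) (suc c) = nthOr-lookup ts c

fsubT-num : ∀ θ k → fsubT θ (num k) ≡ num k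
fsubT-num θ zero = refl
fsubT-num θ (suc k) = cong sc (fsubT-num θ k)

-- Every rule is read as if it substituted, most of them the identity; edges then need no case
-- distinction on the rule.
thetaOf : ∀ {r} → SubView r → Subst
thetaOf (isSub θ _ _ _) = θ
thetaOf (notSub _ _ _) = fv

prev-eq : ∀ {r} (V : SubView r) Γ t' t → PrecR r Γ t' t → (fsubT (thetaOf V) t' ≐ t) ∈ Γ ⊎ fsubT (thetaOf V) t' ≡ t
prev-eq (isSub θ _ _ refl) Γ t' t p = inj₂ (sym p)
prev-eq (notSub _ from _) Γ t' t p = [ (λ m → inj₁ (subst (λ z → (z ≐ t) ∈ Γ) (sym (fsubT-fv t')) m)) , (λ e → inj₂ (trans (fsubT-fv t') e)) ]′ (from Γ t' t p)

map-fv : ∀ Γ → map (fsubF fv) Γ ≡ Γ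
map-fv Γ = map-id-on fv Γ (λ φ _ → fsubF-fv φ)

-- A substitution is arbitrary, but the substituted premise is the conclusion, again a sequent of
-- the preproof; for other rules it is the premise. This bounds its names and sizes.
image : ∀ {r} (V : SubView r) {Sv Sw S} → Sv ≈S concl r → S ∈ prems r → Sw ≈S S →
  (∀ {φ} → φ ∈ map (fsubF (thetaOf V)) (ante Sw) → φ ∈ ante Sv ⊎ φ ∈ ante Sw) × (∀ {φ} → φ ∈ map (fsubF (thetaOf V)) (succ Sw) → φ ∈ succ Sv ⊎ φ ∈ succ Sw)
image (isSub θ Γ Δ refl) {Sv} {Sw} (eL , eR) (here refl) (fL , fR) = (λ m → inj₁ (half eL fL m)) , (λ m → inj₁ (half eR fR m))
  where
  half : ∀ {A B C} → A ≋ map (fsubF θ) B → C ≋ B → map (fsubF θ) C ⊆ A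
  half e f m = let ψ , k , q = ∈-map⁻ (fsubF θ) m in ≋⇒⊇ e (subst (_∈ _) (sym q) (∈-map⁺ (fsubF θ) (≋⇒⊆ f k)))
image (notSub _ _ _) {Sw = Sw} _ _ _ = (λ {φ} m → inj₂ (subst (φ ∈_) (map-fv (ante Sw)) m)) , (λ {φ} m → inj₂ (subst (φ ∈_) (map-fv (succ Sw)) m))

pointwise-lookup : ∀ {A B : Set} {R : A → B → Set} {xs ys} → Pointwise R xs ys → ∀ {x} → x ∈ xs → Σ B λ y → y ∈ ys × R x y
pointwise-lookup (r ∷ rs) (here refl) = _ , here refl , r
pointwise-lookup (r ∷ rs) (there m) = let y , k , q = pointwise-lookup rs m in y , there k , q

sz-dual : ∀ Γ → sz (map dual Γ) ≡ sz Γ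
sz-dual [] = refl
sz-dual (φ ∷ Γ) = cong₂ _+_ (dual-size φ) (sz-dual Γ)

-- The parameter k bounds the right side separately: it is W for the guards before the run and W + 1
-- after a possible weakening by a successor.
Ok : ℕ → ℕ → Formula 0 → Set
Ok W k (t ≺ u) = termSize t ≤ W × termSize u ≤ k
Ok W k _ = ⊥

rowGuards-ok : ∀ {W k} t bs Rs → termSize t ≤ W → (∀ i → suc (termSize (Rs i)) ≤ k) → All (Ok W k) (rowGuards t bs Rs)
rowGuards-ok t [] Rs h g = []
rowGuards-ok t (true ∷ bs) Rs h g with anyB bs
... | true = (h , ≤-trans (n≤1+n _) (g 0)) ∷ rowGuards-ok t bs (Rs ∘ suc) h (g ∘ suc)
... | false = (h , g 0) ∷ rowGuards-ok t bs (Rs ∘ suc) h (g ∘ suc)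
rowGuards-ok t (false ∷ bs) Rs h g = rowGuards-ok t bs (Rs ∘ suc) h (g ∘ suc)

-- Guards along an edge, before the run

module Local (π : Preproof) (gtc : (β : Branch π) → ProgressingTrace β) (W : ℕ) (32≤W : 32 ≤ W) (κ≤W : κ ≤ W)
  (hK : ∀ p → p < Main.L π → formSize (Main.Kf π p) ≤ W) (hL : Main.L π ≤ W) (hS : ∀ v → suc (seqSize (seq π v)) ≤ W) where
  open Descent π W 32≤W κ≤W hK hL public
  open Lasso π gtc using (rank-strict)
  open RuleStep W 8≤W

  ⋀≤ : formSize (⋀ (map Dform states)) ≤ W
  ⋀≤ = ≤-trans (≤-reflexive (cong formSize (sym E≡))) E≤

  members≤ : length (map Dform states) + sz (map Dform states) + 3 ≤ W
  members≤ = ≤-trans (≤-reflexive (sym (⋀-size (map Dform states)))) ⋀≤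

  states-length : length (map Dform states) ≤ W
  states-length = ≤-trans (≤-trans (m≤m+n (length (map Dform states)) (sz (map Dform states))) (m≤m+n _ 3)) members≤

  Dform≤ : ∀ {s} → s ∈ states → formSize (Dform s) ≤ W
  Dform≤ m = ≤-trans (∈-size (∈-map⁺ Dform m)) (≤-trans (≤-trans (m≤n+m _ (length (map Dform states))) (m≤m+n _ 3)) members≤)

  disjuncts : State → Cedent
  disjuncts s = map dual (hyps s) ++ succ (seq π (node s))

  disj≤ : ∀ {s} → s ∈ states → length (disjuncts s) + sz (disjuncts s) + 3 ≤ W
  disj≤ {s} m = ≤-trans (≤-reflexive (sym (⋁-size (disjuncts s)))) (Dform≤ m)

  disj-length : ∀ {s} → s ∈ states → length (disjuncts s) ≤ W
  disj-length m = ≤-trans (≤-trans (m≤m+n _ _) (m≤m+n _ 3)) (disj≤ m)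

  disj-sz : ∀ {s} → s ∈ states → sz (disjuncts s) ≤ W
  disj-sz {s} m = ≤-trans (≤-trans (m≤n+m _ (length (disjuncts s))) (m≤m+n _ 3)) (disj≤ m)

  hyps-sz : ∀ {s} → s ∈ states → sz (hyps s) ≤ W
  hyps-sz {s} m = ≤-trans (≤-trans (≤-reflexive (sym (sz-dual (hyps s)))) (≤-trans (m≤m+n _ _) (≤-reflexive (sym (sz-++ (map dual (hyps s)) (succ (seq π (node s)))))))) (disj-sz m)

  hyps-length : ∀ {s} → s ∈ states → length (hyps s) ≤ W
  hyps-length {s} m = ≤-trans (≤-trans (≤-reflexive (sym (length-map dual (hyps s)))) (≤-trans (m≤m+n _ _) (≤-reflexive (sym (length-++ (map dual (hyps s))))))) (disj-length m)

  succ≤ : ∀ v → sz (succ (seq π v)) ≤ W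
  succ≤ v = ≤-trans (m≤n+m _ (sz (ante (seq π v)))) (≤-trans (n≤1+n _) (hS v))

  ante≤ : ∀ v → sz (ante (seq π v)) ≤ W
  ante≤ v = ≤-trans (m≤m+n _ _) (≤-trans (n≤1+n _) (hS v))

  E-elim : ∀ {s Γ} → s ∈ states → E ∈ Γ → D 4 Γ [ Dform s ]
  E-elim {s} {Γ} m k = toD 4 cost (⋀L (map Dform states) (subst (_∈ Γ) E≡ k) (∈-map⁺ Dform m))
    where
    cost : 2 + (formSize (Dform s) + formSize (Dform s)) + length (map Dform states) * suc (formSize (⋀ (map Dform states))) ≤ W ^ 4
    cost = add₂ {3} (suc₁ {2} (≤-trans (s≤s (+-mono-≤ (Dform≤ m) (Dform≤ m))) (small² (≤-trans (+-monoʳ-≤ 1 (≤-reflexive (cong (W +_) (sym (+-identityʳ W))))) (+-mono-≤ (m≤m+n 1 19) (*-monoˡ-≤ W (m≤m+n 2 8)))))))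
      (mul {1} {2} {length (map Dform states)} (base {_} {0} states-length) (suc₁ {1} (base {_} {0} ⋀≤)))

  imp-elim : ∀ {s Γ} → s ∈ states → Dform s ∈ Γ → hyps s ⊆ Γ → D 8 Γ (succ (seq π (node s)))
  imp-elim {s} m k i = toD 8 cost (impL (hyps s) (succ (seq π (node s))) W
      (λ n → ≤-trans (∈-size n) (hyps-sz m)) (λ n → ≤-trans (∈-size n) (succ≤ (node s))) k i)
    where
    cost : 17 + length (disjuncts s) * suc (suc (contraCost W) + formSize (Dform s)) ≤ W ^ 8
    cost = add₂ {7} (base {17} {6} (lit 17)) (up {7} {7} ≤-refl (mul {1} {6} (base {_} {0} (disj-length m))
      (rule₁-cost 5 (suc₁ {4} (contraCost≤ {1} (base {_} {0} ≤-refl))) (base {_} {4} (Dform≤ m)))))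

  module Successor (s s' : State) (r : Reachable s) (e : Edge s s') where

    v = node s
    w = node s'

    r' : Reachable s'
    r' = r ◅◅ (e ◅ ε)

    V : SubView (rl π v)
    V = subView (rl π v)

    θ : Subst
    θ = thetaOf V

    prem : Σ Sequent λ S → S ∈ prems (rl π v) × seq π w ≈S S
    prem = pointwise-lookup (lprem π v) (proj₁ e)

    Γθ Δθ Ξ Ξ' : Cedent
    Γθ = map (fsubF θ) (ante (seq π w))
    Δθ = map (fsubF θ) (succ (seq π w))
    Ξ = hyps s ++ ctx L
    Ξ' = Γθ ++ Ξ

    imgL : ∀ {φ} → φ ∈ Γθ → φ ∈ ante (seq π v) ⊎ φ ∈ ante (seq π w)
    imgL = proj₁ (image V {seq π v} {seq π w} (lconc π v) (proj₁ (proj₂ prem)) (proj₂ (proj₂ prem)))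

    imgR : ∀ {φ} → φ ∈ Δθ → φ ∈ succ (seq π v) ⊎ φ ∈ succ (seq π w)
    imgR = proj₂ (image V {seq π v} {seq π w} (lconc π v) (proj₁ (proj₂ prem)) (proj₂ (proj₂ prem)))

    Γθ-size : ∀ {φ} → φ ∈ Γθ → suc (formSize φ) ≤ W
    Γθ-size m = [ (λ k → ≤-trans (s≤s (≤-trans (∈-size k) (m≤m+n _ _))) (hS v)) , (λ k → ≤-trans (s≤s (≤-trans (∈-size k) (m≤m+n _ _))) (hS w)) ]′ (imgL m)

    Δθ-size : ∀ {φ} → φ ∈ Δθ → formSize φ ≤ W
    Δθ-size m = [ (λ k → ≤-trans (∈-size k) (succ≤ v)) , (λ k → ≤-trans (∈-size k) (succ≤ w)) ]′ (imgR m)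

    Γθ-name : ∀ {φ x} → φ ∈ Γθ → FreeF x φ → x < bnd
    Γθ-name {φ} {x} m f = [ (λ k → seq-name< v {φ} {x} (inj₁ k) f) , (λ k → seq-name< w {φ} {x} (inj₁ k) f) ]′ (imgL m)

    Δθ-name : ∀ {φ x} → φ ∈ Δθ → FreeF x φ → x < bnd
    Δθ-name {φ} {x} m f = [ (λ k → seq-name< v {φ} {x} (inj₂ k) f) , (λ k → seq-name< w {φ} {x} (inj₂ k) f) ]′ (imgR m)

    p : ℕ
    p = prio s w

    p<L : p < L
    p<L = s≤s (≤-trans (prio≤ s w) (n≤1+n _))

    -- A register opened for a term starts with the value of that term, substituted as the edge
    -- demands, so its first guard is t < s t.
    extTags : ℕ → Term 0
    extTags i = choose (i <? n) (reg i) (fsubT θ (nthOr terms (i ∸ n)))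

    extTags-reg : ∀ {i} → i < n → extTags i ≡ reg i
    extTags-reg {i} h = choose-yes (i <? n) h

    extTags-fresh : ∀ c → extTags (n + toℕ c) ≡ fsubT θ (term c)
    extTags-fresh c = trans (choose-no (n + toℕ c <? n) (λ h → <-irrefl refl (≤-trans h (m≤m+n n (toℕ c)))))
      (cong (fsubT θ) (trans (cong (nthOr terms) (m+n∸m≡n n (toℕ c))) (nthOr-lookup terms c)))

    termθ : Fin n → Term 0
    termθ c = fsubT θ (term c)

    Good : ℕ → ℕ → Cedent → Formula 0 → Set
    Good k a Extra φ = Ok W k φ × (∀ {Γ} → (Extra ++ Ξ') ⊆ Γ → D a Γ [ φ ])

    inΓv : ∀ {φ} → φ ∈ ante (seq π v) → φ ∈ Ξ'
    inΓv m = ∈-++⁺ʳ Γθ (∈-++⁺ˡ (∈-++⁺ʳ (guards s) m))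

    inG : ∀ {φ} → φ ∈ guards s → φ ∈ Ξ'
    inG m = ∈-++⁺ʳ Γθ (∈-++⁺ˡ (∈-++⁺ˡ m))

    inCtx : ∀ {φ} → φ ∈ ctx L → φ ∈ Ξ'
    inCtx m = ∈-++⁺ʳ Γθ (∈-++⁺ʳ (hyps s) m)

    occ-size : ∀ {v t} → Occ v t → termSize t ≤ W
    occ-size {v} {t} o = let φ , m , k = collect⁻ subsF (seq π v) o in
      ≤-trans (subsF-size φ k) ([ (λ l → ≤-trans (∈-size l) (ante≤ v)) , (λ l → ≤-trans (∈-size l) (succ≤ v)) ]′ m)

    Base : Formula 0 → Set
    Base φ = Ok W W φ × φ ∈ guards s

    baseGuards : ∀ a → Occ v (term a) → All Base (rowGuards (term a) (rowOf s a) extTags)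
    baseGuards a o = subst (All Base) (rowGuards-cong (term a) (rowOf s a) (λ i h → sym (extTags-reg (subst (i <_) (rowOf-length s a) h))))
      (All.zip (rowGuards-ok (term a) (rowOf s a) reg (occ-size o) (λ _ → lit 2) ,
        All.tabulate (λ m → ∈-++⁺ʳ (uGuards s) (∈-cM⁺ (rGuards-at s) (∈-allFin a) (when⁺ (occ? v (term a)) o m)))))

    AtMost : Term 0 → Term 0 → Set
    AtMost t' t = ((t' ≐ t) ∈ ante (seq π v)) ⊎ t' ≡ t

    prev-le : ∀ c a → Prev v (term c) (term a) → AtMost (termθ c) (term a)
    prev-le c a q = prev-eq V (ante (seq π v)) (term c) (term a) q

    replaceBy : ∀ t' t u → AtMost t' t → termSize t ≤ W → Base (t ≺ u) → termSize t' ≤ W × (∀ {Γ} → Ξ' ⊆ Γ → D 5 Γ [ t' ≺ u ])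
    replaceBy t' t u (inj₁ m) ht ((_ , hu) , g) = ht' , λ i → lift (m≤m+n 3 2) (eqD t' t u ht' ht (≤-trans hu (n≤1+n W)) (i (inΓv m)) (i (inG g)))
      where
      ht' : termSize t' ≤ W
      ht' = ≤-trans (≤-trans (m≤m+n _ (termSize t)) (≤-trans (n≤1+n _) (∈-size m))) (ante≤ v)
    replaceBy t' .t' u (inj₂ refl) ht ((_ , hu) , g) = ht , λ i → idrD 2 (t' ≺ u) (≺-size t' u ht (≤-trans hu (n≤1+n W))) (i (inG g)) (here refl)

    leGuards : ∀ {a c} → Le v a c → All (Good W 7 []) (rowGuards (termθ c) (rowOf s a) extTags)
    leGuards {a} {c} (o , q) = rowGuards-map {Base} {Good W 7 []} (term a) (termθ c) (rowOf s a) extTags (λ i → conv (extTags i)) (λ i → conv (sc (extTags i))) (baseGuards a o)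
      where
      conv : ∀ u → Base (term a ≺ u) → Good W 7 [] (termθ c ≺ u)
      conv u b = let h , d = replaceBy (termθ c) (term a) u (prev-le c a q) (occ-size o) b in (h , proj₂ (proj₁ b)) , λ i → lift (m≤m+n 5 2) (d i)

    -- With d the precursor of a one has c < d = a. Hence a weak bound on a becomes a strict bound
    -- on c.
    ltGuards : ∀ {a c} → Lt v w a c → All (Good W 7 []) (rowGuards (termθ c) (rowOf s a ++ oneHot c) extTags)
    ltGuards {a} {c} (o , d , q , m) = rowGuards-progress {Base} {Good W 7 []} (term a) (termθ c) (rowOf s a) c extTags (λ i → strict (extTags i)) (λ i → below (extTags i))
      (subst (λ z → Good W 7 [] (termθ c ≺ sc z)) (sym (trans (cong (λ k → extTags (k + toℕ c)) (rowOf-length s a)) (extTags-fresh c))) fresh) (baseGuards a o)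
      where
      lessθ : (termθ c ≺ termθ d) ∈ Γθ
      lessθ = ∈-map⁺ (fsubF θ) m
      hc : suc (termSize (termθ c)) ≤ W
      hc = ≤-trans (s≤s (≤-trans (m≤m+n _ (termSize (termθ d))) (n≤1+n _))) (Γθ-size lessθ)
      hd : termSize (termθ d) ≤ W
      hd = ≤-trans (≤-trans (m≤n+m _ (termSize (termθ c))) (n≤1+n _)) (≤-trans (n≤1+n _) (Γθ-size lessθ))
      hc' : termSize (termθ c) ≤ W
      hc' = ≤-trans (n≤1+n _) hc
      strict : ∀ R → Base (term a ≺ R) → Good W 7 [] (termθ c ≺ R)
      strict R b = (hc' , hR) , λ i → haveD 5 (termθ d ≺ R) (up {2} {5} (m≤m+n 2 3) (≺-size (termθ d) R hd (≤-trans hR (n≤1+n W)))) (proj₂ dv i)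
        (haveD 3 (termθ d ≺ sc R) (up {2} {3} (n≤1+n 2) (≺-size (termθ d) (sc R) hd (s≤s hR))) (stepD (termθ d) R hd hR (here refl))
          (transD (termθ c) (termθ d) R hc' hd hR (there (there (i (∈-++⁺ˡ lessθ)))) (here refl)))
        where
        hR : termSize R ≤ W
        hR = proj₂ (proj₁ b)
        dv = replaceBy (termθ d) (term a) R (prev-le d a q) (occ-size o) b
      below : ∀ R → Base (term a ≺ sc R) → Good W 7 [] (termθ c ≺ R)
      below R b = (hc' , hR) , λ i → haveD 5 (termθ d ≺ sc R) (up {2} {5} (m≤m+n 2 3) (≺-size (termθ d) (sc R) hd (s≤s hR))) (proj₂ dv i)
        (lift (m≤m+n 3 2) (transD (termθ c) (termθ d) R hc' hd hR (there (i (∈-++⁺ˡ lessθ))) (here refl)))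
        where
        hR : termSize R ≤ W
        hR = ≤-trans (n≤1+n _) (proj₂ (proj₁ b))
        dv = replaceBy (termθ d) (term a) (sc R) (prev-le d a q) (occ-size o) b
      fresh : Good W 7 [] (termθ c ≺ sc (termθ c))
      fresh = (hc' , hc) , λ i → lift (m≤m+n 3 4) (sucD (termθ c) hc' (here refl))

    extGuards : ∀ c → All (Good W 7 []) (rowGuards (termθ c) (ext s w c) extTags)
    extGuards c = [ none , (λ m → some (cand⁻ s w c m)) ]′ (bestOf-choice (zeros (n + n)) (cands s w c))
      where
      none : ext s w c ≡ zeros (n + n) → All (Good W 7 []) (rowGuards (termθ c) (ext s w c) extTags)
      none q = subst (All (Good W 7 [])) (sym (rowGuards-none (termθ c) (ext s w c) extTags (trans (cong anyB q) (anyB-zeros (n + n))))) []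
      some : Σ (Fin n) (λ a → (Le v a c × ext s w c ≡ rowOf s a ++ zeros n) ⊎ (Lt v w a c × ext s w c ≡ rowOf s a ++ oneHot c)) → All (Good W 7 []) (rowGuards (termθ c) (ext s w c) extTags)
      some (a , inj₁ (l , q)) = subst (All (Good W 7 [])) (sym (trans (cong (λ u → rowGuards (termθ c) u extTags) q) (rowGuards-pad (termθ c) (rowOf s a) n extTags))) (leGuards l)
      some (a , inj₂ (l , q)) = subst (λ u → All (Good W 7 []) (rowGuards (termθ c) u extTags)) (sym q) (ltGuards l)

-- Applying an induction hypothesis to a successor state

module Assemble (π : Preproof) (gtc : (β : Branch π) → ProgressingTrace β) (W : ℕ) (32≤W : 32 ≤ W) (κ≤W : κ ≤ W)
  (hK : ∀ p → p < Main.L π → formSize (Main.Kf π p) ≤ W) (hL : Main.L π ≤ W) (hS : ∀ v → suc (seqSize (seq π v)) ≤ W) where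
  open Local π gtc W 32≤W κ≤W hK hL hS public
  open Lasso π gtc using (rank-strict)
  open RuleStep W 8≤W

  rank-size : ∀ {s} → s ∈ states → ∀ j → j < suc n → suc (rank j s) ≤ W
  rank-size {s} m j h = ≤-trans (≤-trans (≤-reflexive (sym (num-size (rank j s)))) (≤-trans (m≤m+n _ 2) (n≤1+n _)))
    (≤-trans (∈-size (∈-++⁺ˡ (∈-++⁺ˡ (∈-map⁺ (uGuard s) (∈-upTo⁺ h))))) (hyps-sz m))

  module Premise (s s' : State) (r : Reachable s) (e : Edge s s') where
    open Successor s s' r e public

    in-states : s ∈ states
    in-states = states⁺ r

    in-states' : s' ∈ states
    in-states' = states⁺ r'

    weaken : ∀ Extra {t R} → Good W 7 Extra (t ≺ R) → Good (suc W) 9 Extra (t ≺ sc R)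
    weaken Extra {t} {R} ((ht , hR) , d) = (ht , s≤s hR) , λ i → haveD 7 (t ≺ R) (up {2} {7} (m≤m+n 2 5) (≺-size t R ht (≤-trans hR (n≤1+n W)))) (d i)
      (lift (m≤m+n 3 4) (stepD t R ht hR (here refl)))

    -- Shared by both parities. For an even priority g is the identity and `Extra` is empty; for an
    -- odd one g passes to a predecessor and `Extra` holds the equation that defines it.
    module With (Extra : Cedent) (g : Term 0 → Term 0) (wg : ∀ {t R} → Good W 7 Extra (t ≺ R) → Good (suc W) 9 Extra (t ≺ sc (g R))) where

      tags : ℕ → Term 0
      tags = Columns.tagsRun n (theRun s w) g extTags

      newRegs : ℕ → Term 0
      newRegs = alt (λ j → num (rank j s')) tags

      -- Components below the priority must stay literally as they are, since `Kf p` has them free.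
      -- For registers the run guarantees this; a rank may fall, but its old bound remains valid.
      regVal : ℕ → Term 0
      regVal i = choose (i <? p) (fv (vN i)) (newRegs i)

      Θ : Subst
      Θ x = choose (x <? bnd) (θ x) (choose (x ∸ bnd <? L) (regVal (x ∸ bnd)) (fv x))

      Θ-low : ∀ {x} → x < bnd → Θ x ≡ θ x
      Θ-low {x} h = choose-yes (x <? bnd) h

      Θ-v : ∀ {i} → i < L → Θ (vN i) ≡ regVal i
      Θ-v {i} h = trans (choose-no (vN i <? bnd) v≮bnd)
        (trans (choose-yes (vN i ∸ bnd <? L) (subst (_< L) (sym (m+n∸m≡n bnd i)) h)) (cong regVal (m+n∸m≡n bnd i)))

      Θ-y : ∀ i → Θ (yN i) ≡ fv (yN i)
      Θ-y i = trans (choose-no (yN i <? bnd) y≮bnd)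
        (choose-no (yN i ∸ bnd <? L) (λ h → <-irrefl refl (≤-trans (subst (_< L) (m+n∸m≡n bnd (L + i)) h) (m≤m+n L i))))

      regVal-low : ∀ {i} → i < p → regVal i ≡ fv (vN i)
      regVal-low {i} h = choose-yes (i <? p) h

      regVal-high : ∀ {i} → p ≤ i → regVal i ≡ newRegs i
      regVal-high {i} h = choose-no (i <? p) (λ k → <-irrefl refl (≤-trans k h))

      regVal-tag : ∀ {j} → j < n → regVal (suc (j * 2)) ≡ tags j
      regVal-tag {j} h = choose-elim (_≡ tags j) (suc (j * 2) <? p)
        (λ k → sym (trans (Columns.tagsRun-below n (theRun s w) g extTags j k) (extTags-reg h)))
        (λ k → alt-odd (λ j → num (rank j s')) tags j)

      ΘK : fsubF Θ (Kf p) ≡ Kf p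
      ΘK = fsubF-id (Kf p) (λ x f → [ fixV x , fixY x ]′ (K-name p {x} p<L f))
        where
        fixV : ∀ x → RegBelow p x → Θ x ≡ fv x
        fixV x (i , h , q) = trans (cong Θ q) (trans (Θ-v (≤-trans h (<⇒≤ p<L))) (trans (regVal-low h) (cong fv (sym q))))
        fixY : ∀ x → x ≡ yN p → Θ x ≡ fv x
        fixY x q = trans (cong Θ q) (trans (Θ-y p) (cong fv (sym q)))

      Θseq : ∀ φ → φ ∈S seq π w → fsubF Θ φ ≡ fsubF θ φ
      Θseq φ m = fsubF-cong φ (λ x f → Θ-low (seq-name< w {φ} {x} m f))

      ΘΓ : map (fsubF Θ) (ante (seq π w)) ≡ Γθ
      ΘΓ = map-cong-on Θ θ (ante (seq π w)) (λ φ m → Θseq φ (inj₁ m))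

      ΘΔ : map (fsubF Θ) (succ (seq π w)) ≡ Δθ
      ΘΔ = map-cong-on Θ θ (succ (seq π w)) (λ φ m → Θseq φ (inj₂ m))

      Θterm : ∀ {t} → Occ w t → fsubT Θ t ≡ fsubT θ t
      Θterm {t} o = fsubT-cong t (λ x f → let φ , m , q = occ-formula {w} o f in Θ-low (seq-name< w {φ} {x} m q))

      PQ : ∀ {φ} → Good W 7 Extra φ → Good (suc W) 9 Extra φ
      PQ {t ≺ u} ((ht , hu) , d) = (ht , ≤-trans hu (n≤1+n W)) , λ i → lift (m≤m+n 7 2) (d i)

      extGuards' : ∀ c → All (Good W 7 Extra) (rowGuards (termθ c) (Columns.row n (cols s w) c) extTags)
      extGuards' c = subst (λ u → All (Good W 7 Extra) (rowGuards (termθ c) u extTags)) (sym (row-cols s w c))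
        (All.map (λ {φ} → widen φ) (extGuards c))
        where
        widen : ∀ φ → Good W 7 [] φ → Good W 7 Extra φ
        widen φ (ok , d) = ok , λ {Γ} i → d {Γ} (λ {ψ} m → i {ψ} (∈-++⁺ʳ Extra m))

      newGuards : ∀ c → Occ w (term c) → All (Good (suc W) 9 Extra) (map (fsubF Θ) (rowGuards (term c) (rowOf s' c) reg))
      newGuards c o = subst (All (Good (suc W) 9 Extra)) (sym eq)
        (GuardTransfer.run-guards n {Good W 7 Extra} {Good (suc W) 9 Extra} (termθ c) PQ (weaken Extra) (theRun s w) g extTags c wg (extGuards' c))
        where
        bits : List Bool
        bits = Columns.row n (out s w) c
        bits≤ : length bits ≤ n
        bits≤ = ≤-trans (≤-reflexive (row-length (out s w) c)) (Columns.run-length n (theRun s w))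
        rows : rowOf s' c ≡ bits ++ zeros (n ∸ length bits)
        rows = trans (cong (λ z → rowOf z c) (proj₂ e)) (rowOf-δ s w c)
        eq : map (fsubF Θ) (rowGuards (term c) (rowOf s' c) reg) ≡ rowGuards (termθ c) bits tags
        eq = trans (rowGuards-sub Θ (term c) (rowOf s' c) reg)
          (trans (cong₂ (λ t u → rowGuards t u (fsubT Θ ∘ reg)) (Θterm o) rows)
            (trans (rowGuards-pad (termθ c) bits (n ∸ length bits) (fsubT Θ ∘ reg))
              (rowGuards-cong (termθ c) bits (λ i h → trans (embed-id (Θ (vN (suc (i * 2))))) (trans (Θ-v (reg< (≤-trans h bits≤))) (regVal-tag (≤-trans h bits≤)))))))

      uLow : ∀ j → j < suc n → j * 2 < p → Good (suc W) 9 Extra (num (rank j s') ≺ sc (ureg j))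
      uLow j h k = (≤-trans (≤-reflexive (num-size (rank j s'))) (rank-size in-states' j h) , s≤s (lit 1)) ,
        λ i → [ (λ lt → smaller lt i) , (λ q → unchanged q i) ]′ (m≤n⇒m<n∨m≡n (rank-mono j (e , <⇒≤ k)))
        where
        hr : suc (rank j s) ≤ W
        hr = rank-size in-states j h
        hs : termSize (num (rank j s)) ≤ W
        hs = ≤-trans (≤-reflexive (num-size (rank j s))) hr
        hs' : termSize (num (rank j s')) ≤ W
        hs' = ≤-trans (≤-reflexive (num-size (rank j s'))) (rank-size in-states' j h)
        old : ∀ {Γ} → (Extra ++ Ξ') ⊆ Γ → (num (rank j s) ≺ sc (ureg j)) ∈ Γ
        old i = i (∈-++⁺ʳ Extra (inG (∈-++⁺ˡ (∈-map⁺ (uGuard s) (∈-upTo⁺ h)))))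
        unchanged : rank j s' ≡ rank j s → ∀ {Γ} → (Extra ++ Ξ') ⊆ Γ → D 9 Γ [ num (rank j s') ≺ sc (ureg j) ]
        unchanged q {Γ} i = lift (m≤m+n 5 4) (idrD 2 (num (rank j s') ≺ sc (ureg j)) (≺-size (num (rank j s')) (sc (ureg j)) hs' (s≤s (lit 1)))
          (subst (λ z → (num z ≺ sc (ureg j)) ∈ Γ) (sym q) (old i)) (here refl))
        smaller : rank j s' < rank j s → ∀ {Γ} → (Extra ++ Ξ') ⊆ Γ → D 9 Γ [ num (rank j s') ≺ sc (ureg j) ]
        smaller lt i = lift (m≤m+n 7 2) (haveD 5 (num (rank j s') ≺ num (rank j s)) (up {2} {5} (m≤m+n 2 3) (≺-size (num (rank j s')) (num (rank j s)) hs' (≤-trans hs (n≤1+n W))))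
          (numLtD (rank j s') (rank j s) lt hr)
          (haveD 3 (num (rank j s') ≺ ureg j) (up {2} {3} (n≤1+n 2) (≺-size (num (rank j s')) (ureg j) hs' (≤-trans (lit 1) (n≤1+n W))))
            (transD (num (rank j s')) (num (rank j s)) (ureg j) hs' hs (lit 1) (here refl) (there (old i)))
            (stepD (num (rank j s')) (ureg j) hs' (lit 1) (here refl))))

      uHigh : ∀ j → j < suc n → Good (suc W) 9 Extra (num (rank j s') ≺ sc (num (rank j s')))
      uHigh j h = (hs' , s≤s hs') , λ i → lift (m≤m+n 3 6) (sucD (num (rank j s')) hs' (here refl))
        where
        hs' : termSize (num (rank j s')) ≤ W
        hs' = ≤-trans (≤-reflexive (num-size (rank j s'))) (rank-size in-states' j h)

      uNew : ∀ j → j < suc n → Good (suc W) 9 Extra (fsubF Θ (uGuard s' j))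
      uNew j h = subst (Good (suc W) 9 Extra) (sym (cong₂ (λ t u → t ≺ sc u) (fsubT-num Θ (rank j s')) (trans (embed-id (Θ (vN (j * 2)))) (Θ-v (*-monoˡ-< 2 h)))))
        (choose-elim (λ z → Good (suc W) 9 Extra (num (rank j s') ≺ sc z)) (j * 2 <? p) (uLow j h)
          (λ k → subst (λ z → Good (suc W) 9 Extra (num (rank j s') ≺ sc z)) (sym (alt-even (λ j → num (rank j s')) tags j)) (uHigh j h)))

      guardsΘ : All (Good (suc W) 9 Extra) (map (fsubF Θ) (guards s'))
      guardsΘ = All.tabulate (λ m → let φ , k , q = ∈-map⁻ (fsubF Θ) m in subst (Good (suc W) 9 Extra) (sym q) (one φ (∈-++⁻ (uGuards s') {rGuards s'} k)))
        where
        one : ∀ φ → φ ∈ uGuards s' ⊎ φ ∈ rGuards s' → Good (suc W) 9 Extra (fsubF Θ φ)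
        one φ (inj₁ k) = let j , l , q = ∈-map⁻ (uGuard s') k in subst (λ z → Good (suc W) 9 Extra (fsubF Θ z)) (sym q) (uNew j (∈-upTo⁻ l))
        one φ (inj₂ k) = let t , o , l = rGuards⁻ s' {φ} k in All.lookup (newGuards t o) (∈-map⁺ (fsubF Θ) l)

      -- The quantifiers of `Kf p` are instantiated by their own names, and `Θ` then replaces all of
      -- these at once by the substitution rule. By `ΘK` the hypothesis itself survives this
      -- unchanged.
      generic : D 12 (Kf p ∷ (fv (vN p) ≺ fv (yN p)) ∷ hyps s') (succ (seq π w))
      generic = haveD 10 E (base {_} {9} E≤) (lift (m≤m+n 7 3) (openK p p<L (here refl) (there (here refl))))
        (haveD 8 (Dform s') (base {_} {7} (Dform≤ in-states')) (lift (m≤m+n 4 4) (E-elim in-states' (here refl)))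
          (imp-elim in-states' (here refl) (there ∘ there ∘ there ∘ there)))

      generic-size : seqSize ((Kf p ∷ (fv (vN p) ≺ fv (yN p)) ∷ hyps s') ⇒ succ (seq π w)) ≤ W ^ 12
      generic-size = up {4} {12} (m≤m+n 4 8) (add₂ {3} (add₂ {2} (base {_} {1} (hK p p<L)) (add₂ {1} {3} (base {3} {0} (lit 3)) (base {_} {0} (hyps-sz in-states')))) (base {_} {2} (succ≤ w)))

      conclude : Good (suc W) 9 Extra (regVal p ≺ fv (yN p)) → D 18 (Extra ++ Ξ') Δθ
      conclude main = toD 18 cost (cutAll gs {Extra ++ Ξ'} {Δθ} {Γ₀} {Δ₀} (W ^ 2) g-size (λ φ m i → get (proj₂ (All.lookup gs-good m) i)) Γ₀⊆ (λ {φ} m → subst (φ ∈_) ΘΔ m) (get sub'))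
        where
        A = regVal p ≺ fv (yN p)
        gs : Cedent
        gs = A ∷ map (fsubF Θ) (guards s')
        Γ₀ Δ₀ : Cedent
        Γ₀ = map (fsubF Θ) (Kf p ∷ (fv (vN p) ≺ fv (yN p)) ∷ hyps s')
        Δ₀ = map (fsubF Θ) (succ (seq π w))
        gs-good : All (Good (suc W) 9 Extra) gs
        gs-good = main ∷ guardsΘ
        ok-size : ∀ φ → Ok W (suc W) φ → formSize φ ≤ W ^ 2
        ok-size (t ≺ u) (ht , hu) = ≺-size t u ht hu
        g-size : ∀ {φ} → φ ∈ gs → formSize φ ≤ W ^ 2
        g-size {φ} m = ok-size φ (proj₁ (All.lookup gs-good m))
        sub' : D 13 Γ₀ Δ₀
        sub' = subD 12 Θ generic-size generic
        A≡ : fsubF Θ (fv (vN p) ≺ fv (yN p)) ≡ A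
        A≡ = cong₂ _≺_ (trans (embed-id (Θ (vN p))) (Θ-v p<L)) (trans (embed-id (Θ (yN p))) (Θ-y p))
        split : ∀ {φ} → φ ∈ Γ₀ → φ ≡ Kf p ⊎ (φ ∈ gs ⊎ φ ∈ Γθ)
        split (here q) = inj₁ (trans q ΘK)
        split (there (here q)) = inj₂ (inj₁ (here (trans q A≡)))
        split {φ} (there (there m)) = [ (λ k → inj₂ (inj₁ (there k))) , (λ k → inj₂ (inj₂ (subst (φ ∈_) ΘΓ k))) ]′
          (∈-++⁻ (map (fsubF Θ) (guards s')) {map (fsubF Θ) (ante (seq π w))} (subst (φ ∈_) (map-++ (fsubF Θ) (guards s') (ante (seq π w))) m))
        Γ₀⊆ : Γ₀ ⊆ (gs ++ (Extra ++ Ξ'))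
        Γ₀⊆ {φ} m = [ (λ q → ∈-++⁺ʳ gs (∈-++⁺ʳ Extra (subst (_∈ Ξ') (sym q) (inCtx (ctx-K p L p<L))))) , [ ∈-++⁺ˡ , (λ k → ∈-++⁺ʳ gs (∈-++⁺ʳ Extra (∈-++⁺ˡ k))) ]′ ]′ (split m)
        Γ₀-size : ∀ φ → φ ∈ Γ₀ → formSize φ ≤ W ^ 2
        Γ₀-size φ m = [ (λ q → ≤-trans (≤-reflexive (cong formSize q)) (base {_} {1} (hK p p<L))) , [ g-size , (λ k → base {_} {1} (≤-trans (n≤1+n _) (Γθ-size k))) ]′ ]′ (split m)
        len : length (hyps s') ≤ W
        len = hyps-length in-states'
        Γ₀-len : length Γ₀ ≤ W ^ 2
        Γ₀-len = ≤-trans (≤-reflexive (length-map (fsubF Θ) (Kf p ∷ (fv (vN p) ≺ fv (yN p)) ∷ hyps s'))) (small² (≤-trans (s≤s (s≤s len)) (+-mono-≤ (m≤m+n 2 18) (m≤m+n W (9 * W)))))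
        gs-len : length gs ≤ W ^ 2
        gs-len = ≤-trans (s≤s (≤-trans (≤-reflexive (length-map (fsubF Θ) (guards s'))) (≤-trans (≤-trans (m≤m+n _ _) (≤-reflexive (sym (length-++ (guards s'))))) len))) (small² (+-mono-≤ (m≤m+n 1 19) (m≤m+n W (9 * W))))
        Δ₀-len : length (succ (seq π w)) ≤ W
        Δ₀-len = ≤-trans (≤-trans (m≤n+m _ (length (map dual (hyps s')))) (≤-reflexive (sym (length-++ (map dual (hyps s')))))) (disj-length in-states')
        Δ₀-size : sz Δ₀ ≤ W ^ 2
        Δ₀-size = ≤-trans (sz-bound Δ₀ (λ φ m → Δθ-size (subst (φ ∈_) ΘΔ m))) (mul {1} {1} {length Δ₀} (base {_} {0} (≤-trans (≤-reflexive (length-map (fsubF Θ) (succ (seq π w)))) Δ₀-len)) (base {_} {0} ≤-refl))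
        S₀≤ : seqSize (Γ₀ ⇒ Δ₀) ≤ W ^ 5
        S₀≤ = add₂ {4} (≤-trans (sz-bound Γ₀ Γ₀-size) (mul {2} {2} {length Γ₀} Γ₀-len ≤-refl)) (up {2} {4} (m≤m+n 2 2) Δ₀-size)
        cost : suc (W ^ 13 + seqSize (Γ₀ ⇒ Δ₀)) + length gs * suc (suc (W ^ 9) + W ^ 2) ≤ W ^ 18
        cost = up {15} {18} (m≤m+n 15 3) (add₂ {14} (rule₁-cost 13 ≤-refl (up {5} {13} (m≤m+n 5 8) S₀≤))
          (up {2 + 11} {14} (n≤1+n 13) (mul {2} {11} {length gs} gs-len (rule₁-cost 10 (suc₁ {9} ≤-refl) (pow-mono {2} {10} (m≤m+n 2 8))))))

halve : ∀ p → Σ ℕ λ j → p ≡ j * 2 ⊎ p ≡ suc (j * 2)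
halve zero = 0 , inj₁ refl
halve (suc zero) = 0 , inj₂ refl
halve (suc (suc p)) = let j , q = halve p in suc j , [ inj₁ ∘ cong (2 +_) , inj₂ ∘ cong (2 +_) ]′ q

side-fresh : ∀ r → Side r → ∀ {x} → eigen r ≡ suc x → ∀ φ → φ ∈S concl r → ¬ FreeF x φ
side-fresh (∀R Γ Δ ψ x) (f , g , h) refl φ (inj₁ m) = f φ m
side-fresh (∀R Γ Δ ψ x) (f , g , h) refl φ (inj₂ (here refl)) = h
side-fresh (∀R Γ Δ ψ x) (f , g , h) refl φ (inj₂ (there m)) = g φ m
side-fresh (∃L Γ Δ ψ x) (f , g , h) refl φ (inj₁ (here refl)) = h
side-fresh (∃L Γ Δ ψ x) (f , g , h) refl φ (inj₁ (there m)) = f φ m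
side-fresh (∃L Γ Δ ψ x) (f , g , h) refl φ (inj₂ m) = g φ m

pointwise-all : ∀ {A B : Set} {R : A → B → Set} {Q : B → Set} {xs ys} → Pointwise R xs ys → (∀ x y → x ∈ xs → R x y → Q y) → All Q ys
pointwise-all [] h = []
pointwise-all (r ∷ rs) h = h _ _ (here refl) r ∷ pointwise-all rs (λ x y m → h x y (there m))

pointwise-head : ∀ {A B : Set} {R : A → B → Set} {xs y} → Pointwise R xs (y ∷ []) → Σ A λ x → x ∈ xs × R x y
pointwise-head (r ∷ []) = _ , here refl , r

-- Edges, nodes and the root

module Global (π : Preproof) (gtc : (β : Branch π) → ProgressingTrace β) (W : ℕ) (32≤W : 32 ≤ W) (κ≤W : κ ≤ W)
  (hK : ∀ p → p < Main.L π → formSize (Main.Kf π p) ≤ W) (hL : Main.L π ≤ W) (hS : ∀ v → suc (seqSize (seq π v)) ≤ W) where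
  open Assemble π gtc W 32≤W κ≤W hK hL hS public
  open Lasso π gtc using (rank-strict)
  open RuleStep W 8≤W

  pN≢v : ∀ {i} → i < L → pN ≢ vN i
  pN≢v {i} h q = <-irrefl (sym (+-cancelˡ-≡ bnd _ _ q)) (≤-trans h (m≤m+n L L))

  pN≢y : ∀ {i} → i < L → pN ≢ yN i
  pN≢y {i} h q = <-irrefl (sym (+-cancelˡ-≡ L _ _ (+-cancelˡ-≡ bnd _ _ q))) h

  pN≮bnd : ¬ pN < bnd
  pN≮bnd h = <-irrefl refl (≤-trans h (m≤m+n bnd (L + L)))

  pN-hyps : ∀ s → FreshIn pN (hyps s)
  pN-hyps s φ m f = [ (λ k → pN≮bnd (X<bnd k)) , (λ { (i , h , q) → pN≢v h q }) ]′ (hyps-name s {φ} {pN} m f)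

  pN-ctx : FreshIn pN (ctx L)
  pN-ctx φ m f = [ (λ { (i , h , q) → pN≢v h q }) , (λ { (i , h , q) → pN≢y h q }) ]′ (ctx-name L {pN} {φ} ≤-refl m f)

  module _ (s s' : State) (r : Reachable s) (e : Edge s s') where
    open Premise s s' r e

    vp yp : Term 0
    vp = fv (vN p)
    yp = fv (yN p)

    y-bound : (vp ≺ sc yp) ∈ Ξ'
    y-bound = inCtx (ctx-y p L p<L)

    Γθ-sz : sz Γθ ≤ W ^ 2
    Γθ-sz = ≤-trans (sz-bound Γθ (λ φ m → ≤-trans (n≤1+n _) (Γθ-size m)))
      (mul {1} {1} {length Γθ} (base {_} {0} (≤-trans (≤-reflexive (length-map (fsubF θ) (ante (seq π w))))
        (≤-trans (≤-trans (m≤n+m _ (length (guards s'))) (≤-reflexive (sym (length-++ (guards s'))))) (hyps-length in-states')))) (base {_} {0} ≤-refl))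

    Δθ-sz : sz Δθ ≤ W ^ 2
    Δθ-sz = ≤-trans (sz-bound Δθ (λ φ m → Δθ-size m))
      (mul {1} {1} {length Δθ} (base {_} {0} (≤-trans (≤-reflexive (length-map (fsubF θ) (succ (seq π w))))
        (≤-trans (≤-trans (m≤n+m _ (length (map dual (hyps s')))) (≤-reflexive (sym (length-++ (map dual (hyps s')))))) (disj-length in-states')))) (base {_} {0} ≤-refl))

    Ξ'-sz : sz Ξ' ≤ W ^ 5
    Ξ'-sz = ≤-trans (≤-reflexive (trans (sz-++ Γθ Ξ) (cong (sz Γθ +_) (sz-++ (hyps s) (ctx L)))))
      (add₂ {4} (up {2} {4} (m≤m+n 2 2) Γθ-sz) (add₂ {3} (base {_} {2} (hyps-sz in-states)) (ctx≤ L ≤-refl)))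

    -- The chain is: new rank < old rank ≤ v_p ≤ y_p. The new rank itself becomes the next value of
    -- v_p.
    module Even (j : ℕ) (pe : p ≡ j * 2) where
      open With [] id (weaken [])

      j< : j < suc n
      j< = *-cancelʳ-< 2 j (suc n) (subst (_< L) pe p<L)

      hs : termSize (num (rank j s)) ≤ W
      hs = ≤-trans (≤-reflexive (num-size (rank j s))) (rank-size in-states j j<)
      hs' : termSize (num (rank j s')) ≤ W
      hs' = ≤-trans (≤-reflexive (num-size (rank j s'))) (rank-size in-states' j j<)

      guard : (num (rank j s) ≺ sc vp) ∈ Ξ'
      guard = subst (λ q → (num (rank j s) ≺ sc (fv (vN q))) ∈ Ξ') (sym pe) (inG (∈-++⁺ˡ (∈-map⁺ (uGuard s) (∈-upTo⁺ j<))))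

      descent : ∀ {Γ} → Ξ' ⊆ Γ → D 9 Γ [ num (rank j s') ≺ yp ]
      descent i = lift (m≤m+n 7 2) (haveD 5 (num (rank j s') ≺ num (rank j s)) (up {2} {5} (m≤m+n 2 3) (≺-size (num (rank j s')) (num (rank j s)) hs' (≤-trans hs (n≤1+n W))))
          (numLtD (rank j s') (rank j s) (rank-strict j r e pe) (rank-size in-states j j<))
          (haveD 3 (num (rank j s') ≺ vp) (up {2} {3} (n≤1+n 2) (≺-size (num (rank j s')) vp hs' (≤-trans (lit 1) (n≤1+n W))))
            (transD (num (rank j s')) (num (rank j s)) vp hs' hs (lit 1) (here refl) (there (i guard)))
            (transD (num (rank j s')) vp yp hs' (lit 1) (lit 1) (here refl) (there (there (i y-bound))))))

      val : regVal p ≡ num (rank j s')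
      val = trans (regVal-high ≤-refl) (trans (cong newRegs pe) (alt-even (λ j → num (rank j s')) tags j))

      result : D 18 Ξ' Δθ
      result = conclude (subst (λ z → Good (suc W) 9 [] (z ≺ yp)) (sym val) ((hs' , lit' ) , descent))
        where
        lit' : 1 ≤ suc W
        lit' = s≤s z≤n

    -- The register being reset is positive by `flash-guard`. Its predecessor, named `pN`, becomes
    -- the next value and satisfies pN < v_p ≤ y_p.
    module Odd (j : ℕ) (pe : p ≡ suc (j * 2)) where
      Extra : Cedent
      Extra = [ vp ≐ sc (fv pN) ]

      -- The property `wg` is demanded for every bound R although g acts on one register, so g is
      -- made the identity on all other terms, where weakening suffices.
      g : Term 0 → Term 0
      g R = choose (R ≟T vp) (fv pN) R

      wg : ∀ {t R} → Good W 7 Extra (t ≺ R) → Good (suc W) 9 Extra (t ≺ sc (g R))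
      wg {t} {R} q = choose-elim (λ z → Good (suc W) 9 Extra (t ≺ sc z)) (R ≟T vp) (λ eq → atReg (subst (λ z → Good W 7 Extra (t ≺ z)) eq q)) (λ _ → weaken Extra q)
        where
        atReg : Good W 7 Extra (t ≺ vp) → Good (suc W) 9 Extra (t ≺ sc (fv pN))
        atReg ((ht , _) , d) = (ht , s≤s (lit 1)) , λ i → haveD 7 (t ≺ vp) (up {2} {7} (m≤m+n 2 5) (≺-size t vp ht (s≤s z≤n))) (d i)
          (lift (m≤m+n 3 4) (predBoundD t vp (fv pN) ht (lit 1) (lit 1) (here refl) (there (i (here refl)))))

      open With Extra g wg

      j< : j < n
      j< = *-cancelʳ-< 2 j n (≤-trans (≤-reflexive (sym pe)) (prio≤ s w))

      regj : reg j ≡ vp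
      regj = cong (λ q → fv (vN q)) (sym pe)

      val : regVal p ≡ fv pN
      val = trans (regVal-high ≤-refl) (trans (cong newRegs pe) (trans (alt-odd (λ j → num (rank j s')) tags j)
        (trans (Columns.tagsRun-flash n (theRun s w) g extTags j pe) (choose-yes (extTags j ≟T vp) (trans (extTags-reg j<) regj)))))

      opened : D 18 (Extra ++ Ξ') Δθ
      opened = conclude (subst (λ z → Good (suc W) 9 Extra (z ≺ yp)) (sym val) ((lit 1 , s≤s z≤n) , λ i → lift (m≤m+n 5 4)
        (haveD 3 (fv pN ≺ vp) (base {3} {2} (lit 3)) (predLessD pN (vN p) (i (here refl)))
          (transD (fv pN) vp yp (lit 1) (lit 1) (lit 1) (here refl) (there (i (there y-bound)))))))

      ψ : Formula 0
      ψ = ∃' (fv (vN p) ≐ sc (bv zero))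

      flashed : D 9 Ξ' [ ψ ]
      flashed = use (proj₁ fg) (proj₂ fg {Good W 7 []} (termθ (proj₁ fg)) extTags (subst (λ u → All (Good W 7 []) (rowGuards (termθ (proj₁ fg)) u extTags)) (sym (row-cols s w (proj₁ fg))) (extGuards (proj₁ fg))))
        where
        fg = FlashGuard.flash-guard n (theRun s w) j pe
        use : ∀ c → Good W 7 [] (termθ c ≺ extTags j) → D 9 Ξ' [ ψ ]
        use c q = let (ht , _) , d = subst (λ z → Good W 7 [] (termθ c ≺ z)) (trans (extTags-reg j<) regj) q in
          haveD 7 (termθ c ≺ vp) (up {2} {7} (m≤m+n 2 5) (≺-size (termθ c) vp ht (s≤s z≤n))) (d id)
            (lift (m≤m+n 3 4) (predD (termθ c) (vN p) ht (here refl)))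

      freshΞ' : FreshIn pN (ψ ∷ Ξ')
      freshΞ' φ (here refl) (inj₁ f) = pN≢v p<L (fv-name f)
        where
        fv-name : ∀ {m x y} → FreeT {m} x (fv y) → x ≡ y
        fv-name here = refl
      freshΞ' φ (here refl) (inj₂ (sc₁ ()))
      freshΞ' φ (there m) f = [ (λ k → pN≮bnd (Γθ-name k f)) , (λ k → [ (λ l → pN-hyps s φ l f) , (λ l → pN-ctx φ l f) ]′ (∈-++⁻ (hyps s) {ctx L} k)) ]′ (∈-++⁻ Γθ {Ξ} m)

      result : D 23 Ξ' Δθ
      result = haveD 21 ψ (base {5} {20} (lit 5)) (lift (m≤m+n 9 12) flashed)
        (∃LD 20 pN (base {5} {19} (lit 5)) freshΞ' (λ φ m f → pN≮bnd (Δθ-name m f)) (here refl)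
          (wkD 19 size (∷-⊆ (here refl) (there ∘ there)) id (lift (n≤1+n 18) opened)))
        where
        size : seqSize ((Extra ++ Ξ') ⇒ Δθ) ≤ W ^ 19
        size = up {7} {19} (m≤m+n 7 12) (add₂ {6} (add₂ {5} {4} (base {4} {4} (lit 4)) Ξ'-sz) (up {2} {6} (m≤m+n 2 4) Δθ-sz))

    premiseD : D 23 Ξ' Δθ
    premiseD = let j , q = halve p in [ (λ pe → lift (m≤m+n 18 5) (Even.result j pe)) , (λ pe → Odd.result j pe) ]′ q

  module Node (s : State) (r : Reachable s) where

    v : Fin (nodes π)
    v = node s

    Ξ : Cedent
    Ξ = hyps s ++ ctx L

    Ξ-sz : sz Ξ ≤ W ^ 4
    Ξ-sz = ≤-trans (≤-reflexive (sz-++ (hyps s) (ctx L))) (add₂ {3} (base {_} {2} (hyps-sz (states⁺ r))) (ctx≤ L ≤-refl))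

    ante⊆ : ante (seq π v) ⊆ Ξ
    ante⊆ m = ∈-++⁺ˡ (∈-++⁺ʳ (guards s) m)

    edgeTo : ∀ w → w ∈ next π v → Edge s (δ s w)
    edgeTo w m = subst (_∈ next π v) (sym (node-δ s w)) m , cong (δ s) (sym (node-δ s w))

    Image : Subst → Fin (nodes π) → Set
    Image θ w = D 23 (map (fsubF θ) (ante (seq π w)) ++ Ξ) (map (fsubF θ) (succ (seq π w)))

    premiseAt : ∀ w → w ∈ next π v → Image (thetaOf (subView (rl π v))) w
    premiseAt w m = subst (Image (thetaOf (subView (rl π v)))) (node-δ s w) (premiseD s (δ s w) r (edgeTo w m))

    fresh-seq : ∀ x → eigen (rl π v) ≡ suc x → ∀ φ → φ ∈S seq π v → ¬ FreeF x φ
    fresh-seq x q φ m = side-fresh (rl π v) (side π v) q φ ([ inj₁ ∘ ≋⇒⊆ (proj₁ (lconc π v)) , inj₂ ∘ ≋⇒⊆ (proj₂ (lconc π v)) ]′ m)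

    fresh-Ξ : ∀ x → eigen (rl π v) ≡ suc x → FreshIn x Ξ
    fresh-Ξ x q φ m f = [ (λ k → [ (λ l → inGuards (guards-free s {φ} {x} l f)) , (λ l → fresh-seq x q φ (inj₁ l) f) ]′ (∈-++⁻ (guards s) {ante (seq π v)} k))
                        , (λ k → [ (λ { (i , _ , h) → v≮bnd (subst (_< bnd) h x<) }) , (λ { (i , _ , h) → y≮bnd (subst (_< bnd) h x<) }) ]′ (ctx-name L {x} {φ} ≤-refl k f)) ]′
                        (∈-++⁻ (hyps s) {ctx L} m)
      where
      x< : x < bnd
      x< = ≤-trans (≤-reflexive (sym q)) (eigen≤ v)
      inGuards : SeqName s x ⊎ IsReg x → ⊥
      inGuards (inj₁ (ψ , k , g)) = fresh-seq x q ψ k g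
      inGuards (inj₂ (i , _ , h)) = v≮bnd (subst (_< bnd) h x<)

    -- For a substitution rule nothing remains to be applied: the premise was derived in its
    -- substituted form, which is the conclusion up to weakening.
    byRule : (V : SubView (rl π v)) → (∀ w → w ∈ next π v → Image (thetaOf V) w) → D 31 Ξ (succ (seq π v))
    byRule (isSub θ Γ Δ q) h = let w , m , k = pointwise-head (subst (λ ρ → Pointwise (λ w S → seq π w ≈S S) (next π v) (prems ρ)) q (lprem π v)) in at w m k
      where
      conc : seq π v ≈S concl (subR θ Γ Δ)
      conc = subst (λ ρ → seq π v ≈S concl ρ) q (lconc π v)
      at : ∀ w → w ∈ next π v → seq π w ≈S (Γ ⇒ Δ) → D 31 Ξ (succ (seq π v))
      at w m (kL , kR) = lift (m≤m+n 24 7) (wkD 23 size (++-⊆ (ante⊆ ∘ half (proj₁ conc) kL) id) (half (proj₂ conc) kR) (h w m))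
        where
        half : ∀ {A B C} → A ≋ map (fsubF θ) B → C ≋ B → map (fsubF θ) C ⊆ A
        half a c n = let χ , l , eq = ∈-map⁻ (fsubF θ) n in ≋⇒⊇ a (subst (_∈ _) (sym eq) (∈-map⁺ (fsubF θ) (≋⇒⊆ c l)))
        s' : State
        s' = δ s w
        inw : s' ∈ states
        inw = states⁺ (r ◅◅ (edgeTo w m ◅ ε))
        lenL : length (ante (seq π w)) ≤ W
        lenL = subst (λ z → length (ante (seq π z)) ≤ W) (node-δ s w)
          (≤-trans (≤-trans (m≤n+m _ (length (guards s'))) (≤-reflexive (sym (length-++ (guards s'))))) (hyps-length inw))
        lenR : length (succ (seq π w)) ≤ W
        lenR = subst (λ z → length (succ (seq π z)) ≤ W) (node-δ s w)
          (≤-trans (≤-trans (m≤n+m _ (length (map dual (hyps s')))) (≤-reflexive (sym (length-++ (map dual (hyps s')))))) (disj-length inw))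
        szL : sz (map (fsubF θ) (ante (seq π w))) ≤ W ^ 2
        szL = ≤-trans (sz-bound (map (fsubF θ) (ante (seq π w))) (λ φ n → ≤-trans (∈-size (half (proj₁ conc) kL n)) (ante≤ v)))
          (mul {1} {1} {length (map (fsubF θ) (ante (seq π w)))} (base {_} {0} (≤-trans (≤-reflexive (length-map (fsubF θ) (ante (seq π w)))) lenL)) (base {_} {0} ≤-refl))
        szR : sz (map (fsubF θ) (succ (seq π w))) ≤ W ^ 2
        szR = ≤-trans (sz-bound (map (fsubF θ) (succ (seq π w))) (λ φ n → ≤-trans (∈-size (half (proj₂ conc) kR n)) (succ≤ v)))
          (mul {1} {1} {length (map (fsubF θ) (succ (seq π w)))} (base {_} {0} (≤-trans (≤-reflexive (length-map (fsubF θ) (succ (seq π w)))) lenR)) (base {_} {0} ≤-refl))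
        size : seqSize ((map (fsubF θ) (ante (seq π w)) ++ Ξ) ⇒ map (fsubF θ) (succ (seq π w))) ≤ W ^ 23
        size = up {6} {23} (m≤m+n 6 17) (≤-trans (≤-reflexive (cong (_+ sz (map (fsubF θ) (succ (seq π w)))) (sz-++ (map (fsubF θ) (ante (seq π w))) Ξ)))
          (add₂ {5} (add₂ {4} (up {2} {4} (m≤m+n 2 2) szL) Ξ-sz) (up {2} {5} (m≤m+n 2 3) szR)))
    byRule (notSub st _ _) h = ruleStep 23 Ξ (succ (seq π v)) (up {4} {23} (m≤m+n 4 19) Ξ-sz) (seq π v) (≤-trans (n≤1+n _) (hS v)) ante⊆ id (rl π v) st (side π v) (lconc π v)
      fresh-Ξ (λ x q _ φ m → fresh-seq x q φ (inj₂ m))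
      (pointwise-all (lprem π v) (λ w S m k → seq π w , k , ≤-trans (n≤1+n _) (hS w) , subst₂ (λ A B → D 23 (A ++ Ξ) B) (map-fv (ante (seq π w))) (map-fv (succ (seq π w))) (h w m)))

    nodeD : D 31 Ξ (succ (seq π v))
    nodeD = byRule (subView (rl π v)) premiseAt

    formD : D 38 (ctx L) [ Dform s ]
    formD = toD 38 cost (impR (hyps s) (succ (seq π v)) {ctx L} {Ξ} W (λ m → ≤-trans (∈-size m) (hyps-sz (states⁺ r))) id (get nodeD))
      where
      S₁≤ : seqSize (Ξ ⇒ succ (seq π v)) ≤ W ^ 31
      S₁≤ = up {5} {31} (m≤m+n 5 26) (add₂ {4} Ξ-sz (base {_} {3} (succ≤ v)))
      S₂≤ : seqSize (ctx L ⇒ (map dual (hyps s) ++ succ (seq π v))) ≤ W ^ 33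
      S₂≤ = up {4} {33} (m≤m+n 4 29) (add₂ {3} (ctx≤ L ≤-refl) (base {_} {2} (disj-sz (states⁺ r))))
      cost : suc (suc (W ^ 31 + seqSize (Ξ ⇒ succ (seq π v))) + length (hyps s) * suc (contraCost W + W) + seqSize (ctx L ⇒ (map dual (hyps s) ++ succ (seq π v))))
        + length (map dual (hyps s) ++ succ (seq π v)) * suc (formSize (Dform s)) ≤ W ^ 38
      cost = up {35} {38} (m≤m+n 35 3) (add₂ {34}
        (rule₂-cost 33 (up {32} {33} (n≤1+n 32) (rule₁-cost 31 ≤-refl S₁≤))
          (up {6} {33} (m≤m+n 6 27) (mul {1} {5} {length (hyps s)} (base {_} {0} (hyps-length (states⁺ r))) (rule₁-cost 4 (contraCost≤ {1} (base {_} {0} ≤-refl)) (base {_} {3} ≤-refl))))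
          S₂≤)
        (up {3} {34} (m≤m+n 3 31) (mul {1} {2} {length (disjuncts s)} (base {_} {0} (disj-length (states⁺ r))) (suc₁ {1} (base {_} {0} (Dform≤ (states⁺ r)))))))

  leafD : D 42 (ctx L) [ E ]
  leafD = toD 42 cost (coerceR (sym E≡) (⋀R (map Dform states) (λ φ m → let s , k , q = ∈-map⁻ Dform m in coerceR (sym q) (get (Node.formD s (states⁻ k))))))
    where
    cost : 5 + length (map Dform states) * suc (suc (W ^ 38) + formSize (⋀ (map Dform states))) ≤ W ^ 42
    cost = add₂ {41} {5} (base {5} {40} (lit 5)) (mul {1} {40} {length (map Dform states)} (base {_} {0} states-length) (rule₁-cost 39 (suc₁ {38} ≤-refl) (base {_} {38} ⋀≤)))

  allD : D (L * 34 + 42) [] [ E ]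
  allD = descend 42 L 0 (+-identityʳ L) leafD

  -- Each rank component starts at the rank of the initial state. The registers track nothing there,
  -- so zero serves for them.
  Θ₀ : Subst
  Θ₀ x = choose (x <? bnd) (fv x) (alt (λ j → num (rank j initial)) (λ _ → zer) (x ∸ bnd))

  Θ₀-u : ∀ j → Θ₀ (vN (j * 2)) ≡ num (rank j initial)
  Θ₀-u j = trans (choose-no (vN (j * 2) <? bnd) v≮bnd) (trans (cong (alt (λ j → num (rank j initial)) (λ _ → zer)) (m+n∸m≡n bnd (j * 2))) (alt-even _ _ j))

  noRows : ∀ {φ} → φ ∈ rGuards initial → ⊥
  noRows {φ} m = let t , _ , k = rGuards⁻ initial {φ} m in none t k
    where
    blank : ∀ t → rowOf initial t ≡ zeros n
    blank t = trans (tabulate-cong (mat-encode (root π) (λ _ _ → false) t)) (tabulate-nthB n [] z≤n)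
    none : ∀ t → φ ∈ rowGuards (term t) (rowOf initial t) reg → ⊥
    none t k = case subst (φ ∈_) (rowGuards-none (term t) (rowOf initial t) reg (trans (cong anyB (blank t)) (anyB-zeros n))) k of λ ()

  rootD : ∀ φ → seq π (root π) ≈S ([] ⇒ [ φ ]) → D (L * 34 + 70) [] [ φ ]
  rootD φ (eL , eR) = lift (≤-reflexive (trans (sym (+-assoc 28 (L * 34) 42)) (trans (cong (_+ 42) (+-comm 28 (L * 34))) (+-assoc (L * 34) 28 42))))
      (wkD (27 + a) Δ≤ id Δ⊆ (toD (27 + a) cost (cutAll gs {[]} {succ (seq π v₀)} {Γ₀} {Δ₀} (W ^ 2) gs-size (λ g m _ → get (good g m)) Γ₀⊆ (λ {χ} m → subst (χ ∈_) Δ₀≡ m) (get substituted))))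
    where
    a = L * 34 + 42
    v₀ = node initial
    inI : initial ∈ states
    inI = states⁺ ε
    v₀≡ : v₀ ≡ root π
    v₀≡ = node-initial
    noAnte : ∀ {χ} → χ ∈ ante (seq π v₀) → ⊥
    noAnte {χ} m = case ≋⇒⊆ eL (subst (λ z → χ ∈ ante (seq π z)) v₀≡ m) of λ ()
    Δ⊆ : succ (seq π v₀) ⊆ [ φ ]
    Δ⊆ {χ} m = ≋⇒⊆ eR (subst (λ z → χ ∈ succ (seq π z)) v₀≡ m)
    Δ≤ : seqSize ([] ⇒ succ (seq π v₀)) ≤ W ^ (27 + a)
    Δ≤ = base {_} {26 + a} (succ≤ v₀)
    generic : D (12 + a) (hyps initial) (succ (seq π v₀))
    generic = haveD (10 + a) E (base {_} {9 + a} E≤) (lift (m≤n+m (1 + a) 9) (dropD a z≤n ∅-⊆ allD))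
      (haveD (8 + a) (Dform initial) (base {_} {7 + a} (Dform≤ inI)) (lift (≤-trans (m≤m+n 4 4) (m≤m+n 8 a)) (E-elim inI (here refl)))
        (lift (m≤m+n 8 a) (imp-elim inI (here refl) (there ∘ there))))
    size : seqSize (hyps initial ⇒ succ (seq π v₀)) ≤ W ^ (12 + a)
    size = add₂ {11 + a} (base {_} {10 + a} (hyps-sz inI)) (base {_} {10 + a} (succ≤ v₀))
    Γ₀ Δ₀ gs : Cedent
    Γ₀ = map (fsubF Θ₀) (hyps initial)
    Δ₀ = map (fsubF Θ₀) (succ (seq π v₀))
    gs = map (fsubF Θ₀) (uGuards initial)
    substituted : D (13 + a) Γ₀ Δ₀
    substituted = subD (12 + a) Θ₀ size generic
    Δ₀≡ : Δ₀ ≡ succ (seq π v₀)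
    Δ₀≡ = map-id-on Θ₀ (succ (seq π v₀)) (λ χ m → fsubF-id χ (λ x f → choose-yes (x <? bnd) (seq-name< v₀ {χ} {x} (inj₂ m) f)))
    Γ₀⊆ : Γ₀ ⊆ (gs ++ [])
    Γ₀⊆ {χ} m = let ψ , k , q = ∈-map⁻ (fsubF Θ₀) m in ∈-++⁺ˡ (subst (_∈ gs) (sym q) (place ψ (∈-++⁻ (guards initial) {ante (seq π v₀)} k)))
      where
      place : ∀ ψ → ψ ∈ guards initial ⊎ ψ ∈ ante (seq π v₀) → fsubF Θ₀ ψ ∈ gs
      place ψ (inj₁ k) = [ ∈-map⁺ (fsubF Θ₀) , (λ l → ⊥-elim (noRows {ψ} l)) ]′ (∈-++⁻ (uGuards initial) {rGuards initial} k)
      place ψ (inj₂ k) = ⊥-elim (noAnte k)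
    gs⁻ : ∀ {g} → g ∈ gs → Σ ℕ λ j → j < suc n × g ≡ (num (rank j initial) ≺ sc (num (rank j initial)))
    gs⁻ m = let ψ , k , q = ∈-map⁻ (fsubF Θ₀) m
                j , l , q' = ∈-map⁻ (uGuard initial) k
            in j , ∈-upTo⁻ l , trans q (trans (cong (fsubF Θ₀) q') (cong₂ (λ t u → t ≺ sc u) (fsubT-num Θ₀ (rank j initial)) (trans (embed-id (Θ₀ (vN (j * 2)))) (Θ₀-u j))))
    num≤ : ∀ j → j < suc n → termSize (num (rank j initial)) ≤ W
    num≤ j h = ≤-trans (≤-reflexive (num-size (rank j initial))) (rank-size inI j h)
    gs-size : ∀ {g} → g ∈ gs → formSize g ≤ W ^ 2
    gs-size m = let j , h , q = gs⁻ m in ≤-trans (≤-reflexive (cong formSize q)) (≺-size (num (rank j initial)) (sc (num (rank j initial))) (num≤ j h) (s≤s (num≤ j h)))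
    good : ∀ g → g ∈ gs → ∀ {Γ} → D 3 Γ [ g ]
    good g m {Γ} = let j , h , q = gs⁻ m in subst (λ z → D 3 Γ [ z ]) (sym q) (sucD (num (rank j initial)) (num≤ j h) (here refl))
    gs-len : length gs ≤ W
    gs-len = ≤-trans (≤-reflexive (length-map (fsubF Θ₀) (uGuards initial)))
      (≤-trans (≤-trans (m≤m+n _ _) (≤-trans (≤-reflexive (sym (length-++ (uGuards initial)))) (≤-trans (m≤m+n _ _) (≤-reflexive (sym (length-++ (guards initial))))))) (hyps-length inI))
    Γ₀-size : sz Γ₀ ≤ W ^ 3
    Γ₀-size = ≤-trans (sz-bound Γ₀ (λ χ m → [ gs-size , (λ ()) ]′ (∈-++⁻ gs {[]} (Γ₀⊆ m)))) (mul {1} {2} {length Γ₀} (base {_} {0} (≤-trans (≤-reflexive (length-map (fsubF Θ₀) (hyps initial))) (hyps-length inI))) ≤-refl)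
    cost : suc (W ^ (13 + a) + seqSize (Γ₀ ⇒ Δ₀)) + length gs * suc (suc (W ^ 3) + W ^ 2) ≤ W ^ (27 + a)
    cost = up {15 + a} {27 + a} (+-monoˡ-≤ a (m≤m+n 15 12)) (add₂ {14 + a}
      (rule₁-cost (13 + a) ≤-refl (up {4} {13 + a} (≤-trans (m≤m+n 4 9) (m≤m+n 13 a)) (add₂ {3} Γ₀-size (≤-trans (≤-reflexive (cong sz Δ₀≡)) (base {_} {2} (succ≤ v₀))))))
      (up {6} {14 + a} (≤-trans (m≤m+n 6 8) (m≤m+n 14 a)) (mul {1} {5} {length gs} (base {_} {0} gs-len) (rule₁-cost 4 (suc₁ {3} ≤-refl) (pow-mono {2} {4} (m≤m+n 2 2))))))

-- Size bounds


formSize≥1 : ∀ {n} (φ : Formula n) → 1 ≤ formSize φ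
formSize≥1 (t ≐ u) = s≤s z≤n
formSize≥1 (t ≺ u) = s≤s z≤n
formSize≥1 (t ≉ u) = s≤s z≤n
formSize≥1 (t ⊀ u) = s≤s z≤n
formSize≥1 (φ ∧' ψ) = s≤s z≤n
formSize≥1 (φ ∨' ψ) = s≤s z≤n
formSize≥1 (∀' φ) = s≤s z≤n
formSize≥1 (∃' φ) = s≤s z≤n

length≤sz : ∀ Γ → length Γ ≤ sz Γ
length≤sz [] = z≤n
length≤sz (φ ∷ Γ) = +-mono-≤ (formSize≥1 φ) (length≤sz Γ)

concatMap-length : ∀ {A B : Set} (f : A → List B) k xs → (∀ x → length (f x) ≤ k) → length (concatMap f xs) ≤ length xs * k
concatMap-length f k [] h = z≤n
concatMap-length f k (x ∷ xs) h = ++-length≤ (f x) (h x) (concatMap-length f k xs h)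

onlyIf-length : ∀ {A P : Set} (d : Dec P) (a : A) → length (onlyIf d a) ≤ 1
onlyIf-length (yes _) a = ≤-refl
onlyIf-length (no _) a = z≤n

when-length : ∀ {A P : Set} (d : Dec P) (xs : List A) → length (when d xs) ≤ length xs
when-length (yes _) xs = ≤-refl
when-length (no _) xs = z≤n

module Sizes (π : Preproof) (2≤N : 2 ≤ ppSize π) where
  open Main π

  -- A state stores n·n bits with n ≤ N, hence 2 to the N·N. The assumption 2 ≤ N makes V at least
  -- 16, enough for the arithmetic of powers.
  N V : ℕ
  N = ppSize π
  V = 2 ^ (N * N)

  N≤N² : N ≤ N * N
  N≤N² = ≤-trans (≤-reflexive (sym (*-identityʳ N))) (*-monoʳ-≤ N (≤-trans (s≤s z≤n) 2≤N))

  N≤V : N ≤ V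
  N≤V = ≤-trans (<⇒≤ (n<2^n N)) (^-monoʳ-≤ 2 N≤N²)

  8≤V : 8 ≤ V
  8≤V = ≤-trans (m≤m+n 8 8) (^-monoʳ-≤ 2 {4} (*-mono-≤ 2≤N 2≤N))

  open Scaled V 8≤V

  node≤ : ∀ v → suc (seqSize (seq π v)) ≤ N
  node≤ v = sumFin-≥ (nodes π) (λ v → suc (seqSize (seq π v))) v

  nodes≤ : nodes π ≤ N
  nodes≤ = sumFin-count (nodes π) (λ v → suc (seqSize (seq π v))) (λ _ → s≤s z≤n)

  n≤N : n ≤ N
  n≤N = gather-length (nodes π) (λ v → collect subsF (seq π v)) (λ v → suc (seqSize (seq π v))) (λ v → m≤n⇒m≤1+n (collect-length subsF subsF-length (seq π v)))

  X≤N : length X ≤ N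
  X≤N = gather-length (nodes π) (λ v → collect namesF (seq π v)) (λ v → suc (seqSize (seq π v))) (λ v → m≤n⇒m≤1+n (collect-length namesF namesF-length (seq π v)))

  M≤ : M ≤ V ^ 2
  M≤ = mul {1} {1} {nodes π} (base {_} {0} (≤-trans nodes≤ N≤V)) (base {_} {0} (≤-trans (≤-reflexive (^-*-assoc 2 n n)) (^-monoʳ-≤ 2 (*-mono-≤ n≤N n≤N))))

  small : ∀ k {_ : T (k ≤ᵇ 8)} → k ≤ V
  small k {h} = ≤-trans (≤ᵇ⇒≤ k 8 h) 8≤V

  n≤V : ∀ {x} → x ≤ N → x ≤ V ^ 1
  n≤V h = base {_} {0} (≤-trans h N≤V)

  ante-length : ∀ v → length (ante (seq π v)) ≤ N
  ante-length v = ≤-trans (length≤sz (ante (seq π v))) (≤-trans (m≤m+n _ _) (≤-trans (n≤1+n _) (node≤ v)))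

  succ-length : ∀ v → length (succ (seq π v)) ≤ N
  succ-length v = ≤-trans (length≤sz (succ (seq π v))) (≤-trans (m≤n+m _ (sz (ante (seq π v)))) (≤-trans (n≤1+n _) (node≤ v)))

  ∈S-size : ∀ {v φ} → φ ∈S seq π v → formSize φ ≤ N
  ∈S-size {v} m = ≤-trans ([ (λ k → ≤-trans (∈-size k) (m≤m+n _ _)) , (λ k → ≤-trans (∈-size k) (m≤n+m _ (sz (ante (seq π v))))) ]′ m) (≤-trans (n≤1+n _) (node≤ v))

  occ≤ : ∀ {v t} → Occ v t → termSize t ≤ N
  occ≤ {v} o = let φ , m , k = collect⁻ subsF (seq π v) o in ≤-trans (subsF-size φ k) (∈S-size {v} m)

  uGuard-size : ∀ s j → formSize (uGuard s j) ≤ V ^ 4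
  uGuard-size s j = rule₁-cost 3 (≤-trans (≤-reflexive (num-size (rank j s))) (suc₁ {2} (≤-trans (rank≤ j s) M≤))) (base {2} {2} (small 2))

  guard-size : ∀ s {φ} → φ ∈ guards s → formSize φ ≤ V ^ 4
  guard-size s {φ} m = [ (λ k → upper (∈-map⁻ (uGuard s) k)) , (λ k → lower (rGuards⁻ s {φ} k)) ]′ (∈-++⁻ (uGuards s) {rGuards s} m)
    where
    upper : Σ ℕ (λ j → j ∈ upTo (suc n) × φ ≡ uGuard s j) → formSize φ ≤ V ^ 4
    upper (j , _ , q) = ≤-trans (≤-reflexive (cong formSize q)) (uGuard-size s j)
    lower : Σ (Fin n) (λ t → Occ (node s) (term t) × φ ∈ rowGuards (term t) (rowOf s t) reg) → formSize φ ≤ V ^ 4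
    lower (t , o , l) = ≤-trans (rowGuards-size {φ} {1} (term t) (rowOf s t) reg (λ _ → ≤-refl) l) (rule₁-cost 3 (base {_} {2} (≤-trans (occ≤ o) N≤V)) (base {2} {2} (small 2)))

  guards-length : ∀ s → length (guards s) ≤ V ^ 3
  guards-length s = ≤-trans (≤-reflexive (length-++ (uGuards s))) (add₂ {2}
    (≤-trans (≤-reflexive (trans (length-map (uGuard s) (upTo (suc n))) (length-upTo (suc n)))) (suc₁ {1} (n≤V n≤N)))
    (≤-trans (concatMap-length (rGuards-at s) n (allFin n) (λ t → ≤-trans (when-length (occ? (node s) (term t)) _) (≤-trans (rowGuards-length (term t) (rowOf s t) reg) (≤-reflexive (rowOf-length s t)))))
      (≤-trans (≤-reflexive (cong (_* n) (length-tabulate {n = n} id))) (mul {1} {1} {n} (n≤V n≤N) (n≤V n≤N)))))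

  hyps-length' : ∀ s → length (hyps s) ≤ V ^ 4
  hyps-length' s = ≤-trans (≤-reflexive (length-++ (guards s))) (add₂ {3} (guards-length s) (up {1} {3} (m≤m+n 1 2) (n≤V (ante-length (node s)))))

  hyps-size' : ∀ s {φ} → φ ∈ hyps s → formSize φ ≤ V ^ 4
  hyps-size' s {φ} m = [ guard-size s , (λ k → up {1} {4} (m≤m+n 1 3) (n≤V (∈S-size {node s} {φ} (inj₁ k)))) ]′ (∈-++⁻ (guards s) {ante (seq π (node s))} m)

  Dform-size : ∀ s → formSize (Dform s) ≤ V ^ 11
  Dform-size s = ≤-trans (≤-reflexive (trans (⋁-size (map dual (hyps s) ++ Δ)) (cong₂ (λ a b → a + b + 3) (trans (length-++ (map dual (hyps s))) (cong (_+ length Δ) (length-map dual (hyps s)))) (trans (sz-++ (map dual (hyps s)) Δ) (cong (_+ sz Δ) (sz-dual (hyps s)))))))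
    (add₂ {10} (add₂ {9} (up {5} {9} (m≤m+n 5 4) (add₂ {4} (hyps-length' s) (up {1} {4} (m≤m+n 1 3) (n≤V (succ-length (node s))))))
      (add₂ {8} (≤-trans (sz-bound (hyps s) (λ φ m → hyps-size' s m)) (mul {4} {4} {length (hyps s)} (hyps-length' s) ≤-refl)) (base {_} {7} (≤-trans (≤-trans (m≤n+m _ (sz (ante (seq π (node s))))) (≤-trans (n≤1+n _) (node≤ (node s)))) N≤V))))
      (base {3} {9} (small 3)))
    where
    Δ = succ (seq π (node s))

  states≤ : length states ≤ V ^ 2
  states≤ = ≤-trans (concatMap-length (λ s → onlyIf (reachable? s) s) 1 (allFin M) (λ s → onlyIf-length (reachable? s) s))
    (≤-trans (≤-reflexive (trans (*-identityʳ _) (length-tabulate {n = M} id))) M≤)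

  E-size : formSize E ≤ V ^ 15
  E-size = ≤-trans (≤-reflexive (trans (cong formSize E≡) (trans (⋀-size (map Dform states)) (cong (λ z → z + sz (map Dform states) + 3) (length-map Dform states)))))
    (add₂ {14} (add₂ {13} (up {2} {13} (m≤m+n 2 11) states≤)
      (≤-trans (sz-bound (map Dform states) (λ φ m → let s , _ , q = ∈-map⁻ Dform m in ≤-trans (≤-reflexive (cong formSize q)) (Dform-size s)))
        (mul {2} {11} {length (map Dform states)} (≤-trans (≤-reflexive (length-map Dform states)) states≤) ≤-refl)))
      (base {3} {13} (small 3)))

  L≤ : L ≤ V ^ 3
  L≤ = mul {2} {1} {suc n} (suc₁ {1} (n≤V n≤N)) (base {2} {0} (small 2))

  K-size' : ∀ p → formSize (Kf p) ≤ V ^ 17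
  K-size' p = ≤-trans (≤-reflexive (closeAll-size (xs p) (body p (fv (yN p)))))
    (add₂ {16} (up {4} {16} (m≤m+n 4 12) (≤-trans (≤-reflexive (trans (length-++ (vsFrom p (L ∸ p))) (cong (_+ length X) (vsFrom-length p (L ∸ p)))))
      (add₂ {3} (≤-trans (m∸n≤m L p) L≤) (up {1} {3} (m≤m+n 1 2) (n≤V X≤N)))))
      (add₂ {15} {4} (base {4} {14} (small 4)) E-size))

  -- The summand 17 is the exponent of the largest formulas, in `K-size'`; κ is added because κ ≤
  -- V^κ, which brings the order lemmas under W.
  e₀ : ℕ
  e₀ = 17 + κ

  W : ℕ
  W = V ^ e₀

  V≤W : ∀ {x} a → a ≤ 17 → x ≤ V ^ a → x ≤ W
  V≤W a h q = up (≤-trans h (m≤m+n 17 κ)) q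

  32≤W : 32 ≤ W
  32≤W = V≤W 2 (m≤m+n 2 15) (≤-trans (m≤m+n 32 32) (≤-trans (*-mono-≤ 8≤V 8≤V) (≤-reflexive (cong (V *_) (sym (*-identityʳ V))))))

  κ≤W : κ ≤ W
  κ≤W = up (m≤n+m κ 17) (self≤pow κ)

-- The total is V to the power e₀(2a + 1) with a = 34L + 70. As 2a + 1 = 68L + 141 and L ≤ 3N, this
-- factor is at most 345N, since 3·68 + 141 = 345. The summand 3 collects this N and the N·N in V.
constant : ℕ
constant = 3 + (17 + κ) * 345

-- A constant factor c is absorbed into the exponent through c < 2^c ≤ N^c, so that the bound is a
-- pure power of N.
exponent-bound : ∀ N e L → 2 ≤ N → L ≤ 3 * N → N * N * (e * (suc (L * 34 + 70) + (L * 34 + 70))) ≤ N ^ (3 + e * 345)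
exponent-bound N e L 2≤N hL = begin
    N * N * (e * (suc (L * 34 + 70) + (L * 34 + 70)))
  ≤⟨ *-monoʳ-≤ (N * N) (*-monoʳ-≤ e (≤-trans (≤-reflexive (solve 1 (λ l → con 1 :+ (l :* con 34 :+ con 70) :+ (l :* con 34 :+ con 70) := con 68 :* l :+ con 141) refl L)) (≤-trans (+-mono-≤ (*-monoʳ-≤ 68 hL) (*-monoʳ-≤ 141 (≤-trans (s≤s z≤n) 2≤N))) (≤-reflexive (solve 1 (λ x → con 68 :* (con 3 :* x) :+ con 141 :* x := con 345 :* x) refl N))))) ⟩
    N * N * (e * (345 * N))
  ≡⟨ solve 2 (λ x k → x :* x :* (k :* (con 345 :* x)) := x :* (x :* (x :* con 1)) :* (k :* con 345)) refl N e ⟩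
    N ^ 3 * (e * 345)
  ≤⟨ *-monoʳ-≤ (N ^ 3) (≤-trans (<⇒≤ (n<2^n (e * 345))) (^-monoˡ-≤ (e * 345) 2≤N)) ⟩
    N ^ 3 * N ^ (e * 345)
  ≡⟨ sym (^-distribˡ-+-* N 3 (e * 345)) ⟩
    N ^ (3 + e * 345) ∎
  where
  open ≤-Reasoning
  open +-*-Solver

cyclic-to-PA : (φ : Formula 0) (π : CAProof ([] ⇒ (φ ∷ []))) → Σ (PAProof ([] ⇒ (φ ∷ []))) λ ρ → paSize ρ ≤ 2 ^ (ppSize (pre π) ^ constant)
cyclic-to-PA φ π = Der.proof result , final
  where
  π₀ = pre π
  φ∈ : φ ∈ succ (seq π₀ (root π₀))
  φ∈ = ≋⇒⊇ (proj₂ (rootSeq π)) (here refl)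
  root≤ : suc (formSize φ) ≤ ppSize π₀
  root≤ = ≤-trans (s≤s (≤-trans (∈-size φ∈) (m≤n+m _ (sz (ante (seq π₀ (root π₀))))))) (sumFin-≥ (nodes π₀) (λ v → suc (seqSize (seq π₀ v))) (root π₀))
  2≤N : 2 ≤ ppSize π₀
  2≤N = ≤-trans (s≤s (formSize≥1 φ)) root≤
  open Sizes π₀ 2≤N
  open Main π₀ using (L)
  open Scaled W (≤-trans (m≤m+n 8 24) 32≤W)
  a = L * 34 + 70
  result : Der (W ^ a) [] [ φ ]
  result = D.get {a} {[]} {[ φ ]} (Global.rootD π₀ (gtc π) W 32≤W κ≤W (λ p _ → V≤W 17 ≤-refl (K-size' p)) (V≤W 3 (m≤m+n 3 14) L≤)
    (λ v → V≤W 1 (s≤s z≤n) (n≤V (node≤ v))) φ (rootSeq π))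
  L≤3N : L ≤ 3 * ppSize π₀
  L≤3N = ≤-trans (+-monoʳ-≤ 2 (*-monoˡ-≤ 2 n≤N)) (≤-trans (+-monoˡ-≤ (N * 2) 2≤N) (≤-reflexive (solve 1 (λ x → x :+ x :* con 2 := con 3 :* x) refl N)))
    where open +-*-Solver
  final : paSize (Der.proof result) ≤ 2 ^ (ppSize π₀ ^ constant)
  final = begin
    paSize (Der.proof result) ≤⟨ Der.bound result ⟩
    W ^ a * (formSize φ + 0 + W ^ a) ≤⟨ *-monoʳ-≤ (W ^ a) (add₂ {a} (≤-trans (≤-reflexive (+-identityʳ (formSize φ))) (up {1} {a} (≤-trans (m≤m+n 1 69) (m≤n+m 70 (L * 34))) (base {_} {0} (V≤W 1 (s≤s z≤n) (n≤V (≤-trans (n≤1+n _) root≤)))))) ≤-refl) ⟩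
    W ^ a * W ^ suc a ≡⟨ trans (*-comm (W ^ a) (W ^ suc a)) (sym (^-distribˡ-+-* W (suc a) a)) ⟩
    W ^ (suc a + a) ≡⟨ ^-*-assoc V e₀ (suc a + a) ⟩
    V ^ (e₀ * (suc a + a)) ≡⟨ ^-*-assoc 2 (N * N) (e₀ * (suc a + a)) ⟩
    2 ^ (N * N * (e₀ * (suc a + a))) ≤⟨ ^-monoʳ-≤ 2 (exponent-bound N e₀ L 2≤N L≤3N) ⟩
    2 ^ (N ^ constant) ∎
    where open ≤-Reasoning

theorem6p10 : Σ ℕ λ c → (φ : Formula 0) (π : CAProof ([] ⇒ (φ ∷ []))) → Σ (PAProof ([] ⇒ (φ ∷ []))) λ ρ → paSize ρ ≤ 2 ^ (ppSize (pre π) ^ c)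
theorem6p10 = constant , cyclic-to-PA
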